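{- There is an absolute constant $C$ such that the following holds. Let $n\ge 2$, let $G=(V,E)$ be a directed graph on $n$ vertices with integer edge weights in $[1,W]$, let $\varepsilon\in(0,1)$ and let $\beta\ge 20\log n$. Then there exists a $(\beta,\varepsilon)$-hopset $H$ for $G$ with \[ |H|\le \begin{cases} C\cdot\dfrac{n^2\,\log^7 n\,\log^2(nW)}{\varepsilon^2\beta^3} & \text{if } \beta\le n^{1/3},\\[1em] C\cdot\dfrac{n^{3/2}\,\log^7 n\,\log^2(nW)}{\varepsilon^2\beta^{3/2}} & \text{if } \beta> n^{1/3}. \end{cases} \]
   Context: Logarithms are to base 2. For a directed graph $G=(V,E)$ with non-negative edge weights, $\mathrm{dist}_G(u,v)$ denotes the weighted shortest-path distance from $u$ to $v$ ($\infty$ if $u$ cannot reach $v$). Hopset: a $(\beta,\varepsilon)$-hopset for $G$ is a set $H\subseteq V\times V$ of directed edges with non-negative weights such that for all $u,v\in V$: (1) $\mathrm{dist}_G(u,v)=\mathrm{dist}_{G\cup H}(u,v)$; and (2) if $u$ can reach $v$, then there is a path from $u$ to $v$ in $G\cup H$ that contains at most $\beta$ edges and has total weight at most $(1+\varepsilon)\,\mathrm{dist}_G(u,v)$. -}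

module Defs where

open import Data.Nat.Base as ℕ using (ℕ; zero; suc; NonZero)
import Data.Nat.Properties as ℕ
open import Data.Integer.Base as ℤ using (+_; +[1+_])
import Data.Integer.Properties as ℤ
open import Data.Rational.Base as ℚ
  using (ℚ; mkℚ; 0ℚ; 1ℚ; ½; Positive; NonNegative; positive; nonNegative)
import Data.Rational.Properties as ℚ
import Data.Rational.Unnormalised.Base as ℚᵘ
import Data.Rational.Unnormalised.Properties as ℚᵘ
open import Data.Rational.Solver using (module +-*-Solver)
open import Data.Fin.Base using (Fin)
open import Data.List.Base using (length; mapMaybe; allFin; cartesianProduct)
open import Data.Maybe.Base using (Maybe; just; nothing)
open import Data.Product.Base using (Σ; ∃; ∃₂; _×_; _,_; proj₁; proj₂; uncurry)
open import Data.Sum.Base using (_⊎_; inj₁; inj₂)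
open import Relation.Binary.Construct.Closure.ReflexiveTransitive as Star using (Star; _◅_)
open import Relation.Binary.PropositionalEquality
open import Relation.Nullary using (¬_; Dec; yes; no; contradiction)

last : ∀ (P : ℕ → Set) → (∀ j → Dec (P j)) → P 0 →
       ∀ N → ¬ P N → ∃ λ j → P j × ¬ P (suc j)
last P P? p zero    ¬p = contradiction p ¬p
last P P? p (suc N) ¬p with P? N
... | yes pN = N , pN , ¬p
... | no ¬pN = last P P? p N ¬pN

n<2^n : ∀ n → n ℕ.< 2 ℕ.^ n
n<2^n zero    = ℕ.s≤s ℕ.z≤n
n<2^n (suc n) = begin
  suc (suc n)               ≤⟨ ℕ.+-mono-≤ (ℕ.m^n>0 2 n) (n<2^n n) ⟩
  2 ℕ.^ n ℕ.+ 2 ℕ.^ n       ≡⟨ cong (2 ℕ.^ n ℕ.+_) (ℕ.+-identityʳ (2 ℕ.^ n)) ⟨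
  2 ℕ.^ suc n               ∎
  where open ℕ.≤-Reasoning

^-swap : ∀ m a b → (m ℕ.^ a) ℕ.^ b ≡ (m ℕ.^ b) ℕ.^ a
^-swap m a b = trans (ℕ.^-*-assoc m a b)
  (trans (cong (m ℕ.^_) (ℕ.*-comm a b)) (sym (ℕ.^-*-assoc m b a)))

infixl 7 _/⁺_

_/⁺_ : ℕ → ℕ → ℚ
a /⁺ b = (+ a) ℚ./ suc b

/⁺-mono : ∀ {a b c d} → a ℕ.* suc d ℕ.≤ c ℕ.* suc b → a /⁺ b ℚ.≤ c /⁺ d
/⁺-mono {a} {b} {c} {d} h = ℚ.toℚᵘ-cancel-≤
  (ℚᵘ.≤-respˡ-≃ (ℚᵘ.≃-sym (ℚ.toℚᵘ-fromℚᵘ (ℚᵘ.mkℚᵘ (+ a) b)))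
  (ℚᵘ.≤-respʳ-≃ (ℚᵘ.≃-sym (ℚ.toℚᵘ-fromℚᵘ (ℚᵘ.mkℚᵘ (+ c) d)))
  (ℚᵘ.*≤* (subst₂ ℤ._≤_ (ℤ.pos-* a (suc d)) (ℤ.pos-* c (suc b)) (ℤ.+≤+ h)))))

/⁺-nonNeg : ∀ a b → 0ℚ ℚ.≤ a /⁺ b
/⁺-nonNeg a b = ℚ.nonNegative⁻¹ (a /⁺ b) {{ℚ.normalize-nonNeg a (suc b)}}

/⁺-suc : ∀ a δ .{{_ : Positive δ}} →
         suc a /⁺ ℚ.denominator-1 δ ℚ.≤ a /⁺ ℚ.denominator-1 δ ℚ.+ δ
/⁺-suc a δ@(mkℚ +[1+ m ] d c) = ℚ.toℚᵘ-cancel-≤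
  (ℚᵘ.≤-respˡ-≃ (ℚᵘ.≃-sym (ℚ.toℚᵘ-fromℚᵘ (ℚᵘ.mkℚᵘ (+ suc a) d)))
  (ℚᵘ.≤-respʳ-≃ (ℚᵘ.≃-sym (ℚᵘ.≃-trans (ℚ.toℚᵘ-homo-+ (a /⁺ d) δ)
      (ℚᵘ.+-congˡ (ℚᵘ.mkℚᵘ +[1+ m ] d) (ℚ.toℚᵘ-fromℚᵘ (ℚᵘ.mkℚᵘ (+ a) d)))))
  (ℚᵘ.*≤* (subst (ℤ._≤ (+ a ℤ.* + suc d ℤ.+ +[1+ m ] ℤ.* + suc d) ℤ.* + suc d) eq
    (ℤ.*-monoʳ-≤-nonNeg (+ suc d) (ℤ.+-monoʳ-≤ (+ a ℤ.* + suc d)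
      (ℤ.*-monoʳ-≤-nonNeg (+ suc d) (ℤ.+≤+ (ℕ.s≤s (ℕ.z≤n {m}))))))))))
  where
  eq : (+ a ℤ.* + suc d ℤ.+ + 1 ℤ.* + suc d) ℤ.* + suc d ≡ + suc a ℤ.* + (suc d ℕ.* suc d)
  eq = trans (cong (ℤ._* + suc d) (trans (sym (ℤ.*-distribʳ-+ (+ suc d) (+ a) (+ 1)))
               (cong (λ k → + k ℤ.* + suc d) (ℕ.+-comm a 1))))
       (trans (ℤ.*-assoc (+ suc a) (+ suc d) (+ suc d))
              (cong (+ suc a ℤ.*_) (sym (ℤ.pos-* (suc d) (suc d)))))

*-mono-≤ : ∀ {p q r s} → 0ℚ ℚ.≤ p → 0ℚ ℚ.≤ s → p ℚ.≤ q → r ℚ.≤ s → p ℚ.* r ℚ.≤ q ℚ.* s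
*-mono-≤ {p} {q} {r} {s} 0≤p 0≤s p≤q r≤s = ℚ.≤-trans
  (ℚ.*-monoˡ-≤-nonNeg p {{nonNegative 0≤p}} r≤s)
  (ℚ.*-monoʳ-≤-nonNeg s {{nonNegative 0≤s}} p≤q)

0≤* : ∀ {p q} → 0ℚ ℚ.≤ p → 0ℚ ℚ.≤ q → 0ℚ ℚ.≤ p ℚ.* q
0≤* 0≤p 0≤q = *-mono-≤ ℚ.≤-refl 0≤q 0≤p 0≤q

0≤+ : ∀ {p q} → 0ℚ ℚ.≤ p → 0ℚ ℚ.≤ q → 0ℚ ℚ.≤ p ℚ.+ q
0≤+ = ℚ.+-mono-≤

p≤p+q : ∀ {p q} → 0ℚ ℚ.≤ q → p ℚ.≤ p ℚ.+ q
p≤p+q {p} {q} 0≤q = subst (λ r → r ℚ.≤ p ℚ.+ q) (ℚ.+-identityʳ p) (ℚ.+-monoʳ-≤ p 0≤q)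

p≤q+p : ∀ {p q} → 0ℚ ℚ.≤ q → p ℚ.≤ q ℚ.+ p
p≤q+p {p} {q} 0≤q = subst (λ r → r ℚ.≤ q ℚ.+ p) (ℚ.+-identityˡ p) (ℚ.+-monoˡ-≤ p 0≤q)

pos⊓pos⇒pos : ∀ p q .{{_ : Positive p}} .{{_ : Positive q}} → Positive (p ℚ.⊓ q)
pos⊓pos⇒pos p q with p ℚ.⊓ q | ℚ.⊓-sel p q
... | _ | inj₁ refl = positive (ℚ.positive⁻¹ p)
... | _ | inj₂ refl = positive (ℚ.positive⁻¹ q)

infixr 8 _^ℚ_

_^ℚ_ : ℚ → ℕ → ℚ
q ^ℚ zero  = 1ℚ
q ^ℚ suc k = q ℚ.* q ^ℚ k

0≤1 : 0ℚ ℚ.≤ 1ℚ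
0≤1 = ℚ.nonNegative⁻¹ 1ℚ

^ℚ-nonNeg : ∀ {q} k → 0ℚ ℚ.≤ q → 0ℚ ℚ.≤ q ^ℚ k
^ℚ-nonNeg zero    0≤q = 0≤1
^ℚ-nonNeg (suc k) 0≤q = 0≤* 0≤q (^ℚ-nonNeg k 0≤q)

^ℚ-pos : ∀ q k .{{_ : Positive q}} → Positive (q ^ℚ k)
^ℚ-pos q zero    = _
^ℚ-pos q (suc k) = ℚ.pos*pos⇒pos q (q ^ℚ k) {{^ℚ-pos q k}}

^ℚ-mono-≤ : ∀ {p q} k → 0ℚ ℚ.≤ p → p ℚ.≤ q → p ^ℚ k ℚ.≤ q ^ℚ k
^ℚ-mono-≤ zero    0≤p p≤q = ℚ.≤-refl
^ℚ-mono-≤ (suc k) 0≤p p≤q =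
  *-mono-≤ 0≤p (^ℚ-nonNeg k (ℚ.≤-trans 0≤p p≤q)) p≤q (^ℚ-mono-≤ k 0≤p p≤q)

^ℚ-mono-< : ∀ {p q} k → 0ℚ ℚ.≤ p → p ℚ.< q → p ^ℚ suc k ℚ.< q ^ℚ suc k
^ℚ-mono-< {p} {q} k 0≤p p<q = ℚ.≤-<-trans
  (ℚ.*-monoˡ-≤-nonNeg p {{nonNegative 0≤p}} (^ℚ-mono-≤ k 0≤p (ℚ.<⇒≤ p<q)))
  (ℚ.*-monoˡ-<-pos (q ^ℚ k) {{^ℚ-pos q k {{positive (ℚ.≤-<-trans 0≤p p<q)}}}} p<q)

<⇒≱ : ∀ {p q} → p ℚ.< q → ¬ q ℚ.≤ p
<⇒≱ p<q q≤p = ℚ.<-irrefl refl (ℚ.<-≤-trans p<q q≤p)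

^ℚ-cancel-≤ : ∀ {p q} k → 0ℚ ℚ.≤ q → p ^ℚ suc k ℚ.≤ q ^ℚ suc k → p ℚ.≤ q
^ℚ-cancel-≤ k 0≤q h = ℚ.≮⇒≥ λ q<p → <⇒≱ (^ℚ-mono-< k 0≤q q<p) h

^ℚ-superadditive : ∀ {p q} k → 0ℚ ℚ.≤ p → 0ℚ ℚ.≤ q →
                   p ^ℚ suc k ℚ.+ q ^ℚ suc k ℚ.≤ (p ℚ.+ q) ^ℚ suc k
^ℚ-superadditive {p} {q} k 0≤p 0≤q = begin
  p ^ℚ suc k ℚ.+ q ^ℚ suc k
    ≤⟨ ℚ.+-mono-≤
         (ℚ.*-monoˡ-≤-nonNeg p {{nonNegative 0≤p}} (^ℚ-mono-≤ k 0≤p (p≤p+q 0≤q)))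
         (ℚ.*-monoˡ-≤-nonNeg q {{nonNegative 0≤q}} (^ℚ-mono-≤ k 0≤q (p≤q+p 0≤p))) ⟩
  p ℚ.* (p ℚ.+ q) ^ℚ k ℚ.+ q ℚ.* (p ℚ.+ q) ^ℚ k
    ≡⟨ ℚ.*-distribʳ-+ ((p ℚ.+ q) ^ℚ k) p q ⟨
  (p ℚ.+ q) ^ℚ suc k ∎
  where open ℚ.≤-Reasoning

q≤q^suc : ∀ {q} k → 1ℚ ℚ.≤ q → q ℚ.≤ q ^ℚ suc k
q≤q^suc {q} k 1≤q = begin
  q             ≡⟨ ℚ.*-identityʳ q ⟨
  q ℚ.* 1ℚ      ≤⟨ ℚ.*-monoˡ-≤-nonNeg q {{nonNegative (ℚ.≤-trans 0≤1 1≤q)}} (1≤^ k) ⟩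
  q ^ℚ suc k    ∎
  where
  open ℚ.≤-Reasoning
  1≤^ : ∀ k → 1ℚ ℚ.≤ q ^ℚ k
  1≤^ zero    = ℚ.≤-refl
  1≤^ (suc k) = *-mono-≤ 0≤1 (^ℚ-nonNeg k (ℚ.≤-trans 0≤1 1≤q)) 1≤q (1≤^ k)

archimedean : ∀ q → ∃ λ N → q ℚ.≤ N /⁺ 0
archimedean q@(mkℚ num d c) = ℤ.∣ num ∣ , ℚ.toℚᵘ-cancel-≤
  (ℚᵘ.≤-respʳ-≃ (ℚᵘ.≃-sym (ℚ.toℚᵘ-fromℚᵘ (ℚᵘ.mkℚᵘ (+ ℤ.∣ num ∣) 0)))
  (ℚᵘ.*≤* (subst₂ ℤ._≤_ (sym (ℤ.*-identityʳ num)) (ℤ.pos-* ℤ.∣ num ∣ (suc d)) (bound num))))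
  where
  bound : ∀ i → i ℤ.≤ + (ℤ.∣ i ∣ ℕ.* suc d)
  bound (+ m)        = ℤ.+≤+ (ℕ.m≤m*n m (suc d))
  bound ℤ.-[1+ m ]   = ℤ.-≤+

suc-/⁺ : ∀ j → suc j /⁺ 0 ≡ j /⁺ 0 ℚ.+ 1ℚ
suc-/⁺ j = ℚ.toℚᵘ-injective (ℚᵘ.≃-trans (ℚ.toℚᵘ-fromℚᵘ (ℚᵘ.mkℚᵘ (+ suc j) 0))
  (ℚᵘ.≃-trans (ℚᵘ.*≡* (cong (ℤ._* + 1) eq))
  (ℚᵘ.≃-sym (ℚᵘ.≃-trans (ℚ.toℚᵘ-homo-+ (j /⁺ 0) 1ℚ)
    (ℚᵘ.+-congˡ (ℚ.toℚᵘ 1ℚ) (ℚ.toℚᵘ-fromℚᵘ (ℚᵘ.mkℚᵘ (+ j) 0)))))))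
  where
  eq : + suc j ≡ + j ℤ.* + 1 ℤ.+ + 1
  eq = trans (cong +_ (ℕ.+-comm 1 j)) (cong (ℤ._+ + 1) (sym (ℤ.*-identityʳ (+ j))))

½δ+½δ≡δ : ∀ δ → ½ ℚ.* δ ℚ.+ ½ ℚ.* δ ≡ δ
½δ+½δ≡δ δ = trans (sym (ℚ.*-distribʳ-+ δ ½ ½)) (ℚ.*-identityˡ δ)

+-close : ∀ a a′ b b′ δ → a′ ℚ.≤ a ℚ.+ ½ ℚ.* δ → b′ ℚ.≤ b ℚ.+ ½ ℚ.* δ →
          a′ ℚ.+ b′ ℚ.≤ a ℚ.+ b ℚ.+ δ
+-close a a′ b b′ δ a′≤ b′≤ = begin
  a′ ℚ.+ b′                                   ≤⟨ ℚ.+-mono-≤ a′≤ b′≤ ⟩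
  (a ℚ.+ ½ ℚ.* δ) ℚ.+ (b ℚ.+ ½ ℚ.* δ)
    ≡⟨ solve 3 (λ a b h → (a :+ h) :+ (b :+ h) := (a :+ b) :+ (h :+ h)) refl a b (½ ℚ.* δ) ⟩
  a ℚ.+ b ℚ.+ (½ ℚ.* δ ℚ.+ ½ ℚ.* δ)           ≡⟨ cong (a ℚ.+ b ℚ.+_) (½δ+½δ≡δ δ) ⟩
  a ℚ.+ b ℚ.+ δ                               ∎
  where
  open ℚ.≤-Reasoning
  open +-*-Solver

tolerance : ∀ M δ .{{_ : Positive M}} .{{_ : Positive δ}} →
            ∃ λ η → Positive η × η ℚ.≤ 1ℚ × η ℚ.* M ℚ.≤ δ
tolerance M δ = ε ℚ.⊓ 1ℚ , pos⊓pos⇒pos ε 1ℚ , ℚ.p⊓q≤q ε 1ℚ , (begin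
  (ε ℚ.⊓ 1ℚ) ℚ.* M       ≤⟨ ℚ.*-monoʳ-≤-nonNeg M {{ℚ.pos⇒nonNeg M}} (ℚ.p⊓q≤p ε 1ℚ) ⟩
  δ ℚ.* ℚ.1/ M ℚ.* M     ≡⟨ ℚ.*-assoc δ (ℚ.1/ M) M ⟩
  δ ℚ.* (ℚ.1/ M ℚ.* M)   ≡⟨ cong (δ ℚ.*_) (ℚ.*-inverseˡ M) ⟩
  δ ℚ.* 1ℚ               ≡⟨ ℚ.*-identityʳ δ ⟩
  δ                      ∎)
  where
  open ℚ.≤-Reasoning
  instance
    M≢0 : ℚ.NonZero M
    M≢0 = ℚ.pos⇒nonZero M
  ε : ℚ
  ε = δ ℚ.* ℚ.1/ M
  instance
    ε>0 : Positive ε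
    ε>0 = ℚ.pos*pos⇒pos δ (ℚ.1/ M) {{ℚ.1/pos⇒pos M}}

*-close : ∀ a a′ b b′ X Y η δ → Positive η → η ℚ.≤ 1ℚ → η ℚ.* (X ℚ.+ Y ℚ.+ 1ℚ) ℚ.≤ δ →
          0ℚ ℚ.≤ a′ → 0ℚ ℚ.≤ b′ → a ℚ.≤ X → b ℚ.≤ Y → a′ ℚ.≤ a ℚ.+ η → b′ ℚ.≤ b ℚ.+ η →
          a′ ℚ.* b′ ℚ.≤ a ℚ.* b ℚ.+ δ
*-close a a′ b b′ X Y η δ η>0 η≤1 ηM≤δ 0≤a′ 0≤b′ a≤X b≤Y a′≤ b′≤ = begin
  a′ ℚ.* b′
    ≤⟨ *-mono-≤ 0≤a′ (ℚ.≤-trans 0≤b′ b′≤) a′≤ b′≤ ⟩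
  (a ℚ.+ η) ℚ.* (b ℚ.+ η)
    ≡⟨ solve 3 (λ a b η → (a :+ η) :* (b :+ η) := a :* b :+ η :* (a :+ b :+ η)) refl a b η ⟩
  a ℚ.* b ℚ.+ η ℚ.* (a ℚ.+ b ℚ.+ η)
    ≤⟨ ℚ.+-monoʳ-≤ (a ℚ.* b) (ℚ.*-monoˡ-≤-nonNeg η {{ℚ.pos⇒nonNeg η {{η>0}}}}
         (ℚ.+-mono-≤ (ℚ.+-mono-≤ a≤X b≤Y) η≤1)) ⟩
  a ℚ.* b ℚ.+ η ℚ.* (X ℚ.+ Y ℚ.+ 1ℚ)
    ≤⟨ ℚ.+-monoʳ-≤ (a ℚ.* b) ηM≤δ ⟩
  a ℚ.* b ℚ.+ δ ∎
  where
  open ℚ.≤-Reasoning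
  open +-*-Solver

^ℚ-bracket : ∀ k h a .{{_ : Positive h}} → 0ℚ ℚ.≤ a →
  ∃ λ q → 0ℚ ℚ.≤ q × q ^ℚ suc k ℚ.≤ a × a ℚ.+ h ^ℚ suc k ℚ.≤ (q ℚ.+ (h ℚ.+ h)) ^ℚ suc k
^ℚ-bracket k h a 0≤a =
  let N , N≥ = archimedean ((a ℚ.+ 1ℚ) ℚ.* ℚ.1/ h)
  in finish (last (λ j → [ j ]h ^ℚ suc k ℚ.≤ a) (λ j → [ j ]h ^ℚ suc k ℚ.≤? a)
               base N (<⇒≱ (above N N≥)))
  where
  open ℚ.≤-Reasoning
  instance
    h≥0 : NonNegative h
    h≥0 = ℚ.pos⇒nonNeg h
    h≢0 : ℚ.NonZero h
    h≢0 = ℚ.pos⇒nonZero h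

  [_]h : ℕ → ℚ
  [ j ]h = j /⁺ 0 ℚ.* h

  0≤[_]h : ∀ j → 0ℚ ℚ.≤ [ j ]h
  0≤[ j ]h = 0≤* (/⁺-nonNeg j 0) (ℚ.nonNegative⁻¹ h)

  base : [ 0 ]h ^ℚ suc k ℚ.≤ a
  base = begin
    [ 0 ]h ^ℚ suc k      ≡⟨ cong (_^ℚ suc k) (ℚ.*-zeroˡ h) ⟩
    0ℚ ℚ.* 0ℚ ^ℚ k       ≡⟨ ℚ.*-zeroˡ (0ℚ ^ℚ k) ⟩
    0ℚ                   ≤⟨ 0≤a ⟩
    a                    ∎

  shift : ∀ j → [ suc j ]h ℚ.+ h ≡ [ j ]h ℚ.+ (h ℚ.+ h)
  shift j = begin-equality
    suc j /⁺ 0 ℚ.* h ℚ.+ h            ≡⟨ cong (λ i → i ℚ.* h ℚ.+ h) (suc-/⁺ j) ⟩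
    (j /⁺ 0 ℚ.+ 1ℚ) ℚ.* h ℚ.+ h       ≡⟨ cong (ℚ._+ h) (ℚ.*-distribʳ-+ h (j /⁺ 0) 1ℚ) ⟩
    [ j ]h ℚ.+ 1ℚ ℚ.* h ℚ.+ h         ≡⟨ cong (λ i → [ j ]h ℚ.+ i ℚ.+ h) (ℚ.*-identityˡ h) ⟩
    [ j ]h ℚ.+ h ℚ.+ h                ≡⟨ ℚ.+-assoc [ j ]h h h ⟩
    [ j ]h ℚ.+ (h ℚ.+ h)              ∎

  above : ∀ N → (a ℚ.+ 1ℚ) ℚ.* ℚ.1/ h ℚ.≤ N /⁺ 0 → a ℚ.< [ N ]h ^ℚ suc k
  above N N≥ = begin-strict
    a                     ≡⟨ ℚ.+-identityʳ a ⟨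
    a ℚ.+ 0ℚ              <⟨ ℚ.+-monoʳ-< a (ℚ.positive⁻¹ 1ℚ) ⟩
    a ℚ.+ 1ℚ              ≤⟨ a+1≤ ⟩
    [ N ]h                ≤⟨ q≤q^suc k (ℚ.≤-trans (p≤q+p 0≤a) a+1≤) ⟩
    [ N ]h ^ℚ suc k       ∎
    where
    a+1≤ : a ℚ.+ 1ℚ ℚ.≤ [ N ]h
    a+1≤ = begin
      a ℚ.+ 1ℚ                       ≡⟨ ℚ.*-identityʳ (a ℚ.+ 1ℚ) ⟨
      (a ℚ.+ 1ℚ) ℚ.* 1ℚ              ≡⟨ cong ((a ℚ.+ 1ℚ) ℚ.*_) (ℚ.*-inverseˡ h) ⟨
      (a ℚ.+ 1ℚ) ℚ.* (ℚ.1/ h ℚ.* h)  ≡⟨ ℚ.*-assoc (a ℚ.+ 1ℚ) (ℚ.1/ h) h ⟨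
      (a ℚ.+ 1ℚ) ℚ.* ℚ.1/ h ℚ.* h    ≤⟨ ℚ.*-monoʳ-≤-nonNeg h N≥ ⟩
      [ N ]h                         ∎

  finish : (∃ λ j → [ j ]h ^ℚ suc k ℚ.≤ a × ¬ [ suc j ]h ^ℚ suc k ℚ.≤ a) →
    ∃ λ q → 0ℚ ℚ.≤ q × q ^ℚ suc k ℚ.≤ a × a ℚ.+ h ^ℚ suc k ℚ.≤ (q ℚ.+ (h ℚ.+ h)) ^ℚ suc k
  finish (j , lo , hi) = [ j ]h , 0≤[ j ]h , lo , (begin
    a ℚ.+ h ^ℚ suc k                         ≤⟨ ℚ.+-monoˡ-≤ (h ^ℚ suc k) (ℚ.<⇒≤ (ℚ.≰⇒> hi)) ⟩
    [ suc j ]h ^ℚ suc k ℚ.+ h ^ℚ suc k       ≤⟨ ^ℚ-superadditive k 0≤[ suc j ]h (ℚ.nonNegative⁻¹ h) ⟩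
    ([ suc j ]h ℚ.+ h) ^ℚ suc k              ≡⟨ cong (_^ℚ suc k) (shift j) ⟩
    ([ j ]h ℚ.+ (h ℚ.+ h)) ^ℚ suc k          ∎)

Gap : (Lower Upper : ℚ → Set) → ℚ → Set
Gap Lower Upper δ = ∃₂ λ q r → Lower q × Upper r × r ℚ.≤ q ℚ.+ δ

-- A Dedekind-style real, given by some of its rational lower bounds and
-- some of its rational upper bounds.  Neither set need be closed or open;
-- that they come arbitrarily close to each other makes x = sup Lower = inf Upper
-- a single located real, and every non-negative real arises in this way.
-- Equality of reals is _≈_ below, not _≡_.

record ℝ≥0 : Set₁ where
  field
    Lower Upper : ℚ → Set
    nonNeg      : ∀ {q} → Lower q → 0ℚ ℚ.≤ q
    bounded     : ∀ {q r} → Lower q → Upper r → q ℚ.≤ r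
    close       : ∀ δ .{{_ : Positive δ}} → Gap Lower Upper δ

  nonNegᵘ : ∀ {r} → Upper r → 0ℚ ℚ.≤ r
  nonNegᵘ u = let (_ , _ , l , _ , _) = close 1ℚ in ℚ.≤-trans (nonNeg l) (bounded l u)

open ℝ≥0

infix 4 _≤_ _<_ _≈_

_≤_ _<_ _≈_ : ℝ≥0 → ℝ≥0 → Set
x ≤ y = ∀ {q r} → Lower x q → Upper y r → q ℚ.≤ r
x < y = ∃₂ λ q r → Upper x q × Lower y r × q ℚ.< r
x ≈ y = x ≤ y × y ≤ x

fromℚ : ∀ q → 0ℚ ℚ.≤ q → ℝ≥0
fromℚ q 0≤q = record
  { Lower   = _≡ q
  ; Upper   = _≡ q
  ; nonNeg  = λ { refl → 0≤q }
  ; bounded = λ { refl refl → ℚ.≤-refl }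
  ; close   = λ δ → q , q , refl , refl , p≤p+q (ℚ.<⇒≤ (ℚ.positive⁻¹ δ))
  }

fromℕ : ℕ → ℝ≥0
fromℕ n = fromℚ (n /⁺ 0) (/⁺-nonNeg n 0)

infixl 6 _+_
infixl 7 _*_
infixr 8 _^_

_+_ : ℝ≥0 → ℝ≥0 → ℝ≥0
x + y = record
  { Lower   = L
  ; Upper   = U
  ; nonNeg  = λ { (_ , _ , a , b , refl) → 0≤+ (nonNeg x a) (nonNeg y b) }
  ; bounded = λ { (_ , _ , a , b , refl) (_ , _ , a′ , b′ , refl) →
                  ℚ.+-mono-≤ (bounded x a a′) (bounded y b b′) }
  ; close   = λ δ → LU-close δ
      (close x (½ ℚ.* δ) {{ℚ.pos*pos⇒pos ½ δ}}) (close y (½ ℚ.* δ) {{ℚ.pos*pos⇒pos ½ δ}})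
  }
  where
  L U : ℚ → Set
  L q = ∃₂ λ a b → Lower x a × Lower y b × q ≡ a ℚ.+ b
  U q = ∃₂ λ a b → Upper x a × Upper y b × q ≡ a ℚ.+ b

  LU-close : ∀ δ → Gap (Lower x) (Upper x) (½ ℚ.* δ) → Gap (Lower y) (Upper y) (½ ℚ.* δ) → Gap L U δ
  LU-close δ (a , a′ , la , ua , a′≤) (b , b′ , lb , ub , b′≤) =
    a ℚ.+ b , a′ ℚ.+ b′ , (a , b , la , lb , refl) , (a′ , b′ , ua , ub , refl) ,
    +-close a a′ b b′ δ a′≤ b′≤

_*_ : ℝ≥0 → ℝ≥0 → ℝ≥0
x * y = record
  { Lower   = L
  ; Upper   = U
  ; nonNeg  = λ { (_ , _ , a , b , refl) → 0≤* (nonNeg x a) (nonNeg y b) }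
  ; bounded = λ { (_ , _ , a , b , refl) (_ , _ , a′ , b′ , refl) →
                  *-mono-≤ (nonNeg x a) (nonNegᵘ y b′) (bounded x a a′) (bounded y b b′) }
  ; close   = λ δ → LU-close δ (close x 1ℚ) (close y 1ℚ)
  }
  where
  L U : ℚ → Set
  L q = ∃₂ λ a b → Lower x a × Lower y b × q ≡ a ℚ.* b
  U q = ∃₂ λ a b → Upper x a × Upper y b × q ≡ a ℚ.* b

  LU-close : ∀ δ .{{_ : Positive δ}} →
             Gap (Lower x) (Upper x) 1ℚ → Gap (Lower y) (Upper y) 1ℚ → Gap L U δ
  LU-close δ (_ , X , _ , uX , _) (_ , Y , _ , uY , _) = within
    (tolerance (X ℚ.+ Y ℚ.+ 1ℚ) δ {{ℚ.nonNeg+pos⇒pos (X ℚ.+ Y)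
      {{nonNegative (0≤+ (nonNegᵘ x uX) (nonNegᵘ y uY))}} 1ℚ}})
    where
    multiply : ∀ η → Positive η → η ℚ.≤ 1ℚ → η ℚ.* (X ℚ.+ Y ℚ.+ 1ℚ) ℚ.≤ δ →
               Gap (Lower x) (Upper x) η → Gap (Lower y) (Upper y) η → Gap L U δ
    multiply η η>0 η≤1 ηM≤δ (a , a′ , la , ua , a′≤) (b , b′ , lb , ub , b′≤) =
      a ℚ.* b , a′ ℚ.* b′ , (a , b , la , lb , refl) , (a′ , b′ , ua , ub , refl) ,
      *-close a a′ b b′ X Y η δ η>0 η≤1 ηM≤δ (nonNegᵘ x ua) (nonNegᵘ y ub)
        (bounded x la uX) (bounded y lb uY) a′≤ b′≤

    within : (∃ λ η → Positive η × η ℚ.≤ 1ℚ × η ℚ.* (X ℚ.+ Y ℚ.+ 1ℚ) ℚ.≤ δ) → Gap L U δ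
    within (η , η>0 , η≤1 , ηM≤δ) =
      multiply η η>0 η≤1 ηM≤δ (close x η {{η>0}}) (close y η {{η>0}})

_^_ : ℝ≥0 → ℕ → ℝ≥0
x ^ zero  = fromℕ 1
x ^ suc k = x * x ^ k

root : ∀ k .{{_ : NonZero k}} → ℝ≥0 → ℝ≥0
root k@(suc k-1) x = record
  { Lower   = L
  ; Upper   = U
  ; nonNeg  = proj₁
  ; bounded = λ { (_ , _ , a , q≤a) (0≤r , _ , a′ , a′≤r) →
                  ^ℚ-cancel-≤ k-1 0≤r (ℚ.≤-trans q≤a (ℚ.≤-trans (bounded x a a′) a′≤r)) }
  ; close   = λ δ → let instance h>0 = ℚ.pos*pos⇒pos ½ δ in
      LU-close δ (½ ℚ.* δ) (½δ+½δ≡δ δ) (close x ((½ ℚ.* δ) ^ℚ k) {{^ℚ-pos (½ ℚ.* δ) k}})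
  }
  where
  L U : ℚ → Set
  L q = 0ℚ ℚ.≤ q × ∃ λ a → Lower x a × q ^ℚ k ℚ.≤ a
  U q = 0ℚ ℚ.≤ q × ∃ λ a → Upper x a × a ℚ.≤ q ^ℚ k

  LU-close : ∀ δ h .{{_ : Positive δ}} .{{_ : Positive h}} → h ℚ.+ h ≡ δ →
             Gap (Lower x) (Upper x) (h ^ℚ k) → Gap L U δ
  LU-close δ h h+h≡δ (a , a′ , la , ua , a′≤) = widen (^ℚ-bracket k-1 h a (nonNeg x la))
    where
    widen : (∃ λ q → 0ℚ ℚ.≤ q × q ^ℚ k ℚ.≤ a × a ℚ.+ h ^ℚ k ℚ.≤ (q ℚ.+ (h ℚ.+ h)) ^ℚ k) → Gap L U δ
    widen (q , 0≤q , lo , hi) =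
      q , q ℚ.+ δ , (0≤q , a , la , lo) ,
      (0≤+ 0≤q (ℚ.<⇒≤ (ℚ.positive⁻¹ δ)) , a′ , ua ,
       subst (λ d → a′ ℚ.≤ (q ℚ.+ d) ^ℚ k) h+h≡δ (ℚ.≤-trans a′≤ hi)) , ℚ.≤-refl

infixr 8 _^[_/_]

_^[_/_] : ℝ≥0 → (p q : ℕ) .{{_ : NonZero q}} → ℝ≥0
x ^[ p / q ] = root q (x ^ p)

-- a/b ≤ log₂ n iff 2ᵃ ≤ nᵇ, for integers a ≥ 0 and b ≥ 1.

log₂ : (n : ℕ) .{{_ : NonZero n}} → ℝ≥0
log₂ n = record
  { Lower   = L
  ; Upper   = U
  ; nonNeg  = λ { (a , b , _ , refl) → /⁺-nonNeg a b }
  ; bounded = λ { (a , b , lo , refl) (c , d , hi , refl) → /⁺-mono {a} {b} {c} {d} (cross a b c d lo hi) }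
  ; close   = LU-close
  }
  where
  L U : ℚ → Set
  L q = ∃₂ λ a b → 2 ℕ.^ a ℕ.≤ n ℕ.^ suc b × q ≡ a /⁺ b
  U q = ∃₂ λ a b → n ℕ.^ suc b ℕ.≤ 2 ℕ.^ a × q ≡ a /⁺ b

  cross : ∀ a b c d → 2 ℕ.^ a ℕ.≤ n ℕ.^ suc b → n ℕ.^ suc d ℕ.≤ 2 ℕ.^ c →
          a ℕ.* suc d ℕ.≤ c ℕ.* suc b
  cross a b c d lo hi = ℕ.≮⇒≥ λ h → ℕ.<⇒≱ (ℕ.^-monoʳ-< 2 (ℕ.s≤s (ℕ.s≤s ℕ.z≤n)) h) (begin
    2 ℕ.^ (a ℕ.* suc d)          ≡⟨ ℕ.^-*-assoc 2 a (suc d) ⟨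
    (2 ℕ.^ a) ℕ.^ suc d          ≤⟨ ℕ.^-monoˡ-≤ (suc d) lo ⟩
    (n ℕ.^ suc b) ℕ.^ suc d      ≡⟨ ^-swap n (suc b) (suc d) ⟩
    (n ℕ.^ suc d) ℕ.^ suc b      ≤⟨ ℕ.^-monoˡ-≤ (suc b) hi ⟩
    (2 ℕ.^ c) ℕ.^ suc b          ≡⟨ ℕ.^-*-assoc 2 c (suc b) ⟩
    2 ℕ.^ (c ℕ.* suc b)          ∎)
    where open ℕ.≤-Reasoning
  LU-close : ∀ δ .{{_ : Positive δ}} → Gap L U δ
  LU-close δ = enclose (last (λ a → 2 ℕ.^ a ℕ.≤ n ℕ.^ suc d) (λ a → 2 ℕ.^ a ℕ.≤? n ℕ.^ suc d)
                         (ℕ.m^n>0 n (suc d)) (n ℕ.^ suc d) (ℕ.<⇒≱ (n<2^n (n ℕ.^ suc d))))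
    where
    d : ℕ
    d = ℚ.denominator-1 δ

    enclose : (∃ λ a → 2 ℕ.^ a ℕ.≤ n ℕ.^ suc d × ¬ 2 ℕ.^ suc a ℕ.≤ n ℕ.^ suc d) → Gap L U δ
    enclose (a , lo , hi) =
      a /⁺ d , suc a /⁺ d , (a , d , lo , refl) , (suc a , d , ℕ.<⇒≤ (ℕ.≰⇒> hi) , refl) ,
      /⁺-suc a δ

-- `nothing` means that there is no edge.

Digraph : ℕ → Set₁
Digraph n = Fin n → Fin n → Maybe ℝ≥0

∣_∣ : ∀ {n} → Digraph n → ℕ
∣_∣ {n} G = length (mapMaybe (uncurry G) (cartesianProduct (allFin n) (allFin n)))

IntegerWeightsIn[1,_] : ℕ → ∀ {n} → Digraph n → Set₁
IntegerWeightsIn[1, W ] G = ∀ {u v w} → G u v ≡ just w →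
  ∃ λ k → 1 ℕ.≤ k × k ℕ.≤ W × w ≈ fromℕ k

-- Relational, so that in G ∪ H an edge of G and an edge of H with the same
-- endpoints are both present, each with its own weight.

Edges : ℕ → Set₂
Edges n = Fin n → Fin n → ℝ≥0 → Set₁

⟦_⟧ : ∀ {n} → Digraph n → Edges n
⟦ G ⟧ u v w = G u v ≡ just w

_∪_ : ∀ {n} → Digraph n → Digraph n → Edges n
(G ∪ H) u v w = ⟦ G ⟧ u v w ⊎ ⟦ H ⟧ u v w

module _ {n} (E : Edges n) where

  -- Vertices may repeat; as weights are non-negative, this changes neither
  -- distances nor the existence of short paths with few edges.

  Path : Fin n → Fin n → Set₁
  Path = Star (λ u v → ∃ (E u v))

  hops : ∀ {u v} → Path u v → ℕ
  hops Star.ε   = 0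
  hops (_ ◅ p)  = suc (hops p)

  weight : ∀ {u v} → Path u v → ℝ≥0
  weight Star.ε         = fromℕ 0
  weight ((w , _) ◅ p)  = w + weight p

  -- `IsDist u v d` says dist(u,v) = d, where `nothing` stands for ∞.

  IsDist : Fin n → Fin n → Maybe ℝ≥0 → Set₁
  IsDist u v (just d) = (∃ λ (p : Path u v) → weight p ≈ d) × (∀ (p : Path u v) → d ≤ weight p)
  IsDist u v nothing  = ¬ Path u v

record IsHopset {n} (G : Digraph n) (β ε : ℝ≥0) (H : Digraph n) : Set₁ where
  field
    preserves : ∀ u v → ∃ λ d → IsDist ⟦ G ⟧ u v d × IsDist (G ∪ H) u v d
    shortcuts : ∀ u v d → IsDist ⟦ G ⟧ u v (just d) →
                ∃ λ (p : Path (G ∪ H) u v) →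
                  fromℕ (hops (G ∪ H) p) ≤ β ×
                  weight (G ∪ H) p ≤ (fromℕ 1 + ε) * d

{-# OPTIONS --safe #-}

-- Weights are integral, so distances d are natural numbers or infinite.  Let
-- ρ(x, y) = d(x, y) + d(y, x).  Every shortcut (x, y) gets the weight d(x, y).
--
-- Squeezes.  A pair (v, w) is a level-K shortcut if w is among the K²
-- vertices closest to v with respect to ρ.  There are N K² such pairs, so a
-- hitting set of O(N log N) of them meets every path whose first and last K
-- vertices are mutually close; such a path then needs only 2 K hops.
--
-- One scale R ≤ d(u, w) < 2 R.  Chains are taken greedily from shortest
-- paths until every path has fewer than D vertices off the chains.  There
-- are at most N / D chains, and each gets shortcuts that allow two hops
-- between any two of its vertices.  For a stretch of a path, let U be the
-- number of vertices that are ρ-close to it, and Q the number of pieces of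
-- chains (of length about R / X) that it meets.  If U Q ≪ D² / X, the
-- stretch is crossed in 4 D hops: jump along a chain to the last vertex on
-- it, then squeeze to the last vertex nearby, and group the squeezes by
-- balls of radii growing by factors of 5, which at some level grow at most
-- quadratically in cardinality.
-- Otherwise a path splits into a thin start, a middle part and a thin end,
-- where the start with one more vertex and the end with one more vertex are
-- not thin.  Exchanging the factors, U of one of them times Q of the other
-- is large.  Hitting sets then provide hubs close to one of them, and edges
-- from hubs to pieces of chains that meet the other; such a detour costs
-- only R / k.
-- This gives O~(N + N² k² / D³) shortcuts per scale, for 14 D hops and
-- stretch 1 + 1 / k.
--
-- Sampling.  If β³ ≫ n, choose g with g² n ≈ β³ and a hitting set of O~(n / g)
-- vertices for the stretches of g vertices of shortest paths, and apply the
-- above to the sampled vertices with D ≈ β / g.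

module Submission where

module Combinatorics where

  open import Defs using (last; n<2^n)
  open import Data.Nat
  open import Data.Nat.Properties
  open import Data.Nat.DivMod
  open import Data.Nat.Tactic.RingSolver using (solve-∀)
  open import Data.List.Base using (List; []; _∷_; _++_; length; map; filter; take; drop; cartesianProduct; concat; upTo; deduplicate; allFin)
  open import Data.List.Properties using (length-++; ++-assoc; length-map; length-take; length-drop; take++drop≡id; drop-drop; ++-identityʳ; length-upTo; ≡-dec; ∷-injectiveˡ; length-tabulate; length-filter)
  open import Data.List.Membership.Propositional using (_∈_; find; lose)
  open import Data.List.Membership.Propositional.Properties
  open import Data.List.Relation.Unary.Any as Any using (Any; here; there)
  open import Data.List.Relation.Unary.All as All using (All; []; _∷_)
  import Data.List.Relation.Unary.All.Properties as All
  open import Data.List.Relation.Unary.AllPairs as AllPairs using (AllPairs; []; _∷_)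
  import Data.List.Relation.Unary.AllPairs.Properties as AllPairs
  open import Data.List.Relation.Unary.Linked as Linked using (Linked; []; [-]; _∷_)
  open import Data.List.Relation.Unary.Unique.Propositional using (Unique)
  import Data.List.Relation.Unary.Unique.Propositional.Properties as Unique
  open import Data.Product.Base using (Σ; ∃; ∃₂; _×_; _,_; proj₁; proj₂; uncurry; swap)
  open import Data.Sum.Base using (_⊎_; inj₁; inj₂; [_,_]′)
  open import Data.Empty using (⊥; ⊥-elim)
  open import Data.Unit.Base using (tt)
  open import Function.Base using (_∘_; id; case_of_; flip)
  open import Relation.Binary.Definitions using (DecidableEquality)
  open import Relation.Binary.PropositionalEquality hiding ([_])
  open import Relation.Nullary
  open import Relation.Nullary.Decidable using (map′; ¬?; _×-dec_)
  import Data.Product.Properties as Product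
  import Data.List.Relation.Unary.Unique.DecPropositional.Properties as DecUnique
  open import Data.Fin.Base using (Fin)
  open import Data.Fin.Properties using (any?) renaming (_≟_ to _≟ᶠ_)
  open import Data.Maybe.Base using (Maybe; just; nothing)

  module FiniteSums where

    private variable
      A B F X : Set

    ∑ : List A → (A → ℕ) → ℕ
    ∑ []       f = 0
    ∑ (x ∷ xs) f = f x + ∑ xs f

    ∑-mono : ∀ (xs : List A) {f g : A → ℕ} → (∀ {x} → x ∈ xs → f x ≤ g x) → ∑ xs f ≤ ∑ xs g
    ∑-mono []       h = z≤n
    ∑-mono (x ∷ xs) h = +-mono-≤ (h (here refl)) (∑-mono xs (h ∘ there))

    ∑-cong : ∀ (xs : List A) {f g : A → ℕ} → (∀ {x} → x ∈ xs → f x ≡ g x) → ∑ xs f ≡ ∑ xs g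
    ∑-cong []       h = refl
    ∑-cong (x ∷ xs) h = cong₂ _+_ (h (here refl)) (∑-cong xs (h ∘ there))

    ∑-const : ∀ (xs : List A) c → ∑ xs (λ _ → c) ≡ length xs * c
    ∑-const []       c = refl
    ∑-const (x ∷ xs) c = cong (c +_) (∑-const xs c)

    ∑-≤ : ∀ (xs : List A) {f} c → (∀ {x} → x ∈ xs → f x ≤ c) → ∑ xs f ≤ length xs * c
    ∑-≤ xs c h = ≤-trans (∑-mono xs h) (≤-reflexive (∑-const xs c))

    ∑-≥ : ∀ (xs : List A) {f} c → (∀ {x} → x ∈ xs → c ≤ f x) → length xs * c ≤ ∑ xs f
    ∑-≥ xs c h = ≤-trans (≤-reflexive (sym (∑-const xs c))) (∑-mono xs h)

    private
      interchange : ∀ a b c e → (a + b) + (c + e) ≡ (a + c) + (b + e)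
      interchange = solve-∀

    ∑-+ : ∀ (xs : List A) (f g : A → ℕ) → ∑ xs (λ x → f x + g x) ≡ ∑ xs f + ∑ xs g
    ∑-+ []       f g = refl
    ∑-+ (x ∷ xs) f g = trans (cong (f x + g x +_) (∑-+ xs f g)) (interchange (f x) (g x) _ _)

    ∑-*ˡ : ∀ (xs : List A) c (f : A → ℕ) → ∑ xs (λ x → c * f x) ≡ c * ∑ xs f
    ∑-*ˡ []       c f = sym (*-zeroʳ c)
    ∑-*ˡ (x ∷ xs) c f = trans (cong (c * f x +_) (∑-*ˡ xs c f)) (sym (*-distribˡ-+ c (f x) _))

    ∑-swap : ∀ (xs : List A) (ys : List B) (f : A → B → ℕ) →
             ∑ xs (λ x → ∑ ys (f x)) ≡ ∑ ys (λ y → ∑ xs (λ x → f x y))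
    ∑-swap []       ys f = sym (trans (∑-const ys 0) (*-zeroʳ (length ys)))
    ∑-swap (x ∷ xs) ys f = trans (cong (∑ ys (f x) +_) (∑-swap xs ys f)) (sym (∑-+ ys (f x) _))

    ∑-++ : ∀ (xs ys : List A) f → ∑ (xs ++ ys) f ≡ ∑ xs f + ∑ ys f
    ∑-++ []       ys f = refl
    ∑-++ (x ∷ xs) ys f = trans (cong (f x +_) (∑-++ xs ys f)) (sym (+-assoc (f x) _ _))

    ∑-∈ : ∀ {xs : List A} {x} f → x ∈ xs → f x ≤ ∑ xs f
    ∑-∈ f (here refl) = m≤m+n _ _
    ∑-∈ f (there h)   = ≤-trans (∑-∈ f h) (m≤n+m _ _)

    ∑-length : ∀ (xs : List A) (g : A → List B) → length (concat (map g xs)) ≡ ∑ xs (length ∘ g)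
    ∑-length []       g = refl
    ∑-length (x ∷ xs) g = trans (length-++ (g x)) (cong (length (g x) +_) (∑-length xs g))

    ⟨_⟩ : {P : Set} → Dec P → ℕ
    ⟨ yes _ ⟩ = 1
    ⟨ no _ ⟩  = 0

    ⟨⟩≤1 : {P : Set} (d : Dec P) → ⟨ d ⟩ ≤ 1
    ⟨⟩≤1 (yes _) = ≤-refl
    ⟨⟩≤1 (no _)  = z≤n

    ⟨⟩-yes : {P : Set} (d : Dec P) → P → ⟨ d ⟩ ≡ 1
    ⟨⟩-yes (yes _) p = refl
    ⟨⟩-yes (no ¬p) p = contradiction p ¬p

    ⟨⟩-no : {P : Set} (d : Dec P) → ¬ P → ⟨ d ⟩ ≡ 0
    ⟨⟩-no (yes p) ¬p = contradiction p ¬p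
    ⟨⟩-no (no _)  ¬p = refl

    ⟨⟩-mono : {P Q : Set} (d : Dec P) (e : Dec Q) → (P → Q) → ⟨ d ⟩ ≤ ⟨ e ⟩
    ⟨⟩-mono (yes p) e f = ≤-reflexive (sym (⟨⟩-yes e (f p)))
    ⟨⟩-mono (no _)  e f = z≤n

    count : {P : A → Set} → (∀ x → Dec (P x)) → List A → ℕ
    count P? xs = ∑ xs (λ x → ⟨ P? x ⟩)

    count≤length : {P : A → Set} (P? : ∀ x → Dec (P x)) → ∀ xs → count P? xs ≤ length xs
    count≤length P? xs = ≤-trans (∑-≤ xs 1 (λ {x} _ → ⟨⟩≤1 (P? x))) (≤-reflexive (*-identityʳ _))

    count-mono : {P Q : A → Set} (P? : ∀ x → Dec (P x)) (Q? : ∀ x → Dec (Q x)) →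
                 ∀ xs → (∀ {x} → x ∈ xs → P x → Q x) → count P? xs ≤ count Q? xs
    count-mono P? Q? xs h = ∑-mono xs λ {x} m → ⟨⟩-mono (P? x) (Q? x) (h m)

    count-∈ : {P : A → Set} (P? : ∀ x → Dec (P x)) → ∀ {xs x} → x ∈ xs → P x → 1 ≤ count P? xs
    count-∈ P? {x = x} m p = ≤-trans (≤-reflexive (sym (⟨⟩-yes (P? x) p))) (∑-∈ (λ x → ⟨ P? x ⟩) m)

    count-0 : {P : A → Set} (P? : ∀ x → Dec (P x)) → ∀ xs → (∀ {x} → x ∈ xs → ¬ P x) → count P? xs ≡ 0
    count-0 P? []       h = refl
    count-0 P? (x ∷ xs) h = cong₂ _+_ (⟨⟩-no (P? x) (h (here refl))) (count-0 P? xs (h ∘ there))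

    length-filter≡count : {P : A → Set} (P? : ∀ x → Dec (P x)) → ∀ xs → length (filter P? xs) ≡ count P? xs
    length-filter≡count P? []       = refl
    length-filter≡count P? (x ∷ xs) with P? x
    ... | yes _ = cong suc (length-filter≡count P? xs)
    ... | no _  = length-filter≡count P? xs

    count-∁ : {P : A → Set} (P? : ∀ x → Dec (P x)) → ∀ xs → count (¬? ∘ P?) xs + count P? xs ≡ length xs
    count-∁ P? []       = refl
    count-∁ P? (x ∷ xs) with P? x
    ... | yes _ = trans (+-suc _ _) (cong suc (count-∁ P? xs))
    ... | no _  = cong suc (count-∁ P? xs)

    unique-count : {P : A → Set} (P? : ∀ x → Dec (P x)) → ∀ {ys xs : List A} → Unique ys →
                   (∀ {y} → y ∈ ys → y ∈ xs × P y) → length ys ≤ count P? xs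
    unique-count P? {[]}     {xs} u h = z≤n
    unique-count {P = P} P? {y ∷ ys} {xs} (y∉ ∷ u) h with ∈-∃++ (proj₁ (h (here refl)))
    ... | as , bs , refl = begin
      suc (length ys)                            ≤⟨ s≤s (unique-count P? u h′) ⟩
      suc (count P? (as ++ bs))                  ≡⟨ cong suc (∑-++ as bs _) ⟩
      suc (count P? as + count P? bs)            ≡⟨ +-suc (count P? as) (count P? bs) ⟨
      count P? as + suc (count P? bs)
        ≡⟨ cong (λ i → count P? as + (i + count P? bs)) (⟨⟩-yes (P? y) (proj₂ (h (here refl)))) ⟨
      count P? as + (⟨ P? y ⟩ + count P? bs)     ≡⟨ ∑-++ as (y ∷ bs) _ ⟨
      count P? (as ++ y ∷ bs)                    ∎
      where
      open ≤-Reasoning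
      h′ : ∀ {z} → z ∈ ys → z ∈ as ++ bs × P z
      h′ z∈ with ∈-++⁻ as (proj₁ (h (there z∈)))
      ... | inj₁ z∈as            = ∈-++⁺ˡ z∈as , proj₂ (h (there z∈))
      ... | inj₂ (here refl)     = contradiction refl (All.lookup y∉ z∈)
      ... | inj₂ (there z∈bs)    = ∈-++⁺ʳ as z∈bs , proj₂ (h (there z∈))

    unique-length : ∀ {ys xs : List A} → Unique ys → (∀ {y} → y ∈ ys → y ∈ xs) → length ys ≤ length xs
    unique-length {xs = xs} u h =
      ≤-trans (unique-count (λ _ → yes tt) u (λ m → h m , tt)) (count≤length (λ _ → yes tt) xs)

    unique-map : ∀ (f : A → B) {xs : List A} → AllPairs (λ x y → f x ≢ f y) xs → Unique (map f xs)
    unique-map f []       = []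
    unique-map f (p ∷ ps) = All.map⁺ p ∷ unique-map f ps

    maximal : ∀ (g : A → ℕ) x xs → ∃ λ y → y ∈ x ∷ xs × (∀ {z} → z ∈ x ∷ xs → g z ≤ g y)
    maximal g x []        = x , here refl , λ { (here refl) → ≤-refl }
    maximal g x (x′ ∷ xs) with maximal g x′ xs
    ... | y , y∈ , y-max with ≤-total (g x) (g y)
    ...   | inj₁ x≤y = y , there y∈ , λ { (here refl) → x≤y ; (there m) → y-max m }
    ...   | inj₂ y≤x = x , here refl , λ { (here refl) → ≤-refl ; (there m) → ≤-trans (y-max m) y≤x }

    minimal : ∀ (g : A → ℕ) x xs → ∃ λ y → y ∈ x ∷ xs × (∀ {z} → z ∈ x ∷ xs → g y ≤ g z)
    minimal g x []        = x , here refl , λ { (here refl) → ≤-refl }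
    minimal g x (x′ ∷ xs) with minimal g x′ xs
    ... | y , y∈ , y-min with ≤-total (g x) (g y)
    ...   | inj₁ x≤y = x , here refl , λ { (here refl) → ≤-refl ; (there m) → ≤-trans x≤y (y-min m) }
    ...   | inj₂ y≤x = y , there y∈ , λ { (here refl) → y≤x ; (there m) → y-min m }

    -- Greedy hitting sets: as long as more than half of the sets are unhit, some
    -- element hits at least the fraction s / 2|E| of all sets.

    module HittingSet (H : F → X → Set) (H? : ∀ f x → Dec (H f x)) (E : List X) (s : ℕ) (s≥1 : 1 ≤ s) where

      Rich : List F → Set
      Rich fs = ∀ {f} → f ∈ fs → s ≤ count (H? f) E

      popular : ∀ f fs → Rich (f ∷ fs) →
                ∃ λ x → x ∈ E × length (f ∷ fs) * s ≤ length E * count (λ f → H? f x) (f ∷ fs)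
      popular f fs rich = go E refl
        where
        open ≤-Reasoning
        go : ∀ E′ → E′ ≡ E → ∃ λ x → x ∈ E × length (f ∷ fs) * s ≤ length E * count (λ f → H? f x) (f ∷ fs)
        go [] refl = contradiction (≤-trans s≥1 (rich (here refl))) λ ()
        go (x ∷ xs) refl with maximal (λ x → count (λ f → H? f x) (f ∷ fs)) x xs
        ... | y , y∈ , y-max = y , y∈ , (begin
          length (f ∷ fs) * s                                      ≤⟨ ∑-≥ (f ∷ fs) s rich ⟩
          ∑ (f ∷ fs) (λ f → count (H? f) E)                        ≡⟨ ∑-swap (f ∷ fs) E (λ f x → ⟨ H? f x ⟩) ⟩
          ∑ E (λ x → count (λ f → H? f x) (f ∷ fs))                ≤⟨ ∑-≤ E _ y-max ⟩
          length E * count (λ f → H? f y) (f ∷ fs)                 ∎)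

      Covers : List X → List F → Set
      Covers hs fs = ∀ {f} → f ∈ fs → Any (H f) hs

      halve : ∀ fs → Rich fs → ∀ t → ∃₂ λ hs fs′ → All (_∈ E) hs × length hs ≤ t ×
              (∀ {f} → f ∈ fs → Any (H f) hs ⊎ f ∈ fs′) × (∀ {f} → f ∈ fs′ → f ∈ fs) ×
              (2 * length fs′ ≤ length fs ⊎
               t * (length fs * s) + 2 * length E * length fs′ ≤ 2 * length E * length fs)
      halve fs rich zero    = [] , fs , [] , z≤n , inj₂ , id , inj₂ ≤-refl
      halve fs rich (suc t) with halve fs rich t
      ... | hs , fs′ , hs∈ , len , hit , sub , inj₁ few =
        hs , fs′ , hs∈ , ≤-trans len (n≤1+n t) , hit , sub , inj₁ few
      ... | hs , [] , hs∈ , len , hit , sub , inj₂ _ =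
        hs , [] , hs∈ , ≤-trans len (n≤1+n t) , hit , sub , inj₁ z≤n
      ... | hs , fs′@(f′ ∷ fs″) , hs∈ , len , hit , sub , inj₂ progress with 2 * length fs′ ≤? length fs
      ...   | yes few = hs , fs′ , hs∈ , ≤-trans len (n≤1+n t) , hit , sub , inj₁ few
      ...   | no many with popular f′ fs″ (rich ∘ sub)
      ...     | x , x∈ , pop = x ∷ hs , filter (λ f → ¬? (H? f x)) fs′ , x∈ ∷ hs∈ , s≤s len ,
                (λ m → [ inj₁ ∘ there , hit′ ]′ (hit m)) ,
                (λ m → sub (proj₁ (∈-filter⁻ (λ f → ¬? (H? f x)) {xs = fs′} m))) , inj₂ (begin
          suc t * (length fs * s) + 2 * e * length (filter (λ f → ¬? (H? f x)) fs′)
            ≡⟨ cong (λ i → suc t * (length fs * s) + 2 * e * i) (length-filter≡count (λ f → ¬? (H? f x)) fs′) ⟩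
          suc t * (length fs * s) + 2 * e * c̄
            ≡⟨ reorder (length fs * s) (t * (length fs * s)) (2 * e * c̄) ⟩
          t * (length fs * s) + (length fs * s + 2 * e * c̄)
            ≤⟨ +-monoʳ-≤ (t * (length fs * s)) (+-monoˡ-≤ (2 * e * c̄) gain) ⟩
          t * (length fs * s) + (2 * e * c + 2 * e * c̄)
            ≡⟨ cong (t * (length fs * s) +_) (trans (sym (*-distribˡ-+ (2 * e) c c̄))
                 (cong (2 * e *_) (trans (+-comm c c̄) (count-∁ (λ f → H? f x) fs′)))) ⟩
          t * (length fs * s) + 2 * e * length fs′
            ≤⟨ progress ⟩
          2 * e * length fs ∎)
        where
        open ≤-Reasoning
        e c c̄ : ℕ
        e = length E
        c = count (λ f → H? f x) fs′
        c̄ = count (λ f → ¬? (H? f x)) fs′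
        reorder : ∀ a b z → (a + b) + z ≡ b + (a + z)
        reorder = solve-∀
        gain : length fs * s ≤ 2 * e * c
        gain = begin
          length fs * s              ≤⟨ *-monoˡ-≤ s (<⇒≤ (≰⇒> many)) ⟩
          2 * length fs′ * s         ≡⟨ *-assoc 2 (length fs′) s ⟩
          2 * (length fs′ * s)       ≤⟨ *-monoʳ-≤ 2 pop ⟩
          2 * (e * c)                ≡⟨ *-assoc 2 e c ⟨
          2 * e * c                  ∎
        hit′ : ∀ {f} → f ∈ fs′ → Any (H f) (x ∷ hs) ⊎ f ∈ filter (λ f → ¬? (H? f x)) fs′
        hit′ {f} m with H? f x
        ... | yes h = inj₁ (here h)
        ... | no ¬h = inj₂ (∈-filter⁺ (λ f → ¬? (H? f x)) m ¬h)

      hittingSet : ∀ j fs → Rich fs → length fs < 2 ^ j →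
                   ∃ λ hs → All (_∈ E) hs × length hs * s ≤ 2 * length E * j × Covers hs fs
      hittingSet j       []         rich lt = [] , [] , z≤n , λ ()
      hittingSet zero    (f ∷ fs)   rich (s≤s ())
      hittingSet (suc j) fs@(f ∷ _) rich lt with halve fs rich (suc t)
        where
        instance _ = >-nonZero s≥1
        t = length E / s
      ... | hs , fs′ , hs∈ , len , hit , sub , outcome with hittingSet j fs′ (rich ∘ sub) fewer
        where
        open ≤-Reasoning
        instance _ = >-nonZero s≥1
        t = length E / s
        few : 2 * length fs′ ≤ length fs ⊎
              suc t * (length fs * s) + 2 * length E * length fs′ ≤ 2 * length E * length fs →
              2 * length fs′ ≤ length fs
        few (inj₁ h) = h
        few (inj₂ h) = ≮⇒≥ λ many → <-irrefl refl (begin-strict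
          2 * length E * length fs
            ≡⟨ twice (length E) (length fs) ⟩
          length E * length fs + length E * length fs
            <⟨ +-monoˡ-< (length E * length fs) (*-monoˡ-< (length fs) (m<[1+m/n]*n (length E) s)) ⟩
          suc t * s * length fs + length E * length fs
            ≤⟨ +-mono-≤ (≤-reflexive (assoc′ (suc t) s (length fs))) (*-monoʳ-≤ (length E) (<⇒≤ many)) ⟩
          suc t * (length fs * s) + length E * (2 * length fs′)
            ≡⟨ cong (suc t * (length fs * s) +_) (assoc″ (length E) (length fs′)) ⟩
          suc t * (length fs * s) + 2 * length E * length fs′
            ≤⟨ h ⟩
          2 * length E * length fs ∎)
          where
          twice : ∀ a b → 2 * a * b ≡ a * b + a * b
          twice = solve-∀
          assoc′ : ∀ a b c → a * b * c ≡ a * (c * b)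
          assoc′ = solve-∀
          assoc″ : ∀ a b → a * (2 * b) ≡ 2 * a * b
          assoc″ = solve-∀
          m<[1+m/n]*n : ∀ m n .{{_ : NonZero n}} → m < suc (m / n) * n
          m<[1+m/n]*n m n = begin-strict
            m                     ≡⟨ m≡m%n+[m/n]*n m n ⟩
            m % n + m / n * n     <⟨ +-monoˡ-< (m / n * n) (m%n<n m n) ⟩
            n + m / n * n         ∎
        fewer : length fs′ < 2 ^ j
        fewer = *-cancelˡ-< 2 (length fs′) (2 ^ j) (≤-<-trans (few outcome) lt)
      ...   | hs′ , hs′∈ , len′ , hit″ = hs ++ hs′ , All.++⁺ hs∈ hs′∈ , (begin
          length (hs ++ hs′) * s                   ≡⟨ cong (_* s) (length-++ hs) ⟩
          (length hs + length hs′) * s             ≡⟨ *-distribʳ-+ s (length hs) _ ⟩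
          length hs * s + length hs′ * s           ≤⟨ +-mono-≤ (*-monoˡ-≤ s len) len′ ⟩
          suc t * s + 2 * length E * j             ≤⟨ +-monoˡ-≤ (2 * length E * j) (+-mono-≤ s≤E (m/n*n≤m (length E) s)) ⟩
          (length E + length E) + 2 * length E * j ≡⟨ collect (length E) j ⟩
          2 * length E * suc j                     ∎) , all-hit
        where
        open ≤-Reasoning
        instance _ = >-nonZero s≥1
        t = length E / s
        s≤E : s ≤ length E
        s≤E = ≤-trans (rich (here refl)) (count≤length (H? f) E)
        collect : ∀ e j → (e + e) + 2 * e * j ≡ 2 * e * suc j
        collect = solve-∀
        all-hit : Covers (hs ++ hs′) fs
        all-hit m with hit m
        ... | inj₁ h = Any-++ˡ h
          where
          Any-++ˡ : ∀ {f hs} → Any (H f) hs → Any (H f) (hs ++ hs′)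
          Any-++ˡ (here h)  = here h
          Any-++ˡ (there h) = there (Any-++ˡ h)
        ... | inj₂ m′ = Any-++ʳ hs (hit″ m′)
          where
          Any-++ʳ : ∀ {f} hs → Any (H f) hs′ → Any (H f) (hs ++ hs′)
          Any-++ʳ []       h = h
          Any-++ʳ (_ ∷ hs) h = there (Any-++ʳ hs h)

  open FiniteSums

  lastOf : {A : Set} → A → List A → A
  lastOf x []       = x
  lastOf x (y ∷ ys) = lastOf y ys

  lastOf-++ : {A : Set} (x : A) (xs : List A) (y : A) (ys : List A) → lastOf x (xs ++ y ∷ ys) ≡ lastOf y ys
  lastOf-++ x []        y ys = refl
  lastOf-++ x (x′ ∷ xs) y ys = lastOf-++ x′ xs y ys

  lastOf-∈ : {A : Set} (x : A) (xs : List A) → lastOf x xs ∈ x ∷ xs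
  lastOf-∈ x []       = here refl
  lastOf-∈ x (y ∷ ys) = there (lastOf-∈ y ys)

  Linked-++ˡ : {A : Set} {R : A → A → Set} (xs : List A) {ys : List A} → Linked R (xs ++ ys) → Linked R xs
  Linked-++ˡ []            l       = []
  Linked-++ˡ (x ∷ [])      l       = [-]
  Linked-++ˡ (x ∷ y ∷ xs)  (r ∷ l) = r ∷ Linked-++ˡ (y ∷ xs) l

  Linked-++ʳ : {A : Set} {R : A → A → Set} (xs : List A) {ys : List A} → Linked R (xs ++ ys) → Linked R ys
  Linked-++ʳ []                    l       = l
  Linked-++ʳ (x ∷ [])     {[]}     l       = []
  Linked-++ʳ (x ∷ [])     {y ∷ ys} (r ∷ l) = l
  Linked-++ʳ (x ∷ y ∷ xs)          (r ∷ l) = Linked-++ʳ (y ∷ xs) l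

  AllPairs-++ˡ : {A : Set} {R : A → A → Set} (xs : List A) {ys : List A} → AllPairs R (xs ++ ys) → AllPairs R xs
  AllPairs-++ˡ []       ps       = []
  AllPairs-++ˡ (x ∷ xs) (p ∷ ps) = All.++⁻ˡ xs p ∷ AllPairs-++ˡ xs ps

  AllPairs-++ʳ : {A : Set} {R : A → A → Set} (xs : List A) {ys : List A} → AllPairs R (xs ++ ys) → AllPairs R ys
  AllPairs-++ʳ []       ps       = ps
  AllPairs-++ʳ (x ∷ xs) (p ∷ ps) = AllPairs-++ʳ xs ps

  AllPairs-++ˣ : {A : Set} {R : A → A → Set} (xs : List A) {ys : List A} → AllPairs R (xs ++ ys) →
                 ∀ {x y} → x ∈ xs → y ∈ ys → R x y
  AllPairs-++ˣ (x ∷ xs) (p ∷ ps) (here refl) y∈ = All.lookup (All.++⁻ʳ xs p) y∈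
  AllPairs-++ˣ (x ∷ xs) (p ∷ ps) (there x∈)  y∈ = AllPairs-++ˣ xs ps x∈ y∈

  comparable : {A : Set} {R : A → A → Set} {xs : List A} → AllPairs R xs →
            ∀ {x y} → x ∈ xs → y ∈ xs → R x y ⊎ x ≡ y ⊎ R y x
  comparable (p ∷ ps) (here refl) (here refl) = inj₂ (inj₁ refl)
  comparable (p ∷ ps) (here refl) (there y∈)  = inj₁ (All.lookup p y∈)
  comparable (p ∷ ps) (there x∈)  (here refl) = inj₂ (inj₂ (All.lookup p x∈))
  comparable (p ∷ ps) (there x∈)  (there y∈)  = comparable ps x∈ y∈

  lastWith : {A : Set} {P : A → Set} (P? : ∀ x → Dec (P x)) (x : A) (xs : List A) → P x →
             ∃₂ λ as y → ∃ λ bs → x ∷ xs ≡ as ++ y ∷ bs × P y × (∀ {z} → z ∈ bs → ¬ P z)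
  lastWith {P = P} P? x xs px with search xs
    where
    search : ∀ zs → (∀ {z} → z ∈ zs → ¬ P z) ⊎
             (∃₂ λ as y → ∃ λ bs → zs ≡ as ++ y ∷ bs × P y × (∀ {z} → z ∈ bs → ¬ P z))
    search []       = inj₁ λ ()
    search (z ∷ zs) with search zs | P? z
    ... | inj₂ (as , y , bs , eq , py , none) | _      = inj₂ (z ∷ as , y , bs , cong (z ∷_) eq , py , none)
    ... | inj₁ none                           | yes pz = inj₂ ([] , z , zs , refl , pz , none)
    ... | inj₁ none                           | no ¬pz = inj₁ λ { (here refl) → ¬pz ; (there m) → none m }
  ... | inj₁ none                           = [] , x , xs , refl , px , none
  ... | inj₂ (as , y , bs , eq , py , none) = x ∷ as , y , bs , cong (x ∷_) eq , py , none

  module QuasiMetric (A : Set) (d : A → A → ℕ) (d-refl : ∀ x → d x x ≡ 0)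
                     (tri : ∀ x y z → d x z ≤ d x y + d y z) where

    Between : A → A → A → Set
    Between x y z = d x y + d y z ≡ d x z

    between-trans : ∀ {u x y z} → Between u x y → Between u y z → Between u x z × Between x y z
    between-trans {u} {x} {y} {z} uxy uyz = uxz , xyz
      where
      open ≤-Reasoning
      xyz : d x y + d y z ≡ d x z
      xyz = ≤-antisym (+-cancelˡ-≤ (d u x) _ _ (begin
        d u x + (d x y + d y z)    ≡⟨ +-assoc (d u x) _ _ ⟨
        d u x + d x y + d y z      ≡⟨ cong (_+ d y z) uxy ⟩
        d u y + d y z              ≡⟨ uyz ⟩
        d u z                      ≤⟨ tri u x z ⟩
        d u x + d x z              ∎)) (tri x y z)
      uxz : d u x + d x z ≡ d u z
      uxz = begin-equality
        d u x + d x z              ≡⟨ cong (d u x +_) xyz ⟨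
        d u x + (d x y + d y z)    ≡⟨ +-assoc (d u x) _ _ ⟨
        d u x + d x y + d y z      ≡⟨ cong (_+ d y z) uxy ⟩
        d u y + d y z              ≡⟨ uyz ⟩
        d u z                      ∎

    between-splice : ∀ {u w x y} → Between u x w → Between x y w → Between u x y × Between u y w
    between-splice {u} {w} {x} {y} uxw xyw = uxy , uyw
      where
      open ≤-Reasoning
      total : d u x + d x y + d y w ≡ d u w
      total = trans (+-assoc (d u x) _ _) (trans (cong (d u x +_) xyw) uxw)
      uxy : d u x + d x y ≡ d u y
      uxy = ≤-antisym (+-cancelʳ-≤ (d y w) _ _ (≤-trans (≤-reflexive total) (tri u y w))) (tri u x y)
      uyw : d u y + d y w ≡ d u w
      uyw = trans (cong (_+ d y w) (sym uxy)) total

    ρ : A → A → ℕ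
    ρ x y = d x y + d y x

    ρ-refl : ∀ x → ρ x x ≡ 0
    ρ-refl x = cong₂ _+_ (d-refl x) (d-refl x)

    ρ-sym : ∀ x y → ρ x y ≡ ρ y x
    ρ-sym x y = +-comm (d x y) (d y x)

    ρ-tri : ∀ x y z → ρ x z ≤ ρ x y + ρ y z
    ρ-tri x y z = ≤-trans (+-mono-≤ (tri x y z) (tri z y x)) (≤-reflexive (lemma (d x y) (d y z) (d z y) (d y x)))
      where
      lemma : ∀ a b c e → a + b + (c + e) ≡ a + e + (b + c)
      lemma = solve-∀

    -- _≺[ u ]_ : x strictly precedes y on a geodesic issuing from u.

    _≺[_]_ : A → A → A → Set
    x ≺[ u ] y = Between u x y × d u x < d u y

    ρ-monoʳ : ∀ {x y z} → Between x y z → ρ x y ≤ ρ x z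
    ρ-monoʳ {x} {y} {z} b = begin
      d x y + d y x               ≤⟨ +-monoʳ-≤ (d x y) (tri y z x) ⟩
      d x y + (d y z + d z x)     ≡⟨ +-assoc (d x y) _ _ ⟨
      d x y + d y z + d z x       ≡⟨ cong (_+ d z x) b ⟩
      d x z + d z x               ∎
      where open ≤-Reasoning

    ρ-monoˡ : ∀ {x y z} → Between x y z → ρ y z ≤ ρ x z
    ρ-monoˡ {x} {y} {z} b = begin
      d y z + d z y               ≤⟨ +-monoʳ-≤ (d y z) (tri z x y) ⟩
      d y z + (d z x + d x y)     ≡⟨ lemma (d y z) (d z x) (d x y) ⟩
      d x y + d y z + d z x       ≡⟨ cong (_+ d z x) b ⟩
      d x z + d z x               ∎
      where
      open ≤-Reasoning
      lemma : ∀ a b c → a + (b + c) ≡ c + a + b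
      lemma = solve-∀

    data Reach (E : A → A → Set) : ℕ → ℕ → A → A → Set where
      stop : ∀ {k w x} → Reach E k w x x
      step : ∀ {k w v x y z} → E x y → Reach E k v y z → d x y + v ≤ w → Reach E (suc k) w x z

    reach-mono : ∀ {E F : A → A → Set} {k l v w x y} → (∀ {a b} → E a b → F a b) → k ≤ l → v ≤ w →
                 Reach E k v x y → Reach F l w x y
    reach-mono f k≤l       v≤w stop         = stop
    reach-mono f (s≤s k≤l) v≤w (step e r h) = step (f e) (reach-mono f k≤l ≤-refl r) (≤-trans h v≤w)

    reach-++ : ∀ {E : A → A → Set} {k l v w x y z} → Reach E k v x y → Reach E l w y z → Reach E (k + l) (v + w) x z
    reach-++ {k = k} {l} {v} {w} stop         r′ = reach-mono id (m≤n+m l k) (m≤n+m w v) r′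
    reach-++ {w = w}             (step {v = v} {x = x} {y = y} e r h) r′ =
      step e (reach-++ r r′) (≤-trans (≤-reflexive (sym (+-assoc (d x y) v w))) (+-monoˡ-≤ w h))

    reach-⊕ : ∀ {E : A → A → Set} {k l x y z} → Between x y z →
              Reach E k (d x y) x y → Reach E l (d y z) y z → Reach E (k + l) (d x z) x z
    reach-⊕ b r r′ = reach-mono id ≤-refl (≤-reflexive b) (reach-++ r r′)

    edge : ∀ {E : A → A → Set} {x y} → E x y → Reach E 1 (d x y) x y
    edge e = step e (stop {k = 0} {w = 0}) (≤-reflexive (+-identityʳ _))

    module _ {Base : A → A → Set} {u : A} where

      walk : ∀ x xs → Linked Base (x ∷ xs) → AllPairs _≺[ u ]_ (x ∷ xs) →
             Reach Base (length xs) (d x (lastOf x xs)) x (lastOf x xs)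
      walk x []       l       ps             = stop
      walk x (y ∷ ys) (b ∷ l) ((p ∷ _) ∷ ps@(q ∷ _)) = reach-⊕ (btw (lastOf-∈ y ys)) (edge b) (walk y ys l ps)
        where
        btw : ∀ {z} → z ∈ y ∷ ys → Between x y z
        btw (here refl) = trans (cong (d x y +_) (d-refl y)) (+-identityʳ _)
        btw (there z∈)  = proj₂ (between-trans (proj₁ p) (proj₁ (All.lookup q z∈)))

      walkTo : ∀ {x xs} as {y bs} → x ∷ xs ≡ as ++ y ∷ bs → Linked Base (x ∷ xs) → AllPairs _≺[ u ]_ (x ∷ xs) →
               Reach Base (length as) (d x y) x y
      walkTo []       refl l ps = stop
      walkTo {x} (a ∷ as) {y} refl l ps = reach-mono id
        (≤-reflexive (trans (length-++ as) (+-comm (length as) 1)))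
        (≤-reflexive (cong (d x) (lastOf-++ x as y [])))
        (subst (Reach Base _ _ x) (lastOf-++ x as y [])
          (walk x (as ++ y ∷ []) (Linked-++ˡ (x ∷ as ++ y ∷ []) (subst (Linked Base) (sym assoc) l))
                                 (AllPairs-++ˡ (x ∷ as ++ y ∷ []) (subst (AllPairs _) (sym assoc) ps))))
        where
        assoc : ∀ {bs} → x ∷ (as ++ y ∷ []) ++ bs ≡ x ∷ as ++ y ∷ bs
        assoc {bs} = cong (x ∷_) (++-assoc as (y ∷ []) bs)

    data Geodesic (Base : A → A → Set) (z : A) : A → List A → Set where
      done : Geodesic Base z z (z ∷ [])
      _◃_  : ∀ {x y xs} → Base x y × 1 ≤ d x y × Between x y z → Geodesic Base z y xs → Geodesic Base z x (x ∷ xs)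

    module _ {Base : A → A → Set} {z : A} where

      geodesic-head : ∀ {x xs} → Geodesic Base z x xs → ∃ λ ys → xs ≡ x ∷ ys × lastOf x ys ≡ z
      geodesic-head done    = [] , refl , refl
      geodesic-head (p ◃ g) with geodesic-head g
      ... | ys , refl , eq = _ ∷ ys , refl , eq

      geodesic-linked : ∀ {x xs} → Geodesic Base z x xs → Linked Base xs
      geodesic-linked done = [-]
      geodesic-linked (p ◃ g) with geodesic-head g | geodesic-linked g
      ... | ys , refl , eq | l = proj₁ p ∷ l

      geodesic-between : ∀ {x xs} → Geodesic Base z x xs → ∀ {y} → y ∈ xs → Between x y z
      geodesic-between done    (here refl) = trans (cong₂ _+_ (d-refl z) refl) refl
      geodesic-between {x} (p ◃ g) (here refl) = cong (_+ d x z) (d-refl x)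
      geodesic-between (p ◃ g) (there y∈)  = proj₂ (between-splice (proj₂ (proj₂ p)) (geodesic-between g y∈))

      geodesic-sorted : ∀ {x xs} → Geodesic Base z x xs → AllPairs _≺[ x ]_ xs
      geodesic-sorted done = [] ∷ []
      geodesic-sorted {x} (_◃_ {y = y} {xs = xs} (b , 1≤ , xyz) g) = All.tabulate first ∷ shift (geodesic-sorted g) id
        where
        btw : ∀ {v} → v ∈ xs → Between x y v
        btw v∈ = proj₁ (between-splice xyz (geodesic-between g v∈))
        pos : ∀ {v} → v ∈ xs → 1 ≤ d x v
        pos v∈ = ≤-trans 1≤ (≤-trans (m≤m+n _ _) (≤-reflexive (btw v∈)))
        first : ∀ {v} → v ∈ xs → x ≺[ x ] v
        first {v} v∈ = cong (_+ d x v) (d-refl x) , ≤-trans (≤-reflexive (cong suc (d-refl x))) (pos v∈)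
        shift : ∀ {vs} → AllPairs _≺[ y ]_ vs → (∀ {v} → v ∈ vs → v ∈ xs) → AllPairs _≺[ x ]_ vs
        shift []       h = []
        shift {v ∷ vs} (p ∷ ps) h = All.tabulate one ∷ shift ps (h ∘ there)
          where
          one : ∀ {w} → w ∈ vs → v ≺[ x ] w
          one {w} w∈ with All.lookup p w∈
          ... | vw , lt = (begin-equality
            d x v + d v w               ≡⟨ cong (_+ d v w) (btw (h (here refl))) ⟨
            d x y + d y v + d v w       ≡⟨ +-assoc (d x y) _ _ ⟩
            d x y + (d y v + d v w)     ≡⟨ cong (d x y +_) vw ⟩
            d x y + d y w               ≡⟨ btw (h (there w∈)) ⟩
            d x w                       ∎) , (begin-strict
            d x v                       ≡⟨ btw (h (here refl)) ⟨
            d x y + d y v               <⟨ +-monoʳ-< (d x y) lt ⟩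
            d x y + d y w               ≡⟨ btw (h (there w∈)) ⟩
            d x w                       ∎)
            where open ≤-Reasoning

      sorted-unique : ∀ {u xs} → AllPairs _≺[ u ]_ xs → Unique xs
      sorted-unique = AllPairs.map λ { (_ , lt) refl → <-irrefl refl lt }

  length-× : {A B : Set} (xs : List A) (ys : List B) → length (cartesianProduct xs ys) ≡ length xs * length ys
  length-× []       ys = refl
  length-× (x ∷ xs) ys = trans (length-++ (map (x ,_) ys)) (cong₂ _+_ (length-map (x ,_) ys) (length-× xs ys))

  ∑-map : {A B : Set} (g : A → B) (xs : List A) (f : B → ℕ) → ∑ (map g xs) f ≡ ∑ xs (f ∘ g)
  ∑-map g []       f = refl
  ∑-map g (x ∷ xs) f = cong (f (g x) +_) (∑-map g xs f)

  ∑-× : {A B : Set} (xs : List A) (ys : List B) (f : A × B → ℕ) →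
        ∑ (cartesianProduct xs ys) f ≡ ∑ xs (λ x → ∑ ys (λ y → f (x , y)))
  ∑-× []       ys f = refl
  ∑-× (x ∷ xs) ys f = trans (∑-++ (map (x ,_) ys) _ f) (cong₂ _+_ (∑-map (x ,_) ys f) (∑-× xs ys f))

  gather : {X : Set} (P : ℕ → List X → Set) → (∀ {j hs hs′} → (∀ {x} → x ∈ hs → x ∈ hs′) → P j hs → P j hs′) →
           ∀ c → (∀ j → ∃ λ hs → length hs ≤ c × P j hs) →
           ∀ J → ∃ λ hs → length hs ≤ J * c × (∀ {j} → j < J → P j hs)
  gather P mono c build zero    = [] , z≤n , λ ()
  gather P mono c build (suc J) with build J | gather P mono c build J
  ... | hs , len , p | hs′ , len′ , p′ =
    hs ++ hs′ , ≤-trans (≤-reflexive (length-++ hs)) (+-mono-≤ len len′) , all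
    where
    all : ∀ {j} → j < suc J → P j (hs ++ hs′)
    all {j} (s≤s j≤J) with m≤n⇒m<n∨m≡n j≤J
    ... | inj₁ j<J  = mono (∈-++⁺ʳ hs) (p′ j<J)
    ... | inj₂ refl = mono ∈-++⁺ˡ p

  _∪ₗ_ : {A : Set} → (A → A → Set) → List (A × A) → A → A → Set
  (E ∪ₗ H) x y = E x y ⊎ (x , y) ∈ H

  ∪ₗ-mono : {A : Set} {E : A → A → Set} {H H′ : List (A × A)} → (∀ {e} → e ∈ H → e ∈ H′) →
            ∀ {x y} → (E ∪ₗ H) x y → (E ∪ₗ H′) x y
  ∪ₗ-mono f (inj₁ e) = inj₁ e
  ∪ₗ-mono f (inj₂ h) = inj₂ (f h)

  drop-suffix : {A : Set} (K : ℕ) (xs : List A) → 2 * K ≤ length xs →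
                ∃ λ ms → xs ≡ take K xs ++ ms ++ drop (length xs ∸ K) xs ×
                length (take K xs) ≡ K × length (drop (length xs ∸ K) xs) ≡ K
  drop-suffix K xs 2K≤ =
    take (length xs ∸ K ∸ K) (drop K xs) ,
    sym (trans (cong (λ s → take K xs ++ take (length xs ∸ K ∸ K) (drop K xs) ++ s) (sym tail))
        (trans (cong (take K xs ++_) (take++drop≡id (length xs ∸ K ∸ K) (drop K xs))) (take++drop≡id K xs))) ,
    trans (length-take K xs) (m≤n⇒m⊓n≡m K≤) ,
    trans (length-drop (length xs ∸ K) xs) (m∸[m∸n]≡n K≤)
    where
    K+K≤ : K + K ≤ length xs
    K+K≤ = ≤-trans (≤-reflexive (cong (K +_) (sym (+-identityʳ K)))) 2K≤
    K≤ : K ≤ length xs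
    K≤ = ≤-trans (m≤m+n K K) K+K≤
    tail : drop (length xs ∸ K ∸ K) (drop K xs) ≡ drop (length xs ∸ K) xs
    tail = trans (drop-drop K (length xs ∸ K ∸ K) xs)
                 (cong (λ i → drop i xs) (m+[n∸m]≡n (≤-trans (≤-reflexive (sym (m+n∸n≡m K K))) (∸-monoˡ-≤ K K+K≤))))

  prefix-length : {A : Set} (as : List A) {x : A} (bs : List A) {l : List A} {K : ℕ} →
                  l ≡ as ++ x ∷ bs → length l ≡ K → length as ≤ K
  prefix-length as bs refl len = ≤-trans (m≤m+n (length as) _) (≤-reflexive (trans (sym (length-++ as)) len))

  suffix-length : {A : Set} (cs : List A) {x : A} (es : List A) {l : List A} {K : ℕ} →
                  l ≡ cs ++ x ∷ es → length l ≡ K → suc (length es) ≤ K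
  suffix-length cs es refl len = ≤-trans (m≤n+m (suc (length es)) (length cs)) (≤-reflexive (trans (sym (length-++ cs)) len))

  ∈-concat-map : {A B : Set} (f : A → List B) {xs : List A} {x : A} {y : B} → x ∈ xs → y ∈ f x → y ∈ concat (map f xs)
  ∈-concat-map f (here refl) y∈ = ∈-++⁺ˡ y∈
  ∈-concat-map f {x′ ∷ xs} (there x∈)  y∈ = ∈-++⁺ʳ (f x′) (∈-concat-map f x∈ y∈)

  ∈-concat-map⁻ : {A B : Set} (f : A → List B) (xs : List A) {y : B} → y ∈ concat (map f xs) → ∃ λ x → x ∈ xs × y ∈ f x
  ∈-concat-map⁻ f (x ∷ xs) y∈ with ∈-++⁻ (f x) y∈
  ... | inj₁ h = x , here refl , h
  ... | inj₂ h with ∈-concat-map⁻ f xs h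
  ...   | x′ , x′∈ , y∈′ = x′ , there x′∈ , y∈′

  -- A sorted list of length < 2^j gets 2-hop shortcuts from at most j·length
  -- edges: join everything to the middle element and recurse on both halves.

  halvingEdges : {A : Set} → ℕ → List A → List (A × A)
  halvingEdges zero    xs = []
  halvingEdges (suc j) xs with take ⌊ length xs /2⌋ xs | drop ⌊ length xs /2⌋ xs
  ... | ls | []     = []
  ... | ls | m ∷ rs = map (_, m) ls ++ map (m ,_) rs ++ halvingEdges j ls ++ halvingEdges j rs

  halvingEdges-length : {A : Set} (j : ℕ) (xs : List A) → length (halvingEdges j xs) ≤ j * length xs
  halvingEdges-length zero    xs = z≤n
  halvingEdges-length (suc j) xs with take ⌊ length xs /2⌋ xs | drop ⌊ length xs /2⌋ xs | take++drop≡id ⌊ length xs /2⌋ xs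
  ... | ls | []     | eq = z≤n
  ... | ls | m ∷ rs | refl = begin
    length (map (_, m) ls ++ map (m ,_) rs ++ halvingEdges j ls ++ halvingEdges j rs)
      ≡⟨ length-++ (map (_, m) ls) ⟩
    length (map (_, m) ls) + length (map (m ,_) rs ++ halvingEdges j ls ++ halvingEdges j rs)
      ≡⟨ cong₂ _+_ (length-map (_, m) ls) (trans (length-++ (map (m ,_) rs)) (cong₂ _+_ (length-map (m ,_) rs) (length-++ (halvingEdges j ls)))) ⟩
    length ls + (length rs + (length (halvingEdges j ls) + length (halvingEdges j rs)))
      ≤⟨ +-monoʳ-≤ (length ls) (+-monoʳ-≤ (length rs) (+-mono-≤ (halvingEdges-length j ls) (halvingEdges-length j rs))) ⟩
    length ls + (length rs + (j * length ls + j * length rs))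
      ≤⟨ m≤m+n _ (suc j) ⟩
    length ls + (length rs + (j * length ls + j * length rs)) + suc j
      ≡⟨ collect j (length ls) (length rs) ⟩
    suc j * (length ls + suc (length rs))
      ≡⟨ cong (suc j *_) (length-++ ls) ⟨
    suc j * length (ls ++ m ∷ rs) ∎
    where
    open ≤-Reasoning
    collect : ∀ j l r → l + (r + (j * l + j * r)) + suc j ≡ suc j * (l + suc r)
    collect = solve-∀

  module _ {A : Set} (R : A → A → Set) (asym : ∀ {x y} → R x y → R y x → ⊥) where

    TwoHops : List (A × A) → A → A → Set
    TwoHops H a b = (a , b) ∈ H ⊎ ∃ λ m → (a , m) ∈ H × (m , b) ∈ H × R a m × R m b

    private
      twoHops-mono : ∀ {H H′ a b} → (∀ {e} → e ∈ H → e ∈ H′) → TwoHops H a b → TwoHops H′ a b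
      twoHops-mono f (inj₁ e)                 = inj₁ (f e)
      twoHops-mono f (inj₂ (m , e , e′ , p))  = inj₂ (m , f e , f e′ , p)

    halvingEdges-twoHops : ∀ j (xs : List A) → length xs < 2 ^ j → AllPairs R xs →
                           ∀ {a b} → a ∈ xs → b ∈ xs → R a b → TwoHops (halvingEdges j xs) a b
    halvingEdges-twoHops zero    []       lt sorted ()
    halvingEdges-twoHops zero    (x ∷ xs) (s≤s ()) sorted
    halvingEdges-twoHops (suc j) xs lt sorted {a} {b} a∈ b∈ ab
      with take ⌊ length xs /2⌋ xs | drop ⌊ length xs /2⌋ xs | take++drop≡id ⌊ length xs /2⌋ xs
         | length-take ⌊ length xs /2⌋ xs | length-drop ⌊ length xs /2⌋ xs
    ... | ls | [] | eq | len-l | len-r = contradiction (⌊n/2⌋-full (length xs) len-r) (λ e → absurd xs e a∈)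
      where
      ⌊n/2⌋-full : ∀ n → 0 ≡ n ∸ ⌊ n /2⌋ → n ≡ 0
      ⌊n/2⌋-full zero    e = refl
      ⌊n/2⌋-full (suc n) e = contradiction (m∸n≡0⇒m≤n (sym e)) (<⇒≱ (⌊n/2⌋<n n))
      absurd : ∀ xs {a : A} → length xs ≡ 0 → a ∈ xs → ⊥
      absurd []       e ()
      absurd (_ ∷ _)  () a∈
    ... | ls | m ∷ rs | refl | len-l | len-r with ∈-++⁻ ls a∈ | ∈-++⁻ ls b∈
    ...   | inj₁ a∈l         | inj₁ b∈l         =
      twoHops-mono (∈-++⁺ʳ (map (_, m) ls) ∘ ∈-++⁺ʳ (map (m ,_) rs) ∘ ∈-++⁺ˡ)
        (halvingEdges-twoHops j ls (≤-<-trans (≤-trans (≤-reflexive len-l) (m⊓n≤m _ _)) half<) (AllPairs-++ˡ ls sorted) a∈l b∈l ab)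
      where
      half< : ⌊ length (ls ++ m ∷ rs) /2⌋ < 2 ^ j
      half< = ⌊n/2⌋<m (length (ls ++ m ∷ rs)) (2 ^ j) lt
        where
        ⌊n/2⌋<m : ∀ n m → n < 2 * m → ⌊ n /2⌋ < m
        ⌊n/2⌋<m n m h = *-cancelˡ-< 2 _ _ (≤-<-trans (≤-trans (≤-reflexive (cong (⌊ n /2⌋ +_) (+-identityʳ _)))
                          (≤-trans (+-monoʳ-≤ ⌊ n /2⌋ (⌊n/2⌋≤⌈n/2⌉ n)) (≤-reflexive (⌊n/2⌋+⌈n/2⌉≡n n)))) h)
    ...   | inj₁ a∈l         | inj₂ (here refl) = inj₁ (∈-++⁺ˡ (∈-map⁺ (_, m) a∈l))
    ...   | inj₁ a∈l         | inj₂ (there b∈r) = inj₂ (m , ∈-++⁺ˡ (∈-map⁺ (_, m) a∈l) ,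
            ∈-++⁺ʳ (map (_, m) ls) (∈-++⁺ˡ (∈-map⁺ (m ,_) b∈r)) ,
            AllPairs-++ˣ ls sorted a∈l (here refl) , All.lookup (AllPairs.head (AllPairs-++ʳ ls sorted)) b∈r)
    ...   | inj₂ (here refl) | inj₁ b∈l         = ⊥-elim (asym ab (AllPairs-++ˣ ls sorted b∈l (here refl)))
    ...   | inj₂ (there a∈r) | inj₁ b∈l         = ⊥-elim (asym ab (AllPairs-++ˣ ls sorted b∈l (there a∈r)))
    ...   | inj₂ (here refl) | inj₂ (here refl) = ⊥-elim (asym ab ab)
    ...   | inj₂ (here refl) | inj₂ (there b∈r) = inj₁ (∈-++⁺ʳ (map (_, m) ls) (∈-++⁺ˡ (∈-map⁺ (m ,_) b∈r)))
    ...   | inj₂ (there a∈r) | inj₂ (here refl) = ⊥-elim (asym ab (All.lookup (AllPairs.head (AllPairs-++ʳ ls sorted)) a∈r))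
    ...   | inj₂ (there a∈r) | inj₂ (there b∈r) =
      twoHops-mono (∈-++⁺ʳ (map (_, m) ls) ∘ ∈-++⁺ʳ (map (m ,_) rs) ∘ ∈-++⁺ʳ (halvingEdges j ls))
        (halvingEdges-twoHops j rs (right< (length (ls ++ m ∷ rs)) lt len-r) (AllPairs.tail (AllPairs-++ʳ ls sorted)) a∈r b∈r ab)
      where
      open ≤-Reasoning
      right< : ∀ n {r} → n < 2 * 2 ^ j → suc r ≡ n ∸ ⌊ n /2⌋ → r < 2 ^ j
      right< n {r} lt eq = *-cancelˡ-< 2 _ _ (begin-strict
        2 * r                        ≡⟨ cong (r +_) (+-identityʳ r) ⟩
        r + r                        ≤⟨ +-mono-≤ r≤ (n≤1+n r) ⟩
        ⌊ n /2⌋ + suc r              ≡⟨ cong (⌊ n /2⌋ +_) eq ⟩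
        ⌊ n /2⌋ + (n ∸ ⌊ n /2⌋)      ≡⟨ m+[n∸m]≡n (⌊n/2⌋≤n n) ⟩
        n                            <⟨ lt ⟩
        2 * 2 ^ j                    ∎)
        where
        r≤ : r ≤ ⌊ n /2⌋
        r≤ = s≤s⁻¹ (begin
          suc r                                  ≡⟨ eq ⟩
          n ∸ ⌊ n /2⌋                            ≡⟨ cong (_∸ ⌊ n /2⌋) (⌊n/2⌋+⌈n/2⌉≡n n) ⟨
          (⌊ n /2⌋ + ⌈ n /2⌉) ∸ ⌊ n /2⌋          ≡⟨ m+n∸m≡n ⌊ n /2⌋ ⌈ n /2⌉ ⟩
          ⌈ n /2⌉                                ≤⟨ ⌊n/2⌋-mono {suc n} {suc (suc n)} (n≤1+n _) ⟩
          suc ⌊ n /2⌋                            ∎)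

  data Groups {B : Set} (Near : B → B → Set) (Y : List B) : List B → List B → Set where
    []    : Groups Near Y [] []
    group : ∀ {k rest i b S} as bs → k ∷ rest ≡ as ++ b ∷ bs → i ∈ Y → Near i k → Near i b →
            Groups Near Y bs S → Groups Near Y (k ∷ rest) (i ∷ S)

  -- Left-to-right greedy covering of a list by "intervals" (convex sets) I_i =
  -- {q : Near i q}: from the first point k still to be covered, take an
  -- interval containing k that reaches furthest.  An interval selected two
  -- rounds later cannot come back to a point covered before, since it would
  -- have been a better choice one round earlier.

  module GreedyCover {B : Set} (Near : B → B → Set) (near? : ∀ i q → Dec (Near i q)) (near-refl : ∀ i → Near i i)
                     (Y : List B)
                     (convex : ∀ {i q m k} as bs → i ∈ Y → Y ≡ as ++ m ∷ bs → q ∈ as → k ∈ bs →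
                               Near i q → Near i k → Near i m) where

    private
      hits : List B → B → ℕ
      hits S q = count (λ i → near? i q) S

      hits-none : ∀ S q → (∀ {i} → i ∈ S → ¬ Near i q) → hits S q ≡ 0
      hits-none S q = count-0 (λ i → near? i q) S

      record Selection (before rest : List B) : Set where
        field
          chosen  : List B
          groups  : Groups Near Y rest chosen
          chosen⊆ : ∀ {i} → i ∈ chosen → i ∈ Y
          touches : ∀ {i} → i ∈ chosen → ∃ λ k → k ∈ rest × Near i k
          twice   : ∀ {q} → q ∈ Y → hits chosen q ≤ 2
          once    : ∀ {q} → q ∈ before → hits chosen q ≤ 1

      select : ∀ fuel before rest → length rest ≤ fuel → Y ≡ before ++ rest → Selection before rest
      select fuel before [] len eq = record
        { chosen = [] ; groups = [] ; chosen⊆ = λ () ; touches = λ () ; twice = λ _ → z≤n ; once = λ _ → z≤n }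
      select (suc fuel) before (k ∷ rest) (s≤s len) eq
        with lastWith (λ b → Any.any? (λ i → near? i k ×-dec near? i b) Y) k rest
               (lose (subst (k ∈_) (sym eq) (∈-++⁺ʳ before (here refl))) (near-refl k , near-refl k))
      ... | as , b , bs , split , reach , none with find reach
      ...   | i , i∈ , ik , ib = record
        { chosen  = i ∷ chosen
        ; groups  = group as bs split i∈ ik ib groups
        ; chosen⊆ = λ { (here refl) → i∈ ; (there m) → chosen⊆ m }
        ; touches = λ { (here refl) → k , here refl , ik
                      ; (there m) → let k′ , k′∈ , nk′ = touches m in k′ , there (bs⊆ k′∈) , nk′ }
        ; twice   = twice′
        ; once    = λ {q} q∈ → ≤-trans (+-mono-≤ (⟨⟩≤1 (near? i q)) (≤-reflexive (hits-none chosen q (later q∈)))) ≤-refl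
        }
        where
        tail-split : ∀ as {b bs} → k ∷ rest ≡ as ++ b ∷ bs → ∃ λ cs → rest ≡ cs ++ bs
        tail-split []       refl = [] , refl
        tail-split (a ∷ as) {b} {bs} refl = as ++ b ∷ [] , sym (++-assoc as (b ∷ []) bs)
        cs = proj₁ (tail-split as split)
        rest≡ : rest ≡ cs ++ bs
        rest≡ = proj₂ (tail-split as split)
        bs⊆ : ∀ {x} → x ∈ bs → x ∈ rest
        bs⊆ x∈ = subst (_ ∈_) (sym rest≡) (∈-++⁺ʳ cs x∈)
        Y≡ : Y ≡ (before ++ k ∷ cs) ++ bs
        Y≡ = trans eq (trans (cong (λ r → before ++ k ∷ r) rest≡) (sym (++-assoc before (k ∷ cs) bs)))
        open Selection (select fuel (before ++ k ∷ cs) bs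
          (≤-trans (≤-trans (m≤n+m (length bs) (length cs)) (≤-reflexive (trans (sym (length-++ cs)) (cong length (sym rest≡))))) len) Y≡)
        later : ∀ {q} → q ∈ before → ∀ {i′} → i′ ∈ chosen → ¬ Near i′ q
        later q∈ i′∈ iq with touches i′∈
        ... | k′ , k′∈ , ik′ = none k′∈ (lose (chosen⊆ i′∈)
                (convex before rest (chosen⊆ i′∈) eq q∈ (bs⊆ k′∈) iq ik′ , ik′))
        twice′ : ∀ {q} → q ∈ Y → hits (i ∷ chosen) q ≤ 2
        twice′ {q} q∈ with near? i q
        ... | no _ = twice q∈
        ... | yes iq with ∈-++⁻ (before ++ k ∷ cs) (subst (q ∈_) Y≡ q∈)
        ...   | inj₁ q∈before = s≤s (once q∈before)
        ...   | inj₂ q∈bs     = ⊥-elim (none q∈bs (lose i∈ (ik , iq)))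

    greedyCover : ∃ λ S → Groups Near Y Y S × (∀ {i} → i ∈ S → i ∈ Y) × (∀ {q} → q ∈ Y → count (λ i → near? i q) S ≤ 2)
    greedyCover = let open Selection (select (length Y) [] Y ≤-refl refl) in chosen , groups , chosen⊆ , twice

  ∑-filter : {A : Set} {P : A → Set} (P? : ∀ x → Dec (P x)) (xs : List A) (f : A → ℕ) →
             ∑ (filter P? xs) f ≡ ∑ xs (λ x → f x * ⟨ P? x ⟩)
  ∑-filter P? []       f = refl
  ∑-filter P? (x ∷ xs) f with P? x
  ... | yes _ = cong₂ _+_ (sym (*-identityʳ (f x))) (∑-filter P? xs f)
  ... | no _  = trans (∑-filter P? xs f) (cong (_+ ∑ xs (λ x → f x * ⟨ P? x ⟩)) (sym (*-zeroʳ (f x))))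

  -- Σ 1/m ≤ 4 whenever each m satisfies Σ m ≤ 4 m²; fractions are scaled by Λ.

  reciprocal-sum : {B : Set} (μ : B → ℕ) (Λ : ℕ) (J : List B) →
                   (∀ {i} → i ∈ J → ∑ J (suc ∘ μ) ≤ 4 * (suc (μ i) * suc (μ i))) →
                   ∑ J (λ i → Λ / suc (μ i)) ≤ 4 * Λ
  reciprocal-sum μ Λ []       h = z≤n
  reciprocal-sum μ Λ J@(j ∷ js) h with minimal μ j js
  ... | i , i∈ , i-min = begin
    ∑ J (λ i → Λ / suc (μ i))          ≤⟨ ∑-≤ J (Λ / suc (μ i)) (λ j∈ → /-monoʳ-≤ Λ (s≤s (i-min j∈))) ⟩
    length J * (Λ / suc (μ i))         ≤⟨ *-monoˡ-≤ (Λ / suc (μ i)) few ⟩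
    4 * suc (μ i) * (Λ / suc (μ i))    ≡⟨ regroup (suc (μ i)) (Λ / suc (μ i)) ⟩
    4 * (Λ / suc (μ i) * suc (μ i))    ≤⟨ *-monoʳ-≤ 4 (m/n*n≤m Λ (suc (μ i))) ⟩
    4 * Λ                              ∎
    where
    open ≤-Reasoning
    regroup : ∀ m w → 4 * m * w ≡ 4 * (w * m)
    regroup = solve-∀
    few : length J ≤ 4 * suc (μ i)
    few = *-cancelʳ-≤ (length J) (4 * suc (μ i)) (suc (μ i)) (begin
      length J * suc (μ i)             ≤⟨ ∑-≥ J (suc (μ i)) (s≤s ∘ i-min) ⟩
      ∑ J (suc ∘ μ)                    ≤⟨ h i∈ ⟩
      4 * (suc (μ i) * suc (μ i))      ≡⟨ *-assoc 4 (suc (μ i)) (suc (μ i)) ⟨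
      4 * suc (μ i) * suc (μ i)        ∎)

  ballsAt : {B Z : Set} {InBall : B → Z → Set} (inBall? : ∀ i z → Dec (InBall i z)) (level : B → ℕ) →
            List B → Z → ℕ → List B
  ballsAt inBall? level S z ℓ = filter (λ i → (level i ≟ ℓ) ×-dec inBall? i z) S

  -- A Cauchy–Schwarz type bound for Σ aᵢ, where aᵢ² ≤ c |ball i|:  either
  -- aᵢ ≤ θ mᵢ, or θ mᵢ aᵢ ≤ c |ball i|, and the balls overlap little when the
  -- i-th one is weighted by 1/mᵢ.

  module WeightedBalls {B Z : Set} (S : List B) (zs : List Z) (InBall : B → Z → Set) (inBall? : ∀ i z → Dec (InBall i z))
                       (μ a : B → ℕ) (level : B → ℕ) (L Λ c p : ℕ)
                       (level≤ : ∀ {i} → i ∈ S → level i ≤ L)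
                       (m≤Λ : ∀ {i} → i ∈ S → suc (μ i) ≤ Λ)
                       (total : ∑ S (suc ∘ μ) ≤ 2 * p)
                       (square : ∀ {i} → i ∈ S → a i * a i ≤ c * count (inBall? i) zs)
                       (crowd : ∀ z ℓ {i} → i ∈ ballsAt inBall? level S z ℓ →
                                ∑ (ballsAt inBall? level S z ℓ) (suc ∘ μ) ≤ 4 * (suc (μ i) * suc (μ i))) where

    private
      wt : B → ℕ
      wt i = Λ / suc (μ i)

    covered? : ∀ z → Dec (Any (λ i → InBall i z) S)
    covered? z = Any.any? (λ i → inBall? i z) S

    U : ℕ
    U = count covered? zs

    weight-at : ∀ z → ∑ S (λ i → wt i * ⟨ inBall? i z ⟩) ≤ suc L * (4 * Λ) * ⟨ covered? z ⟩
    weight-at z with covered? z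
    ... | no none = ≤-trans (≤-reflexive (trans (∑-cong S λ {i} i∈ →
                      trans (cong (wt i *_) (⟨⟩-no (inBall? i z) λ h → none (lose i∈ h))) (*-zeroʳ (wt i)))
                      (trans (∑-const S 0) (*-zeroʳ (length S))))) z≤n
    ... | yes _ = begin
      ∑ S (λ i → wt i * ⟨ inBall? i z ⟩)
        ≤⟨ ∑-mono S by-level ⟩
      ∑ S (λ i → ∑ (upTo (suc L)) (λ ℓ → wt i * ⟨ (level i ≟ ℓ) ×-dec inBall? i z ⟩))
        ≡⟨ ∑-swap S (upTo (suc L)) (λ i ℓ → wt i * ⟨ (level i ≟ ℓ) ×-dec inBall? i z ⟩) ⟩
      ∑ (upTo (suc L)) (λ ℓ → ∑ S (λ i → wt i * ⟨ (level i ≟ ℓ) ×-dec inBall? i z ⟩))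
        ≡⟨ ∑-cong (upTo (suc L)) (λ {ℓ} _ → ∑-filter (λ i → (level i ≟ ℓ) ×-dec inBall? i z) S wt) ⟨
      ∑ (upTo (suc L)) (λ ℓ → ∑ (filter (λ i → (level i ≟ ℓ) ×-dec inBall? i z) S) wt)
        ≤⟨ ∑-≤ (upTo (suc L)) (4 * Λ) (λ {ℓ} _ → reciprocal-sum μ Λ _ (crowd z ℓ)) ⟩
      length (upTo (suc L)) * (4 * Λ)
        ≡⟨ cong (_* (4 * Λ)) (length-upTo (suc L)) ⟩
      suc L * (4 * Λ)
        ≡⟨ *-identityʳ _ ⟨
      suc L * (4 * Λ) * 1 ∎
      where
      open ≤-Reasoning
      by-level : ∀ {i} → i ∈ S →
                 wt i * ⟨ inBall? i z ⟩ ≤ ∑ (upTo (suc L)) (λ ℓ → wt i * ⟨ (level i ≟ ℓ) ×-dec inBall? i z ⟩)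
      by-level {i} i∈ = ≤-trans (*-monoʳ-≤ (wt i) (⟨⟩-mono (inBall? i z) ((level i ≟ level i) ×-dec inBall? i z) (refl ,_)))
                                (∑-∈ (λ ℓ → wt i * ⟨ (level i ≟ ℓ) ×-dec inBall? i z ⟩) (∈-upTo⁺ (s≤s (level≤ i∈))))

    weighted-sizes : ∑ S (λ i → wt i * count (inBall? i) zs) ≤ suc L * (4 * Λ) * U
    weighted-sizes = begin
      ∑ S (λ i → wt i * count (inBall? i) zs)
        ≡⟨ ∑-cong S (λ {i} _ → ∑-*ˡ zs (wt i) (λ z → ⟨ inBall? i z ⟩)) ⟨
      ∑ S (λ i → ∑ zs (λ z → wt i * ⟨ inBall? i z ⟩))
        ≡⟨ ∑-swap S zs (λ i z → wt i * ⟨ inBall? i z ⟩) ⟩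
      ∑ zs (λ z → ∑ S (λ i → wt i * ⟨ inBall? i z ⟩))
        ≤⟨ ∑-mono zs (λ {z} _ → weight-at z) ⟩
      ∑ zs (λ z → suc L * (4 * Λ) * ⟨ covered? z ⟩)
        ≡⟨ ∑-*ˡ zs (suc L * (4 * Λ)) (λ z → ⟨ covered? z ⟩) ⟩
      suc L * (4 * Λ) * U ∎
      where open ≤-Reasoning

    module _ (θ : ℕ) where

      heavy : B → ℕ
      heavy i with a i ≤? θ * suc (μ i)
      ... | yes _ = 0
      ... | no _  = a i

      a≤ : ∀ i → a i ≤ θ * suc (μ i) + heavy i
      a≤ i with a i ≤? θ * suc (μ i)
      ... | yes h = ≤-trans h (m≤m+n _ 0)
      ... | no _  = m≤n+m (a i) _

      heavy≤ : ∀ {i} → i ∈ S → θ * Λ * heavy i ≤ 2 * c * (wt i * count (inBall? i) zs)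
      heavy≤ {i} i∈ with a i ≤? θ * suc (μ i)
      ... | yes _ = ≤-trans (≤-reflexive (*-zeroʳ (θ * Λ))) z≤n
      ... | no h  = begin
        θ * Λ * a i                                 ≤⟨ *-monoˡ-≤ (a i) (*-monoʳ-≤ θ Λ≤) ⟩
        θ * (2 * wt i * suc (μ i)) * a i            ≡⟨ regroup θ (wt i) (suc (μ i)) (a i) ⟩
        2 * wt i * (θ * suc (μ i) * a i)            ≤⟨ *-monoʳ-≤ (2 * wt i) (*-monoˡ-≤ (a i) (<⇒≤ (≰⇒> h))) ⟩
        2 * wt i * (a i * a i)                      ≤⟨ *-monoʳ-≤ (2 * wt i) (square i∈) ⟩
        2 * wt i * (c * count (inBall? i) zs)       ≡⟨ regroup′ (wt i) c (count (inBall? i) zs) ⟩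
        2 * c * (wt i * count (inBall? i) zs)       ∎
        where
        open ≤-Reasoning
        regroup : ∀ t w m x → t * (2 * w * m) * x ≡ 2 * w * (t * m * x)
        regroup = solve-∀
        regroup′ : ∀ w c s → 2 * w * (c * s) ≡ 2 * c * (w * s)
        regroup′ = solve-∀
        Λ≤ : Λ ≤ 2 * wt i * suc (μ i)
        Λ≤ = begin
          Λ                                            ≡⟨ m≡m%n+[m/n]*n Λ (suc (μ i)) ⟩
          Λ % suc (μ i) + wt i * suc (μ i)             ≤⟨ +-monoˡ-≤ (wt i * suc (μ i)) (≤-trans (<⇒≤ (m%n<n Λ (suc (μ i))))
                                                            (≤-trans (≤-reflexive (sym (*-identityˡ _))) (*-monoˡ-≤ (suc (μ i)) (m≥n⇒m/n>0 {Λ} {suc (μ i)} (m≤Λ i∈))))) ⟩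
          wt i * suc (μ i) + wt i * suc (μ i)          ≡⟨ twice (wt i) (suc (μ i)) ⟩
          2 * wt i * suc (μ i)                         ∎
          where
          twice : ∀ w m → w * m + w * m ≡ 2 * w * m
          twice = solve-∀

      ball-cost : 1 ≤ Λ → θ * ∑ S a ≤ 2 * (θ * θ) * p + 8 * c * suc L * U
      ball-cost 1≤Λ = begin
        θ * ∑ S a                                                ≤⟨ *-monoʳ-≤ θ (∑-mono S (λ {i} _ → a≤ i)) ⟩
        θ * ∑ S (λ i → θ * suc (μ i) + heavy i)                  ≡⟨ cong (θ *_) (∑-+ S (λ i → θ * suc (μ i)) heavy) ⟩
        θ * (∑ S (λ i → θ * suc (μ i)) + ∑ S heavy)              ≡⟨ cong (λ x → θ * (x + ∑ S heavy)) (∑-*ˡ S θ (suc ∘ μ)) ⟩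
        θ * (θ * ∑ S (suc ∘ μ) + ∑ S heavy)                      ≡⟨ *-distribˡ-+ θ (θ * ∑ S (suc ∘ μ)) (∑ S heavy) ⟩
        θ * (θ * ∑ S (suc ∘ μ)) + θ * ∑ S heavy                  ≤⟨ +-mono-≤ (*-monoʳ-≤ θ (*-monoʳ-≤ θ total)) heavy-total ⟩
        θ * (θ * (2 * p)) + 8 * c * suc L * U                    ≡⟨ cong (_+ 8 * c * suc L * U) (regroup θ p) ⟩
        2 * (θ * θ) * p + 8 * c * suc L * U                      ∎
        where
        open ≤-Reasoning
        instance _ = >-nonZero 1≤Λ
        regroup : ∀ t p → t * (t * (2 * p)) ≡ 2 * (t * t) * p
        regroup = solve-∀
        comm₁ : ∀ t l h → t * h * l ≡ t * l * h
        comm₁ = solve-∀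
        comm₂ : ∀ c l Λ u → 2 * c * (l * (4 * Λ) * u) ≡ 8 * c * l * u * Λ
        comm₂ = solve-∀
        heavy-total : θ * ∑ S heavy ≤ 8 * c * suc L * U
        heavy-total = *-cancelʳ-≤ _ _ Λ (begin
          θ * ∑ S heavy * Λ                                      ≡⟨ comm₁ θ Λ (∑ S heavy) ⟩
          θ * Λ * ∑ S heavy                                      ≡⟨ ∑-*ˡ S (θ * Λ) heavy ⟨
          ∑ S (λ i → θ * Λ * heavy i)                            ≤⟨ ∑-mono S heavy≤ ⟩
          ∑ S (λ i → 2 * c * (wt i * count (inBall? i) zs))      ≡⟨ ∑-*ˡ S (2 * c) (λ i → wt i * count (inBall? i) zs) ⟩
          2 * c * ∑ S (λ i → wt i * count (inBall? i) zs)        ≤⟨ *-monoʳ-≤ (2 * c) weighted-sizes ⟩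
          2 * c * (suc L * (4 * Λ) * U)                          ≡⟨ comm₂ c (suc L) Λ U ⟩
          8 * c * suc L * U * Λ                                  ∎)

  -- If f doubles its exponent at every level, 2^L levels exhaust [1, N].

  doubling-level : ∀ (f : ℕ → ℕ) L lg → suc lg < 2 ^ suc L →
                   ∃ λ ℓ → ℓ ≤ L × (1 ≤ f 0 → (∀ l → f l < 2 ^ lg) → f (suc ℓ) ≤ 2 * (f ℓ * f ℓ))
  doubling-level f L lg big = conclude (search (suc L))
    where
    open ≤-Reasoning
    search : ∀ n → (∃ λ ℓ → ℓ < n × f (suc ℓ) ≤ 2 * (f ℓ * f ℓ)) ⊎ (1 ≤ f 0 → 2 ^ (2 ^ n) ≤ 2 * f n)
    search zero    = inj₂ λ 1≤ → *-monoʳ-≤ 2 1≤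
    search (suc n) with search n | f (suc n) ≤? 2 * (f n * f n)
    ... | inj₁ (ℓ , ℓ< , h) | _     = inj₁ (ℓ , ≤-trans ℓ< (n≤1+n n) , h)
    ... | inj₂ _            | yes h = inj₁ (n , ≤-refl , h)
    ... | inj₂ grown        | no h  = inj₂ λ 1≤ → begin
      2 ^ (2 * 2 ^ n)                        ≡⟨ cong (λ i → 2 ^ (2 ^ n + i)) (+-identityʳ (2 ^ n)) ⟩
      2 ^ (2 ^ n + 2 ^ n)                    ≡⟨ ^-distribˡ-+-* 2 (2 ^ n) (2 ^ n) ⟩
      2 ^ (2 ^ n) * 2 ^ (2 ^ n)              ≤⟨ *-mono-≤ (grown 1≤) (grown 1≤) ⟩
      2 * f n * (2 * f n)                    ≡⟨ square (f n) ⟩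
      2 * (2 * (f n * f n))                  ≤⟨ *-monoʳ-≤ 2 (<⇒≤ (≰⇒> h)) ⟩
      2 * f (suc n)                          ∎
      where
      square : ∀ x → 2 * x * (2 * x) ≡ 2 * (2 * (x * x))
      square = solve-∀
    conclude : (∃ λ ℓ → ℓ < suc L × f (suc ℓ) ≤ 2 * (f ℓ * f ℓ)) ⊎ (1 ≤ f 0 → 2 ^ (2 ^ suc L) ≤ 2 * f (suc L)) →
               ∃ λ ℓ → ℓ ≤ L × (1 ≤ f 0 → (∀ l → f l < 2 ^ lg) → f (suc ℓ) ≤ 2 * (f ℓ * f ℓ))
    conclude (inj₁ (ℓ , ℓ< , h)) = ℓ , s≤s⁻¹ ℓ< , λ _ _ → h
    conclude (inj₂ grown) = 0 , z≤n , λ 1≤ bound → contradiction (begin-strict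
      2 ^ (2 ^ suc L)      ≤⟨ grown 1≤ ⟩
      2 * f (suc L)        <⟨ *-monoʳ-< 2 (bound (suc L)) ⟩
      2 ^ suc lg           <⟨ ^-monoʳ-< 2 (s≤s (s≤s z≤n)) big ⟩
      2 ^ (2 ^ suc L)      ∎) (<-irrefl refl)

  square-above : ∀ s lg → s < 2 ^ lg → ∃ λ j → j ≤ lg × s ≤ 2 ^ j * 2 ^ j × (1 ≤ s → 2 ^ j * 2 ^ j ≤ 4 * s)
  square-above s lg s< = go lg (≤-trans (<⇒≤ s<) (m≤m*n (2 ^ lg) (2 ^ lg) {{m^n≢0 2 lg}}))
    where
    go : ∀ lg → s ≤ 2 ^ lg * 2 ^ lg → ∃ λ j → j ≤ lg × s ≤ 2 ^ j * 2 ^ j × (1 ≤ s → 2 ^ j * 2 ^ j ≤ 4 * s)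
    go zero     h = 0 , z≤n , h , λ 1≤s → ≤-trans 1≤s (m≤n*m s 4)
    go (suc lg) h with s ≤? 2 ^ lg * 2 ^ lg
    ... | yes h′ = let j , j≤ , p = go lg h′ in j , m≤n⇒m≤1+n j≤ , p
    ... | no h′  = suc lg , ≤-refl , h , λ _ →
                   ≤-trans (≤-reflexive (square (2 ^ lg))) (*-monoʳ-≤ 4 (<⇒≤ (≰⇒> h′)))
      where
      square : ∀ x → 2 * x * (2 * x) ≡ 4 * (x * x)
      square = solve-∀

  six-times-square : ∀ k s → k * k ≤ 4 * s → 6 * k * (6 * k) ≤ 144 * s
  six-times-square k s h = begin
    6 * k * (6 * k)      ≡⟨ regroup k ⟩
    36 * (k * k)         ≤⟨ *-monoʳ-≤ 36 h ⟩
    36 * (4 * s)         ≡⟨ *-assoc 36 4 s ⟨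
    144 * s              ∎
    where
    open ≤-Reasoning
    regroup : ∀ k → 6 * k * (6 * k) ≡ 36 * (k * k)
    regroup = solve-∀

  m<[1+m/n]*n : ∀ m n .{{_ : NonZero n}} → m < suc (m / n) * n
  m<[1+m/n]*n m n = begin-strict
    m                     ≡⟨ m≡m%n+[m/n]*n m n ⟩
    m % n + m / n * n     <⟨ +-monoˡ-< (m / n * n) (m%n<n m n) ⟩
    n + m / n * n         ∎
    where open ≤-Reasoning

  m*n≤o⇒m≤o/n : ∀ m n o .{{_ : NonZero n}} → m * n ≤ o → m ≤ o / n
  m*n≤o⇒m≤o/n m n o h = ≤-trans (≤-reflexive (sym (m*n/n≡m m n))) (/-monoˡ-≤ n h)

  same-quotient : ∀ a b n .{{_ : NonZero n}} → a / n ≡ b / n → a < b + n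
  same-quotient a b n eq = begin-strict
    a                     <⟨ m<[1+m/n]*n a n ⟩
    n + a / n * n         ≡⟨ cong (λ q → n + q * n) eq ⟩
    n + b / n * n         ≤⟨ +-monoʳ-≤ n (m/n*n≤m b n) ⟩
    n + b                 ≡⟨ +-comm n b ⟩
    b + n                 ∎
    where open ≤-Reasoning

  squares-cancel-≤ : ∀ a b → a * a ≤ b * b → a ≤ b
  squares-cancel-≤ a b h = ≮⇒≥ λ b<a → <⇒≱ (*-mono-< b<a b<a) h

  AllPairs-map-∈ : {A : Set} {R S : A → A → Set} {xs : List A} →
                   (∀ {x y} → x ∈ xs → y ∈ xs → R x y → S x y) → AllPairs R xs → AllPairs S xs
  AllPairs-map-∈ f []       = []
  AllPairs-map-∈ f (p ∷ ps) = All.tabulate (λ m → f (here refl) (there m) (All.lookup p m)) ∷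
                              AllPairs-map-∈ (λ m m′ → f (there m) (there m′)) ps

  private
    dominated : ∀ c {n} D U Q sL X4 p → c ≤ 4608 → 1 ≤ sL → U * Q * (4608 * sL * X4) ≤ D * D → p ≤ U → p ≤ Q * X4 →
                n * n ≡ c * (p * p) → n ≤ D
    dominated c {n} D U Q sL X4 p c≤ 1≤sL thin p≤U p≤Q eq = squares-cancel-≤ n D (begin
      n * n                           ≡⟨ eq ⟩
      c * (p * p)                     ≤⟨ *-mono-≤ (≤-trans c≤ (m≤m*n 4608 sL {{>-nonZero 1≤sL}})) (*-mono-≤ p≤U p≤Q) ⟩
      4608 * sL * (U * (Q * X4))      ≡⟨ regroup (4608 * sL) U Q X4 ⟩
      U * Q * (4608 * sL * X4)        ≤⟨ thin ⟩
      D * D                           ∎)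
      where
      open ≤-Reasoning
      regroup : ∀ a u q x → a * (u * (q * x)) ≡ u * q * (a * x)
      regroup = solve-∀

  -- The balance point is θ ≈ D / 2p.

  hop-budget : ∀ D U Q sL X4 p T → 1 ≤ sL → U * Q * (4608 * sL * X4) ≤ D * D → p ≤ U → p ≤ Q * X4 →
               (p ≡ 0 → T ≡ 0) → (1 ≤ p → ∀ θ → θ * T ≤ 2 * (θ * θ) * p + 8 * 144 * sL * U) → 3 * p + T ≤ 3 * D
  hop-budget D U Q sL X4 zero T 1≤sL thin p≤U p≤Q none bound = ≤-trans (≤-reflexive (none refl)) z≤n
  hop-budget D U Q sL X4 p@(suc _) T 1≤sL thin p≤U p≤Q none bound = begin
    3 * p + T        ≤⟨ +-mono-≤ 3p≤D T≤2D ⟩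
    D + 2 * D        ≡⟨⟩
    3 * D            ∎
    where
    open ≤-Reasoning
    3p≤D : 3 * p ≤ D
    3p≤D = dominated 9 D U Q sL X4 p (m≤m+n 9 4599) 1≤sL thin p≤U p≤Q (sq p)
      where
      sq : ∀ p → 3 * p * (3 * p) ≡ 9 * (p * p)
      sq = solve-∀
    2p≤D : 2 * p ≤ D
    2p≤D = ≤-trans (*-monoˡ-≤ p {2} {3} (s≤s (s≤s z≤n))) 3p≤D
    θ : ℕ
    θ = D / (2 * p)
    1≤θ : 1 ≤ θ
    1≤θ = m≥n⇒m/n>0 2p≤D
    θ2p≤D : θ * (2 * p) ≤ D
    θ2p≤D = m/n*n≤m D (2 * p)
    D≤ : D ≤ θ * (4 * p)
    D≤ = begin
      D                           ≤⟨ <⇒≤ (m<[1+m/n]*n D (2 * p)) ⟩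
      2 * p + θ * (2 * p)         ≤⟨ +-monoˡ-≤ (θ * (2 * p)) (m≤n*m (2 * p) θ {{>-nonZero 1≤θ}}) ⟩
      θ * (2 * p) + θ * (2 * p)   ≡⟨ regroup θ p ⟩
      θ * (4 * p)                 ∎
      where
      regroup : ∀ t p → t * (2 * p) + t * (2 * p) ≡ t * (4 * p)
      regroup = solve-∀
    U≤ : 8 * 144 * sL * U ≤ θ * D
    U≤ = *-cancelʳ-≤ _ _ (4 * p) (begin
      8 * 144 * sL * U * (4 * p)            ≡⟨ regroup (8 * 144) sL U p ⟩
      8 * 144 * 4 * sL * (U * p)            ≤⟨ *-monoʳ-≤ (8 * 144 * 4 * sL) (*-monoʳ-≤ U p≤Q) ⟩
      8 * 144 * 4 * sL * (U * (Q * X4))     ≡⟨ regroup′ (8 * 144 * 4) sL U Q X4 ⟩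
      U * Q * (8 * 144 * 4 * sL * X4)       ≤⟨ thin ⟩
      D * D                                 ≤⟨ *-monoʳ-≤ D D≤ ⟩
      D * (θ * (4 * p))                     ≡⟨ regroup″ D θ (4 * p) ⟩
      θ * D * (4 * p)                       ∎)
      where
      regroup : ∀ c s u p → c * s * u * (4 * p) ≡ c * 4 * s * (u * p)
      regroup = solve-∀
      regroup′ : ∀ c s u q x → c * s * (u * (q * x)) ≡ u * q * (c * s * x)
      regroup′ = solve-∀
      regroup″ : ∀ d t p → d * (t * p) ≡ t * d * p
      regroup″ = solve-∀
    T≤2D : T ≤ 2 * D
    T≤2D = *-cancelˡ-≤ θ {{>-nonZero 1≤θ}} (begin
      θ * T                                   ≤⟨ bound (s≤s z≤n) θ ⟩
      2 * (θ * θ) * p + 8 * 144 * sL * U      ≤⟨ +-mono-≤ (≤-trans (≤-reflexive (regroup θ p)) (*-monoʳ-≤ θ θ2p≤D)) U≤ ⟩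
      θ * D + θ * D                           ≡⟨ regroup′ θ D ⟩
      θ * (2 * D)                             ∎)
      where
      regroup : ∀ t p → 2 * (t * t) * p ≡ t * (t * (2 * p))
      regroup = solve-∀
      regroup′ : ∀ t d → t * d + t * d ≡ t * (2 * d)
      regroup′ = solve-∀

  length-concat-≤1 : {A B : Set} (f : A → List B) (xs : List A) → (∀ x → length (f x) ≤ 1) → length (concat (map f xs)) ≤ length xs
  length-concat-≤1 f xs h = ≤-trans (≤-reflexive (∑-length xs f))
    (≤-trans (∑-≤ xs 1 λ {x} _ → h x) (≤-reflexive (*-identityʳ _)))

  data PrefixScan {A : Set} (P : List A → Set) (xs : List A) : Set where
    good : (∀ as bs → xs ≡ as ++ bs → P as) → PrefixScan P xs
    bad  : ∀ ps y qs → xs ≡ ps ++ y ∷ qs → ¬ P (ps ++ y ∷ []) → (∀ as bs → ps ≡ as ++ bs → P as) → PrefixScan P xs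

  scanPrefixes : {A : Set} {P : List A → Set} → (∀ xs → Dec (P xs)) → P [] → ∀ xs → PrefixScan P xs
  scanPrefixes         P? p[] []       = good λ { [] _ _ → p[] }
  scanPrefixes {P = P} P? p[] (x ∷ xs) with P? (x ∷ [])
  ... | no ¬p = bad [] x xs refl ¬p λ { [] _ _ → p[] }
  ... | yes p with scanPrefixes {P = P ∘ (x ∷_)} (λ ys → P? (x ∷ ys)) p xs
  ...   | good h = good λ { [] _ _ → p[] ; (_ ∷ as) bs refl → h as bs refl }
  ...   | bad ps y qs eq ¬p′ h = bad (x ∷ ps) y qs (cong (x ∷_) eq) ¬p′
          λ { [] _ _ → p[] ; (_ ∷ as) bs refl → h as bs refl }

  data SuffixScan {A : Set} (P : List A → Set) (xs : List A) : Set where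
    good : (∀ as bs → xs ≡ as ++ bs → P bs) → SuffixScan P xs
    bad  : ∀ ps y qs → xs ≡ ps ++ y ∷ qs → ¬ P (y ∷ qs) → (∀ as bs → qs ≡ as ++ bs → P bs) → SuffixScan P xs

  scanSuffixes : {A : Set} {P : List A → Set} → (∀ xs → Dec (P xs)) → P [] → ∀ xs → SuffixScan P xs
  scanSuffixes P? p[] []       = good λ { [] _ refl → p[] }
  scanSuffixes P? p[] (x ∷ xs) with scanSuffixes P? p[] xs
  ... | bad ps y qs eq ¬p h = bad (x ∷ ps) y qs (cong (x ∷_) eq) ¬p h
  ... | good h with P? (x ∷ xs)
  ...   | no ¬p = bad [] x xs refl ¬p h
  ...   | yes p = good λ { [] _ refl → p ; (_ ∷ as) bs refl → h as bs refl }

  entry-budget : ∀ n D Z a N c x j s → D * D < s * (Z * (2 * a)) → c * D ≤ N → n * (s * a) ≤ 4 * (N * c) * x * j →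
                 n * (D * D * D) ≤ 8 * Z * (N * N) * x * j
  entry-budget n D Z a N c x j s lt few h = begin
    n * (D * D * D)                                ≡⟨ *-assoc n (D * D) D ⟨
    n * (D * D) * D                                ≤⟨ *-monoˡ-≤ D (*-monoʳ-≤ n (<⇒≤ lt)) ⟩
    n * (s * (Z * (2 * a))) * D                    ≡⟨ regroup₂ n s Z a D ⟩
    2 * Z * D * (n * (s * a))                      ≤⟨ *-monoʳ-≤ (2 * Z * D) h ⟩
    2 * Z * D * (4 * (N * c) * x * j)              ≡⟨ regroup₃ Z D N c x j ⟩
    8 * Z * (N * (c * D)) * x * j                  ≤⟨ *-monoˡ-≤ j (*-monoˡ-≤ x (*-monoʳ-≤ (8 * Z) (*-monoʳ-≤ N few))) ⟩
    8 * Z * (N * N) * x * j                        ∎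
    where
    open ≤-Reasoning
    regroup₂ : ∀ n s z a d → n * (s * (z * (2 * a))) * d ≡ 2 * z * d * (n * (s * a))
    regroup₂ = solve-∀
    regroup₃ : ∀ z d n c x j → 2 * z * d * (4 * (n * c) * x * j) ≡ 8 * z * (n * (c * d)) * x * j
    regroup₃ = solve-∀

  linked-last : {A : Set} {R : A → A → Set} (x : A) (xs : List A) {y : A} {ys : List A} → Linked R (x ∷ xs ++ y ∷ ys) → R (lastOf x xs) y
  linked-last x []        (r ∷ l) = r
  linked-last x (x′ ∷ xs) (r ∷ l) = linked-last x′ xs l

  lastOf-suffix : {A : Set} (u : A) (xs ps : List A) (x : A) (bs : List A) → u ∷ xs ≡ ps ++ x ∷ bs → lastOf x bs ≡ lastOf u xs
  lastOf-suffix u xs []       x bs refl = refl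
  lastOf-suffix u xs (p ∷ ps) x bs refl = sym (lastOf-++ u ps x bs)

  power-below : ∀ n lg → 1 ≤ n → n < 2 ^ lg → ∃ λ a → a < lg × 2 ^ a ≤ n × n < 2 ^ suc a
  power-below n zero     1≤n n< = contradiction (<-≤-trans n< 1≤n) (<-irrefl refl)
  power-below n (suc lg) 1≤n n< with 2 ^ lg ≤? n
  ... | yes h = lg , ≤-refl , h , n<
  ... | no h  = let a , a< , p = power-below n lg 1≤n (≰⇒> h) in a , m≤n⇒m≤1+n a< , p

  crossed-products : ∀ d u₁ q₁ u₂ q₂ z → d < u₁ * q₁ * z → d < u₂ * q₂ * z → d < u₁ * q₂ * z ⊎ d < u₂ * q₁ * z
  crossed-products d u₁ q₁ u₂ q₂ z h₁ h₂ with d <? u₁ * q₂ * z | d <? u₂ * q₁ * z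
  ... | yes h | _     = inj₁ h
  ... | no _  | yes h = inj₂ h
  ... | no a  | no b  = contradiction (*-mono-≤ (≮⇒≥ a) (≮⇒≥ b))
          (<⇒≱ (<-≤-trans (*-mono-< h₁ h₂) (≤-reflexive (regroup u₁ q₁ u₂ q₂ z))))
    where
    regroup : ∀ a b c e z → a * b * z * (c * e * z) ≡ a * e * z * (c * b * z)
    regroup = solve-∀

  -- The detour over a hub costs at most 2 r + R / 2X extra, which is R / k.

  detour-cost : ∀ k f X R r D wt s t g g′ e v → 1 ≤ k → 1 ≤ f → X ≡ 4 * k * f → r * X ≤ f * R → R ≤ D →
                s + t ≡ D → g + g′ ≤ 2 * r → v ≤ g′ + t → 2 * X * e ≤ 2 * X * v + R → wt ≡ s + g + e →
                k * wt ≤ suc k * D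
  detour-cost k f X R r D wt s t g g′ e v 1≤k 1≤f X≡ rX≤ R≤D s+t gg≤ v≤ e≤ wt≡ = *-cancelˡ-≤ (2 * X) {{2X≢0}} (begin
    2 * X * (k * wt)                                     ≡⟨ comm X k wt ⟩
    k * (2 * X * wt)                                     ≤⟨ *-monoʳ-≤ k bound ⟩
    k * (2 * X * D + 5 * (f * D))                        ≡⟨ split k X D f ⟩
    2 * X * (k * D) + 5 * (k * f * D)                    ≤⟨ +-monoʳ-≤ (2 * X * (k * D)) (*-monoˡ-≤ (k * f * D) (m≤m+n 5 3)) ⟩
    2 * X * (k * D) + 8 * (k * f * D)                    ≡⟨ cong (2 * X * (k * D) +_) (trans (eight k f D) (cong (λ x → 2 * x * D) (sym X≡))) ⟩
    2 * X * (k * D) + 2 * X * D                          ≡⟨ join X k D ⟩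
    2 * X * (suc k * D)                                  ∎)
    where
    open ≤-Reasoning
    2X≢0 : NonZero (2 * X)
    2X≢0 = m*n≢0 2 X
      where instance
        _ = >-nonZero 1≤k
        _ = >-nonZero 1≤f
        _ = m*n≢0 4 k
        X≢0 : NonZero X
        X≢0 = subst NonZero (sym X≡) (m*n≢0 (4 * k) f)
    comm : ∀ x k w → 2 * x * (k * w) ≡ k * (2 * x * w)
    comm = solve-∀
    split : ∀ k x d f → k * (2 * x * d + 5 * (f * d)) ≡ 2 * x * (k * d) + 5 * (k * f * d)
    split = solve-∀
    eight : ∀ k f d → 8 * (k * f * d) ≡ 2 * (4 * k * f) * d
    eight = solve-∀
    join : ∀ x k d → 2 * x * (k * d) + 2 * x * d ≡ 2 * x * (suc k * d)
    join = solve-∀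
    spread : ∀ x s g e → 2 * x * (s + g + e) ≡ 2 * x * (s + g) + 2 * x * e
    spread = solve-∀
    gather′ : ∀ x s g h t r → 2 * x * (s + g) + (2 * x * (h + t) + r) ≡ 2 * x * (s + t) + 2 * x * (g + h) + r
    gather′ = solve-∀
    four : ∀ x r → 2 * x * (2 * r) ≡ 4 * (r * x)
    four = solve-∀
    five : ∀ y d → 4 * y + y ≡ 5 * y
    five = solve-∀
    bound : 2 * X * wt ≤ 2 * X * D + 5 * (f * D)
    bound = begin
      2 * X * wt                                         ≡⟨ trans (cong (2 * X *_) wt≡) (spread X s g e) ⟩
      2 * X * (s + g) + 2 * X * e                        ≤⟨ +-monoʳ-≤ (2 * X * (s + g)) (≤-trans e≤ (+-monoˡ-≤ R (*-monoʳ-≤ (2 * X) v≤))) ⟩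
      2 * X * (s + g) + (2 * X * (g′ + t) + R)           ≡⟨ gather′ X s g g′ t R ⟩
      2 * X * (s + t) + 2 * X * (g + g′) + R             ≤⟨ +-mono-≤ (+-mono-≤ (≤-reflexive (cong (2 * X *_) s+t)) (≤-trans (*-monoʳ-≤ (2 * X) gg≤) (≤-trans (≤-reflexive (four X r)) (*-monoʳ-≤ 4 rX≤)))) (m≤n*m R f {{>-nonZero 1≤f}}) ⟩
      2 * X * D + 4 * (f * R) + f * R                    ≡⟨ trans (+-assoc (2 * X * D) _ _) (cong (2 * X * D +_) (five (f * R) 0)) ⟩
      2 * X * D + 5 * (f * R)                            ≤⟨ +-monoʳ-≤ (2 * X * D) (*-monoʳ-≤ 5 (*-monoʳ-≤ f R≤D)) ⟩
      2 * X * D + 5 * (f * D)                            ∎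

  levels-weight : ∀ L → suc L * 25 ^ L ≤ 2 * 32 ^ L
  levels-weight 0 = s≤s z≤n
  levels-weight 1 = ≤ᵇ⇒≤ 50 64 tt
  levels-weight 2 = ≤ᵇ⇒≤ 1875 2048 tt
  levels-weight (suc (suc (suc L))) = begin
    (4 + L) * (25 * (25 * (25 * 25 ^ L)))         ≡⟨ regroup₁ L (25 ^ L) ⟩
    15625 * (4 + L) * 25 ^ L                      ≤⟨ go L ⟩
    65536 * 32 ^ L                                ≡⟨ regroup₂ (32 ^ L) ⟩
    2 * (32 * (32 * (32 * 32 ^ L)))               ∎
    where
    open ≤-Reasoning
    regroup₁ : ∀ l x → (4 + l) * (25 * (25 * (25 * x))) ≡ 15625 * (4 + l) * x
    regroup₁ = solve-∀
    regroup₂ : ∀ x → 65536 * x ≡ 2 * (32 * (32 * (32 * x)))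
    regroup₂ = solve-∀
    step₁ : ∀ l x → 15625 * (5 + l) * (25 * x) + (15625 * 7 * l + 15625 * 3) * x ≡ 32 * (15625 * (4 + l) * x)
    step₁ = solve-∀
    go : ∀ L → 15625 * (4 + L) * 25 ^ L ≤ 65536 * 32 ^ L
    go zero    = ≤ᵇ⇒≤ (15625 * 4 * 1) (65536 * 1) tt
    go (suc L) = begin
      15625 * (5 + L) * (25 * 25 ^ L)             ≤⟨ m≤m+n _ ((15625 * 7 * L + 15625 * 3) * 25 ^ L) ⟩
      15625 * (5 + L) * (25 * 25 ^ L) + (15625 * 7 * L + 15625 * 3) * 25 ^ L
                                                  ≡⟨ step₁ L (25 ^ L) ⟩
      32 * (15625 * (4 + L) * 25 ^ L)             ≤⟨ *-monoʳ-≤ 32 (go L) ⟩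
      32 * (65536 * 32 ^ L)                       ≡⟨ swap₃ 32 65536 (32 ^ L) ⟩
      65536 * (32 * 32 ^ L)                       ∎
      where
      swap₃ : ∀ a b c → a * (b * c) ≡ b * (a * c)
      swap₃ = solve-∀

  ^-double : ∀ a b → (a * a) ^ b ≡ a ^ b * a ^ b
  ^-double a zero    = refl
  ^-double a (suc b) = trans (cong (a * a *_) (^-double a b)) (regroup a (a ^ b))
    where
    regroup : ∀ a x → a * a * (x * x) ≡ a * x * (a * x)
    regroup = solve-∀

  2^⇒32^ : ∀ L → 32 ^ L ≡ (2 ^ L) ^ 5
  2^⇒32^ L = trans (^-*-assoc 2 5 L) (trans (cong (2 ^_) (*-comm 5 L)) (sym (^-*-assoc 2 L 5)))

  -- The constants are variables, because products with large literals would be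
  -- unfolded in unary.

  scale-budget′ : ∀ c e f C → e ≡ 4352 * c → f ≡ e * 16 → C ≡ f * 64 →
                  ∀ L lg k N X Z → 1 ≤ lg → 2 ^ L ≤ suc lg → 1 ≤ X → X ≡ 4 * k * 5 ^ L → Z ≡ c * suc L * (4 * X) →
                  2 * (8 * Z * (N * N) * suc (16 * X) * (2 * lg * (2 * lg))) ≤ C * (lg ^ 7 * (k * k) * (N * N))
  scale-budget′ c e f C e≡ f≡ C≡ L lg k N X Z 1≤lg 2^L≤ 1≤X X≡ Z≡ = begin
    2 * (8 * Z * (N * N) * suc (16 * X) * (2 * lg * (2 * lg)))
      ≤⟨ *-monoʳ-≤ 2 (*-monoˡ-≤ (2 * lg * (2 * lg)) (*-mono-≤ (≤-reflexive (cong (λ z → 8 * z * (N * N)) Z≡)) (+-monoˡ-≤ (16 * X) 1≤X))) ⟩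
    2 * (8 * (c * suc L * (4 * X)) * (N * N) * (X + 16 * X) * (2 * lg * (2 * lg)))
      ≡⟨ trans (regroup₁ c (suc L) X (N * N) lg) (cong (λ x → x * (suc L * (X * X)) * (N * N) * (lg * lg)) (sym e≡)) ⟩
    e * (suc L * (X * X)) * (N * N) * (lg * lg)
      ≡⟨ cong (λ x → e * (suc L * (x * x)) * (N * N) * (lg * lg)) X≡ ⟩
    e * (suc L * (4 * k * 5 ^ L * (4 * k * 5 ^ L))) * (N * N) * (lg * lg)
      ≡⟨ trans (regroup₂ e (suc L) k (5 ^ L) (N * N) lg) (cong (λ x → x * (suc L * (5 ^ L * 5 ^ L)) * (k * k) * (N * N) * (lg * lg)) (sym f≡)) ⟩
    f * (suc L * (5 ^ L * 5 ^ L)) * (k * k) * (N * N) * (lg * lg)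
      ≡⟨ cong (λ x → f * (suc L * x) * (k * k) * (N * N) * (lg * lg)) (^-double 5 L) ⟨
    f * (suc L * 25 ^ L) * (k * k) * (N * N) * (lg * lg)
      ≤⟨ *-monoˡ-≤ (lg * lg) (*-monoˡ-≤ (N * N) (*-monoˡ-≤ (k * k) (*-monoʳ-≤ f weight))) ⟩
    f * (2 * (32 * lg ^ 5)) * (k * k) * (N * N) * (lg * lg)
      ≡⟨ trans (regroup₃ f (lg ^ 5) (k * k) (N * N) lg) (cong (_* (lg * (lg * lg ^ 5) * (k * k) * (N * N))) (sym C≡)) ⟩
    C * (lg ^ 7 * (k * k) * (N * N)) ∎
    where
    open ≤-Reasoning
    regroup₁ : ∀ c s x n l → 2 * (8 * (c * s * (4 * x)) * n * (x + 16 * x) * (2 * l * (2 * l))) ≡ 4352 * c * (s * (x * x)) * n * (l * l)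
    regroup₁ = solve-∀
    regroup₂ : ∀ e s k f n l → e * (s * (4 * k * f * (4 * k * f))) * n * (l * l) ≡ e * 16 * (s * (f * f)) * (k * k) * n * (l * l)
    regroup₂ = solve-∀
    regroup₃ : ∀ f p k n l → f * (2 * (32 * p)) * k * n * (l * l) ≡ f * 64 * (l * (l * p) * k * n)
    regroup₃ = solve-∀
    weight : suc L * 25 ^ L ≤ 2 * (32 * lg ^ 5)
    weight = begin
      suc L * 25 ^ L           ≤⟨ levels-weight L ⟩
      2 * 32 ^ L               ≡⟨ cong (2 *_) (2^⇒32^ L) ⟩
      2 * (2 ^ L) ^ 5          ≤⟨ *-monoʳ-≤ 2 (^-monoˡ-≤ 5 (≤-trans 2^L≤ (≤-trans (+-monoˡ-≤ lg 1≤lg) (≤-reflexive (cong (lg +_) (sym (+-identityʳ lg))))))) ⟩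
      2 * (2 * lg) ^ 5         ≡⟨ cong (2 *_) (regroup lg) ⟩
      2 * (32 * lg ^ 5)        ∎
      where
      regroup : ∀ l → 2 * l * (2 * l * (2 * l * (2 * l * (2 * l * 1)))) ≡ 32 * (l * (l * (l * (l * (l * 1)))))
      regroup = solve-∀

  abstract
    C₁ : ℕ
    C₁ = 20535312384

    C₁-def : C₁ ≡ 320864256 * 64
    C₁-def = refl

    C₁≥11 : 11 ≤ C₁
    C₁≥11 = ≤ᵇ⇒≤ 11 20535312384 tt

  scale-budget : ∀ L lg k N X Z → 1 ≤ lg → 2 ^ L ≤ suc lg → 1 ≤ X → X ≡ 4 * k * 5 ^ L → Z ≡ 4608 * suc L * (4 * X) →
                 2 * (8 * Z * (N * N) * suc (16 * X) * (2 * lg * (2 * lg))) ≤ C₁ * (lg ^ 7 * (k * k) * (N * N))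
  scale-budget = scale-budget′ 4608 20054016 320864256 C₁ refl refl C₁-def

  total-budget : ∀ D³ lg m N h τ G → 1 ≤ lg → lg ≤ m → h ≤ suc lg * (4 * N * lg) + m * (lg * N + (lg * (N + τ) + lg * (N + τ))) →
                 2 * τ * D³ ≤ C₁ * G →
                 h * D³ ≤ C₁ * (m * (lg * N * D³ + lg * G))
  total-budget D³ lg m N h τ G 1≤lg lg≤m h≤ τ≤ = begin
    h * D³                                                       ≤⟨ *-monoˡ-≤ D³ h≤ ⟩
    (suc lg * (4 * N * lg) + m * (lg * N + (lg * (N + τ) + lg * (N + τ)))) * D³
      ≤⟨ *-monoˡ-≤ D³ (+-monoˡ-≤ _ (*-monoˡ-≤ (4 * N * lg) (≤-trans (+-monoˡ-≤ lg 1≤lg) (+-mono-≤ lg≤m lg≤m)))) ⟩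
    ((m + m) * (4 * N * lg) + m * (lg * N + (lg * (N + τ) + lg * (N + τ)))) * D³
      ≡⟨ regroup m N lg τ D³ ⟩
    11 * (m * (lg * N * D³)) + m * lg * (2 * τ * D³)             ≤⟨ +-mono-≤ (*-monoˡ-≤ _ C₁≥11) (*-monoʳ-≤ (m * lg) τ≤) ⟩
    C₁ * (m * (lg * N * D³)) + m * lg * (C₁ * G)                 ≡⟨ regroup′ C₁ m (lg * N * D³) lg G ⟩
    C₁ * (m * (lg * N * D³ + lg * G))                            ∎
    where
    open ≤-Reasoning
    regroup : ∀ m n l t d → ((m + m) * (4 * n * l) + m * (l * n + (l * (n + t) + l * (n + t)))) * d ≡ 11 * (m * (l * n * d)) + m * l * (2 * t * d)
    regroup = solve-∀
    regroup′ : ∀ c m a l g → c * (m * a) + m * l * (c * g) ≡ c * (m * (a + l * g))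
    regroup′ = solve-∀

  least : {P : ℕ → Set} → (∀ t → Dec (P t)) → ∀ M →
          (∃ λ t → t < M × P t × (∀ {s} → P s → t ≤ s)) ⊎ (∀ {t} → t < M → ¬ P t)
  least P? zero    = inj₂ λ ()
  least {P} P? (suc M) with least P? M | P? M
  ... | inj₁ (t , t< , p , min) | _     = inj₁ (t , m≤n⇒m≤1+n t< , p , min)
  ... | inj₂ none               | yes p = inj₁ (M , ≤-refl , p , λ {s} q → ≮⇒≥ λ s< → none s< q)
  ... | inj₂ none               | no ¬p = inj₂ below
    where
    below : ∀ {t} → t < suc M → ¬ P t
    below (s≤s t≤) p with m≤n⇒m<n∨m≡n t≤
    ... | inj₁ t<   = none t< p
    ... | inj₂ refl = ¬p p

  module GraphDistance (n W m : ℕ) (ω : Fin n → Fin n → Maybe ℕ)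
                       (ω≥1 : ∀ {u v k} → ω u v ≡ just k → 1 ≤ k) (ω≤W : ∀ {u v k} → ω u v ≡ just k → k ≤ W)
                       (nW< : n * W < 2 ^ m) where

    data Walk : ℕ → Fin n → Fin n → Set where
      nil  : ∀ {u} → Walk 0 u u
      cons : ∀ {u x v k t} → ω u x ≡ just k → Walk t x v → Walk (k + t) u v

    walk-++ : ∀ {s t u v w} → Walk s u v → Walk t v w → Walk (s + t) u w
    walk-++ nil                    q = q
    walk-++ {t = t} {u = u} {w = w} (cons {k = k} {t = s} e p) q = subst (λ r → Walk r u w) (sym (+-assoc k s t)) (cons e (walk-++ p q))

    walk? : ∀ t u v → Dec (Walk t u v)
    walk? t u v = go t t u v ≤-refl
      where
      uncons : ∀ {t u v} → Walk (suc t) u v → ∃ λ x → ∃₂ λ k s → ω u x ≡ just k × k + s ≡ suc t × Walk s x v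
      uncons p = helper p refl
        where
        helper : ∀ {r t u v} → Walk r u v → r ≡ suc t → ∃ λ x → ∃₂ λ k s → ω u x ≡ just k × k + s ≡ suc t × Walk s x v
        helper (cons e p) eq = _ , _ , _ , e , eq , p
      go : ∀ fuel t u v → t ≤ fuel → Dec (Walk t u v)
      go fuel zero u v t≤ with u ≟ᶠ v
      ... | yes refl = yes nil
      ... | no u≢v   = no λ p → u≢v (trivial p refl)
        where
        trivial : ∀ {r u v} → Walk r u v → r ≡ 0 → u ≡ v
        trivial nil _ = refl
        trivial (cons {k = k} e p) eq = contradiction (≤-trans (ω≥1 e) (≤-trans (m≤m+n k _) (≤-reflexive eq))) λ ()
      go (suc fuel) (suc t) u v (s≤s t≤) = map′ (λ { (x , k , s , e , eq , p) → subst (λ r → Walk r u v) eq (cons e p) }) uncons (any? first?)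
        where
        first? : ∀ x → Dec (∃₂ λ k s → ω u x ≡ just k × k + s ≡ suc t × Walk s x v)
        first? x with ω u x in eq
        ... | nothing = no λ { (_ , _ , () , _) }
        ... | just k with k ≤? suc t
        ...   | no k> = no λ { (_ , s , refl , sum , _) → k> (≤-trans (m≤m+n k s) (≤-reflexive sum)) }
        ...   | yes k≤ with go fuel (suc t ∸ k) x v (≤-trans (∸-monoʳ-≤ (suc t) (ω≥1 eq)) t≤)
        ...     | yes p = yes (k , suc t ∸ k , refl , m+[n∸m]≡n k≤ , p)
        ...     | no ¬p = no λ { (_ , s , refl , sum , p) → ¬p (subst (λ r → Walk r x v) (trans (sym (m+n∸m≡n k s)) (cong (_∸ k) sum)) p) }

    Shortest : ℕ → Fin n → Fin n → Set
    Shortest s u v = Walk s u v × (∀ {t} → Walk t u v → s ≤ t)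

    shortest-tail : ∀ {u x v k t} → ω u x ≡ just k → Walk t x v → (∀ {r} → Walk r u v → k + t ≤ r) → Shortest t x v
    shortest-tail {k = k} e p min = p , λ {r} q → +-cancelˡ-≤ k _ _ (min (cons e q))

    -- A shortest walk repeats no vertex, as the distances to its end decrease.

    trail : ∀ {s u v} → Walk s u v → List (Fin n)
    trail {u = u} nil        = u ∷ []
    trail {u = u} (cons _ p) = u ∷ trail p

    trail-distances : ∀ {s u v} (p : Walk s u v) → (∀ {t} → Walk t u v → s ≤ t) → ∀ {y} → y ∈ trail p → ∃ λ r → r ≤ s × Shortest r y v
    trail-distances nil min (here refl) = 0 , z≤n , nil , min
    trail-distances (cons e p) min (here refl) = _ , ≤-refl , cons e p , min
    trail-distances (cons {k = k} e p) min (there y∈) =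
      let r , r≤ , sh = trail-distances p (proj₂ (shortest-tail e p min)) y∈ in r , ≤-trans r≤ (m≤n+m _ k) , sh

    trail-unique : ∀ {s u v} (p : Walk s u v) → (∀ {t} → Walk t u v → s ≤ t) → Unique (trail p)
    trail-unique nil min = [] ∷ []
    trail-unique {u = u} (cons {k = k} {t = t} e p) min = All.tabulate fresh ∷ trail-unique p (proj₂ (shortest-tail e p min))
      where
      fresh : ∀ {y} → y ∈ trail p → u ≢ y
      fresh y∈ refl with trail-distances p (proj₂ (shortest-tail e p min)) y∈
      ... | r , r≤t , q , _ = <⇒≱ (<-≤-trans (+-monoˡ-< t (ω≥1 e)) (min q)) r≤t

    trail-weight : ∀ {s u v} (p : Walk s u v) → s + W ≤ length (trail p) * W
    trail-weight nil = ≤-reflexive (sym (+-identityʳ W))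
    trail-weight (cons {k = k} {t = t} e p) = ≤-trans (≤-reflexive (+-assoc k t W)) (+-mono-≤ (ω≤W e) (trail-weight p))

    shortest≤nW : ∀ {s u v} → Shortest s u v → s ≤ n * W
    shortest≤nW {s} (p , min) = ≤-trans (m≤m+n s W) (≤-trans (trail-weight p) (*-monoˡ-≤ W few))
      where
      few : length (trail p) ≤ n
      few = ≤-trans (unique-length (trail-unique p min) λ {y} _ → ∈-allFin y) (≤-reflexive (length-tabulate {n = n} id))

    shortest-bound : ∀ {s u v} → Shortest s u v → s < 2 ^ m
    shortest-bound sh = ≤-<-trans (shortest≤nW sh) nW<

    abstract
      search : ∀ u v → (∃ λ t → t < 2 ^ m × Shortest t u v) ⊎ (∀ {t} → ¬ Walk t u v)
      search u v with least (λ t → walk? t u v) (2 ^ m)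
      ... | inj₁ (t , t< , p , min) = inj₁ (t , t< , p , min)
      ... | inj₂ none = inj₂ λ {t} p → beyond t p
        where
        beyond : ∀ t → ¬ Walk t u v
        beyond t p with least (λ t → walk? t u v) (suc t)
        ... | inj₁ (s , _ , q , min) = none (shortest-bound (q , min)) q
        ... | inj₂ none′             = none′ ≤-refl p

    dist : Fin n → Fin n → ℕ
    dist u v with search u v
    ... | inj₁ (t , _) = t
    ... | inj₂ _       = 2 ^ m

    dist≤∞ : ∀ u v → dist u v ≤ 2 ^ m
    dist≤∞ u v with search u v
    ... | inj₁ (t , t< , _) = <⇒≤ t<
    ... | inj₂ _            = ≤-refl

    dist≤ : ∀ {t u v} → Walk t u v → dist u v ≤ t
    dist≤ {u = u} {v} p with search u v
    ... | inj₁ (t , _ , _ , min) = min p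
    ... | inj₂ none              = contradiction p none

    dist-walk : ∀ {u v} → dist u v < 2 ^ m → Walk (dist u v) u v
    dist-walk {u} {v} lt with search u v
    ... | inj₁ (t , _ , p , _) = p
    ... | inj₂ none            = contradiction lt (<-irrefl refl)

    dist≤nW : ∀ {u v} → dist u v < 2 ^ m → dist u v ≤ n * W
    dist≤nW {u} {v} lt with search u v
    ... | inj₁ (t , _ , sh) = shortest≤nW sh
    ... | inj₂ none         = contradiction lt (<-irrefl refl)

    walk⇒finite : ∀ {t u v} → Walk t u v → dist u v < 2 ^ m
    walk⇒finite {u = u} {v} p with search u v
    ... | inj₁ (t , t< , _) = t<
    ... | inj₂ none         = contradiction p none

    dist-refl : ∀ u → dist u u ≡ 0
    dist-refl u = n≤0⇒n≡0 (dist≤ nil)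

    dist-tri : ∀ x y z → dist x z ≤ dist x y + dist y z
    dist-tri x y z with dist x y <? 2 ^ m | dist y z <? 2 ^ m
    ... | yes p | yes q = dist≤ (walk-++ (dist-walk p) (dist-walk q))
    ... | no ¬p | _     = ≤-trans (dist≤∞ x z) (≤-trans (≮⇒≥ ¬p) (m≤m+n _ _))
    ... | yes _ | no ¬q = ≤-trans (dist≤∞ x z) (≤-trans (≮⇒≥ ¬q) (m≤n+m _ _))

    open QuasiMetric (Fin n) dist dist-refl dist-tri

    Base : Fin n → Fin n → Set
    Base x y = ω x y ≡ just (dist x y)

    path : Fin n → Fin n → List (Fin n)
    path u v with dist u v <? 2 ^ m
    ... | yes lt = trail (dist-walk lt)
    ... | no _   = []

    trail-geodesic : ∀ {s u v} (p : Walk s u v) → s ≡ dist u v → Geodesic Base v u (trail p)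
    trail-geodesic nil eq = done
    trail-geodesic {u = u} {v} (cons {x = x} {k = k} {t = t} e p) eq =
      (trans e (cong just (sym ux)) , ≤-trans (ω≥1 e) (≤-reflexive (sym ux)) , btw) ◃ trail-geodesic p (sym xv)
      where
      open ≤-Reasoning
      ux≤ : dist u x ≤ k
      ux≤ = ≤-trans (dist≤ (cons e nil)) (≤-reflexive (+-identityʳ k))
      xv≤ : dist x v ≤ t
      xv≤ = dist≤ p
      ux : dist u x ≡ k
      ux = ≤-antisym ux≤ (+-cancelʳ-≤ t _ _ (≤-trans (≤-reflexive eq) (≤-trans (dist-tri u x v) (+-monoʳ-≤ (dist u x) xv≤))))
      xv : dist x v ≡ t
      xv = ≤-antisym xv≤ (+-cancelˡ-≤ k _ _ (≤-trans (≤-reflexive eq) (≤-trans (dist-tri u x v) (+-monoˡ-≤ (dist x v) ux≤))))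
      btw : dist u x + dist x v ≡ dist u v
      btw = trans (cong₂ _+_ ux xv) eq

    path-geodesic : ∀ {u v} → dist u v < 2 ^ m → Geodesic Base v u (path u v)
    path-geodesic {u} {v} lt with dist u v <? 2 ^ m
    ... | yes lt′ = trail-geodesic (dist-walk lt′) refl
    ... | no ¬lt  = contradiction lt ¬lt

  square-scale : ∀ x y .{{_ : NonZero y}} → x ≤ y ⊎ (∃ λ g → 1 ≤ g × g * g * y ≤ x × x ≤ 4 * (g * g) * y)
  square-scale x y = from (last (λ g → g * g * y ≤ x) (λ g → g * g * y ≤? x) z≤n (suc x) λ le →
      <-irrefl refl (≤-trans (≤-trans (m≤m*n (suc x) (suc x)) (m≤m*n (suc x * suc x) y)) le))
    where
    open ≤-Reasoning
    regroup : ∀ g → 2 * g * (2 * g) ≡ 4 * (g * g)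
    regroup = solve-∀
    from : (∃ λ g → g * g * y ≤ x × ¬ suc g * suc g * y ≤ x) → x ≤ y ⊎ (∃ λ g → 1 ≤ g × g * g * y ≤ x × x ≤ 4 * (g * g) * y)
    from (zero , _ , above) = inj₁ (<⇒≤ (≰⇒> λ le → above (≤-trans (≤-reflexive (+-identityʳ y)) le)))
    from (g@(suc _) , lower , above) = inj₂ (g , s≤s z≤n , lower , (begin
        x                            ≤⟨ <⇒≤ (≰⇒> above) ⟩
        suc g * suc g * y            ≤⟨ *-monoˡ-≤ y (*-mono-≤ double double) ⟩
        2 * g * (2 * g) * y          ≡⟨ cong (_* y) (regroup g) ⟩
        4 * (g * g) * y              ∎))
      where
      double : suc g ≤ 2 * g
      double = ≤-trans (+-monoˡ-≤ g {1} {g} (s≤s z≤n)) (≤-reflexive (cong (g +_) (sym (+-identityʳ g))))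

  cube-mono : ∀ {a b} → a ≤ b → a * a * a ≤ b * b * b
  cube-mono h = *-mono-≤ (*-mono-≤ h h) h

  square-sum : ∀ a b → (a + b) * (a + b) ≤ 2 * (a * a + b * b)
  square-sum a b with ≤-total a b
  ... | inj₁ h = bound a b h
    where
    bound : ∀ a b → a ≤ b → (a + b) * (a + b) ≤ 2 * (a * a + b * b)
    bound a b h with m≤n⇒∃[o]m+o≡n h
    ... | e , refl = ≤-trans (m≤m+n _ (e * e)) (≤-reflexive (identity a e))
      where
      identity : ∀ a e → (a + (a + e)) * (a + (a + e)) + e * e ≡ 2 * (a * a + (a + e) * (a + e))
      identity = solve-∀
  ... | inj₂ h = bound a b h
    where
    bound : ∀ a b → b ≤ a → (a + b) * (a + b) ≤ 2 * (a * a + b * b)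
    bound a b h with m≤n⇒∃[o]m+o≡n h
    ... | e , refl = ≤-trans (m≤m+n _ (e * e)) (≤-reflexive (identity b e))
      where
      identity : ∀ b e → (b + e + b) * (b + e + b) + e * e ≡ 2 * ((b + e) * (b + e) + b * b)
      identity = solve-∀

  -- p stands for lg⁵, Θ for log² (nW) log⁷ n / ε², and x for the cube of the
  -- hop bound.

  module Counting (m l p κ N x h : ℕ) (1≤m : 1 ≤ m) (1≤l : 1 ≤ l) (l≤m : l ≤ m) (1≤p : 1 ≤ p) (1≤κ : 1 ≤ κ) (1≤x : 1 ≤ x) where

    private instance
      _ = >-nonZero 1≤m
      _ = >-nonZero 1≤l
      _ = >-nonZero 1≤p
      _ = >-nonZero 1≤κ
      _ = >-nonZero 1≤x

    Θ : ℕ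
    Θ = m * m * (l * (l * p)) * κ

    open ≤-Reasoning

    mlp≤Θ : m * l * p ≤ Θ
    mlp≤Θ = begin
      m * l * p                        ≤⟨ m≤m*n (m * l * p) (m * l * κ) {{m*n≢0 (m * l) κ {{m*n≢0 m l}}}} ⟩
      m * l * p * (m * l * κ)          ≡⟨ regroup m l p κ ⟩
      m * m * (l * (l * p)) * κ        ∎
      where
      regroup : ∀ m l p κ → m * l * p * (m * l * κ) ≡ m * m * (l * (l * p)) * κ
      regroup = solve-∀

    ml≤Θ : m * l ≤ Θ
    ml≤Θ = ≤-trans (m≤m*n (m * l) p) mlp≤Θ

    module Dense (c : ℕ) (base : h * x ≤ c * (m * (l * N * x + l * (l * (l * p) * κ * (N * N))))) where

      main≤ : m * (l * N * x + l * (l * (l * p) * κ * (N * N))) ≤ m * l * N * x + Θ * (N * N)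
      main≤ = begin
        m * (l * N * x + l * (l * (l * p) * κ * (N * N)))            ≡⟨ regroup m l p κ N x ⟩
        m * l * N * x + l * (m * (l * (l * p)) * κ * (N * N))        ≤⟨ +-monoʳ-≤ (m * l * N * x) (*-monoˡ-≤ _ l≤m) ⟩
        m * l * N * x + m * (m * (l * (l * p)) * κ * (N * N))        ≡⟨ cong (m * l * N * x +_) (regroup′ m (l * (l * p)) κ (N * N)) ⟩
        m * l * N * x + Θ * (N * N)                                  ∎
        where
        regroup : ∀ m l p κ n x → m * (l * n * x + l * (l * (l * p) * κ * (n * n))) ≡ m * l * n * x + l * (m * (l * (l * p)) * κ * (n * n))
        regroup = solve-∀
        regroup′ : ∀ m a κ n → m * (m * a * κ * n) ≡ m * m * a * κ * n
        regroup′ = solve-∀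

      small-β : x ≤ 8 * N → h * x ≤ 9 * c * (Θ * (N * N))
      small-β x≤8N = begin
        h * x                                      ≤⟨ base ⟩
        c * _                                      ≤⟨ *-monoʳ-≤ c main≤ ⟩
        c * (m * l * N * x + Θ * (N * N))          ≤⟨ *-monoʳ-≤ c (+-monoˡ-≤ _ (*-mono-≤ (*-monoˡ-≤ N ml≤Θ) x≤8N)) ⟩
        c * (Θ * N * (8 * N) + Θ * (N * N))        ≡⟨ regroup c Θ N ⟩
        9 * c * (Θ * (N * N))                      ∎
        where
        regroup : ∀ c t n → c * (t * n * (8 * n) + t * (n * n)) ≡ 9 * c * (t * (n * n))
        regroup = solve-∀

      large-β : N ≤ 8 * x → x ≤ N * (p * p) → h * h * x ≤ 18 * (c * c) * (Θ * Θ * (N * N * N))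
      large-β N≤ x≤ = *-cancelʳ-≤ _ _ x (begin
        h * h * x * x                                                  ≡⟨ regroup₁ h x ⟩
        h * x * (h * x)                                                ≤⟨ *-mono-≤ bound bound ⟩
        c * s * (c * s)                                                ≡⟨ regroup₂ c s ⟩
        c * c * (s * s)                                                ≤⟨ *-monoʳ-≤ (c * c) (square-sum (m * l * N * x) (Θ * (N * N))) ⟩
        c * c * (2 * (m * l * N * x * (m * l * N * x) + Θ * (N * N) * (Θ * (N * N))))
                                                                       ≤⟨ *-monoʳ-≤ (c * c) (*-monoʳ-≤ 2 (+-mono-≤ first second)) ⟩
        c * c * (2 * (Θ * Θ * (N * N * N) * x + 8 * (Θ * Θ * (N * N * N) * x)))
                                                                       ≡⟨ regroup₃ (c * c) (Θ * Θ * (N * N * N)) x ⟩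
        18 * (c * c) * (Θ * Θ * (N * N * N)) * x                       ∎)
        where
        s : ℕ
        s = m * l * N * x + Θ * (N * N)
        bound : h * x ≤ c * s
        bound = ≤-trans base (*-monoʳ-≤ c main≤)
        regroup₁ : ∀ h x → h * h * x * x ≡ h * x * (h * x)
        regroup₁ = solve-∀
        regroup₂ : ∀ c s → c * s * (c * s) ≡ c * c * (s * s)
        regroup₂ = solve-∀
        regroup₃ : ∀ c g x → c * (2 * (g * x + 8 * (g * x))) ≡ 18 * c * g * x
        regroup₃ = solve-∀
        first : m * l * N * x * (m * l * N * x) ≤ Θ * Θ * (N * N * N) * x
        first = begin
          m * l * N * x * (m * l * N * x)                              ≤⟨ *-monoʳ-≤ (m * l * N * x) (*-monoʳ-≤ (m * l * N) x≤) ⟩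
          m * l * N * x * (m * l * N * (N * (p * p)))                  ≡⟨ regroup m l N x p ⟩
          m * l * p * (m * l * p) * (N * N * N) * x                    ≤⟨ *-monoˡ-≤ x (*-monoˡ-≤ (N * N * N) (*-mono-≤ mlp≤Θ mlp≤Θ)) ⟩
          Θ * Θ * (N * N * N) * x                                      ∎
          where
          regroup : ∀ m l n x p → m * l * n * x * (m * l * n * (n * (p * p))) ≡ m * l * p * (m * l * p) * (n * n * n) * x
          regroup = solve-∀
        second : Θ * (N * N) * (Θ * (N * N)) ≤ 8 * (Θ * Θ * (N * N * N) * x)
        second = begin
          Θ * (N * N) * (Θ * (N * N))                                  ≡⟨ regroup Θ N ⟩
          Θ * Θ * (N * N * N) * N                                      ≤⟨ *-monoʳ-≤ (Θ * Θ * (N * N * N)) N≤ ⟩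
          Θ * Θ * (N * N * N) * (8 * x)                                ≡⟨ regroup′ (Θ * Θ * (N * N * N)) x ⟩
          8 * (Θ * Θ * (N * N * N) * x)                                ∎
          where
          regroup : ∀ t n → t * (n * n) * (t * (n * n)) ≡ t * t * (n * n * n) * n
          regroup = solve-∀
          regroup′ : ∀ t x → t * (8 * x) ≡ 8 * (t * x)
          regroup′ = solve-∀

    module Sampled (c g N′ : ℕ) (p≡ : p ≡ l ^ 5) (1≤N : 1 ≤ N)
                   (base : h * x ≤ c * (m * (l * N′ * x + l * (l * (l * p) * κ * (N′ * N′)) * (g * g * g))))
                   (sampled : N′ * g ≤ 4 * (N * l)) (lower : g * g * (N * (p * p)) ≤ x) (upper : x ≤ 4 * (g * g) * (N * (p * p))) where

      private instance
        _ = >-nonZero 1≤N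

      per-stretch : h * g ≤ 20 * c * (m * N * (l * l * κ))
      per-stretch = *-cancelʳ-≤ _ _ x (begin
        h * g * x                                                      ≡⟨ regroup₁ h g x ⟩
        h * x * g                                                      ≤⟨ *-monoˡ-≤ g base ⟩
        c * (m * (l * N′ * x + l * (l * (l * p) * κ * (N′ * N′)) * (g * g * g))) * g
                                                                       ≡⟨ regroup₂ c m l N′ x p κ g ⟩
        c * m * (l * (N′ * g) * x + l * (l * (l * p)) * κ * (N′ * g * (N′ * g)) * (g * g))
          ≤⟨ *-monoʳ-≤ (c * m) (+-mono-≤ (*-monoˡ-≤ x (*-monoʳ-≤ l sampled)) (*-monoˡ-≤ (g * g) (*-monoʳ-≤ (l * (l * (l * p)) * κ) (*-mono-≤ sampled sampled)))) ⟩
        c * m * (l * (4 * (N * l)) * x + l * (l * (l * p)) * κ * (4 * (N * l) * (4 * (N * l))) * (g * g))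
                                                                       ≡⟨ regroup₃ (c * m) l N x p κ (g * g) ⟩
        c * m * (4 * (N * (l * l) * x) + 16 * (κ * N * (g * g * (N * ((l * (l * (l * (l * (l * 1))))) * p)))))
          ≤⟨ *-monoʳ-≤ (c * m) (+-mono-≤ (*-monoʳ-≤ 4 (*-monoˡ-≤ x (m≤m*n (N * (l * l)) κ)))
               (*-monoʳ-≤ 16 (≤-trans (*-monoʳ-≤ (κ * N) (≤-trans (≤-reflexive (cong (λ q → g * g * (N * (q * p))) (sym p≡))) lower))
                 (m≤m*n (κ * N * x) (l * l) {{m*n≢0 l l}})))) ⟩
        c * m * (4 * (N * (l * l) * κ * x) + 16 * (κ * N * x * (l * l)))   ≡⟨ regroup₄ c m l N x κ ⟩
        20 * c * (m * N * (l * l * κ)) * x                             ∎)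
        where
        regroup₁ : ∀ h g x → h * g * x ≡ h * x * g
        regroup₁ = solve-∀
        regroup₂ : ∀ c m l n x p κ g → c * (m * (l * n * x + l * (l * (l * p) * κ * (n * n)) * (g * g * g))) * g
                                     ≡ c * m * (l * (n * g) * x + l * (l * (l * p)) * κ * (n * g * (n * g)) * (g * g))
        regroup₂ = solve-∀
        regroup₃ : ∀ c l n x p κ g → c * (l * (4 * (n * l)) * x + l * (l * (l * p)) * κ * (4 * (n * l) * (4 * (n * l))) * g)
                                   ≡ c * (4 * (n * (l * l) * x) + 16 * (κ * n * (g * (n * ((l * (l * (l * (l * (l * 1))))) * p)))))
        regroup₃ = solve-∀
        regroup₄ : ∀ c m l n x κ → c * m * (4 * (n * (l * l) * κ * x) + 16 * (κ * n * x * (l * l))) ≡ 20 * c * (m * n * (l * l * κ)) * x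
        regroup₄ = solve-∀

      large-β : h * h * x ≤ 1600 * (c * c) * (Θ * Θ * (N * N * N))
      large-β = begin
        h * h * x                                                      ≤⟨ *-monoʳ-≤ (h * h) upper ⟩
        h * h * (4 * (g * g) * (N * (p * p)))                          ≡⟨ regroup₁ h g N p ⟩
        4 * (N * (p * p)) * (h * g * (h * g))                          ≤⟨ *-monoʳ-≤ (4 * (N * (p * p))) (*-mono-≤ per-stretch per-stretch) ⟩
        4 * (N * (p * p)) * (20 * c * (m * N * (l * l * κ)) * (20 * c * (m * N * (l * l * κ))))
                                                                       ≡⟨ regroup₂ c N p m l κ ⟩
        1600 * (c * c) * (m * (l * (l * p)) * κ * (m * (l * (l * p)) * κ) * (N * N * N))
          ≤⟨ *-monoʳ-≤ (1600 * (c * c)) (*-monoˡ-≤ (N * N * N) (*-mono-≤ half half)) ⟩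
        1600 * (c * c) * (Θ * Θ * (N * N * N))                         ∎
        where
        regroup₁ : ∀ h g n p → h * h * (4 * (g * g) * (n * (p * p))) ≡ 4 * (n * (p * p)) * (h * g * (h * g))
        regroup₁ = solve-∀
        regroup₂ : ∀ c n p m l κ → 4 * (n * (p * p)) * (20 * c * (m * n * (l * l * κ)) * (20 * c * (m * n * (l * l * κ))))
                 ≡ 1600 * (c * c) * (m * (l * (l * p)) * κ * (m * (l * (l * p)) * κ) * (n * n * n))
        regroup₂ = solve-∀
        half : m * (l * (l * p)) * κ ≤ Θ
        half = *-monoˡ-≤ κ (*-monoˡ-≤ (l * (l * p)) (m≤m*n m m))

  rescale : ∀ s h g D B m a G C₂ C₁ → C₂ ≡ s * s * s * C₁ → B ≤ s * (g * D) → g * D ≤ B → h * (D * D * D) ≤ C₁ * (m * (a * (D * D * D) + G)) →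
            h * (B * B * B) ≤ C₂ * (m * (a * (B * B * B) + G * (g * g * g)))
  rescale s h g D B m a G C₂ C₁ C₂≡ B≤ gD≤ le = begin
    h * (B * B * B)                                                 ≤⟨ *-monoʳ-≤ h (cube-mono B≤) ⟩
    h * (s * (g * D) * (s * (g * D)) * (s * (g * D)))               ≡⟨ regroup h s g D ⟩
    s * s * s * (h * (D * D * D)) * (g * g * g)                     ≤⟨ *-monoˡ-≤ (g * g * g) (*-monoʳ-≤ (s * s * s) le) ⟩
    s * s * s * (C₁ * (m * (a * (D * D * D) + G))) * (g * g * g)    ≡⟨ regroup′ (s * s * s) C₁ m a D G g ⟩
    s * s * s * C₁ * (m * (a * (g * D * (g * D) * (g * D)) + G * (g * g * g)))
                                                                    ≡⟨ cong (_* (m * (a * (g * D * (g * D) * (g * D)) + G * (g * g * g)))) C₂≡ ⟨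
    C₂ * (m * (a * (g * D * (g * D) * (g * D)) + G * (g * g * g)))  ≤⟨ *-monoʳ-≤ C₂ (*-monoʳ-≤ m (+-monoˡ-≤ (G * (g * g * g)) (*-monoʳ-≤ a (cube-mono gD≤)))) ⟩
    C₂ * (m * (a * (B * B * B) + G * (g * g * g)))                  ∎
    where
    open ≤-Reasoning
    regroup : ∀ h s g d → h * (s * (g * d) * (s * (g * d)) * (s * (g * d))) ≡ s * s * s * (h * (d * d * d)) * (g * g * g)
    regroup = solve-∀
    regroup′ : ∀ t c m a d G g → t * (c * (m * (a * (d * d * d) + G))) * (g * g * g) ≡ t * c * (m * (a * (g * d * (g * d) * (g * d)) + G * (g * g * g)))
    regroup′ = solve-∀

  record Space : Set₁ where
    field
      A      : Set
      _≟ᴬ_   : DecidableEquality A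
      d      : A → A → ℕ
      d-refl : ∀ x → d x x ≡ 0
      tri    : ∀ x y z → d x z ≤ d x y + d y z

  module Hopsets (space : Space) where

    open Space space
    open QuasiMetric A d d-refl tri

    Canonical : List A → (A → A → Set) → ℕ → (A → A → List A) → Set
    Canonical vs Base ∞ path = ∀ {x y} → x ∈ vs → y ∈ vs → d x y < ∞ →
                               Geodesic Base y x (path x y) × (∀ {z} → z ∈ path x y → z ∈ vs)

    -- Distances of at least ∞ are not those of an actual path.

    record Graph : Set₁ where
      field
        vs        : List A
        Base      : A → A → Set
        ∞         : ℕ
        path      : A → A → List A
        canonical : Canonical vs Base ∞ path
        lg        : ℕ
        N<        : length vs < 2 ^ lg

    module Network (graph : Graph) where

      open Graph graph

      _∈?_ : (x : A) (xs : List A) → Dec (x ∈ xs)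
      x ∈? xs = Any.any? (x ≟ᴬ_) xs

      pairs : List (A × A)
      pairs = cartesianProduct vs vs

      N : ℕ
      N = length vs

      ballSize : A → ℕ → ℕ
      ballSize c t = count (λ z → ρ c z ≤? t) vs

      ballSize≤N : ∀ c t → ballSize c t ≤ N
      ballSize≤N c t = count≤length (λ z → ρ c z ≤? t) vs

      rank : A → A → ℕ
      rank v w = ballSize v (ρ v w)

      few-below : ∀ v M → count (λ w → rank v w ≤? M) vs ≤ M
      few-below v M with filter (λ w → rank v w ≤? M) vs in eq
      ... | [] = ≤-trans (≤-reflexive (trans (sym (length-filter≡count (λ w → rank v w ≤? M) vs)) (cong length eq))) z≤n
      ... | w ∷ ws with maximal (ρ v) w ws
      ...   | m , m∈ , m-max = ≤-trans (count-mono (λ w → rank v w ≤? M) (λ w → ρ v w ≤? ρ v m) vs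
                λ {x} x∈ r → m-max (subst (x ∈_) eq (∈-filter⁺ (λ w → rank v w ≤? M) x∈ r)))
                (proj₂ (∈-filter⁻ (λ w → rank v w ≤? M) {xs = vs} (subst (m ∈_) (sym eq) m∈)))

      Squeezes : ℕ → List (A × A) → Set
      Squeezes K H = ∀ {y z c t} → y ∈ vs → z ∈ vs → d y z < ∞ → d c y + d y z + d z c ≤ t →
                     ballSize c (2 * t) ≤ K * K → Reach (Base ∪ₗ H) (2 * K) (d y z) y z

      squeezes-mono : ∀ {K H H′} → (∀ {e} → e ∈ H → e ∈ H′) → Squeezes K H → Squeezes K H′
      squeezes-mono sub p y∈ z∈ fin cyc small =
        reach-mono (∪ₗ-mono {E = Base} sub) ≤-refl ≤-refl (p y∈ z∈ fin cyc small)

      -- A pair is a candidate edge at level K if w is among the K² vertices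
      -- closest to v in the round-trip metric ρ.  There are only N K² of these,
      -- while a path whose first and last K vertices are all mutually close
      -- contains K² of them.

      module Level (K : ℕ) (1≤K : 1 ≤ K) where

        private
          instance _ = >-nonZero 1≤K

        close? : ∀ (e : A × A) → Dec (rank (proj₁ e) (proj₂ e) ≤ K * K)
        close? e = rank (proj₁ e) (proj₂ e) ≤? K * K

        candidates : List (A × A)
        candidates = filter close? pairs

        candidates-length : length candidates ≤ N * (K * K)
        candidates-length = begin
          length candidates                                 ≡⟨ length-filter≡count close? pairs ⟩
          count close? pairs                                ≡⟨ ∑-× vs vs _ ⟩
          ∑ vs (λ v → count (λ w → rank v w ≤? K * K) vs)   ≤⟨ ∑-≤ vs (K * K) (λ {v} _ → few-below v (K * K)) ⟩
          N * (K * K)                                       ∎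
          where open ≤-Reasoning

        front back : A × A → List A
        front (y , z) = take K (path y z)
        back  (y , z) = drop (length (path y z) ∸ K) (path y z)

        Hits : A × A → A × A → Set
        Hits f (v , w) = v ∈ front f × w ∈ back f

        hits? : ∀ f e → Dec (Hits f e)
        hits? f (v , w) = (v ∈? front f) ×-dec (w ∈? back f)

        Squeezable : A × A → Set
        Squeezable f@(y , z) = d y z < ∞ × 2 * K ≤ length (path y z) ×
                               All (λ v → All (λ w → rank v w ≤ K * K) (back f)) (front f)

        squeezable? : ∀ f → Dec (Squeezable f)
        squeezable? f@(y , z) = (d y z <? ∞) ×-dec ((2 * K ≤? length (path y z)) ×-dec
          All.all? (λ v → All.all? (λ w → rank v w ≤? K * K) (back f)) (front f))

        open HittingSet Hits hits? candidates (K * K) (*-mono-≤ 1≤K 1≤K)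

        family : List (A × A)
        family = filter squeezable? pairs

        rich : Rich family
        rich {f@(y , z)} f∈ with ∈-filter⁻ squeezable? {xs = pairs} f∈
        ... | f∈pairs , fin , long , all-close with ∈-cartesianProduct⁻ vs vs f∈pairs
        ...   | y∈ , z∈ with canonical y∈ z∈ fin | drop-suffix K (path y z) long
        ...     | geo , sub | ms , eq , len-front , len-back = begin
          K * K                                     ≡⟨ cong₂ _*_ len-front len-back ⟨
          length (front f) * length (back f)        ≡⟨ length-× (front f) (back f) ⟨
          length (cartesianProduct (front f) (back f))
            ≤⟨ unique-count (hits? f) (Unique.cartesianProduct⁺ front! back!) inside ⟩
          count (hits? f) candidates                ∎
          where
          open ≤-Reasoning
          path! : Unique (path y z)
          path! = sorted-unique {Base = Base} {z = z} (geodesic-sorted geo)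
          front! : Unique (front f)
          front! = AllPairs.take⁺ K path!
          back! : Unique (back f)
          back! = AllPairs.drop⁺ (length (path y z) ∸ K) path!
          in-front : ∀ {v} → v ∈ front f → v ∈ vs
          in-front v∈ = sub (subst (_ ∈_) (sym eq) (∈-++⁺ˡ v∈))
          in-back : ∀ {w} → w ∈ back f → w ∈ vs
          in-back w∈ = sub (subst (_ ∈_) (sym eq) (∈-++⁺ʳ (front f) (∈-++⁺ʳ ms w∈)))
          inside : ∀ {e} → e ∈ cartesianProduct (front f) (back f) → e ∈ candidates × Hits f e
          inside {v , w} e∈ with ∈-cartesianProduct⁻ (front f) (back f) e∈
          ... | v∈ , w∈ = ∈-filter⁺ close? (∈-cartesianProduct⁺ (in-front v∈) (in-back w∈))
                            (All.lookup (All.lookup all-close v∈) w∈) , v∈ , w∈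

        family< : length family < 2 ^ (2 * lg)
        family< = begin-strict
          length family         ≡⟨ length-filter≡count squeezable? pairs ⟩
          count squeezable? pairs ≤⟨ count≤length squeezable? pairs ⟩
          length pairs          ≡⟨ length-× vs vs ⟩
          N * N                 <⟨ *-mono-< N< N< ⟩
          2 ^ lg * 2 ^ lg       ≡⟨ ^-distribˡ-+-* 2 lg lg ⟨
          2 ^ (lg + lg)         ≡⟨ cong (λ i → 2 ^ (lg + i)) (+-identityʳ lg) ⟨
          2 ^ (2 * lg)          ∎
          where open ≤-Reasoning

        abstract
          hitting : ∃ λ H → All (_∈ candidates) H × length H * (K * K) ≤ 2 * length candidates * (2 * lg) × Covers H family
          hitting = hittingSet (2 * lg) family rich family<

        H : List (A × A)
        H = proj₁ hitting

        H-length : length H ≤ 4 * N * lg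
        H-length = *-cancelʳ-≤ (length H) (4 * N * lg) (K * K) (begin
            length H * (K * K)                       ≤⟨ proj₁ (proj₂ (proj₂ hitting)) ⟩
            2 * length candidates * (2 * lg)         ≤⟨ *-monoˡ-≤ (2 * lg) (*-monoʳ-≤ 2 candidates-length) ⟩
            2 * (N * (K * K)) * (2 * lg)             ≡⟨ regroup N lg (K * K) ⟩
            4 * N * lg * (K * K)                     ∎)
          where
          open ≤-Reasoning
          instance _ = m*n≢0 K K
          regroup : ∀ n l k → 2 * (n * k) * (2 * l) ≡ 4 * n * l * k
          regroup = solve-∀

        module Squeezed {y z c t} (y∈ : y ∈ vs) (z∈ : z ∈ vs) (fin : d y z < ∞) (cycle : d c y + d y z + d z c ≤ t)
                        (small : ballSize c (2 * t) ≤ K * K) where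

          geo : Geodesic Base z y (path y z)
          geo = proj₁ (canonical y∈ z∈ fin)

          xs : List A
          xs = proj₁ (geodesic-head geo)

          p≡ : path y z ≡ y ∷ xs
          p≡ = proj₁ (proj₂ (geodesic-head geo))

          last≡ : lastOf y xs ≡ z
          last≡ = proj₂ (proj₂ (geodesic-head geo))

          linked : Linked Base (path y z)
          linked = geodesic-linked geo

          sorted : AllPairs _≺[ y ]_ (path y z)
          sorted = geodesic-sorted geo

          fr bk : List A
          fr = front (y , z)
          bk = back (y , z)

          in-fr : ∀ {v} → v ∈ fr → v ∈ path y z
          in-fr {v} v∈ = subst (v ∈_) (take++drop≡id K (path y z)) (∈-++⁺ˡ v∈)

          in-bk : ∀ {w} → w ∈ bk → w ∈ path y z
          in-bk {w} w∈ = subst (w ∈_) (take++drop≡id (length (path y z) ∸ K) (path y z)) (∈-++⁺ʳ (take (length (path y z) ∸ K) (path y z)) w∈)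

          ordered : ∀ ms → path y z ≡ fr ++ ms ++ bk → ∀ {v w} → v ∈ fr → w ∈ bk → Between y v w
          ordered ms eq v∈ w∈ = proj₁ (AllPairs-++ˣ fr (subst (AllPairs _≺[ y ]_) eq sorted) v∈ (∈-++⁺ʳ ms w∈))

          close : ∀ ms → path y z ≡ fr ++ ms ++ bk → ∀ {v w} → v ∈ fr → w ∈ bk → rank v w ≤ K * K
          close ms eq {v} {w} v∈ w∈ = ≤-trans (count-mono (λ x → ρ v x ≤? ρ v w) (λ x → ρ c x ≤? 2 * t) vs λ {x} _ vx≤ → begin
              ρ c x                    ≤⟨ ρ-tri c v x ⟩
              ρ c v + ρ v x            ≤⟨ +-monoʳ-≤ (ρ c v) vx≤ ⟩
              ρ c v + ρ v w            ≤⟨ +-mono-≤ ρcv ρvw ⟩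
              t + t                    ≡⟨ cong (t +_) (+-identityʳ t) ⟨
              2 * t                    ∎) small
            where
            open ≤-Reasoning
            ρcv : ρ c v ≤ t
            ρcv = begin
              d c v + d v c                                ≤⟨ +-mono-≤ (tri c y v) (tri v z c) ⟩
              (d c y + d y v) + (d v z + d z c)            ≡⟨ arrange (d c y) (d y v) (d v z) (d z c) ⟩
              d c y + (d y v + d v z) + d z c              ≡⟨ cong (λ i → d c y + i + d z c) (geodesic-between geo (in-fr v∈)) ⟩
              d c y + d y z + d z c                        ≤⟨ cycle ⟩
              t                                            ∎
              where
              arrange : ∀ a b c e → (a + b) + (c + e) ≡ a + (b + c) + e
              arrange = solve-∀
            ρvw : ρ v w ≤ t
            ρvw = begin
              d v w + d w v                                ≤⟨ +-monoʳ-≤ (d v w) (≤-trans (tri w z v) (+-monoʳ-≤ (d w z) (≤-trans (tri z c v) (+-monoʳ-≤ (d z c) (tri c y v))))) ⟩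
              d v w + (d w z + (d z c + (d c y + d y v)))  ≡⟨ arrange (d v w) (d w z) (d z c) (d c y) (d y v) ⟩
              d c y + (d y v + d v w + d w z) + d z c      ≡⟨ cong (λ i → d c y + (i + d w z) + d z c) (ordered ms eq v∈ w∈) ⟩
              d c y + (d y w + d w z) + d z c              ≡⟨ cong (λ i → d c y + i + d z c) (geodesic-between geo (in-bk w∈)) ⟩
              d c y + d y z + d z c                        ≤⟨ cycle ⟩
              t                                            ∎
              where
              arrange : ∀ a b c e f → a + (b + (c + (e + f))) ≡ e + (f + a + b) + c
              arrange = solve-∀

          via : ∀ ms → path y z ≡ fr ++ ms ++ bk → length fr ≡ K → length bk ≡ K → ∀ {v w} → (v , w) ∈ H →
                ∀ as bs → fr ≡ as ++ v ∷ bs → ∀ cs es → bk ≡ cs ++ w ∷ es → Reach (Base ∪ₗ H) (2 * K) (d y z) y z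
          via ms eq len-fr len-bk {v} {w} vw∈H as bs fr≡ cs es bk≡ =
            reach-mono id count≤ ≤-refl
              (reach-⊕ (geodesic-between geo (in-fr v∈)) (reach-mono inj₁ ≤-refl ≤-refl y⇝v)
                (reach-⊕ vwz (edge (inj₂ vw∈H)) (reach-mono inj₁ ≤-refl ≤-refl w⇝z)))
            where
            v∈ : v ∈ fr
            v∈ = subst (v ∈_) (sym fr≡) (∈-++⁺ʳ as (here refl))
            w∈ : w ∈ bk
            w∈ = subst (w ∈_) (sym bk≡) (∈-++⁺ʳ cs (here refl))
            before : List A
            before = fr ++ ms ++ cs
            whole₁ : path y z ≡ as ++ v ∷ (bs ++ ms ++ bk)
            whole₁ = trans eq (trans (cong (_++ ms ++ bk) fr≡) (++-assoc as (v ∷ bs) (ms ++ bk)))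
            whole₂ : path y z ≡ before ++ w ∷ es
            whole₂ = trans eq (trans (cong (λ b → fr ++ ms ++ b) bk≡)
                       (trans (cong (fr ++_) (sym (++-assoc ms cs (w ∷ es)))) (sym (++-assoc fr (ms ++ cs) (w ∷ es)))))
            vwz : Between v w z
            vwz = proj₂ (between-trans (ordered ms eq v∈ w∈) (geodesic-between geo (in-bk w∈)))
            y⇝v : Reach Base (length as) (d y v) y v
            y⇝v = walkTo as (trans (sym p≡) whole₁) (subst (Linked Base) p≡ linked) (subst (AllPairs _≺[ y ]_) p≡ sorted)
            w⇝z : Reach Base (length es) (d w z) w z
            w⇝z = subst (λ z → Reach Base (length es) (d w z) w z) (trans (lastOf-suffix y xs before w es (trans (sym p≡) whole₂)) last≡)
                    (walk w es (Linked-++ʳ before (subst (Linked Base) whole₂ linked)) (AllPairs-++ʳ before (subst (AllPairs _≺[ y ]_) whole₂ sorted)))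
            open ≤-Reasoning
            count≤ : length as + suc (length es) ≤ 2 * K
            count≤ = begin
              length as + suc (length es)        ≤⟨ +-mono-≤ (prefix-length as bs fr≡ len-fr) (suffix-length cs es bk≡ len-bk) ⟩
              K + K                              ≡⟨ cong (K +_) (+-identityʳ K) ⟨
              2 * K                              ∎

          squeezed : Reach (Base ∪ₗ H) (2 * K) (d y z) y z
          squeezed = from (2 * K ≤? length (path y z))
            where
            from : Dec (2 * K ≤ length (path y z)) → Reach (Base ∪ₗ H) (2 * K) (d y z) y z
            from (no short) = reach-mono inj₁ (≤-trans (n≤1+n _) (≤-trans (≤-reflexive (sym (cong length p≡))) (<⇒≤ (≰⇒> short)))) ≤-refl
              (subst (λ z → Reach Base (length xs) (d y z) y z) last≡
                (walk y xs (subst (Linked Base) p≡ linked) (subst (AllPairs _≺[ y ]_) p≡ sorted)))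
            from (yes long) =
              let ms , eq , len-fr , len-bk = drop-suffix K (path y z) long
                  (v , w) , vw∈H , v∈ , w∈ = find (proj₂ (proj₂ (proj₂ hitting)) (∈-filter⁺ squeezable? (∈-cartesianProduct⁺ y∈ z∈)
                    (fin , long , All.tabulate λ v∈ → All.tabulate λ w∈ → close ms eq v∈ w∈)))
                  as , bs , fr≡ = ∈-∃++ v∈
                  cs , es , bk≡ = ∈-∃++ w∈
              in via ms eq len-fr len-bk vw∈H as bs fr≡ cs es bk≡

        squeeze : ∃ λ H → length H ≤ 4 * N * lg × Squeezes K H
        squeeze = H , H-length , Squeezed.squeezed

      squeezeAll : ∃ λ H → length H ≤ suc lg * (4 * N * lg) × (∀ {j} → j ≤ lg → Squeezes (2 ^ j) H)
      squeezeAll =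
        let H , len , p = gather (λ j → Squeezes (2 ^ j)) (λ {j} → squeezes-mono {2 ^ j}) (4 * N * lg)
                            (λ j → Level.squeeze (2 ^ j) (m^n>0 2 j)) (suc lg)
        in H , len , λ j≤ → p (s≤s j≤)

      Chain : Set
      Chain = A × List A

      source : Chain → A
      source = proj₁

      members : Chain → List A
      members = proj₂

      Covered : List Chain → A → Set
      Covered cs x = Any (λ c → x ∈ members c) cs

      covered? : ∀ cs x → Dec (Covered cs x)
      covered? cs x = Any.any? (λ c → x ∈? members c) cs

      uncovered : List Chain → List A → ℕ
      uncovered cs = count (¬? ∘ covered? cs)

      module _ (M D : ℕ) where

        ValidChain : Chain → Set
        ValidChain c = AllPairs _≺[ source c ]_ (members c) ×
                       (∀ {x} → x ∈ members c → x ∈ vs × d (source c) x < M) × D ≤ length (members c)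

        record IsCover (ps : List (A × A)) (cs : List Chain) : Set where
          field
            valid  : ∀ {c} → c ∈ cs → ValidChain c
            unique : Unique (concat (map members cs))
            covers : ∀ {u w} → (u , w) ∈ ps → d u w < M → uncovered cs (path u w) < D

        module _ (M≤ : M ≤ ∞) (1≤D : 1 ≤ D) where

          open IsCover

          cover : ∀ ps → (∀ {e} → e ∈ ps → e ∈ pairs) → ∃ (IsCover ps)
          cover [] sub = [] , record { valid = λ () ; unique = [] ; covers = λ () }
          cover ((u , w) ∷ ps) sub with cover ps (sub ∘ there)
          ... | cs , ok with d u w <? M
          ...   | no far = cs , record { valid = valid ok ; unique = unique ok ; covers = λ
                  { (here refl) near → contradiction near far ; (there m) near → covers ok m near } }
          ...   | yes near with length (filter (¬? ∘ covered? cs) (path u w)) <? D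
          ...     | yes few = cs , record { valid = valid ok ; unique = unique ok ; covers = λ
                    { (here refl) _ → subst (_< D) (length-filter≡count (¬? ∘ covered? cs) (path u w)) few
                    ; (there m) near → covers ok m near } }
          ...     | no many = (u , fresh) ∷ cs , record
                    { valid = λ { (here refl) → AllPairs.filter⁺ (¬? ∘ covered? cs) (geodesic-sorted geo) , fresh-ok , ≮⇒≥ many
                                ; (there m) → valid ok m }
                    ; unique = Unique.++⁺ (AllPairs.filter⁺ (¬? ∘ covered? cs) (sorted-unique {Base = Base} {z = w} (geodesic-sorted geo)))
                                 (unique ok) λ { (x∈ , x∈′) → proj₂ (from-fresh x∈) (covered x∈′) }
                    ; covers = λ { {u′} {w′} (here refl) _ → ≤-<-trans (≤-reflexive (count-0 (¬? ∘ covered? ((u , fresh) ∷ cs)) (path u w) now-covered)) 1≤D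
                                 ; {u′} {w′} (there m) near → ≤-<-trans (count-mono (¬? ∘ covered? ((u , fresh) ∷ cs)) (¬? ∘ covered? cs) (path u′ w′) λ _ ¬c c → ¬c (there c))
                                                      (covers ok m near) } }
            where
            fresh : List A
            fresh = filter (¬? ∘ covered? cs) (path u w)
            ends : u ∈ vs × w ∈ vs
            ends = ∈-cartesianProduct⁻ vs vs (sub (here refl))
            canon = canonical (proj₁ ends) (proj₂ ends) (<-≤-trans near M≤)
            geo : Geodesic Base w u (path u w)
            geo = proj₁ canon
            from-fresh : ∀ {x} → x ∈ fresh → x ∈ path u w × ¬ Covered cs x
            from-fresh x∈ = ∈-filter⁻ (¬? ∘ covered? cs) {xs = path u w} x∈
            fresh-ok : ∀ {x} → x ∈ fresh → x ∈ vs × d u x < M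
            fresh-ok x∈ = proj₂ canon (proj₁ (from-fresh x∈)) ,
              ≤-<-trans (≤-trans (m≤m+n _ _) (≤-reflexive (geodesic-between geo (proj₁ (from-fresh x∈))))) near
            covered : ∀ {x} → x ∈ concat (map members cs) → Covered cs x
            covered x∈ with ∈-concat-map⁻ members cs x∈
            ... | c , c∈ , x∈c = lose c∈ x∈c
            now-covered : ∀ {x} → x ∈ path u w → ¬ ¬ Covered ((u , fresh) ∷ cs) x
            now-covered {x} x∈ ¬c = ¬c (here (∈-filter⁺ (¬? ∘ covered? cs) x∈ (¬c ∘ there)))

      module ChainProperties {M D : ℕ} {ps : List (A × A)} {cs : List Chain} (ok : IsCover M D ps cs) where

        open IsCover ok

        total-members : ∑ cs (length ∘ members) ≤ N
        total-members = ≤-trans (≤-reflexive (sym (∑-length cs members))) (unique-length unique λ x∈ →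
          let c , c∈ , x∈c = ∈-concat-map⁻ members cs x∈ in proj₁ (proj₁ (proj₂ (valid c∈)) x∈c))

        few-chains : length cs * D ≤ N
        few-chains = ≤-trans (∑-≥ cs D λ c∈ → proj₂ (proj₂ (valid c∈))) total-members

        chain-ordered : ∀ {c} → c ∈ cs → ∀ {x y} → x ∈ members c → y ∈ members c → d (source c) x ≤ d (source c) y →
                        x ≡ y ⊎ x ≺[ source c ] y
        chain-ordered c∈ x∈ y∈ x≤y with comparable (proj₁ (valid c∈)) x∈ y∈
        ... | inj₁ p               = inj₂ p
        ... | inj₂ (inj₁ eq)       = inj₁ eq
        ... | inj₂ (inj₂ (_ , lt)) = contradiction x≤y (<⇒≱ lt)

        chain-between : ∀ {c} → c ∈ cs → ∀ {x y} → x ∈ members c → y ∈ members c → d (source c) x ≤ d (source c) y →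
                        Between (source c) x y
        chain-between {c} c∈ {x} x∈ y∈ x≤y with chain-ordered c∈ x∈ y∈ x≤y
        ... | inj₁ refl    = trans (cong (d (source c) x +_) (d-refl x)) (+-identityʳ _)
        ... | inj₂ (p , _) = p

        chainEdges : List (A × A)
        chainEdges = concat (map (halvingEdges lg ∘ members) cs)

        chainEdges-length : length chainEdges ≤ lg * N
        chainEdges-length = begin
          length chainEdges                               ≡⟨ ∑-length cs (halvingEdges lg ∘ members) ⟩
          ∑ cs (λ c → length (halvingEdges lg (members c))) ≤⟨ ∑-mono cs (λ {c} _ → halvingEdges-length lg (members c)) ⟩
          ∑ cs (λ c → lg * length (members c))            ≡⟨ ∑-*ˡ cs lg (length ∘ members) ⟩
          lg * ∑ cs (length ∘ members)                    ≤⟨ *-monoʳ-≤ lg total-members ⟩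
          lg * N                                          ∎
          where open ≤-Reasoning

        chain-hop : ∀ {c} → c ∈ cs → ∀ {x y} → x ∈ members c → y ∈ members c → d (source c) x ≤ d (source c) y →
                    Reach (Base ∪ₗ chainEdges) 2 (d x y) x y
        chain-hop {c} c∈ x∈ y∈ x≤y with chain-ordered c∈ x∈ y∈ x≤y
        ... | inj₁ refl = stop
        ... | inj₂ x≺y with halvingEdges-twoHops _≺[ source c ]_ (λ { (_ , lt) (_ , gt) → <-asym lt gt }) lg (members c)
                              (≤-<-trans (≤-trans (∑-∈ (length ∘ members) c∈) total-members) N<)
                              (proj₁ (valid c∈)) x∈ y∈ x≺y
        ...   | inj₁ e = reach-mono id (n≤1+n 1) ≤-refl (edge (inj₂ (∈-concat-map (halvingEdges lg ∘ members) c∈ e)))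
        ...   | inj₂ (m , e , e′ , (sxm , _) , (smy , _)) =
          reach-⊕ (proj₂ (between-trans sxm smy)) (edge (inj₂ (∈-concat-map (halvingEdges lg ∘ members) c∈ e)))
                                                  (edge (inj₂ (∈-concat-map (halvingEdges lg ∘ members) c∈ e′)))

      record Parameters : Set where
        field
          L k D R : ℕ
          big     : suc lg < 2 ^ suc L
          1≤k     : 1 ≤ k
          1≤D     : 1 ≤ D
          1≤R     : 1 ≤ R
          2R≤∞    : 2 * R ≤ ∞

      module ScaleHopset (parameters : Parameters) where

        open Parameters parameters

        private
          instance
            k≢0 : NonZero k
            k≢0 = >-nonZero 1≤k
            D≢0 : NonZero D
            D≢0 = >-nonZero 1≤D
            R≢0 : NonZero R
            R≢0 = >-nonZero 1≤R

        abstract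
          X : ℕ
          X = 4 * k * 5 ^ L

          X-def : X ≡ 4 * k * 5 ^ L
          X-def = refl

        private
          instance
            X≢0 : NonZero X
            X≢0 = subst NonZero (sym X-def) (m*n≢0 (4 * k) (5 ^ L) {{m*n≢0 4 k}} {{m^n≢0 5 L}})

        abstract
          cover-data : ∃ (IsCover (2 * R) D pairs)
          cover-data = cover (2 * R) D 2R≤∞ 1≤D pairs id

        cs : List Chain
        cs = proj₁ cover-data

        open IsCover (proj₂ cover-data) using (valid; covers)

        _≟ᵏ_ : DecidableEquality Chain
        _≟ᵏ_ = Product.≡-dec _≟ᴬ_ (≡-dec _≟ᴬ_)

        _≟ᶜ_ : DecidableEquality (Chain × ℕ)
        _≟ᶜ_ = Product.≡-dec _≟ᵏ_ _≟_

        chain-between : ∀ {c} → c ∈ cs → ∀ {x y} → x ∈ members c → y ∈ members c → d (source c) x ≤ d (source c) y →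
                        Between (source c) x y
        chain-between = ChainProperties.chain-between (proj₂ cover-data)

        chain-near : ∀ {c} → c ∈ cs → ∀ {x} → x ∈ members c → d (source c) x < 2 * R
        chain-near c∈ x∈ = proj₂ (proj₁ (proj₂ (valid c∈)) x∈)

        chainEdges : List (A × A)
        chainEdges = ChainProperties.chainEdges (proj₂ cover-data)

        r : ℕ → ℕ
        r ℓ = 5 ^ ℓ * R / X

        r-step : ∀ ℓ → 5 * r ℓ ≤ r (suc ℓ)
        r-step ℓ = begin
          5 * (5 ^ ℓ * R / X)             ≡⟨ m*n/n≡m (5 * (5 ^ ℓ * R / X)) X ⟨
          5 * (5 ^ ℓ * R / X) * X / X     ≤⟨ /-monoˡ-≤ X (≤-trans (≤-reflexive (*-assoc 5 (5 ^ ℓ * R / X) X)) (*-monoʳ-≤ 5 (m/n*n≤m (5 ^ ℓ * R) X))) ⟩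
          5 * (5 ^ ℓ * R) / X             ≡⟨ cong (_/ X) (*-assoc 5 (5 ^ ℓ) R) ⟨
          5 ^ suc ℓ * R / X               ∎
          where open ≤-Reasoning

        r-mono : ∀ ℓ ℓ′ → ℓ ≤ ℓ′ → r ℓ ≤ r ℓ′
        r-mono ℓ ℓ′ h = /-monoˡ-≤ X (*-monoˡ-≤ R (^-monoʳ-≤ 5 h))

        chainOf : A → Chain
        chainOf x with covered? cs x
        ... | yes c = proj₁ (find c)
        ... | no _  = x , []

        chainOf-∈ : ∀ {x} → Covered cs x → chainOf x ∈ cs × x ∈ members (chainOf x)
        chainOf-∈ {x} c with covered? cs x
        ... | yes c′ = proj₂ (find c′)
        ... | no ¬c  = contradiction c ¬c

        pos : A → ℕ
        pos x = d (source (chainOf x)) x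

        piece : A → ℕ
        piece x = 2 * X * pos x / R

        label : A → Chain × ℕ
        label x = chainOf x , piece x

        labels : List A → List (Chain × ℕ)
        labels xs = deduplicate _≟ᶜ_ (map label (filter (covered? cs) xs))

        Q : List A → ℕ
        Q xs = length (labels xs)

        reached? : ∀ (xs : List A) z → Dec (Any (λ x → ρ x z ≤ 2 * r L) xs)
        reached? xs z = Any.any? (λ x → ρ x z ≤? 2 * r L) xs

        U : List A → ℕ
        U xs = count (reached? xs) vs

        abstract
          Z : ℕ
          Z = 4608 * suc L * (4 * X)

          Z-def : Z ≡ 4608 * suc L * (4 * X)
          Z-def = refl

        Thin : List A → Set
        Thin xs = U xs * Q xs * Z ≤ D * D

        thin? : ∀ xs → Dec (Thin xs)
        thin? xs = U xs * Q xs * Z ≤? D * D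

        radius : ℕ
        radius = 2 * r L

        q⁺ q⁻ p⁺ p⁻ : Chain → A → ℕ
        q⁺ c b = d (source c) b
        q⁻ c b = 2 * R ∸ q⁺ c b
        p⁺ c b = 2 * X * q⁺ c b / R
        p⁻ c b = 4 * X ∸ p⁺ c b

        p⁺≤ : ∀ {c b} → c ∈ cs → b ∈ members c → p⁺ c b ≤ 4 * X
        p⁺≤ {c} {b} c∈ b∈ = begin
          2 * X * q⁺ c b / R           ≤⟨ /-monoˡ-≤ R (*-monoʳ-≤ (2 * X) (<⇒≤ (chain-near c∈ b∈))) ⟩
          2 * X * (2 * R) / R          ≡⟨ cong (_/ R) (regroup X R) ⟩
          4 * X * R / R                ≡⟨ m*n/n≡m (4 * X) R ⟩
          4 * X                        ∎
          where
          open ≤-Reasoning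
          regroup : ∀ x r → 2 * x * (2 * r) ≡ 4 * x * r
          regroup = solve-∀

        q⁻-order : ∀ {c a b} → c ∈ cs → a ∈ members c → b ∈ members c → q⁻ c a ≤ q⁻ c b → q⁺ c b ≤ q⁺ c a
        q⁻-order {c} {a} {b} c∈ a∈ b∈ h = ≮⇒≥ λ lt → <⇒≱ (∸-monoʳ-< lt (<⇒≤ (chain-near c∈ b∈))) h

        on-chain⁺ : ∀ {c a b} → c ∈ cs → a ∈ members c → b ∈ members c → q⁺ c a ≤ q⁺ c b → q⁺ c a + d a b ≡ q⁺ c b
        on-chain⁺ c∈ a∈ b∈ h = chain-between c∈ a∈ b∈ h

        on-chain⁻ : ∀ {c a b} → c ∈ cs → a ∈ members c → b ∈ members c → q⁻ c a ≤ q⁻ c b → q⁻ c a + d b a ≡ q⁻ c b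
        on-chain⁻ {c} {a} {b} c∈ a∈ b∈ h = +-cancelʳ-≡ (q⁺ c b) _ _ (begin-equality
          2 * R ∸ q⁺ c a + d b a + q⁺ c b        ≡⟨ +-assoc (2 * R ∸ q⁺ c a) _ _ ⟩
          2 * R ∸ q⁺ c a + (d b a + q⁺ c b)      ≡⟨ cong (2 * R ∸ q⁺ c a +_) (trans (+-comm (d b a) (q⁺ c b)) (chain-between c∈ b∈ a∈ (q⁻-order c∈ a∈ b∈ h))) ⟩
          2 * R ∸ q⁺ c a + q⁺ c a                ≡⟨ m∸n+n≡m (<⇒≤ (chain-near c∈ a∈)) ⟩
          2 * R                                  ≡⟨ m∸n+n≡m (<⇒≤ (chain-near c∈ b∈)) ⟨
          2 * R ∸ q⁺ c b + q⁺ c b                ∎)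
          where open ≤-Reasoning

        p⁺-mono : ∀ {c a b} → c ∈ cs → a ∈ members c → b ∈ members c → q⁺ c a ≤ q⁺ c b → p⁺ c a ≤ p⁺ c b
        p⁺-mono _ _ _ h = /-monoˡ-≤ R (*-monoʳ-≤ (2 * X) h)

        p⁻-mono : ∀ {c a b} → c ∈ cs → a ∈ members c → b ∈ members c → q⁻ c a ≤ q⁻ c b → p⁻ c a ≤ p⁻ c b
        p⁻-mono c∈ a∈ b∈ h = ∸-monoʳ-≤ (4 * X) (/-monoˡ-≤ R (*-monoʳ-≤ (2 * X) (q⁻-order c∈ a∈ b∈ h)))

        q⁺≤ : ∀ {c b} → c ∈ cs → b ∈ members c → q⁺ c b ≤ 2 * R
        q⁺≤ c∈ b∈ = <⇒≤ (chain-near c∈ b∈)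

        q⁻≤ : ∀ {c b} → c ∈ cs → b ∈ members c → q⁻ c b ≤ 2 * R
        q⁻≤ {c} {b} _ _ = m∸n≤m (2 * R) (q⁺ c b)

        p⁻≤ : ∀ {c b} → c ∈ cs → b ∈ members c → p⁻ c b ≤ 4 * X
        p⁻≤ {c} {b} _ _ = m∸n≤m (4 * X) (p⁺ c b)

        module _ (xs : List A) where

          pick : ∀ ls → (∀ {l} → l ∈ ls → ∃ λ b → b ∈ xs × Covered cs b × label b ≡ l) →
                 ∃ λ bs → map label bs ≡ ls × (∀ {b} → b ∈ bs → b ∈ xs × Covered cs b)
          pick []       h = [] , refl , λ ()
          pick (l ∷ ls) h = let b , b∈ , c , eq = h (here refl) ; bs , eqs , ok = pick ls (h ∘ there)
                            in b ∷ bs , cong₂ _∷_ eq eqs , λ { (here refl) → b∈ , c ; (there m) → ok m }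

          abstract
            picked : ∃ λ bs → map label bs ≡ labels xs × (∀ {b} → b ∈ bs → b ∈ xs × Covered cs b)
            picked = pick (labels xs) λ l∈ → case ∈-map⁻ label (∈-deduplicate⁻ _≟ᶜ_ (map label (filter (covered? cs) xs)) l∈) of λ
              { (b , b∈ , eq) → b , proj₁ (∈-filter⁻ (covered? cs) {xs = xs} b∈) , proj₂ (∈-filter⁻ (covered? cs) {xs = xs} b∈) , sym eq }

          aim : A → A × Chain
          aim b = b , chainOf b

          targets : List (A × Chain)
          targets = map aim (proj₁ picked)

          targets-length : length targets ≡ Q xs
          targets-length = trans (length-map aim (proj₁ picked))
            (trans (sym (length-map label (proj₁ picked))) (cong length (proj₁ (proj₂ picked))))

          targets-∈ : ∀ {b c} → (b , c) ∈ targets → b ∈ xs × c ∈ cs × b ∈ members c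
          targets-∈ t∈ with ∈-map⁻ aim t∈
          ... | b , b∈ , refl = let b∈xs , cov = proj₂ (proj₂ picked) b∈ in b∈xs , chainOf-∈ cov

          labels-differ : AllPairs (λ a b → label a ≢ label b) (proj₁ picked)
          labels-differ = AllPairs.map⁻ (subst Unique (sym (proj₁ (proj₂ picked))) (DecUnique.deduplicate-! _≟ᶜ_ (map label (filter (covered? cs) xs))))

        Thin-[] : Thin []
        Thin-[] = ≤-trans (≤-reflexive (cong (λ u → u * Q [] * Z) (count-0 (reached? []) vs λ _ ()))) z≤n

        data Outcome (xs : List A) : Set where
          allThin : (∀ as bs → xs ≡ as ++ bs → Thin as) → Outcome xs
          halfway : ∀ ps y qs → xs ≡ ps ++ y ∷ qs → (∀ as bs → ps ≡ as ++ bs → Thin as) →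
                    (∀ as bs → qs ≡ as ++ bs → Thin bs) → Outcome xs
          twoEnds : ∀ ps y ms z qs → xs ≡ ps ++ y ∷ ms ++ z ∷ qs →
                    (∀ as bs → ps ≡ as ++ bs → Thin as) → (∀ as bs → qs ≡ as ++ bs → Thin bs) →
                    ¬ Thin (ps ++ y ∷ []) → ¬ Thin (z ∷ qs) → Outcome xs

        outcome : ∀ xs → Outcome xs
        outcome xs with scanPrefixes thin? Thin-[] xs
        ... | good h = allThin h
        ... | bad ps y qs eq ¬thin h with scanSuffixes thin? Thin-[] qs
        ...   | good h′ = halfway ps y qs eq h h′
        ...   | bad ms z qs′ refl ¬thin′ h′ = twoEnds ps y ms z qs′ eq h h′ ¬thin ¬thin′

        Instance : Set
        Instance = List A × List A

        heavy? : ∀ f b → Dec (D * D < U f * Q b * Z)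
        heavy? f b = D * D <? U f * Q b * Z

        keep : ∀ f b → Dec (D * D < U f * Q b * Z) → List Instance
        keep f b (yes _) = (f , b) ∷ []
        keep f b (no _)  = []

        fromOutcome⁺ fromOutcome⁻ : ∀ {xs} → Outcome xs → List Instance
        fromOutcome⁺ (allThin _)                    = []
        fromOutcome⁺ (halfway _ _ _ _ _ _)         = []
        fromOutcome⁺ (twoEnds ps y ms z qs _ _ _ _ _) = keep (ps ++ y ∷ []) (z ∷ qs) (heavy? (ps ++ y ∷ []) (z ∷ qs))
        fromOutcome⁻ (allThin _)                    = []
        fromOutcome⁻ (halfway _ _ _ _ _ _)         = []
        fromOutcome⁻ (twoEnds ps y ms z qs _ _ _ _ _) = keep (z ∷ qs) (ps ++ y ∷ []) (heavy? (z ∷ qs) (ps ++ y ∷ []))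

        ifNear : ∀ {n} → Dec (n < 2 * R) → List Instance → List Instance
        ifNear (yes _) is = is
        ifNear (no _)  is = []

        instances⁺ instances⁻ : A × A → List Instance
        instances⁺ (u , w) = ifNear (d u w <? 2 * R) (fromOutcome⁺ (outcome (path u w)))
        instances⁻ (u , w) = ifNear (d u w <? 2 * R) (fromOutcome⁻ (outcome (path u w)))

        keep≤1 : ∀ f b h → length (keep f b h) ≤ 1
        keep≤1 f b (yes _) = s≤s z≤n
        keep≤1 f b (no _)  = z≤n

        fromOutcome⁺≤1 : ∀ {xs} (o : Outcome xs) → length (fromOutcome⁺ o) ≤ 1
        fromOutcome⁺≤1 (allThin _)                    = z≤n
        fromOutcome⁺≤1 (halfway _ _ _ _ _ _)         = z≤n
        fromOutcome⁺≤1 (twoEnds ps y ms z qs _ _ _ _ _) = keep≤1 (ps ++ y ∷ []) (z ∷ qs) (heavy? (ps ++ y ∷ []) (z ∷ qs))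

        fromOutcome⁻≤1 : ∀ {xs} (o : Outcome xs) → length (fromOutcome⁻ o) ≤ 1
        fromOutcome⁻≤1 (allThin _)                    = z≤n
        fromOutcome⁻≤1 (halfway _ _ _ _ _ _)         = z≤n
        fromOutcome⁻≤1 (twoEnds ps y ms z qs _ _ _ _ _) = keep≤1 (z ∷ qs) (ps ++ y ∷ []) (heavy? (z ∷ qs) (ps ++ y ∷ []))

        ifNear≤1 : ∀ {n} (h : Dec (n < 2 * R)) {is} → length is ≤ 1 → length (ifNear h is) ≤ 1
        ifNear≤1 (yes _) le = le
        ifNear≤1 (no _)  le = z≤n

        Admissible : Instance → Set
        Admissible (f , b) = (∀ {x} → x ∈ f → x ∈ vs) × D * D < U f * Q b * Z

        path⊆ : ∀ {u w} → (u , w) ∈ pairs → d u w < 2 * R → ∀ {x} → x ∈ path u w → x ∈ vs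
        path⊆ e∈ lt = let u∈ , w∈ = ∈-cartesianProduct⁻ vs vs e∈ in proj₂ (canonical u∈ w∈ (<-≤-trans lt 2R≤∞))

        front⊆ : ∀ {xs : List A} ps y qs → xs ≡ ps ++ y ∷ qs → ∀ {x} → x ∈ ps ++ y ∷ [] → x ∈ xs
        front⊆ ps y qs refl x∈ = subst (_ ∈_) (++-assoc ps (y ∷ []) qs) (∈-++⁺ˡ x∈)

        back⊆ : ∀ {xs : List A} ps y ms z qs → xs ≡ ps ++ y ∷ ms ++ z ∷ qs → ∀ {x} → x ∈ z ∷ qs → x ∈ xs
        back⊆ ps y ms z qs refl x∈ = ∈-++⁺ʳ ps (there (∈-++⁺ʳ ms x∈))

        keep-∈ : ∀ f b {i} h → i ∈ keep f b h → i ≡ (f , b) × D * D < U f * Q b * Z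
        keep-∈ f b (yes h) (here refl) = refl , h

        keep-∋ : ∀ f b h → D * D < U f * Q b * Z → (f , b) ∈ keep f b h
        keep-∋ f b (yes _) lt = here refl
        keep-∋ f b (no h)  lt = contradiction lt h

        fromOutcome⁺-∈ : ∀ {xs} (o : Outcome xs) → (∀ {x} → x ∈ xs → x ∈ vs) → ∀ {i} → i ∈ fromOutcome⁺ o → Admissible i
        fromOutcome⁺-∈ (twoEnds ps y ms z qs eq _ _ _ _) sub i∈ with keep-∈ (ps ++ y ∷ []) (z ∷ qs) (heavy? (ps ++ y ∷ []) (z ∷ qs)) i∈
        ... | refl , h = sub ∘ front⊆ ps y _ eq , h

        fromOutcome⁻-∈ : ∀ {xs} (o : Outcome xs) → (∀ {x} → x ∈ xs → x ∈ vs) → ∀ {i} → i ∈ fromOutcome⁻ o → Admissible i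
        fromOutcome⁻-∈ (twoEnds ps y ms z qs eq _ _ _ _) sub i∈ with keep-∈ (z ∷ qs) (ps ++ y ∷ []) (heavy? (z ∷ qs) (ps ++ y ∷ [])) i∈
        ... | refl , h = sub ∘ back⊆ ps y ms z qs eq , h

        ifNear-∈ : ∀ {n} (h : Dec (n < 2 * R)) {is i} → i ∈ ifNear h is → n < 2 * R × i ∈ is
        ifNear-∈ (yes h) i∈ = h , i∈

        ifNear-∋ : ∀ {n} (h : Dec (n < 2 * R)) {is i} → n < 2 * R → i ∈ is → i ∈ ifNear h is
        ifNear-∋ (yes _) lt i∈ = i∈
        ifNear-∋ (no h)  lt i∈ = contradiction lt h

        admissible⁺ : ∀ {e} → e ∈ pairs → ∀ {i} → i ∈ instances⁺ e → Admissible i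
        admissible⁺ {u , w} e∈ i∈ = let lt , i∈′ = ifNear-∈ (d u w <? 2 * R) i∈ in fromOutcome⁺-∈ (outcome (path u w)) (path⊆ e∈ lt) i∈′

        admissible⁻ : ∀ {e} → e ∈ pairs → ∀ {i} → i ∈ instances⁻ e → Admissible i
        admissible⁻ {u , w} e∈ i∈ = let lt , i∈′ = ifNear-∈ (d u w <? 2 * R) i∈ in fromOutcome⁻-∈ (outcome (path u w)) (path⊆ e∈ lt) i∈′

        instances⁺≤1 : ∀ e → length (instances⁺ e) ≤ 1
        instances⁺≤1 (u , w) = ifNear≤1 (d u w <? 2 * R) (fromOutcome⁺≤1 (outcome (path u w)))

        instances⁻≤1 : ∀ e → length (instances⁻ e) ≤ 1
        instances⁻≤1 (u , w) = ifNear≤1 (d u w <? 2 * R) (fromOutcome⁻≤1 (outcome (path u w)))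

        -- Edge budget of one direction, one class of instances.

        τ : ℕ
        τ = 8 * Z * (N * N) * suc (16 * X) * (2 * lg * (2 * lg)) / (D * D * D)
          where instance
            _ = m*n≢0 D D
            _ = m*n≢0 (D * D) D

        Z≢0 : ∀ a → NonZero (Z * 2 ^ suc a)
        Z≢0 a = m*n≢0 Z (2 ^ suc a) {{subst NonZero (sym Z-def) (m*n≢0 (4608 * suc L) (4 * X) {{m*n≢0 4608 (suc L)}} {{m*n≢0 4 X}})}} {{m^n≢0 2 (suc a)}}

        quota : ℕ → ℕ
        quota a = suc ((D * D / (Z * 2 ^ suc a)) {{Z≢0 a}})

        entries≤τ : ∀ a n → n * (quota a * 2 ^ a) ≤ 4 * (N * length cs) * suc (16 * X) * (2 * lg * (2 * lg)) → n ≤ τ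
        entries≤τ a n h = m*n≤o⇒m≤o/n n (D * D * D) _
          (entry-budget n D Z (2 ^ a) N (length cs) (suc (16 * X)) (2 * lg * (2 * lg)) (quota a)
            (m<[1+m/n]*n (D * D) (Z * 2 ^ suc a) {{Z≢0 a}}) (ChainProperties.few-chains (proj₂ cover-data)) h)
          where instance
            _ = m*n≢0 D D
            _ = m*n≢0 (D * D) D

        pairs< : length pairs < 2 ^ (2 * lg)
        pairs< = begin-strict
          length pairs          ≡⟨ length-× vs vs ⟩
          N * N                 <⟨ *-mono-< N< N< ⟩
          2 ^ lg * 2 ^ lg       ≡⟨ ^-distribˡ-+-* 2 lg lg ⟨
          2 ^ (lg + lg)         ≡⟨ cong (λ i → 2 ^ (lg + i)) (+-identityʳ lg) ⟨
          2 ^ (2 * lg)          ∎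
          where open ≤-Reasoning

        aimed : Instance → List A × List (A × Chain)
        aimed (f , b) = f , targets b

        InClass : ℕ → Instance → Set
        InClass a (f , b) = 2 ^ a ≤ U f × U f < 2 ^ suc a

        inClass? : ∀ a i → Dec (InClass a i)
        inClass? a (f , b) = (2 ^ a ≤? U f) ×-dec (U f <? 2 ^ suc a)

        Front Back : Set
        Front = List A
        Back  = List (A × Chain)

        record Target (b : A) (c : Chain) : Set where
          constructor target
          field
            chain∈ : c ∈ cs
            member : b ∈ members c

        record Jump (δ : A → A → ℕ) (q : Chain → A → ℕ) (links entries : List (A × A)) (front : Front) (back : Back) : Set where
          field
            {x v y b} : A
            {c}       : Chain
            x∈        : x ∈ front
            v∈        : v ∈ vs
            bc∈       : (b , c) ∈ back
            link      : (x , v) ∈ links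
            close     : ρ x v ≤ radius
            entry     : (v , y) ∈ entries
            y∈        : y ∈ members c
            y≤b       : q c y ≤ q c b
            short     : δ v b ≤ 3 * R → 2 * X * (δ v y + δ y b) ≤ 2 * X * δ v b + R

        jump-mono : ∀ {δ q links links′ entries entries′ f t} → (∀ {e} → e ∈ links → e ∈ links′) → (∀ {e} → e ∈ entries → e ∈ entries′) →
                    Jump δ q links entries f t → Jump δ q links′ entries′ f t
        jump-mono sub sub′ j = record { x∈ = x∈ ; v∈ = v∈ ; bc∈ = bc∈ ; link = sub link ; close = close ; entry = sub′ entry
                                      ; y∈ = y∈ ; y≤b = y≤b ; short = short }
          where open Jump j

        allInstances : (A × A → List Instance) → List Instance
        allInstances instances = concat (map instances pairs)

        Served : (A → A → ℕ) → (Chain → A → ℕ) → (A × A → List Instance) → ℕ → List (A × A) → Set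
        Served δ q instances a H = ∀ {f b} → (f , b) ∈ allInstances instances → InClass a (f , b) → Jump δ q H H f (targets b)

        -- The chains are followed in the direction given by δ: for the reverse
        -- graph, δ and the position q along a chain are reversed.

        record Direction : Set where
          field
            δ     : A → A → ℕ
            δ-tri : ∀ x y z → δ x z ≤ δ x y + δ y z
            q pc  : Chain → A → ℕ
            on-chain : ∀ {c a b} → c ∈ cs → a ∈ members c → b ∈ members c → q c a ≤ q c b → q c a + δ a b ≡ q c b
            pc-mono : ∀ {c a b} → c ∈ cs → a ∈ members c → b ∈ members c → q c a ≤ q c b → pc c a ≤ pc c b
            q≤ : ∀ {c b} → c ∈ cs → b ∈ members c → q c b ≤ 2 * R
            pc≤ : ∀ {c b} → c ∈ cs → b ∈ members c → pc c b ≤ 4 * X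

        module Jumps (direction : Direction) where

          open Direction direction

          clamp : A → A → ℕ
          clamp v b = δ v b ⊓ (4 * R)

          height : Chain → A → A → ℕ
          height c v b = 4 * R + q c b ∸ clamp v b

          height-eq : ∀ c v b → height c v b + clamp v b ≡ 4 * R + q c b
          height-eq c v b = m∸n+n≡m (≤-trans (m⊓n≤n (δ v b) (4 * R)) (m≤m+n (4 * R) (q c b)))

          tier : Chain → A → A → ℕ
          tier c v b = 2 * X * height c v b / R

          key : Chain → A → A → ℕ
          key c v b = tier c v b + pc c b

          Element : Set
          Element = A × Chain × ℕ

          entryEdge : Element → List (A × A)
          entryEdge (v , c , k) with filter (λ y → key c v y ≟ k) (members c)
          ... | []     = []
          ... | y ∷ ys = (v , proj₁ (minimal (q c) y ys)) ∷ []

          entryEdge≤1 : ∀ e → length (entryEdge e) ≤ 1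
          entryEdge≤1 (v , c , k) with filter (λ y → key c v y ≟ k) (members c)
          ... | []     = z≤n
          ... | y ∷ ys = s≤s z≤n

          entryEdge-∈ : ∀ c v b → b ∈ members c →
                        ∃ λ y → y ∈ members c × key c v y ≡ key c v b × q c y ≤ q c b × (v , y) ∈ entryEdge (v , c , key c v b)
          entryEdge-∈ c v b b∈ with filter (λ y → key c v y ≟ key c v b) (members c) in eq
          ... | []     = contradiction (subst (b ∈_) eq (∈-filter⁺ (λ y → key c v y ≟ key c v b) b∈ refl)) λ ()
          ... | z ∷ zs with minimal (q c) z zs
          ...   | y , y∈ , y-min =
            let y∈c , same = ∈-filter⁻ (λ y → key c v y ≟ key c v b) {xs = members c} (subst (y ∈_) (sym eq) y∈)
            in y , y∈c , same , y-min (subst (b ∈_) eq (∈-filter⁺ (λ y → key c v y ≟ key c v b) b∈ refl)) , here refl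

          climb : ∀ {c v a b} → c ∈ cs → a ∈ members c → b ∈ members c → q c a ≤ q c b →
                  height c v b + clamp v b ≡ height c v a + (clamp v a + δ a b)
          climb {c} {v} {a} {b} c∈ a∈ b∈ a≤b = begin-equality
            height c v b + clamp v b                 ≡⟨ height-eq c v b ⟩
            4 * R + q c b                            ≡⟨ cong (4 * R +_) (on-chain c∈ a∈ b∈ a≤b) ⟨
            4 * R + (q c a + δ a b)                  ≡⟨ +-assoc (4 * R) (q c a) (δ a b) ⟨
            4 * R + q c a + δ a b                    ≡⟨ cong (_+ δ a b) (height-eq c v a) ⟨
            height c v a + clamp v a + δ a b         ≡⟨ +-assoc (height c v a) (clamp v a) (δ a b) ⟩
            height c v a + (clamp v a + δ a b)       ∎
            where open ≤-Reasoning

          height-mono : ∀ {c v a b} → c ∈ cs → a ∈ members c → b ∈ members c → q c a ≤ q c b → height c v a ≤ height c v b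
          height-mono {c} {v} {a} {b} c∈ a∈ b∈ a≤b = +-cancelʳ-≤ (clamp v b) _ _ (begin
            height c v a + clamp v b                  ≤⟨ +-monoʳ-≤ (height c v a) clamp≤ ⟩
            height c v a + (clamp v a + δ a b)        ≡⟨ climb c∈ a∈ b∈ a≤b ⟨
            height c v b + clamp v b                  ∎)
            where
            open ≤-Reasoning
            clamp≤ : clamp v b ≤ clamp v a + δ a b
            clamp≤ with ≤-total (δ v a) (4 * R)
            ... | inj₁ le = ≤-trans (m⊓n≤m _ _) (≤-trans (δ-tri v a b) (≤-reflexive (cong (_+ δ a b) (sym (m≤n⇒m⊓n≡m le)))))
            ... | inj₂ ge = ≤-trans (m⊓n≤n _ _) (≤-trans (≤-reflexive (sym (m≥n⇒m⊓n≡n ge))) (m≤m+n _ _))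

          tier-mono : ∀ {c v a b} → c ∈ cs → a ∈ members c → b ∈ members c → q c a ≤ q c b → tier c v a ≤ tier c v b
          tier-mono c∈ a∈ b∈ a≤b = /-monoˡ-≤ R (*-monoʳ-≤ (2 * X) (height-mono c∈ a∈ b∈ a≤b))

          -- Both summands of the key increase along a chain, so that equal keys
          -- have equal summands.

          same-key : ∀ {c v a b} → c ∈ cs → a ∈ members c → b ∈ members c → q c a ≤ q c b → key c v a ≡ key c v b →
                     tier c v a ≡ tier c v b × pc c a ≡ pc c b
          same-key {c} {v} {a} {b} c∈ a∈ b∈ a≤b eq = tier≡ , +-cancelˡ-≡ (tier c v b) _ _ (trans (cong (_+ pc c a) (sym tier≡)) eq)
            where
            tier≡ : tier c v a ≡ tier c v b
            tier≡ = ≤-antisym (tier-mono c∈ a∈ b∈ a≤b)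
              (+-cancelʳ-≤ (pc c b) _ _ (≤-trans (≤-reflexive (sym eq)) (+-monoʳ-≤ (tier c v a) (pc-mono c∈ a∈ b∈ a≤b))))

          key≤ : ∀ {c v b} → c ∈ cs → b ∈ members c → key c v b < suc (16 * X)
          key≤ {c} {v} {b} c∈ b∈ = s≤s (begin
            tier c v b + pc c b                       ≤⟨ +-mono-≤ tier≤ (pc≤ c∈ b∈) ⟩
            12 * X + 4 * X                            ≡⟨ *-distribʳ-+ X 12 4 ⟨
            16 * X                                    ∎)
            where
            open ≤-Reasoning
            regroup : ∀ x r → 2 * x * (4 * r + 2 * r) ≡ 12 * x * r
            regroup = solve-∀
            tier≤ : tier c v b ≤ 12 * X
            tier≤ = begin
              2 * X * height c v b / R                ≤⟨ /-monoˡ-≤ R (*-monoʳ-≤ (2 * X) (≤-trans (m∸n≤m _ (clamp v b)) (+-monoʳ-≤ (4 * R) (q≤ c∈ b∈)))) ⟩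
              2 * X * (4 * R + 2 * R) / R             ≡⟨ cong (_/ R) (regroup X R) ⟩
              12 * X * R / R                          ≡⟨ m*n/n≡m (12 * X) R ⟩
              12 * X                                  ∎

          detour : ∀ {c v y b} → c ∈ cs → y ∈ members c → b ∈ members c → q c y ≤ q c b → key c v y ≡ key c v b →
                   δ v b ≤ 3 * R → 2 * X * (δ v y + δ y b) ≤ 2 * X * δ v b + R
          detour {c} {v} {y} {b} c∈ y∈ b∈ y≤b eq vb≤ = begin
              2 * X * (δ v y + δ y b)                    ≡⟨ cong (λ n → 2 * X * (n + δ y b)) clamp≡ ⟨
              2 * X * (clamp v y + δ y b)                ≤⟨ clamped ⟩
              2 * X * clamp v b + R                      ≤⟨ +-monoˡ-≤ R (*-monoʳ-≤ (2 * X) (m⊓n≤m (δ v b) (4 * R))) ⟩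
              2 * X * δ v b + R                          ∎
            where
            open ≤-Reasoning
            clamped : 2 * X * (clamp v y + δ y b) ≤ 2 * X * clamp v b + R
            clamped = +-cancelˡ-≤ (2 * X * height c v y) _ _ (begin
              2 * X * height c v y + 2 * X * (clamp v y + δ y b)    ≡⟨ *-distribˡ-+ (2 * X) (height c v y) _ ⟨
              2 * X * (height c v y + (clamp v y + δ y b))          ≡⟨ cong (2 * X *_) (climb c∈ y∈ b∈ y≤b) ⟨
              2 * X * (height c v b + clamp v b)                    ≡⟨ *-distribˡ-+ (2 * X) (height c v b) (clamp v b) ⟩
              2 * X * height c v b + 2 * X * clamp v b              ≤⟨ +-monoˡ-≤ (2 * X * clamp v b) (<⇒≤ (same-quotient _ _ R (sym (proj₁ (same-key c∈ y∈ b∈ y≤b eq))))) ⟩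
              2 * X * height c v y + R + 2 * X * clamp v b          ≡⟨ shuffle (2 * X * height c v y) R _ ⟩
              2 * X * height c v y + (2 * X * clamp v b + R)        ∎)
              where
              shuffle : ∀ a b c → a + b + c ≡ a + (c + b)
              shuffle = solve-∀
            clamp≡ : clamp v y ≡ δ v y
            clamp≡ with ≤-total (δ v y) (4 * R)
            ... | inj₁ le = m≤n⇒m⊓n≡m le
            ... | inj₂ ge = contradiction clamped (<⇒≱ (begin-strict
              2 * X * clamp v b + R                      ≤⟨ +-monoˡ-≤ R (*-monoʳ-≤ (2 * X) (≤-trans (m⊓n≤m (δ v b) (4 * R)) vb≤)) ⟩
              2 * X * (3 * R) + R                        <⟨ +-monoʳ-< (2 * X * (3 * R)) R< ⟩
              2 * X * (3 * R) + 2 * X * R                ≡⟨ regroup X R ⟩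
              2 * X * (4 * R)                            ≡⟨ cong (2 * X *_) (m≥n⇒m⊓n≡n ge) ⟨
              2 * X * clamp v y                          ≤⟨ *-monoʳ-≤ (2 * X) (m≤m+n _ (δ y b)) ⟩
              2 * X * (clamp v y + δ y b)                ∎))
              where
              regroup : ∀ x r → 2 * x * (3 * r) + 2 * x * r ≡ 2 * x * (4 * r)
              regroup = solve-∀
              R< : R < 2 * X * R
              R< = <-≤-trans (≤-trans (m<m+n R (>-nonZero⁻¹ R)) (≤-reflexive (cong (R +_) (sym (+-identityʳ R)))))
                     (*-monoˡ-≤ R (≤-trans (≤-reflexive (sym (*-identityʳ 2))) (*-monoʳ-≤ 2 (>-nonZero⁻¹ X))))

          DistinctPieces : A × Chain → A × Chain → Set
          DistinctPieces (b , c) (b′ , c′) = c ≡ c′ → pc c b ≢ pc c′ b′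

          -- Hubs are close to the fronts, and the backs meet many pieces of chains.

          module Class (h s : ℕ) (1≤h : 1 ≤ h) (1≤s : 1 ≤ s) (fs : List (Front × Back)) (j : ℕ) (fs< : length fs < 2 ^ j)
                   (front⊆ : ∀ {f} → f ∈ fs → ∀ {x} → x ∈ proj₁ f → x ∈ vs)
                   (dense : ∀ {f} → f ∈ fs → h ≤ count (reached? (proj₁ f)) vs)
                   (targets : ∀ {f} → f ∈ fs → ∀ {b c} → (b , c) ∈ proj₂ f → Target b c)
                   (diverse : ∀ {f} → f ∈ fs → AllPairs DistinctPieces (proj₂ f))
                   (many : ∀ {f} → f ∈ fs → s ≤ length (proj₂ f)) where

            private
              module Hubs = HittingSet (λ (f : Front × Back) z → Any (λ x → ρ x z ≤ radius) (proj₁ f)) (λ f → reached? (proj₁ f)) vs h 1≤h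

            abstract
              hub-data : ∃ λ hs → All (_∈ vs) hs × length hs * h ≤ 2 * length vs * j × Hubs.Covers hs fs
              hub-data = Hubs.hittingSet j fs dense fs<

            hubs : List A
            hubs = proj₁ hub-data

            hubs⊆ : ∀ {v} → v ∈ hubs → v ∈ vs
            hubs⊆ = All.lookup (proj₁ (proj₂ hub-data))

            linkEdge : A → List (A × A)
            linkEdge x with Any.any? (λ v → ρ x v ≤? radius) hubs
            ... | yes near = (x , proj₁ (find near)) ∷ []
            ... | no _     = []

            linkEdge≤1 : ∀ x → length (linkEdge x) ≤ 1
            linkEdge≤1 x with Any.any? (λ v → ρ x v ≤? radius) hubs
            ... | yes near = s≤s z≤n
            ... | no _     = z≤n

            linkEdge-∈ : ∀ x → Any (λ v → ρ x v ≤ radius) hubs → ∃ λ v → v ∈ hubs × ρ x v ≤ radius × (x , v) ∈ linkEdge x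
            linkEdge-∈ x some with Any.any? (λ v → ρ x v ≤? radius) hubs
            ... | yes near = let v , v∈ , xv = find near in v , v∈ , xv , here refl
            ... | no none  = contradiction some none

            links : List (A × A)
            links = concat (map linkEdge vs)

            links-length : length links ≤ length vs
            links-length = length-concat-≤1 linkEdge vs linkEdge≤1

            Uses : Front × Back → A → Set
            Uses f v = Any (λ x → (x , v) ∈ linkEdge x × ρ x v ≤ radius) (proj₁ f)

            uses? : ∀ f v → Dec (Uses f v)
            uses? f v = Any.any? (λ x → Any.any? (Product.≡-dec _≟ᴬ_ _≟ᴬ_ (x , v)) (linkEdge x) ×-dec (ρ x v ≤? radius)) (proj₁ f)

            uses-some : ∀ {f} → f ∈ fs → ∃ λ v → v ∈ hubs × Uses f v
            uses-some f∈ with find (proj₂ (proj₂ (proj₂ hub-data)) f∈)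
            ... | z , z∈ , some with find some
            ...   | x , x∈ , xz with linkEdge-∈ x (lose z∈ xz)
            ...     | v , v∈ , xv , e = v , v∈ , lose x∈ (e , xv)

            elements : List Element
            elements = cartesianProduct hubs (cartesianProduct cs (upTo (suc (16 * X))))

            elements-length : length elements ≡ length hubs * (length cs * suc (16 * X))
            elements-length = trans (length-× hubs _) (cong (length hubs *_)
              (trans (length-× cs _) (cong (length cs *_) (length-upTo (suc (16 * X))))))

            Aims : A → ℕ → Chain → A × Chain → Set
            Aims v k c (b , c′) = c ≡ c′ × k ≡ key c v b

            Hit : Front × Back → Element → Set
            Hit f (v , c , k) = Uses f v × Any (Aims v k c) (proj₂ f)

            hit? : ∀ f e → Dec (Hit f e)
            hit? f (v , c , k) = uses? f v ×-dec Any.any? (λ t → (c ≟ᵏ proj₂ t) ×-dec (k ≟ key c v (proj₁ t))) (proj₂ f)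

            private
              module Entries = HittingSet Hit hit? elements s 1≤s

            rich : Entries.Rich fs
            rich {f} f∈ = let v , v∈ , uses = uses-some f∈ in
              ≤-trans (many f∈) (≤-trans (≤-reflexive (sym (length-map (aimAt v) (proj₂ f))))
                (unique-count (hit? f) (unique-map (aimAt v) (AllPairs-map-∈ (distinct v) (diverse f∈))) (ok v∈ uses)))
              where
              aimAt : A → A × Chain → Element
              aimAt v (b , c) = v , c , key c v b
              distinct : ∀ v {t t′} → t ∈ proj₂ f → t′ ∈ proj₂ f → DistinctPieces t t′ → aimAt v t ≢ aimAt v t′
              distinct v {b , c} {b′ , c′} t∈ t′∈ d≢ eq with cong (proj₁ ∘ proj₂) eq
              ... | refl with ≤-total (q c b) (q c b′) | targets f∈ t∈ | targets f∈ t′∈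
              ...   | inj₁ le | target c∈ b∈ | target _ b′∈ = d≢ refl (proj₂ (same-key c∈ b∈ b′∈ le (cong (proj₂ ∘ proj₂) eq)))
              ...   | inj₂ ge | target c∈ b∈ | target _ b′∈ = d≢ refl (sym (proj₂ (same-key c∈ b′∈ b∈ ge (sym (cong (proj₂ ∘ proj₂) eq)))))
              ok : ∀ {v} → v ∈ hubs → Uses f v → ∀ {e} → e ∈ map (aimAt v) (proj₂ f) → e ∈ elements × Hit f e
              ok {v} v∈ uses e∈ with ∈-map⁻ (aimAt v) e∈
              ... | (b , c) , t∈ , refl with targets f∈ t∈
              ...   | target c∈ b∈ = ∈-cartesianProduct⁺ v∈ (∈-cartesianProduct⁺ c∈ (∈-upTo⁺ (key≤ c∈ b∈))) , uses , lose t∈ (refl , refl)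

            abstract
              entry-data : ∃ λ hs → All (_∈ elements) hs × length hs * s ≤ 2 * length elements * j × Entries.Covers hs fs
              entry-data = Entries.hittingSet j fs rich fs<

            entries : List (A × A)
            entries = concat (map entryEdge (proj₁ entry-data))

            entries-length : length entries * (s * h) ≤ 4 * (length vs * length cs) * suc (16 * X) * (j * j)
            entries-length = begin
              length entries * (s * h)                                     ≤⟨ *-monoˡ-≤ (s * h) (length-concat-≤1 entryEdge (proj₁ entry-data) entryEdge≤1) ⟩
              length (proj₁ entry-data) * (s * h)                          ≡⟨ *-assoc (length (proj₁ entry-data)) s h ⟨
              length (proj₁ entry-data) * s * h                            ≤⟨ *-monoˡ-≤ h (proj₁ (proj₂ (proj₂ entry-data))) ⟩
              2 * length elements * j * h                                  ≡⟨ cong (λ n → 2 * n * j * h) elements-length ⟩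
              2 * (length hubs * (length cs * suc (16 * X))) * j * h       ≡⟨ regroup (length hubs) (length cs) (suc (16 * X)) j h ⟩
              2 * (length cs * suc (16 * X) * j) * (length hubs * h)       ≤⟨ *-monoʳ-≤ (2 * (length cs * suc (16 * X) * j)) (proj₁ (proj₂ (proj₂ hub-data))) ⟩
              2 * (length cs * suc (16 * X) * j) * (2 * length vs * j)     ≡⟨ regroup′ (length cs) (suc (16 * X)) j (length vs) ⟩
              4 * (length vs * length cs) * suc (16 * X) * (j * j)         ∎
              where
              open ≤-Reasoning
              regroup : ∀ a c x j h → 2 * (a * (c * x)) * j * h ≡ 2 * (c * x * j) * (a * h)
              regroup = solve-∀
              regroup′ : ∀ c x j n → 2 * (c * x * j) * (2 * n * j) ≡ 4 * (n * c) * x * (j * j)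
              regroup′ = solve-∀

            jump : ∀ {f} → f ∈ fs → Jump δ q links entries (proj₁ f) (proj₂ f)
            jump {f} f∈ with find (proj₂ (proj₂ (proj₂ entry-data)) f∈)
            ... | (v , c , k) , e∈ , uses , aims with find uses | find aims
            ...   | x , x∈ , link , xv | (b , _) , t∈ , refl , refl with targets f∈ t∈
            ...     | target c∈ b∈ with entryEdge-∈ c v b b∈
            ...       | y , y∈ , same , y≤b , edge∈ = record
              { x∈ = x∈ ; v∈ = hubs⊆ (proj₁ (∈-cartesianProduct⁻ hubs _ (All.lookup (proj₁ (proj₂ entry-data)) e∈)))
              ; bc∈ = t∈ ; link = ∈-concat-map linkEdge (front⊆ f∈ x∈) link ; close = xv
              ; entry = ∈-concat-map entryEdge e∈ edge∈ ; y∈ = y∈ ; y≤b = y≤b ; short = detour c∈ y∈ b∈ y≤b same }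

            serveAll : ∃₂ λ ls es → length ls ≤ N × length es * (s * h) ≤ 4 * (N * length cs) * suc (16 * X) * (j * j) ×
                                  (∀ {f} → f ∈ fs → Jump δ q ls es (proj₁ f) (proj₂ f))
            serveAll = links , entries , links-length , entries-length , jump

          module Serve (instances : A × A → List Instance) (instances≤1 : ∀ e → length (instances e) ≤ 1)
                       (admissible : ∀ {e} → e ∈ pairs → ∀ {i} → i ∈ instances e → Admissible i)
                       (diverse : ∀ xs → AllPairs DistinctPieces (targets xs)) where

            all : List Instance
            all = allInstances instances

            class : ℕ → List (List A × List (A × Chain))
            class a = map aimed (filter (inClass? a) all)

            class< : ∀ a → length (class a) < 2 ^ (2 * lg)
            class< a = ≤-<-trans (≤-trans (≤-reflexive (trans (length-map aimed (filter (inClass? a) all)) (length-filter≡count (inClass? a) all)))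
              (≤-trans (count≤length (inClass? a) all) (length-concat-≤1 instances pairs instances≤1))) pairs<

            class-∈ : ∀ a {g} → g ∈ class a → ∃ λ i → g ≡ aimed i × Admissible i × InClass a i
            class-∈ a g∈ with ∈-map⁻ aimed g∈
            ... | i , i∈ , refl with ∈-filter⁻ (inClass? a) {xs = all} i∈
            ...   | i∈all , cl with ∈-concat-map⁻ instances pairs i∈all
            ...     | e , e∈ , i∈e = i , refl , admissible e∈ i∈e , cl

            front-inside : ∀ a {g} → g ∈ class a → ∀ {x} → x ∈ proj₁ g → x ∈ vs
            front-inside a g∈ with class-∈ a g∈
            ... | _ , refl , (sub , _) , _ = sub

            dense : ∀ a {g} → g ∈ class a → 2 ^ a ≤ U (proj₁ g)
            dense a g∈ with class-∈ a g∈
            ... | _ , refl , _ , (h , _) = h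

            on-target : ∀ a {g} → g ∈ class a → ∀ {b c} → (b , c) ∈ proj₂ g → c ∈ cs × b ∈ members c
            on-target a g∈ t∈ with class-∈ a g∈
            ... | (_ , b) , refl , _ = proj₂ (targets-∈ b t∈)

            many : ∀ a {g} → g ∈ class a → quota a ≤ length (proj₂ g)
            many a g∈ with class-∈ a g∈
            ... | (f , b) , refl , (_ , h) , (_ , U<) = ≤-trans (m<n*o⇒m/o<n {{Z≢0 a}} (begin-strict
              D * D                        <⟨ h ⟩
              U f * Q b * Z                ≤⟨ *-monoˡ-≤ Z (*-monoˡ-≤ (Q b) (<⇒≤ U<)) ⟩
              2 ^ suc a * Q b * Z          ≡⟨ regroup (2 ^ suc a) (Q b) Z ⟩
              Q b * (Z * 2 ^ suc a)        ∎)) (≤-reflexive (sym (targets-length b)))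
              where
              open ≤-Reasoning
              regroup : ∀ a q z → a * q * z ≡ q * (z * a)
              regroup = solve-∀

            serve : ∀ a → ∃ λ H → length H ≤ N + τ × Served δ q instances a H
            serve a =
              let ls , es , ls≤ , es≤ , jump = Class.serveAll (2 ^ a) (quota a) (m^n>0 2 a) (s≤s z≤n) (class a) (2 * lg) (class< a)
                                                 (front-inside a) (dense a) (λ g∈ t∈ → uncurry target (on-target a g∈ t∈)) diverse′ (many a)
              in ls ++ es , ≤-trans (≤-reflexive (length-++ ls)) (+-mono-≤ ls≤ (entries≤τ a (length es) es≤)) ,
                 λ {f} {b} i∈ cl → jump-mono ∈-++⁺ˡ (∈-++⁺ʳ ls) (jump (∈-map⁺ aimed (∈-filter⁺ (inClass? a) i∈ cl)))
              where
              diverse′ : ∀ {g} → g ∈ class a → AllPairs DistinctPieces (proj₂ g)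
              diverse′ g∈ with class-∈ a g∈
              ... | (_ , b) , refl , _ = diverse b

            gathered : ∃ λ H → length H ≤ lg * (N + τ) × (∀ {a} → a < lg → Served δ q instances a H)
            gathered = gather (Served δ q instances) (λ sub s i∈ cl → jump-mono sub sub (s i∈ cl)) (N + τ) serve lg

        along against : Direction
        along   = record { δ = d ; δ-tri = tri ; q = q⁺ ; pc = p⁺ ; on-chain = on-chain⁺ ; pc-mono = p⁺-mono ; q≤ = q⁺≤ ; pc≤ = p⁺≤ }
        against = record { δ = flip d ; δ-tri = λ x y z → ≤-trans (tri z y x) (≤-reflexive (+-comm (d z y) (d y x)))
                          ; q = q⁻ ; pc = p⁻ ; on-chain = on-chain⁻ ; pc-mono = p⁻-mono ; q≤ = q⁻≤ ; pc≤ = p⁻≤ }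

        diverse⁺ : ∀ xs → AllPairs (Jumps.DistinctPieces along) (targets xs)
        diverse⁺ xs = AllPairs.map⁺ (AllPairs.map (λ { l≢ same piece≡ → l≢ (cong₂ _,_ same piece≡) }) (labels-differ xs))

        diverse⁻ : ∀ xs → AllPairs (Jumps.DistinctPieces against) (targets xs)
        diverse⁻ xs = AllPairs.map⁺ (AllPairs-map-∈ (λ {a} {b} a∈ b∈ l≢ same piece≡ → l≢ (cong₂ _,_ same
            (∸-cancelˡ-≡ (bound a∈) (bound b∈) piece≡))) (labels-differ xs))
          where
          bound : ∀ {b} → b ∈ proj₁ (picked xs) → p⁺ (chainOf b) b ≤ 4 * X
          bound b∈ = let _ , cov = proj₂ (proj₂ (picked xs)) b∈ ; c∈ , b∈c = chainOf-∈ cov in p⁺≤ c∈ b∈c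

        abstract
          gathered⁺ : ∃ λ H → length H ≤ lg * (N + τ) × (∀ {a} → a < lg → Served d q⁺ instances⁺ a H)
          gathered⁺ = Jumps.Serve.gathered along instances⁺ instances⁺≤1 admissible⁺ diverse⁺

          gathered⁻ : ∃ λ H → length H ≤ lg * (N + τ) × (∀ {a} → a < lg → Served (flip d) q⁻ instances⁻ a H)
          gathered⁻ = Jumps.Serve.gathered against instances⁻ instances⁻≤1 admissible⁻ diverse⁻

        scaleEdges : List (A × A)
        scaleEdges = chainEdges ++ proj₁ gathered⁺ ++ map swap (proj₁ gathered⁻)

        scaleEdges-length : length scaleEdges ≤ lg * N + (lg * (N + τ) + lg * (N + τ))
        scaleEdges-length = ≤-trans (≤-reflexive (trans (length-++ chainEdges) (cong (length chainEdges +_)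
            (trans (length-++ (proj₁ gathered⁺)) (cong (length (proj₁ gathered⁺) +_) (length-map swap (proj₁ gathered⁻)))))))
          (+-mono-≤ (ChainProperties.chainEdges-length (proj₂ cover-data)) (+-mono-≤ (proj₁ (proj₂ gathered⁺)) (proj₁ (proj₂ gathered⁻))))

        record IsSegment (u : A) (xs : List A) : Set where
          field
            linked : Linked Base xs
            sorted : AllPairs _≺[ u ]_ xs
            inside : ∀ {x} → x ∈ xs → x ∈ vs
            near   : ∀ {x} → x ∈ xs → d u x < 2 * R

        segment-++ˡ : ∀ {u} xs {ys} → IsSegment u (xs ++ ys) → IsSegment u xs
        segment-++ˡ xs s = record { linked = Linked-++ˡ xs (linked s) ; sorted = AllPairs-++ˡ xs (sorted s)
                                  ; inside = inside s ∘ ∈-++⁺ˡ ; near = near s ∘ ∈-++⁺ˡ }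
          where open IsSegment

        segment-++ʳ : ∀ {u} xs {ys} → IsSegment u (xs ++ ys) → IsSegment u ys
        segment-++ʳ xs s = record { linked = Linked-++ʳ xs (linked s) ; sorted = AllPairs-++ʳ xs (sorted s)
                                  ; inside = inside s ∘ ∈-++⁺ʳ xs ; near = near s ∘ ∈-++⁺ʳ xs }
          where open IsSegment

        module Core (E : A → A → Set) (base : ∀ {x y} → Base x y → E x y)
                    (squeeze : ∀ {j} → j ≤ lg → ∀ {y z c t} → y ∈ vs → z ∈ vs → d y z < ∞ → d c y + d y z + d z c ≤ t →
                               ballSize c (2 * t) ≤ 2 ^ j * 2 ^ j → Reach E (2 * 2 ^ j) (d y z) y z)
                    (chain-hop : ∀ {c} → c ∈ cs → ∀ {x y} → x ∈ members c → y ∈ members c → d (source c) x ≤ d (source c) y →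
                                 Reach E 2 (d x y) x y)
                    (u : A) where

          open IsSegment

          _≼_ : A → A → Set
          x ≼ y = Between u x y

          ≼-refl : ∀ {x} → x ≼ x
          ≼-refl {x} = trans (cong (d u x +_) (d-refl x)) (+-identityʳ _)

          ≼-finite : ∀ {x y} → x ≼ y → d u y < 2 * R → d x y < ∞
          ≼-finite {x} {y} x≼y lt = <-≤-trans (≤-<-trans (≤-trans (m≤n+m (d x y) (d u x)) (≤-reflexive x≼y)) lt) 2R≤∞

          -- A block (y , z) is a stretch of the path with ρ y z ≤ r 0.

          Block : Set
          Block = A × A

          data Trace (w : A) : A → ℕ → List Block → Set where
            finish : ∀ {x g} → x ≼ w → Reach E g (d x w) x w → Trace w x g []
            block  : ∀ {x y z e g bs} → Reach E e (d x y) x y → x ≼ y → y ≼ z → ρ y z ≤ r 0 →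
                     Trace w z g bs → Trace w x (e + g) ((y , z) ∷ bs)

          trace-≼ : ∀ {w x g bs} → Trace w x g bs → x ≼ w
          trace-≼ (finish p _)      = p
          trace-≼ (block _ p q _ t) = proj₁ (between-trans p (proj₁ (between-trans q (trace-≼ t))))

          prepend : ∀ {w x y e g bs} → Reach E e (d x y) x y → x ≼ y → Trace w y g bs → Trace w x (e + g) bs
          prepend r p (finish q r′) = finish (proj₁ (between-trans p q)) (reach-⊕ (proj₂ (between-trans p q)) r r′)
          prepend {w} {x} {e = e} r p (block {y = y} {z = z} {e = e′} {g = g} {bs = bs} r′ q q′ c t) =
            subst (λ n → Trace w x n ((y , z) ∷ bs)) (+-assoc e e′ g)
              (block (reach-⊕ (proj₂ (between-trans p q)) r r′) (proj₁ (between-trans p q)) q′ c t)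

          trace-mono : ∀ {w x g g′ bs} → g ≤ g′ → Trace w x g bs → Trace w x g′ bs
          trace-mono g≤ (finish p r) = finish p (reach-mono id g≤ ≤-refl r)
          trace-mono {w} {x} {g′ = g′} g≤ (block {y = y} {z = z} {e = e} {g = g} {bs = bs} r p q c t) = subst (λ n → Trace w x n ((y , z) ∷ bs)) eq
              (block (reach-mono id (m≤m+n e (g′ ∸ (e + g))) ≤-refl r) p q c t)
            where
            eq : e + (g′ ∸ (e + g)) + g ≡ g′
            eq = trans (swap₃ e (g′ ∸ (e + g)) g) (m+[n∸m]≡n g≤)
              where
              swap₃ : ∀ a b c → a + b + c ≡ a + c + b
              swap₃ = solve-∀

          trace-drop : ∀ {w x g} as {b bs} → Trace w x g (as ++ b ∷ bs) →
                       proj₁ b ≼ proj₂ b × ρ (proj₁ b) (proj₂ b) ≤ r 0 × Trace w (proj₂ b) g bs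
          trace-drop []       (block {e = e} {g = g} r p q c t) = q , c , trace-mono (m≤n+m g e) t
          trace-drop (_ ∷ as) (block {e = e} {g = g} r p q c t) =
            let q′ , c′ , t′ = trace-drop as t in q′ , c′ , trace-mono (m≤n+m g e) t′

          trace-skip : ∀ {w x g k rest} as {b bs} → k ∷ rest ≡ as ++ b ∷ bs → Trace w x g (k ∷ rest) →
                       ∃₂ λ e g′ → e + g′ ≤ g × Reach E e (d x (proj₁ k)) x (proj₁ k) × x ≼ proj₁ k ×
                       proj₁ b ≼ proj₂ b × ρ (proj₁ b) (proj₂ b) ≤ r 0 × Trace w (proj₂ b) g′ bs
          trace-skip []       refl (block {e = e} {g = g} r p q c t) = e , g , ≤-refl , r , p , q , c , t
          trace-skip (_ ∷ as) refl (block {e = e} {g = g} r p q c t) = e , g , ≤-refl , r , p , trace-drop as t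

          Separated : A → A → Set
          Separated y y′ = y ≺[ u ] y′ × r 0 < ρ y y′ × (chainOf y′ ≡ chainOf y → pos y′ ≤ pos y)

          record Decomposition (xs : List A) (x w : A) : Set where
            field
              blocks    : List Block
              gaps      : ℕ
              trace     : Trace w x gaps blocks
              gaps≤     : gaps ≤ uncovered cs xs + 3 * length blocks
              starts⊆   : ∀ {b} → b ∈ blocks → proj₁ b ∈ xs × Covered cs (proj₁ b)
              ends⊆     : ∀ {b} → b ∈ blocks → proj₂ b ∈ xs
              separated : AllPairs (λ b b′ → Separated (proj₁ b) (proj₁ b′)) blocks

          open Decomposition

          base-step : ∀ {x x′ xs} → IsSegment u (x ∷ x′ ∷ xs) → Reach E 1 (d x x′) x x′ × x ≼ x′
          base-step s with linked s | sorted s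
          ... | b ∷ _ | ((p , _) ∷ _) ∷ _ = edge (base b) , p

          -- After jumping forward along the chain of x to the last possible vertex
          -- y, and from there to the last vertex z close to y, any later vertex on
          -- the same chain is behind y on the chain and far from y in ρ.

          decompose : ∀ fuel x xs → length xs < fuel → IsSegment u (x ∷ xs) → Decomposition (x ∷ xs) x (lastOf x xs)
          decompose (suc fuel) x xs (s≤s len) seg with covered? cs x
          decompose (suc fuel) x [] (s≤s len) seg | no ¬c = record
            { blocks = [] ; gaps = 0 ; trace = finish ≼-refl stop ; gaps≤ = z≤n
            ; starts⊆ = λ () ; ends⊆ = λ () ; separated = [] }
          decompose (suc fuel) x (x′ ∷ xs) (s≤s len) seg | no ¬c = record
            { blocks = blocks rec ; gaps = suc (gaps rec)
            ; trace = prepend (proj₁ (base-step seg)) (proj₂ (base-step seg)) (trace rec)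
            ; gaps≤ = ≤-trans (s≤s (gaps≤ rec)) (≤-reflexive (cong (λ i → i + uncovered cs (x′ ∷ xs) + 3 * length (blocks rec))
                        (sym (⟨⟩-yes (¬? (covered? cs x)) ¬c))))
            ; starts⊆ = λ b∈ → let m , c = starts⊆ rec b∈ in there m , c
            ; ends⊆ = there ∘ ends⊆ rec
            ; separated = separated rec }
            where
            rec : Decomposition (x′ ∷ xs) x′ (lastOf x′ xs)
            rec = decompose fuel x′ xs len (segment-++ʳ (x ∷ []) seg)
          decompose (suc fuel) x xs (s≤s len) seg | yes c
            with lastWith {P = λ y → Covered cs y × chainOf y ≡ chainOf x × pos x ≤ pos y}
                   (λ y → covered? cs y ×-dec (Product.≡-dec _≟ᴬ_ (≡-dec _≟ᴬ_) (chainOf y) (chainOf x) ×-dec (pos x ≤? pos y)))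
                   x xs (c , refl , ≤-refl)
          ... | as , y , bs , split , (cy , same , x≤y) , none
            with lastWith (λ z → ρ y z ≤? r 0) y bs (≤-trans (≤-reflexive (ρ-refl y)) z≤n)
          ...   | as′ , z , post , split′ , yz , none′ = assemble post refl
            where
            whole : x ∷ xs ≡ (as ++ as′) ++ z ∷ post
            whole = trans split (trans (cong (as ++_) split′) (sym (++-assoc as as′ (z ∷ post))))
            seg-y : IsSegment u (y ∷ bs)
            seg-y = segment-++ʳ as (subst (IsSegment u) split seg)
            seg-z : IsSegment u (z ∷ post)
            seg-z = segment-++ʳ (as ++ as′) (subst (IsSegment u) whole seg)
            ≼-of : ∀ ps {v q qs ws} → ws ≡ ps ++ v ∷ qs → AllPairs _≺[ u ]_ (q ∷ []) → ∀ {h t} → ws ≡ h ∷ t → AllPairs _≺[ u ]_ ws → h ≼ v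
            ≼-of []       refl _ refl s       = ≼-refl
            ≼-of (p ∷ ps) refl _ refl (a ∷ s) = proj₁ (All.lookup a (∈-++⁺ʳ ps (here refl)))
            x≼y : x ≼ y
            x≼y = ≼-of as {q = x} split ([] ∷ []) refl (sorted seg)
            y≼z : y ≼ z
            y≼z = ≼-of as′ {q = x} split′ ([] ∷ []) refl (sorted seg-y)
            hop : Reach E 2 (d x y) x y
            hop = chain-hop (proj₁ (chainOf-∈ c)) (proj₂ (chainOf-∈ c))
                    (subst (λ ch → y ∈ members ch) same (proj₂ (chainOf-∈ cy)))
                    (≤-trans x≤y (≤-reflexive (cong (λ ch → d (source ch) y) same)))
            y∈ : y ∈ x ∷ xs
            y∈ = subst (y ∈_) (sym split) (∈-++⁺ʳ as (here refl))
            z∈ : z ∈ x ∷ xs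
            z∈ = subst (z ∈_) (sym whole) (∈-++⁺ʳ (as ++ as′) (here refl))
            post⊆bs : ∀ ps {v qs} → y ∷ bs ≡ ps ++ v ∷ qs → ∀ {t} → t ∈ qs → t ∈ bs
            post⊆bs []       refl t∈ = t∈
            post⊆bs (p ∷ ps) refl t∈ = ∈-++⁺ʳ ps (there t∈)
            apart : ∀ {y′} → y′ ∈ post → Covered cs y′ → Separated y y′
            apart {y′} y′∈ cy′ = All.lookup (AllPairs.head (sorted seg-y)) (post⊆bs as′ split′ y′∈) , ≰⇒> (none′ y′∈) ,
              λ eq → <⇒≤ (<-≤-trans (≰⇒> λ x≤ → none (post⊆bs as′ split′ y′∈) (cy′ , trans eq same , x≤)) x≤y)
            last≡ : ∀ ps {v qs} → x ∷ xs ≡ ps ++ v ∷ qs → lastOf x xs ≡ lastOf v qs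
            last≡ []       refl = refl
            last≡ (p ∷ ps) refl = lastOf-++ _ ps _ _
            post⊆ : ∀ {t} → t ∈ post → t ∈ x ∷ xs
            post⊆ t∈ = subst (_ ∈_) (sym whole) (∈-++⁺ʳ (as ++ as′) (there t∈))
            assemble : ∀ p → post ≡ p → Decomposition (x ∷ xs) x (lastOf x xs)
            assemble [] eq = record
              { blocks = (y , z) ∷ [] ; gaps = 2 + 0
              ; trace = block hop x≼y y≼z yz (subst (λ w → Trace w z 0 []) (sym last-z) (finish ≼-refl stop))
              ; gaps≤ = ≤-trans (s≤s (s≤s z≤n)) (m≤n+m 3 (uncovered cs (x ∷ xs)))
              ; starts⊆ = λ { (here refl) → y∈ , cy } ; ends⊆ = λ { (here refl) → z∈ } ; separated = [] ∷ [] }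
              where
              last-z : lastOf x xs ≡ z
              last-z = trans (last≡ (as ++ as′) whole) (cong (lastOf z) eq)
            assemble (x′ ∷ xs′) eq = record
              { blocks = (y , z) ∷ blocks rec ; gaps = 2 + suc (gaps rec)
              ; trace = block hop x≼y y≼z yz (prepend (proj₁ step₁) (proj₂ step₁) (subst (λ w → Trace w x′ (gaps rec) (blocks rec)) (sym last-x′) (trace rec)))
              ; gaps≤ = begin
                  3 + gaps rec                                          ≤⟨ +-monoʳ-≤ 3 (gaps≤ rec) ⟩
                  3 + (uncovered cs (x′ ∷ xs′) + 3 * length (blocks rec)) ≡⟨ shuffle (uncovered cs (x′ ∷ xs′)) (length (blocks rec)) ⟩
                  uncovered cs (x′ ∷ xs′) + 3 * suc (length (blocks rec)) ≤⟨ +-monoˡ-≤ (3 * suc (length (blocks rec))) unc≤ ⟩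
                  uncovered cs (x ∷ xs) + 3 * suc (length (blocks rec)) ∎
              ; starts⊆ = λ { (here refl) → y∈ , cy
                            ; (there m) → let m′ , cb = starts⊆ rec m in post⊆ (subst (_ ∈_) (sym eq) m′) , cb }
              ; ends⊆ = λ { (here refl) → z∈ ; (there m) → post⊆ (subst (_ ∈_) (sym eq) (ends⊆ rec m)) }
              ; separated = All.tabulate (λ m → let m′ , cb = starts⊆ rec m in apart (subst (_ ∈_) (sym eq) m′) cb) ∷ separated rec }
              where
              open ≤-Reasoning
              shuffle : ∀ a b → 3 + (a + 3 * b) ≡ a + 3 * suc b
              shuffle = solve-∀
              seg-post : IsSegment u (z ∷ x′ ∷ xs′)
              seg-post = subst (λ p → IsSegment u (z ∷ p)) eq seg-z
              step₁ = base-step seg-post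
              whole′ : x ∷ xs ≡ ((as ++ as′) ++ z ∷ []) ++ x′ ∷ xs′
              whole′ = trans whole (trans (cong (λ p → (as ++ as′) ++ z ∷ p) eq) (sym (++-assoc (as ++ as′) (z ∷ []) (x′ ∷ xs′))))
              last-x′ : lastOf x xs ≡ lastOf x′ xs′
              last-x′ = last≡ ((as ++ as′) ++ z ∷ []) whole′
              shorter : ∀ ps {qs} → x ∷ xs ≡ ps ++ z ∷ x′ ∷ qs → length qs < fuel
              shorter []       refl = len
              shorter (p ∷ ps) {qs} refl = ≤-trans (≤-trans (n≤1+n _) (≤-trans (m≤n+m (2 + length qs) (length ps)) (≤-reflexive (sym (length-++ ps))))) len
              rec : Decomposition (x′ ∷ xs′) x′ (lastOf x′ xs′)
              rec = decompose fuel x′ xs′ (shorter (as ++ as′) (trans whole (cong (λ p → (as ++ as′) ++ z ∷ p) eq))) (segment-++ʳ (z ∷ []) seg-post)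
              unc≤ : uncovered cs (x′ ∷ xs′) ≤ uncovered cs (x ∷ xs)
              unc≤ = ≤-trans (m≤n+m _ (uncovered cs ((as ++ as′) ++ z ∷ [])))
                       (≤-reflexive (trans (sym (∑-++ ((as ++ as′) ++ z ∷ []) (x′ ∷ xs′) _)) (cong (uncovered cs) (sym whole′))))

          module Bounded (x : A) (xs : List A) (seg : IsSegment u (x ∷ xs)) where

            private
              w : A
              w = lastOf x xs

            dec : Decomposition (x ∷ xs) x w
            dec = decompose (suc (length xs)) x xs ≤-refl seg

            open Decomposition dec using () renaming
              (blocks to bs; gaps to g; trace to tr; gaps≤ to g≤; starts⊆ to s⊆; ends⊆ to e⊆; separated to sep)

            p : ℕ
            p = length bs

            start∈ : ∀ {b} → b ∈ bs → proj₁ b ∈ vs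
            start∈ m = inside seg (proj₁ (s⊆ m))

            end∈ : ∀ {b} → b ∈ bs → proj₂ b ∈ vs
            end∈ m = inside seg (e⊆ m)

            _⊏_ : Block → Block → Set
            b ⊏ b′ = Separated (proj₁ b) (proj₁ b′)

            p≤U : p ≤ U (x ∷ xs)
            p≤U = ≤-trans (≤-reflexive (sym (length-map proj₁ bs)))
              (unique-count (reached? (x ∷ xs)) (unique-map proj₁ (AllPairs.map (λ { ((_ , lt) , _) refl′ → <-irrefl (cong (d u) refl′) lt }) sep)) ok)
              where
              ok : ∀ {y} → y ∈ map proj₁ bs → y ∈ vs × Any (λ x → ρ x y ≤ 2 * r L) (x ∷ xs)
              ok {y} y∈ with ∈-map⁻ proj₁ y∈
              ... | b , b∈ , refl = start∈ b∈ , lose (proj₁ (s⊆ b∈)) (≤-trans (≤-reflexive (ρ-refl _)) z≤n)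

            p≤N : p ≤ N
            p≤N = ≤-trans p≤U (count≤length (reached? (x ∷ xs)) vs)

            window : A → ℕ
            window y = 2 * X * d u y / R

            below-4X : ∀ {n} → n < 2 * R → 2 * X * n / R < 4 * X
            below-4X {n} n< = m<n*o⇒m/o<n (<-≤-trans (*-monoʳ-< (2 * X) {{m*n≢0 2 X}} n<) (≤-reflexive (regroup X R)))
              where
              regroup : ∀ x r → 2 * x * (2 * r) ≡ 4 * x * r
              regroup = solve-∀

            key : Block → (Chain × ℕ) × ℕ
            key b = label (proj₁ b) , window (proj₁ b)

            -- Equal pieces bound the way back along the chain, equal windows the
            -- way forth along the path.

            keys-distinct : ∀ {b b′} → b ∈ bs → b′ ∈ bs → b ⊏ b′ → key b ≢ key b′
            keys-distinct {y , _} {y′ , _} b∈ b′∈ ((y≼y′ , _) , apart , behind) eq = <⇒≱ apart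
              (m*n≤o⇒m≤o/n (ρ y y′) X (5 ^ 0 * R) (≤-trans (<⇒≤ (*-cancelˡ-< 2 _ _ (begin-strict
                2 * (ρ y y′ * X)                          ≡⟨ regroup X (d y y′) (d y′ y) ⟩
                2 * X * d y y′ + 2 * X * d y′ y           <⟨ +-mono-< forth back ⟩
                R + R                                     ≡⟨ cong (R +_) (+-identityʳ R) ⟨
                2 * R                                     ∎))) (≤-reflexive (sym (*-identityˡ R)))))
              where
              open ≤-Reasoning
              regroup : ∀ x a b → 2 * ((a + b) * x) ≡ 2 * x * a + 2 * x * b
              regroup = solve-∀
              chain≡ : chainOf y′ ≡ chainOf y
              chain≡ = sym (cong (proj₁ ∘ proj₁) eq)
              forth : 2 * X * d y y′ < R
              forth = +-cancelˡ-< (2 * X * d u y) _ _ (begin-strict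
                2 * X * d u y + 2 * X * d y y′            ≡⟨ *-distribˡ-+ (2 * X) (d u y) _ ⟨
                2 * X * (d u y + d y y′)                  ≡⟨ cong (2 * X *_) y≼y′ ⟩
                2 * X * d u y′                            <⟨ same-quotient _ _ R (sym (cong proj₂ eq)) ⟩
                2 * X * d u y + R                         ∎)
              between : pos y′ + d y′ y ≡ pos y
              between = trans (cong (λ c → d (source c) y′ + d y′ y) chain≡)
                (chain-between (proj₁ (chainOf-∈ (proj₂ (s⊆ b∈))))
                  (subst (λ c → y′ ∈ members c) chain≡ (proj₂ (chainOf-∈ (proj₂ (s⊆ b′∈))))) (proj₂ (chainOf-∈ (proj₂ (s⊆ b∈))))
                  (≤-trans (≤-reflexive (cong (λ c → d (source c) y′) (sym chain≡))) (behind chain≡)))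
              back : 2 * X * d y′ y < R
              back = +-cancelˡ-< (2 * X * pos y′) _ _ (begin-strict
                2 * X * pos y′ + 2 * X * d y′ y           ≡⟨ *-distribˡ-+ (2 * X) (pos y′) _ ⟨
                2 * X * (pos y′ + d y′ y)                 ≡⟨ cong (2 * X *_) between ⟩
                2 * X * pos y                             <⟨ same-quotient _ _ R (cong (proj₂ ∘ proj₁) eq) ⟩
                2 * X * pos y′ + R                        ∎)

            p≤Q : p ≤ Q (x ∷ xs) * (4 * X)
            p≤Q = begin
              p                                                    ≡⟨ length-map key bs ⟨
              length (map key bs)                                  ≤⟨ unique-length (unique-map key (AllPairs-map-∈ keys-distinct sep)) ok ⟩
              length (cartesianProduct (labels (x ∷ xs)) (upTo (4 * X))) ≡⟨ length-× (labels (x ∷ xs)) (upTo (4 * X)) ⟩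
              Q (x ∷ xs) * length (upTo (4 * X))                   ≡⟨ cong (Q (x ∷ xs) *_) (length-upTo (4 * X)) ⟩
              Q (x ∷ xs) * (4 * X)                                 ∎
              where
              open ≤-Reasoning
              ok : ∀ {k} → k ∈ map key bs → k ∈ cartesianProduct (labels (x ∷ xs)) (upTo (4 * X))
              ok k∈ with ∈-map⁻ key k∈
              ... | b , b∈ , refl = ∈-cartesianProduct⁺
                (∈-deduplicate⁺ _≟ᶜ_ (∈-map⁺ label (∈-filter⁺ (covered? cs) (proj₁ (s⊆ b∈)) (proj₂ (s⊆ b∈)))))
                (∈-upTo⁺ (below-4X (near seg (proj₁ (s⊆ b∈)))))

            near-count : ℕ → Block → ℕ
            near-count ℓ i = count (λ q → ρ (proj₁ i) (proj₁ q) ≤? r ℓ) bs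

            abstract
              level-data : ∀ i → ∃ λ ℓ → ℓ ≤ L × (1 ≤ near-count 0 i → (∀ l → near-count l i < 2 ^ lg) →
                                                  near-count (suc ℓ) i ≤ 2 * (near-count ℓ i * near-count ℓ i))
              level-data i = doubling-level (λ ℓ → near-count ℓ i) L lg big

            level : Block → ℕ
            level i = proj₁ (level-data i)

            level≤ : ∀ i → level i ≤ L
            level≤ i = proj₁ (proj₂ (level-data i))

            near-count≥1 : ∀ ℓ {i} → i ∈ bs → 1 ≤ near-count ℓ i
            near-count≥1 ℓ {i} i∈ = count-∈ (λ q → ρ (proj₁ i) (proj₁ q) ≤? r ℓ) i∈ (≤-trans (≤-reflexive (ρ-refl (proj₁ i))) z≤n)

            level-grows : ∀ {i} → i ∈ bs → near-count (suc (level i)) i ≤ 2 * (near-count (level i) i * near-count (level i) i)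
            level-grows {i} i∈ = proj₂ (proj₂ (level-data i)) (near-count≥1 0 i∈)
              λ l → ≤-<-trans (≤-trans (count≤length (λ q → ρ (proj₁ i) (proj₁ q) ≤? r l) bs) p≤N) N<

            Near : Block → Block → Set
            Near i q = ρ (proj₁ i) (proj₁ q) ≤ r (level i)

            near? : ∀ i q → Dec (Near i q)
            near? i q = ρ (proj₁ i) (proj₁ q) ≤? r (level i)

            near-refl : ∀ i → Near i i
            near-refl i = ≤-trans (≤-reflexive (ρ-refl (proj₁ i))) z≤n

            convex : ∀ {i q m k} as cs′ → i ∈ bs → bs ≡ as ++ m ∷ cs′ → q ∈ as → k ∈ cs′ → Near i q → Near i k → Near i m
            convex {i} {q} {m} {k} as cs′ i∈ split q∈ k∈ iq ik
              with comparable sep i∈ (subst (m ∈_) (sym split) (∈-++⁺ʳ as (here refl)))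
            ... | inj₂ (inj₁ refl) = near-refl i
            ... | inj₁ (i≺m , _) = ≤-trans (ρ-monoʳ (proj₂ (between-trans (proj₁ i≺m) (proj₁ (proj₁ m⊏k))))) ik
              where
              m⊏k : m ⊏ k
              m⊏k = All.lookup (AllPairs.head (AllPairs-++ʳ as (subst (AllPairs _⊏_) split sep))) k∈
            ... | inj₂ (inj₂ (m≺i , _)) = ≤-trans (≤-reflexive (ρ-sym (proj₁ i) (proj₁ m)))
                (≤-trans (ρ-monoˡ (proj₂ (between-trans (proj₁ (proj₁ q⊏m)) (proj₁ m≺i)))) (≤-trans (≤-reflexive (ρ-sym (proj₁ q) (proj₁ i))) iq))
              where
              q⊏m : q ⊏ m
              q⊏m = AllPairs-++ˣ as (subst (AllPairs _⊏_) split sep) q∈ (here refl)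

            size : Block → ℕ
            size i = ballSize (proj₁ i) (2 * r (level i))

            abstract
              size-data : ∀ i → ∃ λ j → j ≤ lg × size i ≤ 2 ^ j * 2 ^ j × (1 ≤ size i → 2 ^ j * 2 ^ j ≤ 4 * size i)
              size-data i = square-above (size i) lg (≤-<-trans (ballSize≤N (proj₁ i) (2 * r (level i))) N<)

            K : Block → ℕ
            K i = 2 ^ proj₁ (size-data i)

            cost : Block → ℕ
            cost i = 6 * K i

            cost-square : ∀ {i} → i ∈ bs → cost i * cost i ≤ 144 * size i
            cost-square {i} i∈ = six-times-square (K i) (size i) (proj₂ (proj₂ (proj₂ (size-data i))) size≥1)
              where
              size≥1 : 1 ≤ size i
              size≥1 = count-∈ (λ z → ρ (proj₁ i) z ≤? 2 * r (level i)) (start∈ i∈) (≤-trans (≤-reflexive (ρ-refl (proj₁ i))) z≤n)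

            squeezeTo : ∀ i {y z c t} → y ∈ vs → z ∈ vs → y ≼ z → d u z < 2 * R → d c y + d y z + d z c ≤ t →
                        ballSize c (2 * t) ≤ size i → Reach E (2 * K i) (d y z) y z
            squeezeTo i y∈ z∈ y≼z lt cyc small =
              squeeze (proj₁ (proj₂ (size-data i))) y∈ z∈ (≼-finite y≼z lt) cyc (≤-trans small (proj₁ (proj₂ (proj₂ (size-data i)))))

            across : ∀ {i k b} → i ∈ bs → k ∈ bs → b ∈ bs → proj₁ k ≼ proj₁ b → Near i k → Near i b →
                     Reach E (2 * K i + 2 * K i) (d (proj₁ k) (proj₁ b)) (proj₁ k) (proj₁ b)
            across {i} {k} {b} i∈ k∈ b∈ k≼b ik ib = by-position (position i∈ k∈) (position i∈ b∈)
              where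
              yi = proj₁ i
              yk = proj₁ k
              yb = proj₁ b
              b< : d u yb < 2 * R
              b< = near seg (proj₁ (s⊆ b∈))
              position : ∀ {a c} → a ∈ bs → c ∈ bs → proj₁ a ≼ proj₁ c ⊎ proj₁ c ≼ proj₁ a
              position a∈ c∈ with comparable sep a∈ c∈
              ... | inj₁ (p , _)        = inj₁ (proj₁ p)
              ... | inj₂ (inj₁ refl)    = inj₁ ≼-refl
              ... | inj₂ (inj₂ (p , _)) = inj₂ (proj₁ p)
              direct : d yi yk + d yk yb + d yb yi ≤ r (level i) → Reach E (2 * K i + 2 * K i) (d yk yb) yk yb
              direct cyc = reach-mono id (m≤m+n _ _) ≤-refl (squeezeTo i (start∈ k∈) (start∈ b∈) k≼b b< cyc ≤-refl)
              by-position : yi ≼ yk ⊎ yk ≼ yi → yi ≼ yb ⊎ yb ≼ yi → Reach E (2 * K i + 2 * K i) (d yk yb) yk yb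
              by-position (inj₁ i≼k) _ =
                direct (≤-trans (≤-reflexive (cong (_+ d yb yi) (proj₂ (between-trans i≼k k≼b)))) ib)
              by-position _ (inj₂ b≼i) =
                direct (≤-trans (≤-reflexive (trans (+-assoc (d yi yk) _ _) (cong (d yi yk +_) (proj₂ (between-trans k≼b b≼i))))) ik)
              by-position (inj₂ k≼i) (inj₁ i≼b) = reach-⊕ (proj₂ (between-trans k≼i i≼b))
                (squeezeTo i {c = yi} (start∈ k∈) (start∈ i∈) k≼i (near seg (proj₁ (s⊆ i∈)))
                  (≤-trans (≤-reflexive (trans (cong (d yi yk + d yk yi +_) (d-refl yi)) (+-identityʳ _))) ik) ≤-refl)
                (squeezeTo i {c = yi} (start∈ i∈) (start∈ b∈) i≼b b<
                  (≤-trans (≤-reflexive (cong (λ n → n + d yi yb + d yb yi) (d-refl yi))) ib) ≤-refl)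

            within : ∀ {i b} → i ∈ bs → b ∈ bs → proj₁ b ≼ proj₂ b → ρ (proj₁ b) (proj₂ b) ≤ r 0 → Near i b →
                     Reach E (2 * K i) (d (proj₁ b) (proj₂ b)) (proj₁ b) (proj₂ b)
            within {i} {b} i∈ b∈ y≼z yz ib = squeezeTo i {c = proj₁ b} (start∈ b∈) (end∈ b∈) y≼z (near seg (e⊆ b∈))
                (≤-trans (≤-reflexive (cong (λ n → n + d (proj₁ b) (proj₂ b) + d (proj₂ b) (proj₁ b)) (d-refl (proj₁ b)))) yz) (inclusion (comparable sep i∈ b∈))
              where
              enlarge : ρ (proj₁ i) (proj₁ b) + 2 * r 0 ≤ 2 * r (level i) → ballSize (proj₁ b) (2 * r 0) ≤ size i
              enlarge h = count-mono (λ z → ρ (proj₁ b) z ≤? 2 * r 0) (λ z → ρ (proj₁ i) z ≤? 2 * r (level i)) vs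
                λ {z} _ bz → ≤-trans (ρ-tri (proj₁ i) (proj₁ b) z) (≤-trans (+-monoʳ-≤ (ρ (proj₁ i) (proj₁ b)) bz) h)
              higher : ∀ ℓ → ρ (proj₁ i) (proj₁ b) ≤ r ℓ → r 0 < ρ (proj₁ i) (proj₁ b) → ρ (proj₁ i) (proj₁ b) + 2 * r 0 ≤ 2 * r ℓ
              higher zero    ib far = contradiction ib (<⇒≱ far)
              higher (suc ℓ) ib far = begin
                ρ (proj₁ i) (proj₁ b) + 2 * r 0   ≤⟨ +-mono-≤ ib (≤-trans (*-monoˡ-≤ (r 0) {2} {5} (s≤s (s≤s z≤n))) (≤-trans (r-step 0) (r-mono 1 (suc ℓ) (s≤s z≤n)))) ⟩
                r (suc ℓ) + r (suc ℓ)             ≡⟨ cong (r (suc ℓ) +_) (+-identityʳ _) ⟨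
                2 * r (suc ℓ)                     ∎
                where open ≤-Reasoning
              inclusion : i ⊏ b ⊎ i ≡ b ⊎ b ⊏ i → ballSize (proj₁ b) (2 * r 0) ≤ size i
              inclusion (inj₂ (inj₁ refl)) = enlarge (≤-trans (≤-reflexive (cong (_+ 2 * r 0) (ρ-refl (proj₁ b)))) (*-monoʳ-≤ 2 (r-mono 0 (level i) z≤n)))
              inclusion (inj₁ (_ , far , _)) = enlarge (higher (level i) ib far)
              inclusion (inj₂ (inj₂ (_ , far , _))) = enlarge (higher (level i) ib (<-≤-trans far (≤-reflexive (ρ-sym (proj₁ b) (proj₁ i)))))

            traverse : ∀ {rest S x g} → Groups Near bs rest S → (∀ {b} → b ∈ rest → b ∈ bs) → AllPairs _⊏_ rest → Trace w x g rest →
                       Reach E (g + ∑ S cost) (d x w) x w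
            traverse {x = x} {g = g} [] sub sorted′ (finish _ r) = reach-mono id (m≤m+n g 0) ≤-refl r
            traverse {x = x} {g = g} (group {k} {rest} {i} {b} {S} as post split i∈ ik ib gs) sub sorted′ t
              with trace-skip as split t
            ... | e , g′ , e+g′≤ , r , x≼k , y≼z , yz , t′ = reach-mono id (begin
                e + ((2 * K i + 2 * K i) + (2 * K i + (g′ + ∑ S cost)))   ≡⟨ shuffle e (K i) g′ (∑ S cost) ⟩
                (e + g′) + (6 * K i + ∑ S cost)                          ≤⟨ +-monoˡ-≤ _ e+g′≤ ⟩
                g + (6 * K i + ∑ S cost)                                 ∎) ≤-refl
                (reach-⊕ (proj₂ (between-trans x≼k k≼w)) r
                  (reach-⊕ (proj₂ (between-trans k≼b b≼w)) (across i∈ (sub (here refl)) b∈ k≼b ik ib)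
                    (reach-⊕ (proj₂ (between-trans y≼z z≼w)) (within i∈ b∈ y≼z yz ib)
                      (traverse gs (sub ∘ post⊆) sorted-post t′))))
              where
              open ≤-Reasoning
              shuffle : ∀ e k g s → e + ((2 * k + 2 * k) + (2 * k + (g + s))) ≡ (e + g) + (6 * k + s)
              shuffle = solve-∀
              b∈ : b ∈ bs
              b∈ = sub (subst (b ∈_) (sym split) (∈-++⁺ʳ as (here refl)))
              post⊆ : ∀ {q} → q ∈ post → q ∈ k ∷ rest
              post⊆ q∈ = subst (_ ∈_) (sym split) (∈-++⁺ʳ as (there q∈))
              sorted-post : AllPairs _⊏_ post
              sorted-post = AllPairs.tail (AllPairs-++ʳ as (subst (AllPairs _⊏_) split sorted′))
              first≼ : ∀ as → k ∷ rest ≡ as ++ b ∷ post → proj₁ k ≼ proj₁ b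
              first≼ []       refl = ≼-refl
              first≼ (a ∷ as) refl = proj₁ (proj₁ (All.lookup (AllPairs.head sorted′) (∈-++⁺ʳ as (here refl))))
              k≼b : proj₁ k ≼ proj₁ b
              k≼b = first≼ as split
              z≼w : proj₂ b ≼ w
              z≼w = trace-≼ t′
              b≼w : proj₁ b ≼ w
              b≼w = proj₁ (between-trans y≼z z≼w)
              k≼w : proj₁ k ≼ w
              k≼w = proj₁ (between-trans k≼b b≼w)

            abstract
              greedy : ∃ λ S → Groups Near bs bs S × (∀ {i} → i ∈ S → i ∈ bs) × (∀ {q} → q ∈ bs → count (λ i → near? i q) S ≤ 2)
              greedy = GreedyCover.greedyCover Near near? near-refl bs convex

            S : List Block
            S = proj₁ greedy

            S⊆ : ∀ {i} → i ∈ S → i ∈ bs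
            S⊆ = proj₁ (proj₂ (proj₂ greedy))

            twice : ∀ {q} → q ∈ bs → count (λ i → near? i q) S ≤ 2
            twice = proj₂ (proj₂ (proj₂ greedy))

            μ : Block → ℕ
            μ i = pred (near-count (level i) i)

            suc-μ : ∀ {i} → i ∈ bs → suc (μ i) ≡ near-count (level i) i
            suc-μ {i} i∈ = suc-pred (near-count (level i) i) {{>-nonZero (near-count≥1 (level i) i∈)}}

            total : ∑ S (suc ∘ μ) ≤ 2 * p
            total = begin
              ∑ S (suc ∘ μ)                           ≡⟨ ∑-cong S (suc-μ ∘ S⊆) ⟩
              ∑ S (λ i → near-count (level i) i)      ≡⟨ ∑-swap S bs (λ i q → ⟨ near? i q ⟩) ⟩
              ∑ bs (λ q → count (λ i → near? i q) S)  ≤⟨ ∑-≤ bs 2 twice ⟩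
              p * 2                                   ≡⟨ *-comm p 2 ⟩
              2 * p                                   ∎
              where open ≤-Reasoning

            InBall : Block → A → Set
            InBall i z = ρ (proj₁ i) z ≤ 2 * r (level i)

            inBall? : ∀ i z → Dec (InBall i z)
            inBall? i z = ρ (proj₁ i) z ≤? 2 * r (level i)

            -- Intervals of the same level ℓ whose balls meet lie within r (ℓ + 1)
            -- of each other, where the choice of ℓ limits the number of starts.

            crowd : ∀ z ℓ {i} → i ∈ ballsAt inBall? level S z ℓ →
                    ∑ (ballsAt inBall? level S z ℓ) (suc ∘ μ) ≤ 4 * (suc (μ i) * suc (μ i))
            crowd z ℓ {i} i∈J = begin
              ∑ js (suc ∘ μ)                                                 ≡⟨ ∑-cong js (λ j∈ → suc-μ (S⊆ (proj₁ (in-J j∈)))) ⟩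
              ∑ js (λ j → ∑ bs (λ q → ⟨ near? j q ⟩))                        ≤⟨ ∑-mono js (λ j∈ → ∑-mono bs λ {q} _ → restrict j∈ q) ⟩
              ∑ js (λ j → ∑ bs (λ q → ⟨ wide? q ⟩ * ⟨ near? j q ⟩))          ≡⟨ ∑-swap js bs (λ j q → ⟨ wide? q ⟩ * ⟨ near? j q ⟩) ⟩
              ∑ bs (λ q → ∑ js (λ j → ⟨ wide? q ⟩ * ⟨ near? j q ⟩))          ≡⟨ ∑-cong bs (λ {q} _ → ∑-*ˡ js ⟨ wide? q ⟩ (λ j → ⟨ near? j q ⟩)) ⟩
              ∑ bs (λ q → ⟨ wide? q ⟩ * count (λ j → near? j q) js)          ≤⟨ ∑-mono bs (λ {q} q∈ → *-monoʳ-≤ ⟨ wide? q ⟩ (few q∈)) ⟩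
              ∑ bs (λ q → ⟨ wide? q ⟩ * 2)                                  ≡⟨ ∑-cong bs (λ {q} _ → *-comm ⟨ wide? q ⟩ 2) ⟩
              ∑ bs (λ q → 2 * ⟨ wide? q ⟩)                                  ≡⟨ ∑-*ˡ bs 2 (λ q → ⟨ wide? q ⟩) ⟩
              2 * near-count (suc ℓ) i                                      ≡⟨ cong (λ l → 2 * near-count (suc l) i) (proj₁ (proj₂ (in-J i∈J))) ⟨
              2 * near-count (suc (level i)) i                              ≤⟨ *-monoʳ-≤ 2 (level-grows i∈) ⟩
              2 * (2 * (near-count (level i) i * near-count (level i) i))   ≡⟨ *-assoc 2 2 (near-count (level i) i * near-count (level i) i) ⟨
              4 * (near-count (level i) i * near-count (level i) i)         ≡⟨ cong₂ (λ a b → 4 * (a * b)) (suc-μ i∈) (suc-μ i∈) ⟨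
              4 * (suc (μ i) * suc (μ i))                                   ∎
              where
              open ≤-Reasoning
              js : List Block
              js = ballsAt inBall? level S z ℓ
              P? : ∀ j → Dec (level j ≡ ℓ × InBall j z)
              P? j = (level j ≟ ℓ) ×-dec inBall? j z
              in-J : ∀ {j} → j ∈ js → j ∈ S × level j ≡ ℓ × InBall j z
              in-J = ∈-filter⁻ P? {xs = S}
              i∈ : i ∈ bs
              i∈ = S⊆ (proj₁ (in-J i∈J))
              wide? : ∀ q → Dec (ρ (proj₁ i) (proj₁ q) ≤ r (suc ℓ))
              wide? q = ρ (proj₁ i) (proj₁ q) ≤? r (suc ℓ)
              few : ∀ {q} → q ∈ bs → count (λ j → near? j q) js ≤ 2
              few {q} q∈ = ≤-trans (≤-reflexive (∑-filter P? S (λ j → ⟨ near? j q ⟩)))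
                (≤-trans (∑-mono S λ {j} _ → ≤-trans (*-monoʳ-≤ ⟨ near? j q ⟩ (⟨⟩≤1 (P? j))) (≤-reflexive (*-identityʳ _))) (twice q∈))
              restrict : ∀ {j} → j ∈ js → ∀ q → ⟨ near? j q ⟩ ≤ ⟨ wide? q ⟩ * ⟨ near? j q ⟩
              restrict {j} j∈ q with near? j q
              ... | no _   = z≤n
              ... | yes jq = ≤-reflexive (sym (trans (*-identityʳ _) (⟨⟩-yes (wide? q) (begin
                ρ (proj₁ i) (proj₁ q)                                       ≤⟨ ρ-tri (proj₁ i) (proj₁ j) (proj₁ q) ⟩
                ρ (proj₁ i) (proj₁ j) + ρ (proj₁ j) (proj₁ q)               ≤⟨ +-mono-≤ (ρ-tri (proj₁ i) z (proj₁ j)) jq ⟩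
                ρ (proj₁ i) z + ρ z (proj₁ j) + r (level j)                 ≡⟨ cong (λ n → ρ (proj₁ i) z + n + r (level j)) (ρ-sym z (proj₁ j)) ⟩
                ρ (proj₁ i) z + ρ (proj₁ j) z + r (level j)                 ≤⟨ +-monoˡ-≤ (r (level j)) (+-mono-≤ (proj₂ (proj₂ (in-J i∈J))) (proj₂ (proj₂ (in-J j∈)))) ⟩
                2 * r (level i) + 2 * r (level j) + r (level j)             ≡⟨ cong₂ (λ a b → 2 * r a + 2 * r b + r b) (proj₁ (proj₂ (in-J i∈J))) (proj₁ (proj₂ (in-J j∈))) ⟩
                2 * r ℓ + 2 * r ℓ + r ℓ                                     ≡⟨ five (r ℓ) ⟩
                5 * r ℓ                                                     ≤⟨ r-step ℓ ⟩
                r (suc ℓ)                                                   ∎))))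
                where
                five : ∀ a → 2 * a + 2 * a + a ≡ 5 * a
                five = solve-∀

            m≤p : ∀ {i} → i ∈ S → suc (μ i) ≤ p
            m≤p {i} i∈ = ≤-trans (≤-reflexive (suc-μ (S⊆ i∈))) (count≤length (near? i) bs)

            inSomeBall? : ∀ z → Dec (Any (λ i → InBall i z) S)
            inSomeBall? z = Any.any? (λ i → inBall? i z) S

            W≤U : count inSomeBall? vs ≤ U (x ∷ xs)
            W≤U = count-mono inSomeBall? (reached? (x ∷ xs)) vs λ {z} _ c → widen (find c)
              where
              widen : ∀ {z} → (∃ λ i → i ∈ S × InBall i z) → Any (λ x → ρ x z ≤ 2 * r L) (x ∷ xs)
              widen (i , i∈ , iz) = lose (proj₁ (s⊆ (S⊆ i∈))) (≤-trans iz (*-monoʳ-≤ 2 (r-mono (level i) L (level≤ i))))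

            thin-reach : Thin (x ∷ xs) → uncovered cs (x ∷ xs) ≤ D → Reach E (4 * D) (d x w) x w
            thin-reach thin unc = reach-mono id (begin
                g + ∑ S cost                              ≤⟨ +-monoˡ-≤ (∑ S cost) g≤ ⟩
                uncovered cs (x ∷ xs) + 3 * p + ∑ S cost  ≡⟨ +-assoc (uncovered cs (x ∷ xs)) (3 * p) _ ⟩
                uncovered cs (x ∷ xs) + (3 * p + ∑ S cost)
                  ≤⟨ +-mono-≤ unc (hop-budget D (U (x ∷ xs)) (Q (x ∷ xs)) (suc L) (4 * X) p (∑ S cost) (s≤s z≤n) (≤-trans (≤-reflexive (cong (U (x ∷ xs) * Q (x ∷ xs) *_) (sym Z-def))) thin) p≤U p≤Q empty bound) ⟩
                D + 3 * D                                 ≡⟨⟩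
                4 * D                                     ∎) ≤-refl
                (traverse (proj₁ (proj₂ greedy)) id sep tr)
              where
              open ≤-Reasoning
              empty : p ≡ 0 → ∑ S cost ≡ 0
              empty p≡0 = none S S⊆
                where
                none : ∀ S → (∀ {i} → i ∈ S → i ∈ bs) → ∑ S cost ≡ 0
                none []      sub = refl
                none (i ∷ S) sub = contradiction (≤-trans (∈-length (sub (here refl))) (≤-reflexive p≡0)) λ ()
              bound : 1 ≤ p → ∀ θ → θ * ∑ S cost ≤ 2 * (θ * θ) * p + 8 * 144 * suc L * U (x ∷ xs)
              bound 1≤p θ = ≤-trans (WeightedBalls.ball-cost S vs InBall inBall? μ cost level L p 144 p (λ {i} _ → level≤ i) m≤p total (cost-square ∘ S⊆) crowd θ 1≤p) (+-monoʳ-≤ (2 * (θ * θ) * p) (*-monoʳ-≤ (8 * 144 * suc L) W≤U))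

        module Approximation (H : List (A × A)) (squeeze : ∀ {j} → j ≤ lg → Squeezes (2 ^ j) H)
                             (scale⊆ : ∀ {e} → e ∈ scaleEdges → e ∈ H) where

          E : A → A → Set
          E = Base ∪ₗ H

          chain-hop : ∀ {c} → c ∈ cs → ∀ {x y} → x ∈ members c → y ∈ members c → d (source c) x ≤ d (source c) y →
                      Reach E 2 (d x y) x y
          chain-hop c∈ x∈ y∈ x≤y = reach-mono (∪ₗ-mono {E = Base} (scale⊆ ∘ ∈-++⁺ˡ)) ≤-refl ≤-refl (ChainProperties.chain-hop (proj₂ cover-data) c∈ x∈ y∈ x≤y)

          edge⁺ : ∀ {x y} → (x , y) ∈ proj₁ gathered⁺ → E x y
          edge⁺ e = inj₂ (scale⊆ (∈-++⁺ʳ chainEdges (∈-++⁺ˡ e)))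

          edge⁻ : ∀ {x y} → (x , y) ∈ proj₁ gathered⁻ → E y x
          edge⁻ e = inj₂ (scale⊆ (∈-++⁺ʳ chainEdges (∈-++⁺ʳ (proj₁ gathered⁺) (∈-map⁺ swap e))))

          module Pair (u w : A) (u∈ : u ∈ vs) (w∈ : w ∈ vs) (R≤ : R ≤ d u w) (<2R : d u w < 2 * R) where

            P : List A
            P = path u w

            geo : Geodesic Base w u P
            geo = proj₁ (canonical u∈ w∈ (<-≤-trans <2R 2R≤∞))

            xs : List A
            xs = proj₁ (geodesic-head geo)

            P≡ : P ≡ u ∷ xs
            P≡ = proj₁ (proj₂ (geodesic-head geo))

            last≡ : lastOf u xs ≡ w
            last≡ = proj₂ (proj₂ (geodesic-head geo))

            sorted : AllPairs _≺[ u ]_ P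
            sorted = geodesic-sorted geo

            linked : Linked Base P
            linked = geodesic-linked geo

            toEnd : ∀ {x} → x ∈ P → Between u x w
            toEnd = geodesic-between geo

            segment : IsSegment u P
            segment = record { linked = linked ; sorted = sorted ; inside = path⊆ (∈-cartesianProduct⁺ u∈ w∈) <2R
                             ; near = λ x∈ → ≤-<-trans (≤-trans (m≤m+n _ _) (≤-reflexive (toEnd x∈))) <2R }

            uncovered< : uncovered cs P < D
            uncovered< = covers (∈-cartesianProduct⁺ u∈ w∈) <2R

            stretch : ∀ ps x xs′ qs → P ≡ ps ++ (x ∷ xs′) ++ qs → Thin (x ∷ xs′) →
                      Reach E (4 * D) (d x (lastOf x xs′)) x (lastOf x xs′)
            stretch ps x xs′ qs eq thin = Core.Bounded.thin-reach E inj₁ squeeze chain-hop u x xs′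
              (segment-++ˡ (x ∷ xs′) (segment-++ʳ ps (subst (IsSegment u) eq segment))) thin (begin
                uncovered cs (x ∷ xs′)                                     ≤⟨ m≤m+n _ (uncovered cs qs) ⟩
                uncovered cs (x ∷ xs′) + uncovered cs qs                   ≤⟨ m≤n+m _ (uncovered cs ps) ⟩
                uncovered cs ps + (uncovered cs (x ∷ xs′) + uncovered cs qs) ≡⟨ cong (uncovered cs ps +_) (∑-++ (x ∷ xs′) qs _) ⟨
                uncovered cs ps + uncovered cs ((x ∷ xs′) ++ qs)           ≡⟨ ∑-++ ps ((x ∷ xs′) ++ qs) _ ⟨
                uncovered cs (ps ++ (x ∷ xs′) ++ qs)                       ≡⟨ cong (uncovered cs) eq ⟨
                uncovered cs P                                             ≤⟨ <⇒≤ uncovered< ⟩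
                D                                                          ∎)
              where open ≤-Reasoning

            fromStart : ∀ as x qs → P ≡ as ++ x ∷ qs → Thin (as ++ x ∷ []) → Reach E (4 * D) (d u x) u x
            fromStart []       x qs eq thin with ∷-injectiveˡ (trans (sym P≡) eq)
            ... | refl = stop
            fromStart (a ∷ as) x qs eq thin with ∷-injectiveˡ (trans (sym P≡) eq)
            ... | refl = subst (λ y → Reach E (4 * D) (d u y) u y) (lastOf-++ u as x [])
              (stretch [] u (as ++ x ∷ []) qs (trans eq (cong (u ∷_) (sym (++-assoc as (x ∷ []) qs)))) thin)

            untilEnd : ∀ as x bs → P ≡ as ++ x ∷ bs → Thin (x ∷ bs) → Reach E (4 * D) (d x w) x w
            untilEnd as x bs eq thin =
              subst (λ y → Reach E (4 * D) (d x y) x y) (trans (lastOf-suffix u xs as x bs (trans (sym P≡) eq)) last≡)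
                (stretch as x bs [] (trans eq (cong (as ++_) (sym (++-identityʳ (x ∷ bs))))) thin)

            toFront : ∀ ps y qs → P ≡ ps ++ y ∷ qs → (∀ as bs → ps ≡ as ++ bs → Thin as) →
                      ∀ {x} → x ∈ ps ++ y ∷ [] → Reach E (suc (4 * D)) (d u x) u x
            toFront ps y qs eq thin {x} x∈ with ∈-++⁻ ps x∈
            ... | inj₁ x∈ps with ∈-∃++ x∈ps
            ...   | as , bs , refl = reach-mono id (n≤1+n _) ≤-refl
              (fromStart as x (bs ++ y ∷ qs) (trans eq (++-assoc as (x ∷ bs) (y ∷ qs))) (thin (as ++ x ∷ []) bs (sym (++-assoc as (x ∷ []) bs))))
            toFront [] y qs eq thin x∈ | inj₂ (here refl) with ∷-injectiveˡ (trans (sym P≡) eq)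
            ... | refl = stop
            toFront (p ∷ ps) y qs eq thin x∈ | inj₂ (here refl) with ∷-injectiveˡ (trans (sym P≡) eq)
            ... | refl = reach-mono id (≤-reflexive (+-comm (4 * D) 1)) ≤-refl
              (reach-⊕ (proj₁ (AllPairs-++ˣ (u ∷ ps) (subst (AllPairs _≺[ u ]_) eq sorted) (lastOf-∈ u ps) (here refl)))
                (stretch [] u ps (y ∷ qs) eq (thin (u ∷ ps) [] (sym (++-identityʳ (u ∷ ps)))))
                (edge (inj₁ (linked-last u ps (subst (Linked Base) eq linked)))))

            fromBack : ∀ ps z qs → P ≡ ps ++ z ∷ qs → (∀ as bs → qs ≡ as ++ bs → Thin bs) →
                       ∀ {x} → x ∈ z ∷ qs → Reach E (suc (4 * D)) (d x w) x w
            fromBack ps z qs eq thin (there x∈) with ∈-∃++ x∈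
            ... | as , bs , refl = reach-mono id (n≤1+n _) ≤-refl
              (untilEnd (ps ++ z ∷ as) _ bs (trans eq (sym (++-assoc ps (z ∷ as) _))) (thin as _ refl))
            fromBack ps z []       eq thin (here refl) with trans (lastOf-suffix u xs ps z [] (trans (sym P≡) eq)) last≡
            ... | refl = stop
            fromBack ps z (q ∷ qs) eq thin (here refl) =
              reach-⊕ (proj₂ (between-trans (proj₁ z≺q) (toEnd q∈)))
                (edge (inj₁ (linked-last z [] (Linked-++ʳ ps (subst (Linked Base) eq linked)))))
                (untilEnd (ps ++ z ∷ []) q qs (trans eq (sym (++-assoc ps (z ∷ []) (q ∷ qs)))) (thin [] (q ∷ qs) refl))
              where
              z≺q : z ≺[ u ] q
              z≺q = All.lookup (AllPairs.head (AllPairs-++ʳ ps (subst (AllPairs _≺[ u ]_) eq sorted))) (here refl)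
              q∈ : q ∈ P
              q∈ = subst (q ∈_) (sym eq) (∈-++⁺ʳ ps (there (here refl)))

            Approx : Set
            Approx = ∃ λ v → Reach E (14 * D) v u w × k * v ≤ suc k * d u w

            exact : ∀ {n} → n ≤ 14 * D → Reach E n (d u w) u w → Approx
            exact n≤ reach = d u w , reach-mono id n≤ ≤-refl reach , *-monoˡ-≤ (d u w) (n≤1+n k)

            rX≤ : r L * X ≤ 5 ^ L * R
            rX≤ = m/n*n≤m (5 ^ L * R) X

            4r≤R : 4 * r L ≤ R
            4r≤R = *-cancelʳ-≤ _ _ (5 ^ L) {{m^n≢0 5 L}} (begin
              4 * r L * 5 ^ L                ≤⟨ m≤m*n (4 * r L * 5 ^ L) k ⟩
              4 * r L * 5 ^ L * k            ≡⟨ regroup (r L) (5 ^ L) k ⟩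
              r L * (4 * k * 5 ^ L)          ≡⟨ cong (r L *_) X-def ⟨
              r L * X                        ≤⟨ rX≤ ⟩
              5 ^ L * R                      ≡⟨ *-comm (5 ^ L) R ⟩
              R * 5 ^ L                      ∎)
              where
              open ≤-Reasoning
              regroup : ∀ r f k → 4 * r * f * k ≡ r * (4 * k * f)
              regroup = solve-∀

            hub-near : ∀ {g g′ t v} → g + g′ ≤ radius → v ≤ g′ + t → t ≤ d u w → v ≤ 3 * R
            hub-near {g} {g′} {t} {v} gg v≤ t≤ = begin
              v                   ≤⟨ v≤ ⟩
              g′ + t              ≤⟨ +-mono-≤ (≤-trans (m≤n+m g′ g) (≤-trans gg (≤-trans (*-monoˡ-≤ (r L) {2} {4} (s≤s (s≤s z≤n))) 4r≤R))) (≤-trans t≤ (<⇒≤ <2R)) ⟩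
              R + 2 * R           ≡⟨⟩
              3 * R               ∎
              where open ≤-Reasoning

            hops≤ : suc (4 * D) + (1 + (1 + (2 + suc (4 * D)))) ≤ 14 * D
            hops≤ = begin
              suc (4 * D) + (1 + (1 + (2 + suc (4 * D))))  ≡⟨ regroup D ⟩
              8 * D + 6 * 1                                ≤⟨ +-monoʳ-≤ (8 * D) (*-monoʳ-≤ 6 1≤D) ⟩
              8 * D + 6 * D                                ≡⟨ *-distribʳ-+ D 8 6 ⟨
              14 * D                                       ∎
              where
              open ≤-Reasoning
              regroup : ∀ d → suc (4 * d) + (1 + (1 + (2 + suc (4 * d)))) ≡ 8 * d + 6 * 1
              regroup = solve-∀

            class-of : ∀ f q → D * D < U f * q * Z → ∃ λ a → a < lg × 2 ^ a ≤ U f × U f < 2 ^ suc a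
            class-of f q h = power-below (U f) lg (n≢0⇒n>0 λ U≡0 → <⇒≱ h (≤-trans (≤-reflexive (cong (λ n → n * q * Z) U≡0)) z≤n))
              (≤-<-trans (count≤length (reached? f) vs) N<)

            module Ends (ps : List A) (y : A) (ms : List A) (z : A) (qs : List A) (eq : P ≡ ps ++ y ∷ ms ++ z ∷ qs)
                        (thin : ∀ as bs → ps ≡ as ++ bs → Thin as) (thin′ : ∀ as bs → qs ≡ as ++ bs → Thin bs) where

              eq′ : P ≡ (ps ++ y ∷ ms) ++ z ∷ qs
              eq′ = trans eq (sym (++-assoc ps (y ∷ ms) (z ∷ qs)))

              front back : List A
              front = ps ++ y ∷ []
              back  = z ∷ qs

              front⇒ : ∀ {x} → x ∈ front → Reach E (suc (4 * D)) (d u x) u x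
              front⇒ = toFront ps y (ms ++ z ∷ qs) eq thin

              back⇒ : ∀ {x} → x ∈ back → Reach E (suc (4 * D)) (d x w) x w
              back⇒ = fromBack (ps ++ y ∷ ms) z qs eq′ thin′

              back∈ : ∀ {b} → b ∈ back → b ∈ P
              back∈ b∈ = subst (_ ∈_) (sym eq′) (∈-++⁺ʳ (ps ++ y ∷ ms) b∈)

              through : ∀ {x b} → x ∈ front → b ∈ back → d u x + d b w + d x b ≡ d u w
              through {x} {b} x∈ b∈ = begin-equality
                d u x + d b w + d x b      ≡⟨ swap₃ (d u x) (d b w) (d x b) ⟩
                d u x + d x b + d b w      ≡⟨ cong (_+ d b w) uxb ⟩
                d u b + d b w              ≡⟨ toEnd (back∈ b∈) ⟩
                d u w                      ∎
                where
                open ≤-Reasoning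
                swap₃ : ∀ a b c → a + b + c ≡ a + c + b
                swap₃ = solve-∀
                in-front : ∀ {x} → x ∈ front → x ∈ ps ++ y ∷ ms
                in-front x∈ = front⊆ ps y ms refl x∈
                uxb : Between u x b
                uxb = proj₁ (AllPairs-++ˣ (ps ++ y ∷ ms) (subst (AllPairs _≺[ u ]_) eq′ sorted) (in-front x∈) b∈)

              forwardVia : Jump d q⁺ (proj₁ gathered⁺) (proj₁ gathered⁺) front (targets back) → Approx
              forwardVia j = _ , reach-mono id hops≤ ≤-refl
                  (reach-++ (front⇒ x∈) (reach-++ (edge (edge⁺ link)) (reach-++ (edge (edge⁺ entry))
                    (reach-++ (chain-hop c∈ y∈ b∈c y≤b) (back⇒ b∈))))) ,
                  detour-cost k (5 ^ L) X R (r L) (d u w) _ (d u x + d b w) (d x b) (d x v) (d v x) (d v y′ + d y′ b) (d v b)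
                    1≤k (m^n>0 5 L) X-def rX≤ R≤ (through x∈ b∈) close v≤
                    (short (hub-near {d x v} {d v x} {d x b} close v≤ (≤-trans (m≤n+m (d x b) (d u x + d b w)) (≤-reflexive (through x∈ b∈)))))
                    (regroup (d u x) (d x v) (d v y′) (d y′ b) (d b w))
                where
                open Jump j renaming (y to y′)
                b∈ : b ∈ back
                b∈ = proj₁ (targets-∈ back bc∈)
                c∈ : c ∈ cs
                c∈ = proj₁ (proj₂ (targets-∈ back bc∈))
                b∈c : b ∈ members c
                b∈c = proj₂ (proj₂ (targets-∈ back bc∈))
                v≤ : d v b ≤ d v x + d x b
                v≤ = tri v x b
                regroup : ∀ a b c e f → a + (b + (c + (e + f))) ≡ a + f + b + (c + e)
                regroup = solve-∀

              forward : D * D < U front * Q back * Z → (front , back) ∈ allInstances instances⁺ → Approx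
              forward h i∈ = let a , a< , cl = class-of front (Q back) h in forwardVia (proj₂ (proj₂ gathered⁺) a< i∈ cl)

              backwardVia : Jump (flip d) q⁻ (proj₁ gathered⁻) (proj₁ gathered⁻) back (targets front) → Approx
              backwardVia j = _ , reach-mono id (≤-trans (≤-reflexive (shuffle (4 * D))) hops≤) ≤-refl
                  (reach-++ (front⇒ b∈) (reach-++ (chain-hop c∈ b∈c y∈ (q⁻-order c∈ y∈ b∈c y≤b)) (reach-++ (edge (edge⁻ entry))
                    (reach-++ (edge (edge⁻ link)) (back⇒ x∈))))) ,
                  detour-cost k (5 ^ L) X R (r L) (d u w) _ (d u b + d x w) (d b x) (d v x) (d x v) (d y′ v + d b y′) (d b v)
                    1≤k (m^n>0 5 L) X-def rX≤ R≤ (through b∈ x∈) close′ v≤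
                    (short (hub-near {d v x} {d x v} {d b x} close′ v≤ (≤-trans (m≤n+m (d b x) (d u b + d x w)) (≤-reflexive (through b∈ x∈)))))
                    (regroup (d u b) (d b y′) (d y′ v) (d v x) (d x w))
                where
                open Jump j renaming (y to y′)
                b∈ : b ∈ front
                b∈ = proj₁ (targets-∈ front bc∈)
                c∈ : c ∈ cs
                c∈ = proj₁ (proj₂ (targets-∈ front bc∈))
                b∈c : b ∈ members c
                b∈c = proj₂ (proj₂ (targets-∈ front bc∈))
                close′ : d v x + d x v ≤ radius
                close′ = ≤-trans (≤-reflexive (+-comm (d v x) (d x v))) close
                v≤ : d b v ≤ d x v + d b x
                v≤ = ≤-trans (tri b x v) (≤-reflexive (+-comm (d b x) (d x v)))
                shuffle : ∀ e → suc e + (2 + (1 + (1 + suc e))) ≡ suc e + (1 + (1 + (2 + suc e)))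
                shuffle = solve-∀
                regroup : ∀ a b c e f → a + (b + (c + (e + f))) ≡ a + f + e + (c + b)
                regroup = solve-∀

              backward : D * D < U back * Q front * Z → (back , front) ∈ allInstances instances⁻ → Approx
              backward h i∈ = let a , a< , cl = class-of back (Q front) h in backwardVia (proj₂ (proj₂ gathered⁻) a< i∈ cl)

            resolve : (o : Outcome P) → (∀ {i} → i ∈ fromOutcome⁺ o → i ∈ allInstances instances⁺) → (∀ {i} → i ∈ fromOutcome⁻ o → i ∈ allInstances instances⁻) → Approx
            resolve (allThin h) _ _ = exact (*-monoˡ-≤ D (m≤m+n 4 10))
              (subst (λ y → Reach E (4 * D) (d u y) u y) last≡
                (stretch [] u xs [] (trans P≡ (cong (u ∷_) (sym (++-identityʳ xs)))) (h (u ∷ xs) [] (trans P≡ (cong (u ∷_) (sym (++-identityʳ xs)))))))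
            resolve (halfway ps y [] eq h h′) _ _ = exact (≤-trans (+-monoˡ-≤ (4 * D) 1≤D) (*-monoˡ-≤ D (m≤m+n 5 9)))
              (subst (λ y → Reach E (suc (4 * D)) (d u y) u y) (trans (lastOf-suffix u xs ps y [] (trans (sym P≡) eq)) last≡)
                (toFront ps y [] eq h (∈-++⁺ʳ ps (here refl))))
            resolve (halfway ps y (q ∷ qs) eq h h′) _ _ = exact enough
                (reach-⊕ (toEnd y∈) (toFront ps y (q ∷ qs) eq h (∈-++⁺ʳ ps (here refl))) (fromBack ps y (q ∷ qs) eq h′ (here refl)))
              where
              y∈ : y ∈ P
              y∈ = subst (y ∈_) (sym eq) (∈-++⁺ʳ ps (here refl))
              enough : suc (4 * D) + suc (4 * D) ≤ 14 * D
              enough = ≤-trans (+-monoʳ-≤ (suc (4 * D)) (m≤n+m _ 4)) hops≤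
            resolve (twoEnds ps y ms z qs eq h h′ fat fat′) in⁺ in⁻
              with crossed-products (D * D) (U (ps ++ y ∷ [])) (Q (ps ++ y ∷ [])) (U (z ∷ qs)) (Q (z ∷ qs)) Z (≰⇒> fat) (≰⇒> fat′)
            ... | inj₁ lt = Ends.forward ps y ms z qs eq h h′ lt (in⁺ (keep-∋ (ps ++ y ∷ []) (z ∷ qs) (heavy? (ps ++ y ∷ []) (z ∷ qs)) lt))
            ... | inj₂ lt = Ends.backward ps y ms z qs eq h h′ lt (in⁻ (keep-∋ (z ∷ qs) (ps ++ y ∷ []) (heavy? (z ∷ qs) (ps ++ y ∷ [])) lt))

            approx : Approx
            approx = resolve (outcome P)
              (λ i∈ → ∈-concat-map instances⁺ (∈-cartesianProduct⁺ u∈ w∈) (ifNear-∋ (d u w <? 2 * R) <2R i∈))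
              (λ i∈ → ∈-concat-map instances⁻ (∈-cartesianProduct⁺ u∈ w∈) (ifNear-∋ (d u w <? 2 * R) <2R i∈))

        summary : 1 ≤ lg → 2 ^ L ≤ suc lg →
                  ∃₂ λ Es t → t * (2 * (D * D * D)) ≤ C₁ * (lg ^ 7 * (k * k) * (N * N)) × length Es ≤ lg * N + (lg * (N + t) + lg * (N + t)) ×
                  (∀ {H} → (∀ {j} → j ≤ lg → Squeezes (2 ^ j) H) → (∀ {e} → e ∈ Es → e ∈ H) →
                   ∀ {u w} → u ∈ vs → w ∈ vs → R ≤ d u w → d u w < 2 * R → ∃ λ v → Reach (Base ∪ₗ H) (14 * D) v u w × k * v ≤ suc k * d u w)
        summary 1≤lg 2^L≤ = scaleEdges , τ , budget , scaleEdges-length ,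
            λ {H} squeeze scale⊆ {u} {w} u∈ w∈ lo hi → Approximation.Pair.approx H squeeze scale⊆ u w u∈ w∈ lo hi
          where
          open ≤-Reasoning
          regroup : ∀ t d → t * (2 * d) ≡ 2 * (t * d)
          regroup = solve-∀
          budget : τ * (2 * (D * D * D)) ≤ C₁ * (lg ^ 7 * (k * k) * (N * N))
          budget = begin
            τ * (2 * (D * D * D))                ≡⟨ regroup τ (D * D * D) ⟩
            2 * (τ * (D * D * D))                ≤⟨ *-monoʳ-≤ 2 (m/n*n≤m _ (D * D * D) {{m*n≢0 (D * D) D {{m*n≢0 D D}}}}) ⟩
            2 * (8 * Z * (N * N) * suc (16 * X) * (2 * lg * (2 * lg)))
              ≤⟨ scale-budget L lg k N X Z 1≤lg 2^L≤ (>-nonZero⁻¹ X) X-def Z-def ⟩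
            C₁ * (lg ^ 7 * (k * k) * (N * N))    ∎

      module AllScales (m : ℕ) (∞≡ : ∞ ≡ 2 ^ m) (1≤lg : 1 ≤ lg) (lg≤m : lg ≤ m) (k D : ℕ) (1≤k : 1 ≤ k) (1≤D : 1 ≤ D) where

        Approximates : ℕ → List (A × A) → A → A → Set
        Approximates b H u w = ∃ λ v → Reach (Base ∪ₗ H) b v u w × k * v ≤ suc k * d u w

        ScaleProperty : List (A × A) → ℕ → List (A × A) → Set
        ScaleProperty H₀ e H = ∀ {u w} → u ∈ vs → w ∈ vs → 2 ^ e ≤ d u w → d u w < 2 ^ suc e → Approximates (14 * D) (H₀ ++ H) u w

        scaleProperty-mono : ∀ {H₀ e H H′} → (∀ {x} → x ∈ H → x ∈ H′) → ScaleProperty H₀ e H → ScaleProperty H₀ e H′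
        scaleProperty-mono {H₀} {H = H} {H′} sub p u∈ w∈ lo hi = let v , reach , le = p u∈ w∈ lo hi in
          v , reach-mono (∪ₗ-mono {E = Base} inject) ≤-refl ≤-refl reach , le
          where
          inject : ∀ {x} → x ∈ H₀ ++ H → x ∈ H₀ ++ H′
          inject x∈ with ∈-++⁻ H₀ x∈
          ... | inj₁ l = ∈-++⁺ˡ l
          ... | inj₂ r = ∈-++⁺ʳ H₀ (sub r)

        abstract
          level-data : ∃ λ L → L < suc lg × 2 ^ L ≤ suc lg × suc lg < 2 ^ suc L
          level-data = power-below (suc lg) (suc lg) (s≤s z≤n) (n<2^n (suc lg))

          squeeze-data : ∃ λ H → length H ≤ suc lg * (4 * N * lg) × (∀ {j} → j ≤ lg → Squeezes (2 ^ j) H)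
          squeeze-data = squeezeAll

        L : ℕ
        L = proj₁ level-data

        H₀ : List (A × A)
        H₀ = proj₁ squeeze-data

        instance
          D³≢0 : NonZero (D * D * D)
          D³≢0 = let instance _ = >-nonZero 1≤D ; _ = m*n≢0 D D in m*n≢0 (D * D) D

        G : ℕ
        G = lg ^ 7 * (k * k) * (N * N)

        -- 2 τ D³ ≤ C₁ G for the budget τ of every scale.

        τ̂ : ℕ
        τ̂ = C₁ * G / (2 * (D * D * D))
          where instance _ = m*n≢0 2 (D * D * D)

        build-at : ∀ e → e < m → ∃ λ H → length H ≤ lg * N + (lg * (N + τ̂) + lg * (N + τ̂)) × ScaleProperty H₀ e H
        build-at e e<m =
          let Es , t , budget , Es≤ , approx = ScaleHopset.summary (record
                { L = L ; k = k ; D = D ; R = 2 ^ e ; big = proj₂ (proj₂ (proj₂ level-data)) ; 1≤k = 1≤k ; 1≤D = 1≤D ; 1≤R = m^n>0 2 e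
                ; 2R≤∞ = subst (2 ^ suc e ≤_) (sym ∞≡) (^-monoʳ-≤ 2 e<m) }) 1≤lg (proj₁ (proj₂ (proj₂ level-data)))
              grow = *-monoʳ-≤ lg (+-monoʳ-≤ N (m*n≤o⇒m≤o/n t (2 * (D * D * D)) (C₁ * G) {{m*n≢0 2 (D * D * D)}} budget))
          in Es , ≤-trans Es≤ (+-monoʳ-≤ (lg * N) (+-mono-≤ grow grow)) ,
             approx (λ {j} j≤ → squeezes-mono {2 ^ j} ∈-++⁺ˡ (proj₂ (proj₂ squeeze-data) j≤)) (∈-++⁺ʳ H₀)

        build : ∀ e → ∃ λ H → length H ≤ lg * N + (lg * (N + τ̂) + lg * (N + τ̂)) × (e < m → ScaleProperty H₀ e H)
        build e with e <? m
        ... | yes e<m = let H , len , p = build-at e e<m in H , len , λ _ → p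
        ... | no e≮m  = [] , z≤n , λ e<m → contradiction e<m e≮m

        zero-distance : ∀ {z x xs} → Geodesic Base z x xs → d x z ≡ 0 → x ≡ z
        zero-distance done _ = refl
        zero-distance ((_ , 1≤ , btw) ◃ _) eq = contradiction (≤-trans 1≤ (≤-trans (m≤m+n _ _) (≤-reflexive (trans btw eq)))) λ ()

        Good : List (A × A) → Set
        Good H = length H * (D * D * D) ≤ C₁ * (m * (lg * N * (D * D * D) + lg * G)) ×
                 (∀ {u w} → u ∈ vs → w ∈ vs → d u w < ∞ → Approximates (14 * D) H u w)

        hopset : ∃ Good
        hopset =
          let H , len , p = gather (λ e H → e < m → ScaleProperty H₀ e H) (λ {e} sub q e<m → scaleProperty-mono {H₀} {e} sub (q e<m))
                              (lg * N + (lg * (N + τ̂) + lg * (N + τ̂))) build m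
          in H₀ ++ H ,
             total-budget (D * D * D) lg m N (length (H₀ ++ H)) τ̂ G 1≤lg lg≤m
               (≤-trans (≤-reflexive (length-++ H₀)) (+-mono-≤ (proj₁ (proj₂ squeeze-data)) len)) 2τ̂≤ ,
             λ {u} {w} u∈ w∈ lt → by-scale u∈ w∈ lt (λ {e} e<m → p e<m e<m)
          where
          2τ̂≤ : 2 * τ̂ * (D * D * D) ≤ C₁ * G
          2τ̂≤ = ≤-trans (≤-reflexive (regroup τ̂ (D * D * D))) (m/n*n≤m (C₁ * G) (2 * (D * D * D)))
            where
            instance _ = m*n≢0 2 (D * D * D)
            regroup : ∀ t d → 2 * t * d ≡ t * (2 * d)
            regroup = solve-∀
          by-scale : ∀ {H u w} → u ∈ vs → w ∈ vs → d u w < ∞ → (∀ {e} → e < m → ScaleProperty H₀ e H) → Approximates (14 * D) (H₀ ++ H) u w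
          by-scale {u = u} {w} u∈ w∈ lt p with d u w ≟ 0
          ... | yes z with zero-distance (proj₁ (canonical u∈ w∈ lt)) z
          ...   | refl = 0 , stop , ≤-trans (≤-reflexive (*-zeroʳ k)) z≤n
          by-scale {u = u} {w} u∈ w∈ lt p | no nz with power-below (d u w) m (n≢0⇒n>0 nz) (subst (d u w <_) ∞≡ lt)
          ... | e , e<m , lo , hi = p e<m u∈ w∈ lo hi

      module Subsample (g : ℕ) (1≤g : 1 ≤ g) where

        ahead : A × A → List A
        ahead (y , z) = take g (drop 1 (path y z))

        Long : A × A → Set
        Long (y , z) = d y z < ∞ × suc g ≤ length (path y z)

        long? : ∀ e → Dec (Long e)
        long? (y , z) = (d y z <? ∞) ×-dec (suc g ≤? length (path y z))

        private
          module Hit = HittingSet (λ e v → v ∈ ahead e) (λ e v → v ∈? ahead e) vs g 1≤g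

        family : List (A × A)
        family = filter long? pairs

        rich : Hit.Rich family
        rich {y , z} e∈ with ∈-filter⁻ long? {xs = pairs} e∈
        ... | e∈pairs , fin , long with ∈-cartesianProduct⁻ vs vs e∈pairs
        ...   | y∈ , z∈ with canonical y∈ z∈ fin
        ...     | geo , sub with geodesic-head geo
        ...       | xs , eq , _ = ≤-trans (≤-reflexive (sym len)) (unique-count (_∈? ahead (y , z)) ahead! λ v∈ → sub (inside v∈) , v∈)
          where
          ahead≡ : ahead (y , z) ≡ take g xs
          ahead≡ = cong (take g ∘ drop 1) eq
          len : length (ahead (y , z)) ≡ g
          len = trans (cong length ahead≡) (trans (length-take g xs) (m≤n⇒m⊓n≡m (s≤s⁻¹ (≤-trans long (≤-reflexive (cong length eq))))))
          ahead! : Unique (ahead (y , z))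
          ahead! = AllPairs.take⁺ g (AllPairs.drop⁺ 1 (sorted-unique {Base = Base} {z = z} (geodesic-sorted geo)))
          inside : ∀ {v} → v ∈ ahead (y , z) → v ∈ path y z
          inside {v} v∈ = subst (v ∈_) (sym eq) (there (subst (v ∈_) (take++drop≡id g xs) (∈-++⁺ˡ (subst (v ∈_) ahead≡ v∈))))

        family< : length family < 2 ^ (2 * lg)
        family< = begin-strict
          length family         ≤⟨ length-filter long? pairs ⟩
          length pairs          ≡⟨ length-× vs vs ⟩
          N * N                 <⟨ *-mono-< N< N< ⟩
          2 ^ lg * 2 ^ lg       ≡⟨ ^-distribˡ-+-* 2 lg lg ⟨
          2 ^ (lg + lg)         ≡⟨ cong (λ i → 2 ^ (lg + i)) (+-identityʳ lg) ⟨
          2 ^ (2 * lg)          ∎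
          where open ≤-Reasoning

        abstract
          hit-data : ∃ λ hs → All (_∈ vs) hs × length hs * g ≤ 2 * N * (2 * lg) × Hit.Covers hs family
          hit-data = Hit.hittingSet (2 * lg) family rich family<

          sample : List A
          sample = deduplicate _≟ᴬ_ (proj₁ hit-data)

          sample-unique : Unique sample
          sample-unique = DecUnique.deduplicate-! _≟ᴬ_ (proj₁ hit-data)

          sample⊆ : ∀ {v} → v ∈ sample → v ∈ vs
          sample⊆ v∈ = All.lookup (proj₁ (proj₂ hit-data)) (∈-deduplicate⁻ _≟ᴬ_ (proj₁ hit-data) v∈)

          sample-size : length sample * g ≤ 4 * (N * lg)
          sample-size = ≤-trans (*-monoˡ-≤ g (unique-length sample-unique (∈-deduplicate⁻ _≟ᴬ_ (proj₁ hit-data))))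
                          (≤-trans (proj₁ (proj₂ (proj₂ hit-data))) (≤-reflexive (regroup N lg)))
            where
            regroup : ∀ n l → 2 * n * (2 * l) ≡ 4 * (n * l)
            regroup = solve-∀

          sample-hits : ∀ {e} → e ∈ family → ∃ λ v → v ∈ sample × v ∈ ahead e
          sample-hits e∈ = let v , v∈ , h = find (proj₂ (proj₂ (proj₂ hit-data)) e∈) in v , ∈-deduplicate⁺ _≟ᴬ_ v∈ , h

        sample≤N : length sample ≤ N
        sample≤N = unique-length sample-unique sample⊆

        -- The sampled network: a base step is an exact stretch of at most g steps.

        Base₁ : A → A → Set
        Base₁ x y = Reach Base g (d x y) x y

        advance : ∀ {x z} → x ∈ vs → z ∈ vs → d x z < ∞ →
                  Base₁ x z ⊎ ∃ λ v → v ∈ sample × Between x v z × 1 ≤ d x v × Base₁ x v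
        advance {x} {z} x∈ z∈ fin with canonical x∈ z∈ fin
        ... | geo , _ with geodesic-head geo
        ...   | xs , eq , last≡ with suc g ≤? length (path x z)
        ...     | no short = inj₁ (reach-mono id (s≤s⁻¹ (≤-trans (≤-reflexive (sym (cong length eq))) (<⇒≤ (≰⇒> short)))) ≤-refl
                    (subst (λ z → Reach Base (length xs) (d x z) x z) last≡
                      (walk x xs (subst (Linked Base) eq (geodesic-linked geo)) (subst (AllPairs _≺[ x ]_) eq (geodesic-sorted geo)))))
        ...     | yes long with sample-hits (∈-filter⁺ long? (∈-cartesianProduct⁺ x∈ z∈) (fin , long))
        ...       | v , v∈ , v∈ahead with ∈-∃++ (subst (v ∈_) (cong (take g ∘ drop 1) eq) v∈ahead)
        ...         | as , bs , split = inj₂ (v , v∈ , geodesic-between geo (subst (v ∈_) (sym path≡) (there (∈-++⁺ʳ as (here refl)))) ,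
                    ≤-trans (s≤s z≤n) (proj₂ x≺v) ,
                    reach-mono id hops ≤-refl (walkTo (x ∷ as) whole (subst (Linked Base) eq (geodesic-linked geo)) (subst (AllPairs _≺[ x ]_) eq (geodesic-sorted geo))))
          where
          xs≡ : xs ≡ as ++ v ∷ (bs ++ drop g xs)
          xs≡ = trans (sym (take++drop≡id g xs)) (trans (cong (_++ drop g xs) split) (++-assoc as (v ∷ bs) (drop g xs)))
          whole : x ∷ xs ≡ (x ∷ as) ++ v ∷ (bs ++ drop g xs)
          whole = cong (x ∷_) xs≡
          path≡ : path x z ≡ (x ∷ as) ++ v ∷ (bs ++ drop g xs)
          path≡ = trans eq whole
          x≺v : x ≺[ x ] v
          x≺v = All.lookup (AllPairs.head (subst (AllPairs _≺[ x ]_) path≡ (geodesic-sorted geo))) (∈-++⁺ʳ as (here refl))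
          hops : suc (length as) ≤ g
          hops = ≤-trans (suc≤ as split) (≤-trans (≤-reflexive (length-take g xs)) (m⊓n≤m g (length xs)))
            where
            suc≤ : ∀ as {l} → l ≡ as ++ v ∷ bs → suc (length as) ≤ length l
            suc≤ as refl = ≤-trans (≤-trans (s≤s (m≤m+n (length as) (length bs))) (≤-reflexive (sym (+-suc _ _)))) (≤-reflexive (sym (length-++ as)))

        closer : ∀ {x v z fuel} → Between x v z → 1 ≤ d x v → d x z ≤ suc fuel → d v z ≤ fuel
        closer {x} {v} {z} btw 1≤ le = s≤s⁻¹ (≤-trans (+-monoˡ-≤ (d v z) 1≤) (≤-trans (≤-reflexive btw) le))

        stays-finite : ∀ {x v z} → Between x v z → d x z < ∞ → d v z < ∞
        stays-finite {x} {v} {z} btw fin = ≤-<-trans (≤-trans (m≤n+m (d v z) (d x v)) (≤-reflexive btw)) fin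

        route : ∀ fuel {x z} → d x z ≤ fuel → x ∈ sample → z ∈ sample → d x z < ∞ →
                ∃ λ xs → Geodesic Base₁ z x xs × (∀ {y} → y ∈ xs → y ∈ sample)
        route fuel {x} {z} le x∈ z∈ fin with x ≟ᴬ z
        ... | yes refl = x ∷ [] , done , λ { (here refl) → x∈ }
        ... | no x≢z with d x z ≟ 0
        ...   | yes zero-d = contradiction (coincide (proj₁ (canonical (sample⊆ x∈) (sample⊆ z∈) fin)) zero-d) x≢z
          where
          coincide : ∀ {x xs} → Geodesic Base z x xs → d x z ≡ 0 → x ≡ z
          coincide done _ = refl
          coincide ((_ , 1≤ , btw) ◃ _) eq = contradiction (≤-trans 1≤ (≤-trans (m≤m+n _ _) (≤-reflexive (trans btw eq)))) λ ()
        ...   | no positive with advance (sample⊆ x∈) (sample⊆ z∈) fin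
        ...     | inj₁ direct = x ∷ z ∷ [] , ((direct , n≢0⇒n>0 positive , trans (cong (d x z +_) (d-refl z)) (+-identityʳ _)) ◃ done) ,
                  λ { (here refl) → x∈ ; (there (here refl)) → z∈ }
        route zero       le x∈ z∈ fin | no x≢z | no positive | inj₂ _ = contradiction (n≤0⇒n≡0 le) positive
        route (suc fuel) {x} le x∈ z∈ fin | no x≢z | no positive | inj₂ (v , v∈ , btw , 1≤ , reach) =
          let xs , geo , sub = route fuel (closer btw 1≤ le) v∈ z∈ (stays-finite btw fin)
          in x ∷ xs , ((reach , 1≤ , btw) ◃ geo) , λ { (here refl) → x∈ ; (there m) → sub m }

        path₁ : A → A → List A
        path₁ x z with x ∈? sample | z ∈? sample | d x z <? ∞
        ... | yes x∈ | yes z∈ | yes fin = proj₁ (route (d x z) ≤-refl x∈ z∈ fin)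
        ... | _      | _      | _       = []

        canonical₁ : Canonical sample Base₁ ∞ path₁
        canonical₁ {x} {z} x∈ z∈ fin with x ∈? sample | z ∈? sample | d x z <? ∞
        ... | yes x∈′ | yes z∈′ | yes fin′ = proj₂ (route (d x z) ≤-refl x∈′ z∈′ fin′)
        ... | no ¬x   | _       | _        = contradiction x∈ ¬x
        ... | yes _   | no ¬z   | _        = contradiction z∈ ¬z
        ... | yes _   | yes _   | no ¬fin  = contradiction fin ¬fin

        landing : ∀ fuel {x w} → d x w ≤ fuel → x ∈ sample → w ∈ vs → d x w < ∞ →
                  ∃ λ v → v ∈ sample × Between x v w × Base₁ v w
        landing fuel {x} {w} le x∈ w∈ fin with advance (sample⊆ x∈) w∈ fin
        ... | inj₁ direct = x , x∈ , cong (_+ d x w) (d-refl x) , direct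
        landing zero {x} {w} le x∈ w∈ fin | inj₂ (v , v∈ , btw , 1≤ , _) =
          contradiction (≤-trans 1≤ (≤-trans (m≤m+n (d x v) (d v w)) (≤-trans (≤-reflexive btw) le))) λ ()
        landing (suc fuel) {x} {w} le x∈ w∈ fin | inj₂ (v , v∈ , btw , 1≤ , _) =
          let v′ , v′∈ , btw′ , reach = landing fuel (closer btw 1≤ le) v∈ w∈ (stays-finite btw fin)
          in v′ , v′∈ , proj₂ (between-splice btw btw′) , reach

        expand : ∀ {H n v u w} → Reach (Base₁ ∪ₗ H) n v u w → Reach (Base ∪ₗ H) (n * g) v u w
        expand stop                = stop
        expand (step (inj₁ r) rs h) = reach-mono id ≤-refl h (reach-++ (reach-mono inj₁ ≤-refl ≤-refl r) (expand rs))
        expand (step (inj₂ e) rs h) = reach-mono id (+-monoˡ-≤ _ 1≤g) h (reach-++ (edge (inj₂ e)) (expand rs))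

        Approximates : (A → A → Set) → ℕ → ℕ → A → A → Set
        Approximates E k n u w = ∃ λ v → Reach E n v u w × k * v ≤ suc k * d u w

        lift : ∀ {H k n} → (∀ {u w} → u ∈ sample → w ∈ sample → d u w < ∞ → Approximates (Base₁ ∪ₗ H) k n u w) →
               ∀ {u w} → u ∈ vs → w ∈ vs → d u w < ∞ → Approximates (Base ∪ₗ H) k (g + (n * g + g)) u w
        lift {H} {k} {n} approx {u} {w} u∈ w∈ fin with advance u∈ w∈ fin
        ... | inj₁ direct = d u w , reach-mono inj₁ (m≤m+n g _) ≤-refl direct , *-monoˡ-≤ (d u w) (n≤1+n k)
        ... | inj₂ (v , v∈ , uvw , _ , uv) with landing (d v w) ≤-refl v∈ w∈ (stays-finite uvw fin)
        ...   | v′ , v′∈ , vv′w , v′w with approx v∈ v′∈ (≤-<-trans (≤-trans (m≤m+n _ _) (≤-reflexive vv′w)) (stays-finite uvw fin))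
        ...     | t , reach , t≤ = d u v + (t + d v′ w) ,
            reach-++ (reach-mono inj₁ ≤-refl ≤-refl uv) (reach-++ (expand reach) (reach-mono inj₁ ≤-refl ≤-refl v′w)) , (begin
              k * (d u v + (t + d v′ w))                              ≡⟨ spread k (d u v) t (d v′ w) ⟩
              k * d u v + (k * t + k * d v′ w)                        ≤⟨ +-mono-≤ (*-monoˡ-≤ (d u v) (n≤1+n k)) (+-mono-≤ t≤ (*-monoˡ-≤ (d v′ w) (n≤1+n k))) ⟩
              suc k * d u v + (suc k * d v v′ + suc k * d v′ w)       ≡⟨ spread (suc k) (d u v) (d v v′) (d v′ w) ⟨
              suc k * (d u v + (d v v′ + d v′ w))                     ≡⟨ cong (λ x → suc k * (d u v + x)) vv′w ⟩
              suc k * (d u v + d v w)                                 ≡⟨ cong (suc k *_) uvw ⟩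
              suc k * d u w                                           ∎)
          where
          open ≤-Reasoning
          spread : ∀ k a b c → k * (a + (b + c)) ≡ k * a + (k * b + k * c)
          spread = solve-∀

        subgraph : Graph
        subgraph = record { vs = sample ; Base = Base₁ ; ∞ = ∞ ; path = path₁ ; canonical = canonical₁ ; lg = lg ; N< = ≤-<-trans sample≤N N< }

    module Regimes (graph : Graph) (m : ℕ) (∞≡ : Graph.∞ graph ≡ 2 ^ m) (2≤lg : 2 ≤ Graph.lg graph) (lg≤m : Graph.lg graph ≤ m)
                   (1≤N : 1 ≤ length (Graph.vs graph)) (k B : ℕ) (1≤k : 1 ≤ k) (14≤B : 14 ≤ B) (C₂ : ℕ) (C₂≡ : C₂ ≡ 32 * 32 * 32 * C₁) where

      open Graph graph

      private
        N : ℕ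
        N = length vs

      p x Θ : ℕ
      p = lg ^ 5
      x = B * B * B
      Θ = m * m * lg ^ 7 * (k * k)

      1≤lg : 1 ≤ lg
      1≤lg = ≤-trans (s≤s z≤n) 2≤lg

      1≤B : 1 ≤ B
      1≤B = ≤-trans (s≤s z≤n) 14≤B

      1≤x : 1 ≤ x
      1≤x = *-mono-≤ (*-mono-≤ 1≤B 1≤B) 1≤B

      1≤p : 1 ≤ p
      1≤p = ≤-trans (≤-reflexive (sym (^-zeroˡ 5))) (^-monoˡ-≤ 5 1≤lg)

      32≤p : 32 ≤ p
      32≤p = ^-monoˡ-≤ 5 2≤lg

      Good : List (A × A) → Set
      Good H = (∀ {u w} → u ∈ vs → w ∈ vs → d u w < ∞ → ∃ λ v → Reach (Base ∪ₗ H) B v u w × k * v ≤ suc k * d u w) ×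
               (x ≤ 8 * N → length H * x ≤ 9 * C₂ * (Θ * (N * N))) ×
               (N ≤ 8 * x → length H * length H * x ≤ 1600 * (C₂ * C₂) * (Θ * Θ * (N * N * N)))

      1≤m : 1 ≤ m
      1≤m = ≤-trans 1≤lg lg≤m

      1≤κ : 1 ≤ k * k
      1≤κ = *-mono-≤ 1≤k 1≤k

      no-shortcuts : N ≤ B → Good []
      no-shortcuts N≤B = (λ {u} {w} u∈ w∈ fin → d u w , plain u∈ w∈ fin , *-monoˡ-≤ (d u w) (n≤1+n k)) , (λ _ → z≤n) , (λ _ → z≤n)
        where
        plain : ∀ {u w} → u ∈ vs → w ∈ vs → d u w < ∞ → Reach (Base ∪ₗ []) B (d u w) u w
        plain {u} {w} u∈ w∈ fin =
          let geo , sub = canonical u∈ w∈ fin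
              xs , eq , last≡ = geodesic-head geo
          in reach-mono inj₁ (≤-trans (n≤1+n _) (≤-trans (≤-reflexive (sym (cong length eq))) (≤-trans (short geo sub) N≤B))) ≤-refl
               (subst (λ z → Reach Base (length xs) (d u z) u z) last≡
                 (walk u xs (subst (Linked Base) eq (geodesic-linked geo)) (subst (AllPairs _≺[ u ]_) eq (geodesic-sorted geo))))
          where
          short : Geodesic Base w u (path u w) → (∀ {z} → z ∈ path u w → z ∈ vs) → length (path u w) ≤ N
          short geo sub = unique-length (sorted-unique {Base = Base} {z = w} (geodesic-sorted geo)) sub

      unsampled : x ≤ N * (p * p) → ∃ Good
      unsampled x≤ = H , (λ u∈ w∈ fin → let v , reach , le = proj₂ (proj₂ data′) u∈ w∈ fin in v , reach-mono id 14D≤B ≤-refl reach , le) ,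
          Counting.Dense.small-β m lg p (k * k) N x (length H) 1≤m 1≤lg lg≤m 1≤p 1≤κ 1≤x C₂ base ,
          λ N≤ → ≤-trans (Counting.Dense.large-β m lg p (k * k) N x (length H) 1≤m 1≤lg lg≤m 1≤p 1≤κ 1≤x C₂ base N≤ x≤) (*-monoˡ-≤ (Θ * Θ * (N * N * N)) (*-monoˡ-≤ (C₂ * C₂) (≤ᵇ⇒≤ 18 1600 tt)))
        where
        D : ℕ
        D = B / 14
        1≤D : 1 ≤ D
        1≤D = m≥n⇒m/n>0 14≤B
        14D≤B : 14 * D ≤ B
        14D≤B = ≤-trans (≤-reflexive (*-comm 14 D)) (m/n*n≤m B 14)
        data′ : ∃ (Network.AllScales.Good graph m ∞≡ 1≤lg lg≤m k D 1≤k 1≤D)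
        data′ = Network.AllScales.hopset graph m ∞≡ 1≤lg lg≤m k D 1≤k 1≤D
        H : List (A × A)
        H = proj₁ data′
        open ≤-Reasoning
        G : ℕ
        G = lg ^ 7 * (k * k) * (N * N)
        B≤ : B ≤ 32 * D
        B≤ = begin
          B                        ≤⟨ <⇒≤ (m<[1+m/n]*n B 14) ⟩
          14 + D * 14              ≤⟨ +-monoˡ-≤ (D * 14) (*-monoʳ-≤ 14 1≤D) ⟩
          14 * D + D * 14          ≡⟨ regroup D ⟩
          28 * D                   ≤⟨ *-monoˡ-≤ D (m≤m+n 28 4) ⟩
          32 * D                   ∎
          where
          regroup : ∀ d → 14 * d + d * 14 ≡ 28 * d
          regroup = solve-∀
        base : length H * x ≤ C₂ * (m * (lg * N * x + lg * G))
        base = subst (λ t → length H * x ≤ C₂ * (m * (lg * N * x + t))) (*-identityʳ (lg * G))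
          (rescale 32 (length H) 1 D B m (lg * N) (lg * G) C₂ C₁ C₂≡ (≤-trans B≤ (≤-reflexive (cong (32 *_) (sym (*-identityˡ D)))))
            (≤-trans (≤-reflexive (*-identityˡ D)) (≤-trans (m≤n*m D 14) 14D≤B)) (proj₁ (proj₂ data′)))

      sampled : ∀ g → 1 ≤ g → B ≤ N → g * g * (N * (p * p)) ≤ x → x ≤ 4 * (g * g) * (N * (p * p)) → ∃ Good
      sampled g 1≤g B≤N lower upper = H ,
          (λ u∈ w∈ fin → let v , reach , le = Network.Subsample.lift graph g 1≤g {H} {k} {14 * D} (proj₂ (proj₂ data′)) u∈ w∈ fin in v , reach-mono id hops ≤-refl reach , le) ,
          (λ x≤8N → contradiction (≤-trans lower x≤8N) (<⇒≱ 8N<)) ,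
          λ _ → Counting.Sampled.large-β m lg p (k * k) N x (length H) 1≤m 1≤lg lg≤m 1≤p 1≤κ 1≤x C₂ g N′ refl 1≤N base (Network.Subsample.sample-size graph g 1≤g) lower upper
        where
        subgraph : Graph
        subgraph = Network.Subsample.subgraph graph g 1≤g
        open ≤-Reasoning
        instance
          _ = >-nonZero 1≤g
          16g≢0 : NonZero (16 * g)
          16g≢0 = m*n≢0 16 g
          N≢0 : NonZero N
          N≢0 = >-nonZero 1≤N
        N′ D : ℕ
        N′ = length (Graph.vs subgraph)
        D = B / (16 * g)
        16g≤B : 16 * g ≤ B
        16g≤B = squares-cancel-≤ (16 * g) B (*-cancelʳ-≤ _ _ N (begin
          16 * g * (16 * g) * N          ≤⟨ *-monoˡ-≤ N (*-mono-≤ 16g≤ 16g≤) ⟩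
          g * p * (g * p) * N            ≡⟨ regroup g p N ⟩
          g * g * (N * (p * p))          ≤⟨ lower ⟩
          B * B * B                      ≤⟨ *-monoʳ-≤ (B * B) B≤N ⟩
          B * B * N                      ∎))
          where
          regroup : ∀ g p n → g * p * (g * p) * n ≡ g * g * (n * (p * p))
          regroup = solve-∀
          16g≤ : 16 * g ≤ g * p
          16g≤ = ≤-trans (≤-reflexive (*-comm 16 g)) (*-monoʳ-≤ g (≤-trans (m≤m+n 16 16) 32≤p))
        1≤D : 1 ≤ D
        1≤D = m≥n⇒m/n>0 16g≤B
        D16g≤B : D * (16 * g) ≤ B
        D16g≤B = m/n*n≤m B (16 * g)
        hops : g + (14 * D * g + g) ≤ B
        hops = begin
          g + (14 * D * g + g)           ≡⟨ regroup g D ⟩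
          14 * D * g + 2 * (1 * g)       ≤⟨ +-monoʳ-≤ (14 * D * g) (*-monoʳ-≤ 2 (*-monoˡ-≤ g 1≤D)) ⟩
          14 * D * g + 2 * (D * g)       ≡⟨ regroup′ g D ⟩
          D * (16 * g)                   ≤⟨ D16g≤B ⟩
          B                              ∎
          where
          regroup : ∀ g d → g + (14 * d * g + g) ≡ 14 * d * g + 2 * (1 * g)
          regroup = solve-∀
          regroup′ : ∀ g d → 14 * d * g + 2 * (d * g) ≡ d * (16 * g)
          regroup′ = solve-∀
        8N< : 8 * N < g * g * (N * (p * p))
        8N< = begin-strict
          8 * N                          ≡⟨ *-comm 8 N ⟩
          N * 8                          <⟨ *-monoʳ-< N (m<m+n 8 {24} (s≤s z≤n)) ⟩
          N * 32                         ≤⟨ *-monoʳ-≤ N (≤-trans 32≤p (m≤m*n p p {{>-nonZero 1≤p}})) ⟩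
          N * (p * p)                    ≤⟨ m≤n*m (N * (p * p)) (g * g) {{m*n≢0 g g}} ⟩
          g * g * (N * (p * p))          ∎
        data′ : ∃ (Network.AllScales.Good subgraph m ∞≡ 1≤lg lg≤m k D 1≤k 1≤D)
        data′ = Network.AllScales.hopset subgraph m ∞≡ 1≤lg lg≤m k D 1≤k 1≤D
        H : List (A × A)
        H = proj₁ data′
        B≤ : B ≤ 32 * (g * D)
        B≤ = begin
          B                              ≤⟨ <⇒≤ (m<[1+m/n]*n B (16 * g)) ⟩
          16 * g + D * (16 * g)          ≤⟨ +-monoˡ-≤ (D * (16 * g)) (m≤n*m (16 * g) D {{>-nonZero 1≤D}}) ⟩
          D * (16 * g) + D * (16 * g)    ≡⟨ regroup g D ⟩
          32 * (g * D)                   ∎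
          where
          regroup : ∀ g d → d * (16 * g) + d * (16 * g) ≡ 32 * (g * d)
          regroup = solve-∀
        gD≤B : g * D ≤ B
        gD≤B = ≤-trans (≤-trans (m≤n*m (g * D) 16) (≤-reflexive (regroup g D))) D16g≤B
          where
          regroup : ∀ g d → 16 * (g * d) ≡ d * (16 * g)
          regroup = solve-∀
        base : length H * x ≤ C₂ * (m * (lg * N′ * x + lg * (lg ^ 7 * (k * k) * (N′ * N′)) * (g * g * g)))
        base = rescale 32 (length H) g D B m (lg * N′) (lg * (lg ^ 7 * (k * k) * (N′ * N′))) C₂ C₁ C₂≡ B≤ gD≤B (proj₁ (proj₂ data′))

      hopset : ∃ Good
      hopset = from (N ≤? B)
        where
        from : Dec (N ≤ B) → ∃ Good
        from (yes N≤B) = [] , no-shortcuts N≤B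
        from (no N≰B)  = [ unsampled , (λ { (g , 1≤g , lower , upper) → sampled g 1≤g (<⇒≤ (≰⇒> N≰B)) lower upper }) ]′
          (square-scale x (N * (p * p)) {{m*n≢0 N (p * p) {{>-nonZero 1≤N}} {{m*n≢0 p p {{>-nonZero 1≤p}} {{>-nonZero 1≤p}}}}}})

open import Defs
open import Data.Nat.Base as ℕ using (ℕ; zero; suc; NonZero)
import Data.Nat.Properties as ℕ
open import Data.Nat.Properties using (m*n≢0)
open import Data.Nat.Tactic.RingSolver using (solve-∀)
open import Data.Rational.Base as ℚ using (ℚ; 0ℚ; 1ℚ; Positive; NonNegative; positive; nonNegative)
import Data.Rational.Properties as ℚ
open import Data.Rational.Solver using (module +-*-Solver)
open import Data.Fin.Base using (Fin)
open import Data.Fin.Properties using () renaming (_≟_ to _≟ᶠ_)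
open import Data.List.Base using (List; []; _∷_; length; mapMaybe; allFin; cartesianProduct; filter)
open import Data.List.Properties using (length-tabulate)
open import Data.List.Membership.Propositional using (_∈_)
open import Data.List.Membership.Propositional.Properties using (∈-allFin; ∈-filter⁻; ∈-cartesianProduct⁺)
open import Data.List.Relation.Unary.Any as Any using ()
import Data.List.Relation.Unary.Unique.Propositional.Properties as Unique
open import Data.Maybe.Base using (Maybe; just; nothing)
import Data.Product.Properties as Product
open import Data.Product.Base using (∃; ∃₂; _×_; _,_; proj₁; proj₂; uncurry)
open import Data.Sum.Base using (_⊎_; inj₁; inj₂)
open import Function.Base using (_∘_; id)
open import Relation.Binary.Construct.Closure.ReflexiveTransitive as Star using (Star; _◅_)
open import Relation.Binary.PropositionalEquality
open import Relation.Nullary using (¬_; Dec; yes; no; contradiction)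
open import Relation.Nullary.Decidable using (_×-dec_)
open ℝ≥0
open Combinatorics using (module FiniteSums; module QuasiMetric; _∪ₗ_; power-below; C₁; module GraphDistance; Space; module Hopsets)
open FiniteSums using (unique-length)

-- Natural numbers inside the rationals

ι : ℕ → ℚ
ι j = j /⁺ 0

ι-+ : ∀ a b → ι (a ℕ.+ b) ≡ ι a ℚ.+ ι b
ι-+ zero    b = sym (ℚ.+-identityˡ (ι b))
ι-+ (suc a) b = begin
  ι (suc (a ℕ.+ b))           ≡⟨ suc-/⁺ (a ℕ.+ b) ⟩
  ι (a ℕ.+ b) ℚ.+ 1ℚ          ≡⟨ cong (ℚ._+ 1ℚ) (ι-+ a b) ⟩
  ι a ℚ.+ ι b ℚ.+ 1ℚ          ≡⟨ solve 3 (λ x y o → x :+ y :+ o := x :+ o :+ y) refl (ι a) (ι b) 1ℚ ⟩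
  ι a ℚ.+ 1ℚ ℚ.+ ι b          ≡⟨ cong (ℚ._+ ι b) (suc-/⁺ a) ⟨
  ι (suc a) ℚ.+ ι b           ∎
  where
  open ≡-Reasoning
  open +-*-Solver

ι-* : ∀ a b → ι (a ℕ.* b) ≡ ι a ℚ.* ι b
ι-* zero    b = sym (ℚ.*-zeroˡ (ι b))
ι-* (suc a) b = begin
  ι (b ℕ.+ a ℕ.* b)           ≡⟨ ι-+ b (a ℕ.* b) ⟩
  ι b ℚ.+ ι (a ℕ.* b)         ≡⟨ cong (ι b ℚ.+_) (ι-* a b) ⟩
  ι b ℚ.+ ι a ℚ.* ι b         ≡⟨ cong (ℚ._+ ι a ℚ.* ι b) (ℚ.*-identityˡ (ι b)) ⟨
  1ℚ ℚ.* ι b ℚ.+ ι a ℚ.* ι b  ≡⟨ ℚ.*-distribʳ-+ (ι b) 1ℚ (ι a) ⟨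
  (1ℚ ℚ.+ ι a) ℚ.* ι b        ≡⟨ cong (ℚ._* ι b) (trans (ℚ.+-comm 1ℚ (ι a)) (sym (suc-/⁺ a))) ⟩
  ι (suc a) ℚ.* ι b           ∎
  where open ≡-Reasoning

ι-^ : ∀ a k → ι (a ℕ.^ k) ≡ ι a ^ℚ k
ι-^ a zero    = refl
ι-^ a (suc k) = trans (ι-* a (a ℕ.^ k)) (cong (ι a ℚ.*_) (ι-^ a k))

ι-mono : ∀ {a b} → a ℕ.≤ b → ι a ℚ.≤ ι b
ι-mono {a} {b} h = /⁺-mono {a} {0} {b} {0} (ℕ.*-monoˡ-≤ 1 h)

0≤ι : ∀ a → 0ℚ ℚ.≤ ι a
0≤ι a = /⁺-nonNeg a 0

ι<ιsuc : ∀ a → ι a ℚ.< ι (suc a)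
ι<ιsuc a = ℚ.≤-<-trans (ℚ.≤-reflexive (sym (ℚ.+-identityʳ (ι a))))
  (ℚ.<-≤-trans (ℚ.+-monoʳ-< (ι a) (ℚ.positive⁻¹ 1ℚ)) (ℚ.≤-reflexive (sym (suc-/⁺ a))))

ι-cancel-≤ : ∀ a b → ι a ℚ.≤ ι b → a ℕ.≤ b
ι-cancel-≤ a b h = ℕ.≮⇒≥ λ b<a → <⇒≱ (ι<ιsuc b) (ℚ.≤-trans (ι-mono b<a) h)

ι-pos : ∀ {a} → 1 ℕ.≤ a → Positive (ι a)
ι-pos {suc a} _ = positive (ℚ.≤-<-trans (0≤ι a) (ι<ιsuc a))

*-monoʳ-ι : ∀ a {p q} → p ℚ.≤ q → ι a ℚ.* p ℚ.≤ ι a ℚ.* q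
*-monoʳ-ι a = ℚ.*-monoˡ-≤-nonNeg (ι a) {{nonNegative (0≤ι a)}}

-- Order on the reals

≤-trans : ∀ {x y z} → x ≤ y → y ≤ z → x ≤ z
≤-trans {x} {y} {z} x≤y y≤z {q} {r} l u = ℚ.≮⇒≥ λ r<q → impossible r<q
  where
  impossible : ¬ r ℚ.< q
  impossible r<q with ℚ.<-dense r<q
  ... | s , r<s , s<q = separate (close y (s ℚ.- r) {{positive (gap r<s)}})
    where
    gap : ∀ {a b} → a ℚ.< b → 0ℚ ℚ.< b ℚ.- a
    gap {a} {b} h = ℚ.≤-<-trans (ℚ.≤-reflexive (sym (ℚ.+-inverseʳ a))) (ℚ.+-monoˡ-< (ℚ.- a) h)
    separate : ¬ Gap (Lower y) (Upper y) (s ℚ.- r)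
    separate (a , b , la , ub , b≤) = <⇒≱ s<q (begin
      q                  ≤⟨ x≤y l ub ⟩
      b                  ≤⟨ b≤ ⟩
      a ℚ.+ (s ℚ.- r)    ≤⟨ ℚ.+-monoˡ-≤ (s ℚ.- r) (y≤z la u) ⟩
      r ℚ.+ (s ℚ.- r)    ≡⟨ solve 2 (λ r s → r :+ (s :- r) := s) refl r s ⟩
      s                  ∎)
      where
      open ℚ.≤-Reasoning
      open +-*-Solver

fromℕ-mono : ∀ a b → a ℕ.≤ b → fromℕ a ≤ fromℕ b
fromℕ-mono a b h refl refl = ι-mono h

fromℕ-refl : ∀ a → fromℕ a ≈ fromℕ a
fromℕ-refl a = (λ { refl refl → ℚ.≤-refl }) , λ { refl refl → ℚ.≤-refl }

≈-fromℕ-+ : ∀ x y a b → x ≈ fromℕ a → y ≈ fromℕ b → x + y ≈ fromℕ (a ℕ.+ b)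
≈-fromℕ-+ _ _ a b (x≤ , ≤x) (y≤ , ≤y) =
  (λ { (_ , _ , lx , ly , refl) refl → ℚ.≤-trans (ℚ.+-mono-≤ (x≤ lx refl) (y≤ ly refl)) (ℚ.≤-reflexive (sym (ι-+ a b))) }) ,
  (λ { refl (_ , _ , ux , uy , refl) → ℚ.≤-trans (ℚ.≤-reflexive (ι-+ a b)) (ℚ.+-mono-≤ (≤x refl ux) (≤y refl uy)) })

lower-^ : ∀ x k {t} → 0ℚ ℚ.≤ t → (∀ {q} → Lower x q → q ℚ.≤ t) → ∀ {q} → Lower (x ^ k) q → q ℚ.≤ t ^ℚ k
lower-^ x zero    0≤t h refl = ℚ.≤-refl
lower-^ x (suc k) 0≤t h (_ , _ , l , l′ , refl) = *-mono-≤ (nonNeg x l) (^ℚ-nonNeg k 0≤t) (h l) (lower-^ x k 0≤t h l′)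

upper-^ : ∀ x k {t} → 0ℚ ℚ.≤ t → (∀ {r} → Upper x r → t ℚ.≤ r) → ∀ {r} → Upper (x ^ k) r → t ^ℚ k ℚ.≤ r
upper-^ x zero    0≤t h refl = ℚ.≤-refl
upper-^ x (suc k) 0≤t h (_ , _ , u , u′ , refl) = *-mono-≤ 0≤t (nonNegᵘ (x ^ k) u′) (h u) (upper-^ x k 0≤t h u′)

upper-log₂ : ∀ n .{{_ : NonZero n}} a → 2 ℕ.^ a ℕ.≤ n → ∀ {r} → Upper (log₂ n) r → ι a ℚ.≤ r
upper-log₂ n a 2^a≤n u = bounded (log₂ n) (a , 0 , ℕ.≤-trans 2^a≤n (ℕ.≤-reflexive (sym (ℕ.*-identityʳ n))) , refl) u

-- Integer parameters: k ≈ 1/ε and B = ⌊β⌋, up to constant factors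

floor : ∀ {q} → 0ℚ ℚ.≤ q → ∃ λ j → ι j ℚ.≤ q × q ℚ.< ι (suc j)
floor {q} 0≤q = let N , q≤N = archimedean q ; j , lo , hi = last (λ j → ι j ℚ.≤ q) (λ j → ι j ℚ.≤? q) 0≤q (suc N)
                                                         (<⇒≱ (ℚ.≤-<-trans q≤N (ι<ιsuc N)))
                in j , lo , ℚ.≰⇒> hi

InverseScale : ℝ≥0 → Set
InverseScale ε = ∃ λ k → 1 ℕ.≤ k × (∀ {e} → Upper ε e → 1ℚ ℚ.≤ ι k ℚ.* e) × (∀ {e} → Lower ε e → ι k ℚ.* e ℚ.≤ ι 4)

inverse-scale : ∀ ε → fromℕ 0 < ε → ε < fromℕ 1 → InverseScale ε
inverse-scale ε (_ , r , refl , lr , 0<r) (u , _ , uu , refl , u<1) = from (close ε r {{positive 0<r}})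
  where
  open ℚ.≤-Reasoning
  -- e is a lower bound of ε with ε ≤ 2 e.
  finish : ∀ e → 0ℚ ℚ.< e → Lower ε e → (∀ {e′} → Lower ε e′ → e′ ℚ.≤ e ℚ.+ e) → InverseScale ε
  finish e 0<e le twice = conclude (floor {1/e} (ℚ.<⇒≤ (ℚ.positive⁻¹ 1/e {{ℚ.1/pos⇒pos e}})))
    where
    instance
      e-pos : Positive e
      e-pos = positive 0<e
      e-nonNeg : NonNegative e
      e-nonNeg = ℚ.pos⇒nonNeg e
      e≢0 : ℚ.NonZero e
      e≢0 = ℚ.pos⇒nonZero e
    1/e : ℚ
    1/e = ℚ.1/ e
    conclude : (∃ λ j → ι j ℚ.≤ 1/e × 1/e ℚ.< ι (suc j)) → InverseScale ε
    conclude (j , lo , hi) = suc j , ℕ.s≤s ℕ.z≤n , (λ {e′} ue → begin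
        1ℚ                       ≡⟨ ℚ.*-inverseˡ e ⟨
        1/e ℚ.* e                ≤⟨ ℚ.*-monoʳ-≤-nonNeg e (ℚ.<⇒≤ hi) ⟩
        ι (suc j) ℚ.* e          ≤⟨ *-monoʳ-ι (suc j) (bounded ε le ue) ⟩
        ι (suc j) ℚ.* e′         ∎) , (λ {e′} le′ → begin
        ι (suc j) ℚ.* e′                              ≤⟨ *-monoʳ-ι (suc j) (twice le′) ⟩
        ι (suc j) ℚ.* (e ℚ.+ e)                       ≡⟨ ℚ.*-distribˡ-+ (ι (suc j)) e e ⟩
        ι (suc j) ℚ.* e ℚ.+ ι (suc j) ℚ.* e           ≤⟨ ℚ.+-mono-≤ ke≤2 ke≤2 ⟩
        ι 2 ℚ.+ ι 2                                   ≡⟨⟩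
        ι 4                                           ∎)
      where
      ke≤2 : ι (suc j) ℚ.* e ℚ.≤ ι 2
      ke≤2 = begin
        ι (suc j) ℚ.* e             ≡⟨ cong (ℚ._* e) (suc-/⁺ j) ⟩
        (ι j ℚ.+ 1ℚ) ℚ.* e          ≡⟨ ℚ.*-distribʳ-+ e (ι j) 1ℚ ⟩
        ι j ℚ.* e ℚ.+ 1ℚ ℚ.* e      ≤⟨ ℚ.+-mono-≤ (ℚ.*-monoʳ-≤-nonNeg e lo) (ℚ.≤-trans (ℚ.≤-reflexive (ℚ.*-identityˡ e)) (ℚ.<⇒≤ (ℚ.≤-<-trans (bounded ε le uu) u<1))) ⟩
        1/e ℚ.* e ℚ.+ ι 1           ≡⟨ cong (ℚ._+ ι 1) (ℚ.*-inverseˡ e) ⟩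
        1ℚ ℚ.+ ι 1                  ≡⟨⟩
        ι 2                         ∎
  from : Gap (Lower ε) (Upper ε) r → InverseScale ε
  from (a , b , la , ub , b≤) with ℚ.≤-total a r
  ... | inj₁ a≤r = finish r 0<r lr λ l → ℚ.≤-trans (bounded ε l ub) (ℚ.≤-trans b≤ (ℚ.+-monoˡ-≤ r a≤r))
  ... | inj₂ r≤a = finish a (ℚ.<-≤-trans 0<r r≤a) la λ l → ℚ.≤-trans (bounded ε l ub) (ℚ.≤-trans b≤ (ℚ.+-monoʳ-≤ a r≤a))

IntegerPart : ℝ≥0 → Set
IntegerPart β = ∃ λ B → 14 ℕ.≤ B × fromℕ B ≤ β × (∀ {b} → Lower β b → b ℚ.≤ ι (2 ℕ.* B))

integer-part : ∀ β n .{{_ : NonZero n}} → 2 ℕ.≤ n → fromℕ 20 * log₂ n ≤ β → IntegerPart β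
integer-part β n 2≤n 20log≤β = from (close β 1ℚ)
  where
  open ℚ.≤-Reasoning
  from : Gap (Lower β) (Upper β) 1ℚ → IntegerPart β
  from (a , b , la , ub , b≤) = conclude (floor (nonNeg β la))
    where
    conclude : (∃ λ j → ι j ℚ.≤ a × a ℚ.< ι (suc j)) → IntegerPart β
    conclude (B , lo , hi) = B , ℕ.≤-trans (ℕ.m≤m+n 14 4) 18≤B , (λ { refl u → ℚ.≤-trans lo (bounded β la u) }) ,
        λ l → ℚ.≤-trans (bounded β l ub) (ℚ.≤-trans b≤B+2 (ι-mono B+2≤2B))
      where
      b≤B+2 : b ℚ.≤ ι (suc (suc B))
      b≤B+2 = begin
        b                      ≤⟨ b≤ ⟩
        a ℚ.+ 1ℚ               ≤⟨ ℚ.+-monoˡ-≤ 1ℚ (ℚ.<⇒≤ hi) ⟩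
        ι (suc B) ℚ.+ 1ℚ       ≡⟨ suc-/⁺ (suc B) ⟨
        ι (suc (suc B))        ∎
      20≤b : ι 20 ℚ.≤ b
      20≤b = 20log≤β {ι 20 ℚ.* ι 1} (ι 20 , ι 1 , refl , (1 , 0 , ℕ.≤-trans 2≤n (ℕ.≤-reflexive (sym (ℕ.*-identityʳ n))) , refl) , refl) ub
      18≤B : 18 ℕ.≤ B
      18≤B = ℕ.s≤s⁻¹ (ℕ.s≤s⁻¹ (ι-cancel-≤ 20 (suc (suc B)) (ℚ.≤-trans 20≤b b≤B+2)))
      B+2≤2B : suc (suc B) ℕ.≤ 2 ℕ.* B
      B+2≤2B = ℕ.≤-trans (ℕ.+-monoˡ-≤ B (ℕ.≤-trans (ℕ.m≤m+n 2 16) 18≤B)) (ℕ.≤-reflexive (cong (B ℕ.+_) (sym (ℕ.+-identityʳ B))))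

^ℚ-distribˡ-* : ∀ p q k → (p ℚ.* q) ^ℚ k ≡ p ^ℚ k ℚ.* q ^ℚ k
^ℚ-distribˡ-* p q zero    = refl
^ℚ-distribˡ-* p q (suc k) = trans (cong (p ℚ.* q ℚ.*_) (^ℚ-distribˡ-* p q k))
  (solve 4 (λ p q x y → p :* q :* (x :* y) := p :* x :* (q :* y)) refl p q (p ^ℚ k) (q ^ℚ k))
  where open +-*-Solver

1^ℚ : ∀ k → 1ℚ ^ℚ k ≡ 1ℚ
1^ℚ zero    = refl
1^ℚ (suc k) = trans (ℚ.*-identityˡ (1ℚ ^ℚ k)) (1^ℚ k)

module Reciprocal (k : ℕ) (1≤k : 1 ℕ.≤ k) where

  private instance
    k-pos : Positive (ι k)
    k-pos = ι-pos 1≤k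
    k≢0 : ℚ.NonZero (ι k)
    k≢0 = ℚ.pos⇒nonZero (ι k)

  κ : ℚ
  κ = ℚ.1/ ι k

  0≤κ : 0ℚ ℚ.≤ κ
  0≤κ = ℚ.<⇒≤ (ℚ.positive⁻¹ κ {{ℚ.1/pos⇒pos (ι k)}})

  k^κ^ : ∀ j → ι k ^ℚ j ℚ.* κ ^ℚ j ≡ 1ℚ
  k^κ^ j = trans (sym (^ℚ-distribˡ-* (ι k) κ j)) (trans (cong (_^ℚ j) (ℚ.*-inverseʳ (ι k))) (1^ℚ j))

  ≤κ : ∀ {e} → ι k ℚ.* e ℚ.≤ ι 4 → e ℚ.≤ ι 4 ℚ.* κ
  ≤κ {e} h = begin
    e                       ≡⟨ ℚ.*-identityˡ e ⟨
    1ℚ ℚ.* e                ≡⟨ cong (ℚ._* e) (ℚ.*-inverseˡ (ι k)) ⟨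
    κ ℚ.* ι k ℚ.* e         ≡⟨ ℚ.*-assoc κ (ι k) e ⟩
    κ ℚ.* (ι k ℚ.* e)       ≤⟨ ℚ.*-monoˡ-≤-nonNeg κ {{nonNegative 0≤κ}} h ⟩
    κ ℚ.* ι 4               ≡⟨ ℚ.*-comm κ (ι 4) ⟩
    ι 4 ℚ.* κ               ∎
    where open ℚ.≤-Reasoning

  divide : ∀ h f z y j → ι h ℚ.* (ι f ℚ.* z) ℚ.≤ y ℚ.* ι k ^ℚ j → ι h ℚ.* (ι f ℚ.* κ ^ℚ j ℚ.* z) ℚ.≤ y
  divide h f z y j le = begin
    ι h ℚ.* (ι f ℚ.* κ ^ℚ j ℚ.* z)        ≡⟨ solve 4 (λ h f c z → h :* (f :* c :* z) := h :* (f :* z) :* c) refl (ι h) (ι f) (κ ^ℚ j) z ⟩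
    ι h ℚ.* (ι f ℚ.* z) ℚ.* κ ^ℚ j        ≤⟨ ℚ.*-monoʳ-≤-nonNeg (κ ^ℚ j) {{nonNegative (^ℚ-nonNeg j 0≤κ)}} le ⟩
    y ℚ.* ι k ^ℚ j ℚ.* κ ^ℚ j             ≡⟨ ℚ.*-assoc y (ι k ^ℚ j) (κ ^ℚ j) ⟩
    y ℚ.* (ι k ^ℚ j ℚ.* κ ^ℚ j)           ≡⟨ trans (cong (y ℚ.*_) (k^κ^ j)) (ℚ.*-identityʳ y) ⟩
    y                                     ∎
    where
    open ℚ.≤-Reasoning
    open +-*-Solver

stretch : ∀ k v D ε d → 1 ℕ.≤ k → (∀ {e} → Upper ε e → 1ℚ ℚ.≤ ι k ℚ.* e) → fromℕ D ≤ d → k ℕ.* v ℕ.≤ suc k ℕ.* D →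
          fromℕ v ≤ (fromℕ 1 + ε) * d
stretch k v D ε d 1≤k 1≤kε D≤d kv≤ refl (_ , d′ , (_ , e , refl , ue , refl) , ud , refl) =
  ℚ.*-cancelˡ-≤-pos (ι k) {{ι-pos 1≤k}} (begin
    ι k ℚ.* ι v                          ≡⟨ ι-* k v ⟨
    ι (k ℕ.* v)                          ≤⟨ ι-mono kv≤ ⟩
    ι (suc k ℕ.* D)                      ≡⟨ trans (ι-* (suc k) D) (cong (ℚ._* ι D) (suc-/⁺ k)) ⟩
    (ι k ℚ.+ 1ℚ) ℚ.* ι D                 ≤⟨ *-mono-≤ (0≤+ (0≤ι k) 0≤1) (nonNegᵘ d ud) (ℚ.+-monoʳ-≤ (ι k) (1≤kε ue)) (D≤d refl ud) ⟩
    (ι k ℚ.+ ι k ℚ.* e) ℚ.* d′           ≡⟨ cong (λ x → (x ℚ.+ ι k ℚ.* e) ℚ.* d′) (ℚ.*-identityʳ (ι k)) ⟨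
    (ι k ℚ.* ι 1 ℚ.+ ι k ℚ.* e) ℚ.* d′   ≡⟨ solve 4 (λ k o e d → (k :* o :+ k :* e) :* d := k :* ((o :+ e) :* d)) refl (ι k) (ι 1) e d′ ⟩
    ι k ℚ.* ((ι 1 ℚ.+ e) ℚ.* d′)         ∎)
  where
  open ℚ.≤-Reasoning
  open +-*-Solver

cube-root-above : ∀ n B β → 2 ℕ.≤ n → fromℕ B ≤ β → β ≤ fromℕ n ^[ 1 / 3 ] → B ℕ.* B ℕ.* B ℕ.≤ 8 ℕ.* n
cube-root-above n B β 2≤n B≤β β≤ = finish (last (λ j → j ℕ.* j ℕ.* j ℕ.< n) (λ j → j ℕ.* j ℕ.* j ℕ.<? n) (ℕ.≤-trans (ℕ.s≤s ℕ.z≤n) 2≤n) n too-large)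
  where
  open ℕ.≤-Reasoning
  instance
    n≢0 : NonZero n
    n≢0 = ℕ.>-nonZero (ℕ.≤-trans (ℕ.s≤s ℕ.z≤n) 2≤n)
  too-large : ¬ n ℕ.* n ℕ.* n ℕ.< n
  too-large h = ℕ.<⇒≱ h (ℕ.m≤n*m n (n ℕ.* n) {{m*n≢0 n n}})
  finish : (∃ λ j → j ℕ.* j ℕ.* j ℕ.< n × ¬ suc j ℕ.* suc j ℕ.* suc j ℕ.< n) → B ℕ.* B ℕ.* B ℕ.≤ 8 ℕ.* n
  finish (zero , _ , above)      = contradiction 2≤n above
  finish (j@(suc _) , lo , above) = begin
    B ℕ.* B ℕ.* B                              ≤⟨ ℕ.*-mono-≤ (ℕ.*-mono-≤ B≤2j B≤2j) B≤2j ⟩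
    2 ℕ.* j ℕ.* (2 ℕ.* j) ℕ.* (2 ℕ.* j)        ≡⟨ regroup j ⟩
    8 ℕ.* (j ℕ.* j ℕ.* j)                      ≤⟨ ℕ.*-monoʳ-≤ 8 (ℕ.<⇒≤ lo) ⟩
    8 ℕ.* n                                    ∎
    where
    regroup : ∀ j → 2 ℕ.* j ℕ.* (2 ℕ.* j) ℕ.* (2 ℕ.* j) ≡ 8 ℕ.* (j ℕ.* j ℕ.* j)
    regroup = solve-∀
    cube : ∀ s → s ℕ.* s ℕ.* s ≡ (s ℕ.* (s ℕ.* (s ℕ.* 1)))
    cube = solve-∀
    n≤cube : ι n ℚ.* ι 1 ℚ.≤ ι (suc j) ^ℚ 3
    n≤cube = ℚ.≤-trans (ℚ.≤-reflexive (ℚ.*-identityʳ (ι n)))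
      (ℚ.≤-trans (ι-mono (ℕ.≤-trans (ℕ.≮⇒≥ above) (ℕ.≤-reflexive (cube (suc j))))) (ℚ.≤-reflexive (ι-^ (suc j) 3)))
    B≤suc-j : B ℕ.≤ suc j
    B≤suc-j = ι-cancel-≤ B (suc j) (≤-trans {fromℕ B} {β} {fromℕ n ^[ 1 / 3 ]} B≤β β≤ refl
      (0≤ι (suc j) , ι n ℚ.* ι 1 , (ι n , ι 1 , refl , refl , refl) , n≤cube))
    B≤2j : B ℕ.≤ 2 ℕ.* j
    B≤2j = ℕ.≤-trans B≤suc-j (ℕ.≤-trans (ℕ.+-monoˡ-≤ j (ℕ.s≤s ℕ.z≤n)) (ℕ.≤-reflexive (cong (j ℕ.+_) (sym (ℕ.+-identityʳ j)))))

cube-root-below : ∀ n B β → (∀ {b} → Lower β b → b ℚ.≤ ι (2 ℕ.* B)) → fromℕ n ^[ 1 / 3 ] < β → n ℕ.≤ 8 ℕ.* (B ℕ.* B ℕ.* B)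
cube-root-below n B β β≤ (q , r , (0≤q , _ , (_ , _ , refl , refl , refl) , n≤q³) , lr , q<r) =
  ℕ.≤-trans (ι-cancel-≤ n ((2 ℕ.* B) ℕ.^ 3) (begin
    ι n                          ≡⟨ ℚ.*-identityʳ (ι n) ⟨
    ι n ℚ.* ι 1                  ≤⟨ n≤q³ ⟩
    q ^ℚ 3                       ≤⟨ ^ℚ-mono-≤ 3 0≤q (ℚ.≤-trans (ℚ.<⇒≤ q<r) (β≤ lr)) ⟩
    ι (2 ℕ.* B) ^ℚ 3             ≡⟨ ι-^ (2 ℕ.* B) 3 ⟨
    ι ((2 ℕ.* B) ℕ.^ 3)          ∎)) (ℕ.≤-reflexive (regroup B))
  where
  open ℚ.≤-Reasoning
  regroup : ∀ b → ((2 ℕ.* b) ℕ.* ((2 ℕ.* b) ℕ.* ((2 ℕ.* b) ℕ.* 1))) ≡ 8 ℕ.* (b ℕ.* b ℕ.* b)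
  regroup = solve-∀

^2≡ : ∀ s → s ℕ.^ 2 ≡ s ℕ.* s
^2≡ s = cong (s ℕ.*_) (ℕ.*-identityʳ s)

^3≡ : ∀ s → s ℕ.^ 3 ≡ s ℕ.* s ℕ.* s
^3≡ s = trans (cong (s ℕ.*_) (^2≡ s)) (sym (ℕ.*-assoc s s s))

^4≡ : ∀ s → s ℕ.^ 4 ≡ s ℕ.^ 2 ℕ.* s ℕ.^ 2
^4≡ s = ℕ.^-distribˡ-+-* s 2 2

double-^3 : ∀ b → (2 ℕ.* b) ℕ.^ 3 ≡ 8 ℕ.* (b ℕ.* b ℕ.* b)
double-^3 b = trans (^3≡ (2 ℕ.* b)) (regroup b)
  where
  regroup : ∀ b → 2 ℕ.* b ℕ.* (2 ℕ.* b) ℕ.* (2 ℕ.* b) ≡ 8 ℕ.* (b ℕ.* b ℕ.* b)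
  regroup = solve-∀

*-^-distrib : ∀ a b j → (a ℕ.* b) ℕ.^ j ≡ a ℕ.^ j ℕ.* b ℕ.^ j
*-^-distrib a b zero    = refl
*-^-distrib a b (suc j) = trans (cong (a ℕ.* b ℕ.*_) (*-^-distrib a b j)) (interchange a b (a ℕ.^ j) (b ℕ.^ j))
  where
  interchange : ∀ a b s t → a ℕ.* b ℕ.* (s ℕ.* t) ≡ a ℕ.* s ℕ.* (b ℕ.* t)
  interchange = solve-∀

-- v and w are variables, because products with large literals would be
-- unfolded in unary.

module Logarithms (C₂ C₃ v w : ℕ) (v≥ : 16 ℕ.* 8 ℕ.* 9 ℕ.≤ v) (v²≥ : 256 ℕ.* 8 ℕ.* 1600 ℕ.≤ v ℕ.* v) (w≡ : w ≡ 3 ℕ.* 3 ℕ.* 2 ℕ.^ 7)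
                  (C₃≡ : C₃ ≡ v ℕ.* w ℕ.* C₂) (h B m m₀ lg a k n : ℕ) (m≤ : m ℕ.≤ 3 ℕ.* m₀) (lg≤ : lg ℕ.≤ 2 ℕ.* a) where

  open ℕ.≤-Reasoning

  Θ Ψ : ℕ
  Θ = m ℕ.* m ℕ.* lg ℕ.^ 7 ℕ.* (k ℕ.* k)
  Ψ = m₀ ℕ.^ 2 ℕ.* a ℕ.^ 7 ℕ.* k ℕ.^ 2

  Θ≤wΨ : Θ ℕ.≤ w ℕ.* Ψ
  Θ≤wΨ = scale 3 (2 ℕ.^ 7) m≤ (ℕ.≤-trans (ℕ.^-monoˡ-≤ 7 lg≤) (ℕ.≤-reflexive (*-^-distrib 2 a 7))) w≡
    where
    scale : ∀ s t → m ℕ.≤ s ℕ.* m₀ → lg ℕ.^ 7 ℕ.≤ t ℕ.* a ℕ.^ 7 → w ≡ s ℕ.* s ℕ.* t → Θ ℕ.≤ w ℕ.* Ψ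
    scale s t m≤ lg^7≤ w≡ = begin
      m ℕ.* m ℕ.* lg ℕ.^ 7 ℕ.* (k ℕ.* k)                              ≤⟨ ℕ.*-monoˡ-≤ (k ℕ.* k) (ℕ.*-mono-≤ (ℕ.*-mono-≤ m≤ m≤) lg^7≤) ⟩
      s ℕ.* m₀ ℕ.* (s ℕ.* m₀) ℕ.* (t ℕ.* a ℕ.^ 7) ℕ.* (k ℕ.* k)       ≡⟨ regroup s t m₀ (a ℕ.^ 7) (k ℕ.* k) ⟩
      s ℕ.* s ℕ.* t ℕ.* (m₀ ℕ.* m₀ ℕ.* a ℕ.^ 7 ℕ.* (k ℕ.* k))         ≡⟨ cong₂ (λ x y → s ℕ.* s ℕ.* t ℕ.* (x ℕ.* a ℕ.^ 7 ℕ.* y)) (^2≡ m₀) (^2≡ k) ⟨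
      s ℕ.* s ℕ.* t ℕ.* Ψ                                             ≡⟨ cong (ℕ._* Ψ) w≡ ⟨
      w ℕ.* Ψ                                                         ∎
      where
      regroup : ∀ s t m p k → s ℕ.* m ℕ.* (s ℕ.* m) ℕ.* (t ℕ.* p) ℕ.* k ≡ s ℕ.* s ℕ.* t ℕ.* (m ℕ.* m ℕ.* p ℕ.* k)
      regroup = solve-∀

  small : h ℕ.* (B ℕ.* B ℕ.* B) ℕ.≤ 9 ℕ.* C₂ ℕ.* (Θ ℕ.* (n ℕ.* n)) →
          h ℕ.* (16 ℕ.* (2 ℕ.* B) ℕ.^ 3) ℕ.≤ C₃ ℕ.* (n ℕ.^ 2 ℕ.* a ℕ.^ 7 ℕ.* m₀ ℕ.^ 2) ℕ.* k ℕ.^ 2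
  small le = scale 16 8 9 (B ℕ.* B ℕ.* B) (double-^3 B) v≥ le
    where
    scale : ∀ e f g x {X} → X ≡ f ℕ.* x → e ℕ.* f ℕ.* g ℕ.≤ v → h ℕ.* x ℕ.≤ g ℕ.* C₂ ℕ.* (Θ ℕ.* (n ℕ.* n)) →
            h ℕ.* (e ℕ.* X) ℕ.≤ C₃ ℕ.* (n ℕ.^ 2 ℕ.* a ℕ.^ 7 ℕ.* m₀ ℕ.^ 2) ℕ.* k ℕ.^ 2
    scale e f g x refl v≥ le = begin
      h ℕ.* (e ℕ.* (f ℕ.* x))                                           ≡⟨ regroup₁ h e f x ⟩
      e ℕ.* f ℕ.* (h ℕ.* x)                                             ≤⟨ ℕ.*-monoʳ-≤ (e ℕ.* f) (ℕ.≤-trans le (ℕ.*-monoʳ-≤ (g ℕ.* C₂) (ℕ.*-mono-≤ Θ≤wΨ (ℕ.≤-reflexive (sym (^2≡ n)))))) ⟩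
      e ℕ.* f ℕ.* (g ℕ.* C₂ ℕ.* (w ℕ.* Ψ ℕ.* n ℕ.^ 2))                  ≡⟨ regroup₂ (e ℕ.* f) g w C₂ Ψ (n ℕ.^ 2) ⟩
      e ℕ.* f ℕ.* g ℕ.* (w ℕ.* C₂ ℕ.* (Ψ ℕ.* n ℕ.^ 2))                  ≤⟨ ℕ.*-monoˡ-≤ (w ℕ.* C₂ ℕ.* (Ψ ℕ.* n ℕ.^ 2)) v≥ ⟩
      v ℕ.* (w ℕ.* C₂ ℕ.* (Ψ ℕ.* n ℕ.^ 2))                              ≡⟨ regroup₃ v w C₂ (m₀ ℕ.^ 2) (a ℕ.^ 7) (k ℕ.^ 2) (n ℕ.^ 2) ⟩
      v ℕ.* w ℕ.* C₂ ℕ.* (n ℕ.^ 2 ℕ.* a ℕ.^ 7 ℕ.* m₀ ℕ.^ 2) ℕ.* k ℕ.^ 2 ≡⟨ cong (λ c → c ℕ.* (n ℕ.^ 2 ℕ.* a ℕ.^ 7 ℕ.* m₀ ℕ.^ 2) ℕ.* k ℕ.^ 2) C₃≡ ⟨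
      C₃ ℕ.* (n ℕ.^ 2 ℕ.* a ℕ.^ 7 ℕ.* m₀ ℕ.^ 2) ℕ.* k ℕ.^ 2             ∎
      where
      regroup₁ : ∀ h e f x → h ℕ.* (e ℕ.* (f ℕ.* x)) ≡ e ℕ.* f ℕ.* (h ℕ.* x)
      regroup₁ = solve-∀
      regroup₂ : ∀ e g w c p n → e ℕ.* (g ℕ.* c ℕ.* (w ℕ.* p ℕ.* n)) ≡ e ℕ.* g ℕ.* (w ℕ.* c ℕ.* (p ℕ.* n))
      regroup₂ = solve-∀
      regroup₃ : ∀ v w c m p k n → v ℕ.* (w ℕ.* c ℕ.* (m ℕ.* p ℕ.* k ℕ.* n)) ≡ v ℕ.* w ℕ.* c ℕ.* (n ℕ.* p ℕ.* m) ℕ.* k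
      regroup₃ = solve-∀

  large : h ℕ.* h ℕ.* (B ℕ.* B ℕ.* B) ℕ.≤ 1600 ℕ.* (C₂ ℕ.* C₂) ℕ.* (Θ ℕ.* Θ ℕ.* (n ℕ.* n ℕ.* n)) →
          h ℕ.^ 2 ℕ.* (256 ℕ.* (2 ℕ.* B) ℕ.^ 3) ℕ.≤ C₃ ℕ.^ 2 ℕ.* (n ℕ.^ 3 ℕ.* (a ℕ.^ 7 ℕ.* m₀ ℕ.^ 2) ℕ.^ 2) ℕ.* k ℕ.^ 4
  large le = scale 256 8 1600 (B ℕ.* B ℕ.* B) (double-^3 B) v²≥ le
    where
    scale : ∀ e f g x {X} → X ≡ f ℕ.* x → e ℕ.* f ℕ.* g ℕ.≤ v ℕ.* v → h ℕ.* h ℕ.* x ℕ.≤ g ℕ.* (C₂ ℕ.* C₂) ℕ.* (Θ ℕ.* Θ ℕ.* (n ℕ.* n ℕ.* n)) →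
            h ℕ.^ 2 ℕ.* (e ℕ.* X) ℕ.≤ C₃ ℕ.^ 2 ℕ.* (n ℕ.^ 3 ℕ.* (a ℕ.^ 7 ℕ.* m₀ ℕ.^ 2) ℕ.^ 2) ℕ.* k ℕ.^ 4
    scale e f g x refl v²≥ le = begin
      h ℕ.^ 2 ℕ.* (e ℕ.* (f ℕ.* x))                                     ≡⟨ trans (cong (ℕ._* (e ℕ.* (f ℕ.* x))) (^2≡ h)) (regroup₁ (h ℕ.* h) e f x) ⟩
      e ℕ.* f ℕ.* (h ℕ.* h ℕ.* x)
        ≤⟨ ℕ.*-monoʳ-≤ (e ℕ.* f) (ℕ.≤-trans le (ℕ.*-monoʳ-≤ (g ℕ.* (C₂ ℕ.* C₂)) (ℕ.*-mono-≤ (ℕ.*-mono-≤ Θ≤wΨ Θ≤wΨ) (ℕ.≤-reflexive (sym (^3≡ n)))))) ⟩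
      e ℕ.* f ℕ.* (g ℕ.* (C₂ ℕ.* C₂) ℕ.* (w ℕ.* Ψ ℕ.* (w ℕ.* Ψ) ℕ.* n ℕ.^ 3))
                                                                        ≡⟨ regroup₂ (e ℕ.* f) g w C₂ Ψ (n ℕ.^ 3) ⟩
      e ℕ.* f ℕ.* g ℕ.* (w ℕ.* C₂ ℕ.* (w ℕ.* C₂) ℕ.* (Ψ ℕ.* Ψ ℕ.* n ℕ.^ 3))
                                                                        ≤⟨ ℕ.*-monoˡ-≤ (w ℕ.* C₂ ℕ.* (w ℕ.* C₂) ℕ.* (Ψ ℕ.* Ψ ℕ.* n ℕ.^ 3)) v²≥ ⟩
      v ℕ.* v ℕ.* (w ℕ.* C₂ ℕ.* (w ℕ.* C₂) ℕ.* (Ψ ℕ.* Ψ ℕ.* n ℕ.^ 3))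
                                                                        ≡⟨ regroup₃ v w C₂ (m₀ ℕ.^ 2) (a ℕ.^ 7) (k ℕ.^ 2) (n ℕ.^ 3) ⟩
      v ℕ.* w ℕ.* C₂ ℕ.* (v ℕ.* w ℕ.* C₂) ℕ.* (n ℕ.^ 3 ℕ.* (a ℕ.^ 7 ℕ.* m₀ ℕ.^ 2 ℕ.* (a ℕ.^ 7 ℕ.* m₀ ℕ.^ 2))) ℕ.* (k ℕ.^ 2 ℕ.* k ℕ.^ 2)
        ≡⟨ cong₂ (λ c y → c ℕ.* c ℕ.* (n ℕ.^ 3 ℕ.* (a ℕ.^ 7 ℕ.* m₀ ℕ.^ 2 ℕ.* (a ℕ.^ 7 ℕ.* m₀ ℕ.^ 2))) ℕ.* y) C₃≡ (^4≡ k) ⟨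
      C₃ ℕ.* C₃ ℕ.* (n ℕ.^ 3 ℕ.* (a ℕ.^ 7 ℕ.* m₀ ℕ.^ 2 ℕ.* (a ℕ.^ 7 ℕ.* m₀ ℕ.^ 2))) ℕ.* k ℕ.^ 4
        ≡⟨ cong₂ (λ c y → c ℕ.* (n ℕ.^ 3 ℕ.* y) ℕ.* k ℕ.^ 4) (^2≡ C₃) (^2≡ (a ℕ.^ 7 ℕ.* m₀ ℕ.^ 2)) ⟨
      C₃ ℕ.^ 2 ℕ.* (n ℕ.^ 3 ℕ.* (a ℕ.^ 7 ℕ.* m₀ ℕ.^ 2) ℕ.^ 2) ℕ.* k ℕ.^ 4 ∎
      where
      regroup₁ : ∀ h e f x → h ℕ.* (e ℕ.* (f ℕ.* x)) ≡ e ℕ.* f ℕ.* (h ℕ.* x)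
      regroup₁ = solve-∀
      regroup₂ : ∀ e g w c p n → e ℕ.* (g ℕ.* (c ℕ.* c) ℕ.* (w ℕ.* p ℕ.* (w ℕ.* p) ℕ.* n)) ≡ e ℕ.* g ℕ.* (w ℕ.* c ℕ.* (w ℕ.* c) ℕ.* (p ℕ.* p ℕ.* n))
      regroup₂ = solve-∀
      regroup₃ : ∀ v w c m p k n → v ℕ.* v ℕ.* (w ℕ.* c ℕ.* (w ℕ.* c) ℕ.* (m ℕ.* p ℕ.* k ℕ.* (m ℕ.* p ℕ.* k) ℕ.* n))
               ≡ v ℕ.* w ℕ.* c ℕ.* (v ℕ.* w ℕ.* c) ℕ.* (n ℕ.* (p ℕ.* m ℕ.* (p ℕ.* m))) ℕ.* (k ℕ.* k)
      regroup₃ = solve-∀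

module SizeBounds (ε β : ℝ≥0) (n W : ℕ) .{{n≢0 : NonZero n}} .{{nW≢0 : NonZero (n ℕ.* W)}} (k B : ℕ) (1≤k : 1 ℕ.≤ k)
                  (ε≤ : ∀ {e} → Lower ε e → ι k ℚ.* e ℚ.≤ ι 4) (β≤ : ∀ {b} → Lower β b → b ℚ.≤ ι (2 ℕ.* B))
                  (a m₀ : ℕ) (2^a≤ : 2 ℕ.^ a ℕ.≤ n) (2^m₀≤ : 2 ℕ.^ m₀ ℕ.≤ n ℕ.* W) (h C : ℕ) where

  open Reciprocal k 1≤k

  0≤4κ : 0ℚ ℚ.≤ ι 4 ℚ.* κ
  0≤4κ = 0≤* (0≤ι 4) 0≤κ

  ε^2≤ : ∀ {q} → Lower (ε ^ 2) q → q ℚ.≤ ι 16 ℚ.* κ ^ℚ 2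
  ε^2≤ l = ℚ.≤-trans (lower-^ ε 2 0≤4κ (≤κ ∘ ε≤) l) (ℚ.≤-reflexive (^ℚ-distribˡ-* (ι 4) κ 2))

  β^3≤ : ∀ {q} → Lower (β ^ 3) q → q ℚ.≤ ι (2 ℕ.* B) ^ℚ 3
  β^3≤ = lower-^ β 3 (0≤ι (2 ℕ.* B)) β≤

  small-β : h ℕ.* (16 ℕ.* (2 ℕ.* B) ℕ.^ 3) ℕ.≤ C ℕ.* (n ℕ.^ 2 ℕ.* a ℕ.^ 7 ℕ.* m₀ ℕ.^ 2) ℕ.* k ℕ.^ 2 →
            fromℕ h * (ε ^ 2 * β ^ 3) ≤ fromℕ C * (fromℕ n ^ 2 * log₂ n ^ 7 * log₂ (n ℕ.* W) ^ 2)
  small-β le (_ , _ , refl , (e , b , le′ , lb , refl) , refl) (_ , _ , refl , (_ , μ , (ν , λ′ , uν , uλ , refl) , uμ , refl) , refl) = begin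
    ι h ℚ.* (e ℚ.* b)                                       ≤⟨ *-monoʳ-ι h (*-mono-≤ (nonNeg (ε ^ 2) le′) (^ℚ-nonNeg 3 (0≤ι (2 ℕ.* B))) (ε^2≤ le′) (β^3≤ lb)) ⟩
    ι h ℚ.* (ι 16 ℚ.* κ ^ℚ 2 ℚ.* ι (2 ℕ.* B) ^ℚ 3)          ≤⟨ divide h 16 (ι (2 ℕ.* B) ^ℚ 3) (ι C ℚ.* Y) 2 scaled ⟩
    ι C ℚ.* Y                                               ≤⟨ *-monoʳ-ι C (*-mono-≤ (0≤* (^ℚ-nonNeg 2 (0≤ι n)) (^ℚ-nonNeg 7 (0≤ι a))) (nonNegᵘ (log₂ (n ℕ.* W) ^ 2) uμ)
                                                                 (*-mono-≤ (^ℚ-nonNeg 2 (0≤ι n)) (nonNegᵘ (log₂ n ^ 7) uλ) (upper-^ (fromℕ n) 2 (0≤ι n) (λ { refl → ℚ.≤-refl }) uν)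
                                                                   (upper-^ (log₂ n) 7 (0≤ι a) (upper-log₂ n a 2^a≤) uλ))
                                                                 (upper-^ (log₂ (n ℕ.* W)) 2 (0≤ι m₀) (upper-log₂ (n ℕ.* W) m₀ 2^m₀≤) uμ)) ⟩
    ι C ℚ.* (ν ℚ.* λ′ ℚ.* μ)                                ∎
    where
    open ℚ.≤-Reasoning
    Y : ℚ
    Y = ι n ^ℚ 2 ℚ.* ι a ^ℚ 7 ℚ.* ι m₀ ^ℚ 2
    scaled : ι h ℚ.* (ι 16 ℚ.* ι (2 ℕ.* B) ^ℚ 3) ℚ.≤ ι C ℚ.* Y ℚ.* ι k ^ℚ 2
    scaled = begin
      ι h ℚ.* (ι 16 ℚ.* ι (2 ℕ.* B) ^ℚ 3)                   ≡⟨ cong (λ x → ι h ℚ.* (ι 16 ℚ.* x)) (ι-^ (2 ℕ.* B) 3) ⟨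
      ι h ℚ.* (ι 16 ℚ.* ι ((2 ℕ.* B) ℕ.^ 3))                ≡⟨ trans (ι-* h (16 ℕ.* (2 ℕ.* B) ℕ.^ 3)) (cong (ι h ℚ.*_) (ι-* 16 ((2 ℕ.* B) ℕ.^ 3))) ⟨
      ι (h ℕ.* (16 ℕ.* (2 ℕ.* B) ℕ.^ 3))                    ≤⟨ ι-mono le ⟩
      ι (C ℕ.* (n ℕ.^ 2 ℕ.* a ℕ.^ 7 ℕ.* m₀ ℕ.^ 2) ℕ.* k ℕ.^ 2)
        ≡⟨ trans (ι-* (C ℕ.* (n ℕ.^ 2 ℕ.* a ℕ.^ 7 ℕ.* m₀ ℕ.^ 2)) (k ℕ.^ 2)) (cong₂ ℚ._*_ (trans (ι-* C (n ℕ.^ 2 ℕ.* a ℕ.^ 7 ℕ.* m₀ ℕ.^ 2)) (cong (ι C ℚ.*_) Y≡)) (ι-^ k 2)) ⟩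
      ι C ℚ.* Y ℚ.* ι k ^ℚ 2                                ∎
      where
      Y≡ : ι (n ℕ.^ 2 ℕ.* a ℕ.^ 7 ℕ.* m₀ ℕ.^ 2) ≡ Y
      Y≡ = trans (ι-* (n ℕ.^ 2 ℕ.* a ℕ.^ 7) (m₀ ℕ.^ 2)) (cong₂ ℚ._*_ (trans (ι-* (n ℕ.^ 2) (a ℕ.^ 7)) (cong₂ ℚ._*_ (ι-^ n 2) (ι-^ a 7))) (ι-^ m₀ 2))

  -- Both sides are squared to get rid of the roots.

  large-β : h ℕ.^ 2 ℕ.* (256 ℕ.* (2 ℕ.* B) ℕ.^ 3) ℕ.≤ C ℕ.^ 2 ℕ.* (n ℕ.^ 3 ℕ.* (a ℕ.^ 7 ℕ.* m₀ ℕ.^ 2) ℕ.^ 2) ℕ.* k ℕ.^ 4 →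
            fromℕ h * (ε ^ 2 * β ^[ 3 / 2 ]) ≤ fromℕ C * (fromℕ n ^[ 3 / 2 ] * log₂ n ^ 7 * log₂ (n ℕ.* W) ^ 2)
  large-β le (_ , _ , refl , (e , b , le′ , (0≤b , b³ , lb³ , b²≤) , refl) , refl)
             (_ , _ , refl , (_ , μ , (ν , λ′ , (0≤ν , n³ , un³ , n³≤) , uλ , refl) , uμ , refl) , refl) =
    ^ℚ-cancel-≤ 1 0≤rhs (begin
      (ι h ℚ.* (e ℚ.* b)) ^ℚ 2                              ≡⟨ trans (^ℚ-distribˡ-* (ι h) (e ℚ.* b) 2) (cong (ι h ^ℚ 2 ℚ.*_) (^ℚ-distribˡ-* e b 2)) ⟩
      ι h ^ℚ 2 ℚ.* (e ^ℚ 2 ℚ.* b ^ℚ 2)                      ≤⟨ ℚ.*-monoˡ-≤-nonNeg (ι h ^ℚ 2) {{nonNegative (^ℚ-nonNeg 2 (0≤ι h))}}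
                                                                 (*-mono-≤ (^ℚ-nonNeg 2 (nonNeg (ε ^ 2) le′)) (^ℚ-nonNeg 3 (0≤ι (2 ℕ.* B)))
                                                                   (^ℚ-mono-≤ 2 (nonNeg (ε ^ 2) le′) (ε^2≤ le′)) (ℚ.≤-trans b²≤ (β^3≤ lb³))) ⟩
      ι h ^ℚ 2 ℚ.* ((ι 16 ℚ.* κ ^ℚ 2) ^ℚ 2 ℚ.* ι (2 ℕ.* B) ^ℚ 3)
                                                            ≡⟨ cong₂ (λ x y → x ℚ.* (y ℚ.* ι (2 ℕ.* B) ^ℚ 3)) (sym (ι-^ h 2)) κ^4 ⟩
      ι (h ℕ.^ 2) ℚ.* (ι 256 ℚ.* κ ^ℚ 4 ℚ.* ι (2 ℕ.* B) ^ℚ 3)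
                                                            ≤⟨ divide (h ℕ.^ 2) 256 (ι (2 ℕ.* B) ^ℚ 3) (ι C ^ℚ 2 ℚ.* (ι n ^ℚ 3 ℚ.* Λ ^ℚ 2)) 4 scaled ⟩
      ι C ^ℚ 2 ℚ.* (ι n ^ℚ 3 ℚ.* Λ ^ℚ 2)                    ≤⟨ ℚ.*-monoˡ-≤-nonNeg (ι C ^ℚ 2) {{nonNegative (^ℚ-nonNeg 2 (0≤ι C))}}
                                                                 (*-mono-≤ (^ℚ-nonNeg 3 (0≤ι n)) (^ℚ-nonNeg 2 0≤λμ)
                                                                   (ℚ.≤-trans (upper-^ (fromℕ n) 3 (0≤ι n) (λ { refl → ℚ.≤-refl }) un³) n³≤) (^ℚ-mono-≤ 2 0≤Λ Λ≤)) ⟩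
      ι C ^ℚ 2 ℚ.* (ν ^ℚ 2 ℚ.* (λ′ ℚ.* μ) ^ℚ 2)             ≡⟨ trans (^ℚ-distribˡ-* (ι C) (ν ℚ.* λ′ ℚ.* μ) 2) (cong (ι C ^ℚ 2 ℚ.*_)
                                                                 (trans (cong (_^ℚ 2) (ℚ.*-assoc ν λ′ μ)) (^ℚ-distribˡ-* ν (λ′ ℚ.* μ) 2))) ⟨
      (ι C ℚ.* (ν ℚ.* λ′ ℚ.* μ)) ^ℚ 2                       ∎)
    where
    open ℚ.≤-Reasoning
    Λ : ℚ
    Λ = ι (a ℕ.^ 7 ℕ.* m₀ ℕ.^ 2)
    0≤Λ : 0ℚ ℚ.≤ Λ
    0≤Λ = 0≤ι (a ℕ.^ 7 ℕ.* m₀ ℕ.^ 2)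
    0≤λμ : 0ℚ ℚ.≤ λ′ ℚ.* μ
    0≤λμ = 0≤* (nonNegᵘ (log₂ n ^ 7) uλ) (nonNegᵘ (log₂ (n ℕ.* W) ^ 2) uμ)
    0≤rhs : 0ℚ ℚ.≤ ι C ℚ.* (ν ℚ.* λ′ ℚ.* μ)
    0≤rhs = 0≤* (0≤ι C) (0≤* (0≤* 0≤ν (nonNegᵘ (log₂ n ^ 7) uλ)) (nonNegᵘ (log₂ (n ℕ.* W) ^ 2) uμ))
    Λ≤ : Λ ℚ.≤ λ′ ℚ.* μ
    Λ≤ = ℚ.≤-trans (ℚ.≤-reflexive (trans (ι-* (a ℕ.^ 7) (m₀ ℕ.^ 2)) (cong₂ ℚ._*_ (ι-^ a 7) (ι-^ m₀ 2))))
      (*-mono-≤ (^ℚ-nonNeg 7 (0≤ι a)) (nonNegᵘ (log₂ (n ℕ.* W) ^ 2) uμ) (upper-^ (log₂ n) 7 (0≤ι a) (upper-log₂ n a 2^a≤) uλ)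
        (upper-^ (log₂ (n ℕ.* W)) 2 (0≤ι m₀) (upper-log₂ (n ℕ.* W) m₀ 2^m₀≤) uμ))
    κ^4 : (ι 16 ℚ.* κ ^ℚ 2) ^ℚ 2 ≡ ι 256 ℚ.* κ ^ℚ 4
    κ^4 = trans (^ℚ-distribˡ-* (ι 16) (κ ^ℚ 2) 2) (cong (ι 256 ℚ.*_)
      (solve 2 (λ c o → (c :* (c :* o)) :* ((c :* (c :* o)) :* o) := c :* (c :* (c :* (c :* (o :* o :* o)))) ) refl κ 1ℚ))
      where open +-*-Solver
    scaled : ι (h ℕ.^ 2) ℚ.* (ι 256 ℚ.* ι (2 ℕ.* B) ^ℚ 3) ℚ.≤ ι C ^ℚ 2 ℚ.* (ι n ^ℚ 3 ℚ.* Λ ^ℚ 2) ℚ.* ι k ^ℚ 4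
    scaled = begin
      ι (h ℕ.^ 2) ℚ.* (ι 256 ℚ.* ι (2 ℕ.* B) ^ℚ 3)          ≡⟨ cong (λ x → ι (h ℕ.^ 2) ℚ.* (ι 256 ℚ.* x)) (ι-^ (2 ℕ.* B) 3) ⟨
      ι (h ℕ.^ 2) ℚ.* (ι 256 ℚ.* ι ((2 ℕ.* B) ℕ.^ 3))       ≡⟨ trans (ι-* (h ℕ.^ 2) (256 ℕ.* (2 ℕ.* B) ℕ.^ 3)) (cong (ι (h ℕ.^ 2) ℚ.*_) (ι-* 256 ((2 ℕ.* B) ℕ.^ 3))) ⟨
      ι (h ℕ.^ 2 ℕ.* (256 ℕ.* (2 ℕ.* B) ℕ.^ 3))             ≤⟨ ι-mono le ⟩
      ι (C ℕ.^ 2 ℕ.* (n ℕ.^ 3 ℕ.* (a ℕ.^ 7 ℕ.* m₀ ℕ.^ 2) ℕ.^ 2) ℕ.* k ℕ.^ 4)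
        ≡⟨ trans (ι-* (C ℕ.^ 2 ℕ.* (n ℕ.^ 3 ℕ.* (a ℕ.^ 7 ℕ.* m₀ ℕ.^ 2) ℕ.^ 2)) (k ℕ.^ 4)) (cong₂ ℚ._*_ (trans (ι-* (C ℕ.^ 2) (n ℕ.^ 3 ℕ.* (a ℕ.^ 7 ℕ.* m₀ ℕ.^ 2) ℕ.^ 2)) (cong₂ ℚ._*_ (ι-^ C 2)
             (trans (ι-* (n ℕ.^ 3) ((a ℕ.^ 7 ℕ.* m₀ ℕ.^ 2) ℕ.^ 2)) (cong₂ ℚ._*_ (ι-^ n 3) (ι-^ (a ℕ.^ 7 ℕ.* m₀ ℕ.^ 2) 2))))) (ι-^ k 4)) ⟩
      ι C ^ℚ 2 ℚ.* (ι n ^ℚ 3 ℚ.* Λ ^ℚ 2) ℚ.* ι k ^ℚ 4       ∎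

module _ {b} {A : Set} {B : Set b} {f : A → Maybe B} {P : A → Set} (P? : ∀ x → Dec (P x)) (just⇒P : ∀ {x y} → f x ≡ just y → P x) where

  length-mapMaybe≤ : ∀ xs → length (mapMaybe f xs) ℕ.≤ length (filter P? xs)
  length-mapMaybe≤ []       = ℕ.z≤n
  length-mapMaybe≤ (x ∷ xs) with f x in eq | P? x
  ... | just _  | yes _ = ℕ.s≤s (length-mapMaybe≤ xs)
  ... | just _  | no ¬p = contradiction (just⇒P eq) ¬p
  ... | nothing | yes _ = ℕ.m≤n⇒m≤1+n (length-mapMaybe≤ xs)
  ... | nothing | no _  = length-mapMaybe≤ xs

module IntegralGraph {n W : ℕ} (G : Digraph n) (integral : IntegerWeightsIn[1, W ] G) (m : ℕ) (2nW< : 2 ℕ.* (n ℕ.* W) ℕ.< 2 ℕ.^ m) where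

  weightOf : ∀ {u v} (g : Maybe ℝ≥0) → G u v ≡ g → Maybe ℕ
  weightOf (just w) eq = just (proj₁ (integral eq))
  weightOf nothing  _  = nothing

  ω : Fin n → Fin n → Maybe ℕ
  ω u v = weightOf (G u v) refl

  ω-sound : ∀ {u v k} → ω u v ≡ just k → ∃ λ w → ⟦ G ⟧ u v w × 1 ℕ.≤ k × k ℕ.≤ W × w ≈ fromℕ k
  ω-sound {u} {v} = go (G u v) refl
    where
    go : ∀ {k} g (eq : G u v ≡ g) → weightOf g eq ≡ just k → ∃ λ w → ⟦ G ⟧ u v w × 1 ℕ.≤ k × k ℕ.≤ W × w ≈ fromℕ k
    go (just w) eq refl = w , eq , proj₂ (integral eq)

  ω-complete : ∀ {u v w} → ⟦ G ⟧ u v w → ∃ λ k → ω u v ≡ just k × w ≈ fromℕ k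
  ω-complete {u} {v} {w} = go (G u v) refl
    where
    go : ∀ g (eq : G u v ≡ g) → g ≡ just w → ∃ λ k → weightOf g eq ≡ just k × w ≈ fromℕ k
    go (just w) eq refl = _ , refl , proj₂ (proj₂ (proj₂ (integral eq)))

  ω≥1 : ∀ {u v k} → ω u v ≡ just k → 1 ℕ.≤ k
  ω≥1 eq = proj₁ (proj₂ (proj₂ (ω-sound eq)))

  ω≤W : ∀ {u v k} → ω u v ≡ just k → k ℕ.≤ W
  ω≤W eq = proj₁ (proj₂ (proj₂ (proj₂ (ω-sound eq))))

  open GraphDistance n W m ω ω≥1 ω≤W (ℕ.≤-<-trans (ℕ.m≤n*m (n ℕ.* W) 2) 2nW<) public
  open QuasiMetric (Fin n) dist dist-refl dist-tri using (Reach; stop; step; Geodesic; geodesic-between)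

  canonical : ∀ {x y} → x ∈ allFin n → y ∈ allFin n → dist x y ℕ.< 2 ℕ.^ m →
              Geodesic Base y x (path x y) × (∀ {z} → z ∈ path x y → z ∈ allFin n)
  canonical _ _ lt = path-geodesic lt , λ {z} _ → ∈-allFin z

  path⇒walk : ∀ {E : Edges n} → (∀ {u v w} → E u v w → ∃ λ t → Walk t u v × w ≈ fromℕ t) →
              ∀ {u v} (p : Path E u v) → ∃ λ t → Walk t u v × weight E p ≈ fromℕ t
  path⇒walk e⇒ Star.ε        = 0 , nil , fromℕ-refl 0
  path⇒walk {E} e⇒ ((w , e) ◅ p) =
    let s , q , w≈ = e⇒ e
        t , r , p≈ = path⇒walk {E} e⇒ p
    in s ℕ.+ t , walk-++ q r , ≈-fromℕ-+ w (weight E p) s t w≈ p≈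

  edge⇒walk : ∀ {u v w} → ⟦ G ⟧ u v w → ∃ λ t → Walk t u v × w ≈ fromℕ t
  edge⇒walk {u} {v} e = let k , eq , w≈ = ω-complete e
                in k , subst (λ t → Walk t u v) (ℕ.+-identityʳ k) (cons eq nil) , w≈

  walk⇒path : ∀ {E : Edges n} → (∀ {u v w} → ⟦ G ⟧ u v w → E u v w) →
              ∀ {t u v} → Walk t u v → ∃ λ (p : Path E u v) → weight E p ≈ fromℕ t
  walk⇒path inc nil = Star.ε , fromℕ-refl 0
  walk⇒path {E} inc (cons {k = k} {t = t} eq q) =
    let w , e , _ , _ , w≈ = ω-sound eq
        p , p≈ = walk⇒path {E} inc q
    in (w , inc e) ◅ p , ≈-fromℕ-+ w (weight E p) k t w≈ p≈

  module Shortcuts (Hs : List (Fin n × Fin n)) where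

    IsShortcut : Fin n × Fin n → Set
    IsShortcut (u , v) = (u , v) ∈ Hs × dist u v ℕ.< 2 ℕ.^ m

    shortcut? : ∀ e → Dec (IsShortcut e)
    shortcut? (u , v) = Any.any? (Product.≡-dec _≟ᶠ_ _≟ᶠ_ (u , v)) Hs ×-dec (dist u v ℕ.<? 2 ℕ.^ m)

    weightIf : ∀ {u v} → Dec (IsShortcut (u , v)) → Maybe ℝ≥0
    weightIf {u} {v} (yes _) = just (fromℕ (dist u v))
    weightIf         (no _)  = nothing

    H : Digraph n
    H u v = weightIf (shortcut? (u , v))

    H-sound : ∀ {u v w} → H u v ≡ just w → IsShortcut (u , v) × w ≈ fromℕ (dist u v)
    H-sound {u} {v} {w} = go (shortcut? (u , v))
      where
      go : ∀ s? → weightIf s? ≡ just w → IsShortcut (u , v) × w ≈ fromℕ (dist u v)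
      go (yes s) refl = s , fromℕ-refl (dist u v)

    H-complete : ∀ {u v} → IsShortcut (u , v) → H u v ≡ just (fromℕ (dist u v))
    H-complete {u} {v} s = go (shortcut? (u , v))
      where
      go : ∀ s? → weightIf s? ≡ just (fromℕ (dist u v))
      go (yes _) = refl
      go (no ¬s) = contradiction s ¬s

    ∣H∣≤ : ∣ H ∣ ℕ.≤ length Hs
    ∣H∣≤ = ℕ.≤-trans (length-mapMaybe≤ shortcut? (λ eq → proj₁ (H-sound eq)) (cartesianProduct (allFin n) (allFin n)))
      (unique-length (Unique.filter⁺ shortcut? (Unique.cartesianProduct⁺ (Unique.allFin⁺ n) (Unique.allFin⁺ n)))
        λ e∈ → proj₁ (proj₂ (∈-filter⁻ shortcut? {xs = cartesianProduct (allFin n) (allFin n)} e∈)))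

    union⇒walk : ∀ {u v w} → (G ∪ H) u v w → ∃ λ t → Walk t u v × w ≈ fromℕ t
    union⇒walk (inj₁ e) = edge⇒walk e
    union⇒walk {u} {v} (inj₂ e) = let (_ , lt) , w≈ = H-sound e in dist u v , dist-walk lt , w≈

    dist≤weight : ∀ {E : Edges n} → (∀ {u v w} → E u v w → ∃ λ t → Walk t u v × w ≈ fromℕ t) →
                  ∀ {u v} (p : Path E u v) → fromℕ (dist u v) ≤ weight E p
    dist≤weight {E} e⇒ {u} {v} p = let t , q , p≈ = path⇒walk {E} e⇒ p
                           in ≤-trans {fromℕ (dist u v)} {fromℕ t} {weight E p} (fromℕ-mono (dist u v) t (dist≤ q)) (proj₂ p≈)

    reach⇒path : ∀ {b v x y} → Reach (Base ∪ₗ Hs) b v x y → v ℕ.< 2 ℕ.^ m →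
                 ∃ λ (p : Path (G ∪ H) x y) → hops (G ∪ H) p ℕ.≤ b × ∃ λ t → t ℕ.≤ v × weight (G ∪ H) p ≈ fromℕ t
    reach⇒path stop _ = Star.ε , ℕ.z≤n , 0 , ℕ.z≤n , fromℕ-refl 0
    reach⇒path (step {x = x} {y = y} e r le) v< =
      let w , e′ , w≈ = union-edge e
          p , hops≤ , t , t≤ , p≈ = reach⇒path r (ℕ.≤-<-trans (ℕ.≤-trans (ℕ.m≤n+m _ (dist x y)) le) v<)
      in (w , e′) ◅ p , ℕ.s≤s hops≤ , dist x y ℕ.+ t , ℕ.≤-trans (ℕ.+-monoʳ-≤ (dist x y) t≤) le ,
         ≈-fromℕ-+ w (weight (G ∪ H) p) (dist x y) t w≈ p≈
      where
      union-edge : (Base ∪ₗ Hs) x y → ∃ λ w → (G ∪ H) x y w × w ≈ fromℕ (dist x y)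
      union-edge (inj₁ b)  = let w , e , _ , _ , w≈ = ω-sound b in w , inj₁ e , w≈
      union-edge (inj₂ h∈) = fromℕ (dist x y) , inj₂ (H-complete (h∈ , ℕ.≤-<-trans (ℕ.≤-trans (ℕ.m≤m+n (dist x y) _) le) v<)) ,
                             fromℕ-refl (dist x y)

    isHopset : ∀ ε β k B → 1 ℕ.≤ k → (∀ {e} → Upper ε e → 1ℚ ℚ.≤ ι k ℚ.* e) → fromℕ B ≤ β →
               (∀ {u w} → dist u w ℕ.< 2 ℕ.^ m → ∃ λ v → Reach (Base ∪ₗ Hs) B v u w × k ℕ.* v ℕ.≤ suc k ℕ.* dist u w) →
               IsHopset G β ε H
    isHopset ε β k B 1≤k 1≤kε B≤β approx = record { preserves = preserves ; shortcuts = shortcuts }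
      where
      preserves : ∀ u v → ∃ λ d → IsDist ⟦ G ⟧ u v d × IsDist (G ∪ H) u v d
      preserves u v with dist u v ℕ.<? 2 ℕ.^ m
      ... | yes lt = just (fromℕ (dist u v)) , (walk⇒path {⟦ G ⟧} id (dist-walk lt) , dist≤weight {⟦ G ⟧} edge⇒walk) ,
                     (walk⇒path {G ∪ H} inj₁ (dist-walk lt) , dist≤weight {G ∪ H} union⇒walk)
      ... | no ¬lt = nothing , (λ p → ¬lt (walk⇒finite (proj₁ (proj₂ (path⇒walk {⟦ G ⟧} edge⇒walk p))))) ,
                     λ p → ¬lt (walk⇒finite (proj₁ (proj₂ (path⇒walk {G ∪ H} union⇒walk p))))

      shortcuts : ∀ u v d → IsDist ⟦ G ⟧ u v (just d) →
                  ∃ λ (p : Path (G ∪ H) u v) → fromℕ (hops (G ∪ H) p) ≤ β × weight (G ∪ H) p ≤ (fromℕ 1 + ε) * d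
      shortcuts u v d ((q , q≈d) , _) =
        let finite = walk⇒finite (proj₁ (proj₂ (path⇒walk {⟦ G ⟧} edge⇒walk q)))
            s , reach , ks≤ = approx finite
            p , hops≤ , t , t≤ , p≈ = reach⇒path reach (s< s finite ks≤)
        in p , ≤-trans {fromℕ (hops (G ∪ H) p)} {fromℕ B} {β} (fromℕ-mono (hops (G ∪ H) p) B hops≤) B≤β ,
           ≤-trans {weight (G ∪ H) p} {fromℕ s} {(fromℕ 1 + ε) * d}
             (≤-trans {weight (G ∪ H) p} {fromℕ t} {fromℕ s} (proj₁ p≈) (fromℕ-mono t s t≤))
             (stretch k s (dist u v) ε d 1≤k 1≤kε
               (≤-trans {fromℕ (dist u v)} {weight ⟦ G ⟧ q} {d} (dist≤weight {⟦ G ⟧} edge⇒walk q) (proj₁ q≈d)) ks≤)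
        where
        instance
          k≢0 : NonZero k
          k≢0 = ℕ.>-nonZero 1≤k
        s< : ∀ s → dist u v ℕ.< 2 ℕ.^ m → k ℕ.* s ℕ.≤ suc k ℕ.* dist u v → s ℕ.< 2 ℕ.^ m
        s< s lt ks≤ = ℕ.≤-<-trans (ℕ.*-cancelˡ-≤ k (begin
          k ℕ.* s                              ≤⟨ ks≤ ⟩
          suc k ℕ.* dist u v                   ≤⟨ ℕ.*-monoˡ-≤ (dist u v) (ℕ.+-monoˡ-≤ k 1≤k) ⟩
          (k ℕ.+ k) ℕ.* dist u v               ≤⟨ ℕ.*-monoʳ-≤ (k ℕ.+ k) (dist≤nW lt) ⟩
          (k ℕ.+ k) ℕ.* (n ℕ.* W)              ≡⟨ regroup k (n ℕ.* W) ⟩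
          k ℕ.* (2 ℕ.* (n ℕ.* W))              ∎)) 2nW<
          where
          open ℕ.≤-Reasoning
          regroup : ∀ k t → (k ℕ.+ k) ℕ.* t ≡ k ℕ.* (2 ℕ.* t)
          regroup = solve-∀

abstract
  C₂ v w C₃ : ℕ
  C₂ = 32 ℕ.* 32 ℕ.* 32 ℕ.* C₁
  v  = 1811
  w  = 3 ℕ.* 3 ℕ.* 2 ℕ.^ 7
  C₃ = v ℕ.* w ℕ.* C₂

  C₂≡ : C₂ ≡ 32 ℕ.* 32 ℕ.* 32 ℕ.* C₁
  C₂≡ = refl

  w≡ : w ≡ 3 ℕ.* 3 ℕ.* 2 ℕ.^ 7
  w≡ = refl

  C₃≡ : C₃ ≡ v ℕ.* w ℕ.* C₂
  C₃≡ = refl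

  v≥ : 16 ℕ.* 8 ℕ.* 9 ℕ.≤ v
  v≥ = ℕ.≤ᵇ⇒≤ (16 ℕ.* 8 ℕ.* 9) 1811 _

  v²≥ : 256 ℕ.* 8 ℕ.* 1600 ℕ.≤ v ℕ.* v
  v²≥ = ℕ.≤ᵇ⇒≤ (256 ℕ.* 8 ℕ.* 1600) (1811 ℕ.* 1811) _

Conclusion : (n W : ℕ) .{{_ : NonZero n}} .{{_ : NonZero W}} → Digraph n → ℝ≥0 → ℝ≥0 → Set₁
Conclusion n W G ε β = ∃ λ (H : Digraph n) → IsHopset G β ε H ×
  (β ≤ fromℕ n ^[ 1 / 3 ] →
    fromℕ ∣ H ∣ * (ε ^ 2 * β ^ 3) ≤ fromℕ C₃ * (fromℕ n ^ 2 * log₂ n ^ 7 * log₂ (n ℕ.* W) {{m*n≢0 n W}} ^ 2)) ×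
  (fromℕ n ^[ 1 / 3 ] < β →
    fromℕ ∣ H ∣ * (ε ^ 2 * β ^[ 3 / 2 ]) ≤ fromℕ C₃ * (fromℕ n ^[ 3 / 2 ] * log₂ n ^ 7 * log₂ (n ℕ.* W) {{m*n≢0 n W}} ^ 2))

module Construction
  (n W : ℕ) .{{n≢0 : NonZero n}} .{{W≢0 : NonZero W}} (2≤n : 2 ℕ.≤ n) (G : Digraph n) (integral : IntegerWeightsIn[1, W ] G) (ε β : ℝ≥0)
  (k : ℕ) (1≤k : 1 ℕ.≤ k) (1≤kε : ∀ {e} → Upper ε e → 1ℚ ℚ.≤ ι k ℚ.* e) (kε≤4 : ∀ {e} → Lower ε e → ι k ℚ.* e ℚ.≤ ι 4)
  (B : ℕ) (14≤B : 14 ℕ.≤ B) (B≤β : fromℕ B ≤ β) (β≤2B : ∀ {b} → Lower β b → b ℚ.≤ ι (2 ℕ.* B))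
  (a : ℕ) (2^a≤ : 2 ℕ.^ a ℕ.≤ n) (n< : n ℕ.< 2 ℕ.^ suc a)
  (m₀ : ℕ) (2^m₀≤ : 2 ℕ.^ m₀ ℕ.≤ n ℕ.* W) (nW< : n ℕ.* W ℕ.< 2 ℕ.^ suc m₀) where

  private instance
    nW≢0 : NonZero (n ℕ.* W)
    nW≢0 = m*n≢0 n W

  2^-cancel-< : ∀ s t → 2 ℕ.^ s ℕ.< 2 ℕ.^ t → s ℕ.< t
  2^-cancel-< s t h = ℕ.≰⇒> λ t≤s → ℕ.<⇒≱ h (ℕ.^-monoʳ-≤ 2 t≤s)

  1≤a : 1 ℕ.≤ a
  1≤a = ℕ.s≤s⁻¹ (2^-cancel-< 1 (suc a) (ℕ.≤-<-trans 2≤n n<))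

  a≤m₀ : a ℕ.≤ m₀
  a≤m₀ = ℕ.s≤s⁻¹ (2^-cancel-< a (suc m₀) (ℕ.≤-<-trans 2^a≤ (ℕ.≤-<-trans (ℕ.m≤m*n n W) nW<)))

  m lg : ℕ
  m  = suc (suc m₀)
  lg = suc a

  m≤3m₀ : m ℕ.≤ 3 ℕ.* m₀
  m≤3m₀ = ℕ.≤-trans (ℕ.+-monoˡ-≤ m₀ (ℕ.*-monoʳ-≤ 2 (ℕ.≤-trans 1≤a a≤m₀))) (ℕ.≤-reflexive (ℕ.+-comm (2 ℕ.* m₀) m₀))

  lg≤2a : lg ℕ.≤ 2 ℕ.* a
  lg≤2a = ℕ.≤-trans (ℕ.+-monoˡ-≤ a 1≤a) (ℕ.≤-reflexive (cong (a ℕ.+_) (sym (ℕ.+-identityʳ a))))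

  length-allFin : length (allFin n) ≡ n
  length-allFin = length-tabulate id

  1≤N : 1 ℕ.≤ length (allFin n)
  1≤N = subst (1 ℕ.≤_) (sym length-allFin) (ℕ.≤-trans (ℕ.s≤s ℕ.z≤n) 2≤n)

  open IntegralGraph G integral m (ℕ.*-monoʳ-< 2 nW<)

  space : Space
  space = record { A = Fin n ; _≟ᴬ_ = _≟ᶠ_ ; d = dist ; d-refl = dist-refl ; tri = dist-tri }

  graph : Hopsets.Graph space
  graph = record { vs = allFin n ; Base = Base ; ∞ = 2 ℕ.^ m ; path = path ; canonical = canonical
                 ; lg = lg ; N< = subst (ℕ._< 2 ℕ.^ lg) (sym length-allFin) n< }

  Good : List (Fin n × Fin n) → Set
  Good = Hopsets.Regimes.Good space graph m refl (ℕ.s≤s 1≤a) (ℕ.s≤s (ℕ.m≤n⇒m≤1+n a≤m₀)) 1≤N k B 1≤k 14≤B C₂ C₂≡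
  build : ∃ Good → Conclusion n W G ε β
  build (Hs , approx , small-bound , large-bound) =
    H , isHopset ε β k B 1≤k 1≤kε B≤β (approx (∈-allFin _) (∈-allFin _)) ,
    (λ β≤ → small-β (small (short₁ (small-bound (subst (λ N → B ℕ.* B ℕ.* B ℕ.≤ 8 ℕ.* N) (sym length-allFin) (cube-root-above n B β 2≤n B≤β β≤)))))) ,
    (λ <β → large-β (large (short₂ (large-bound (subst (ℕ._≤ 8 ℕ.* (B ℕ.* B ℕ.* B)) (sym length-allFin) (cube-root-below n B β β≤2B <β))))))
    where
    open Shortcuts Hs
    open Logarithms C₂ C₃ v w v≥ v²≥ w≡ C₃≡ ∣ H ∣ B m m₀ lg a k n m≤3m₀ lg≤2a
    open SizeBounds ε β n W k B 1≤k kε≤4 β≤2B a m₀ 2^a≤ 2^m₀≤ ∣ H ∣ C₃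
    short₁ : length Hs ℕ.* (B ℕ.* B ℕ.* B) ℕ.≤ 9 ℕ.* C₂ ℕ.* (Θ ℕ.* (length (allFin n) ℕ.* length (allFin n))) →
             ∣ H ∣ ℕ.* (B ℕ.* B ℕ.* B) ℕ.≤ 9 ℕ.* C₂ ℕ.* (Θ ℕ.* (n ℕ.* n))
    short₁ le = ℕ.≤-trans (ℕ.*-monoˡ-≤ (B ℕ.* B ℕ.* B) ∣H∣≤)
      (subst (λ N → length Hs ℕ.* (B ℕ.* B ℕ.* B) ℕ.≤ 9 ℕ.* C₂ ℕ.* (Θ ℕ.* (N ℕ.* N))) length-allFin le)
    short₂ : length Hs ℕ.* length Hs ℕ.* (B ℕ.* B ℕ.* B) ℕ.≤ 1600 ℕ.* (C₂ ℕ.* C₂) ℕ.* (Θ ℕ.* Θ ℕ.* (length (allFin n) ℕ.* length (allFin n) ℕ.* length (allFin n))) →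
             ∣ H ∣ ℕ.* ∣ H ∣ ℕ.* (B ℕ.* B ℕ.* B) ℕ.≤ 1600 ℕ.* (C₂ ℕ.* C₂) ℕ.* (Θ ℕ.* Θ ℕ.* (n ℕ.* n ℕ.* n))
    short₂ le = ℕ.≤-trans (ℕ.*-monoˡ-≤ (B ℕ.* B ℕ.* B) (ℕ.*-mono-≤ ∣H∣≤ ∣H∣≤))
      (subst (λ N → length Hs ℕ.* length Hs ℕ.* (B ℕ.* B ℕ.* B) ℕ.≤ 1600 ℕ.* (C₂ ℕ.* C₂) ℕ.* (Θ ℕ.* Θ ℕ.* (N ℕ.* N ℕ.* N))) length-allFin le)

  conclusion : Conclusion n W G ε β
  conclusion = build (Hopsets.Regimes.hopset space graph m refl (ℕ.s≤s 1≤a) (ℕ.s≤s (ℕ.m≤n⇒m≤1+n a≤m₀)) 1≤N k B 1≤k 14≤B C₂ C₂≡)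

theorem1p1 :
  ∃ λ (C : ℝ≥0) →
  ∀ (n W : ℕ) .{{_ : NonZero n}} .{{_ : NonZero W}} → 2 ℕ.≤ n →
  ∀ (G : Digraph n) → IntegerWeightsIn[1, W ] G →
  ∀ (ε β : ℝ≥0) → fromℕ 0 < ε → ε < fromℕ 1 → fromℕ 20 * log₂ n ≤ β →
  ∃ λ (H : Digraph n) → IsHopset G β ε H ×
    (β ≤ fromℕ n ^[ 1 / 3 ] →
      fromℕ ∣ H ∣ * (ε ^ 2 * β ^ 3)
        ≤ C * (fromℕ n ^ 2 * log₂ n ^ 7 * log₂ (n ℕ.* W) {{m*n≢0 n W}} ^ 2)) ×
    (fromℕ n ^[ 1 / 3 ] < β →
      fromℕ ∣ H ∣ * (ε ^ 2 * β ^[ 3 / 2 ])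
        ≤ C * (fromℕ n ^[ 3 / 2 ] * log₂ n ^ 7 * log₂ (n ℕ.* W) {{m*n≢0 n W}} ^ 2))
theorem1p1 = fromℕ C₃ , λ n W 2≤n G integral ε β 0<ε ε<1 20log≤β →
  let k , 1≤k , 1≤kε , kε≤4    = inverse-scale ε 0<ε ε<1
      B , 14≤B , B≤β , β≤2B    = integer-part β n 2≤n 20log≤β
      a , _ , 2^a≤ , n<        = power-below n n (ℕ.>-nonZero⁻¹ n) (n<2^n n)
      m₀ , _ , 2^m₀≤ , nW<     = power-below (n ℕ.* W) (n ℕ.* W) (ℕ.>-nonZero⁻¹ (n ℕ.* W) {{m*n≢0 n W}}) (n<2^n (n ℕ.* W))
      open Construction n W 2≤n G integral ε β k 1≤k 1≤kε kε≤4 B 14≤B B≤β β≤2B a 2^a≤ n< m₀ 2^m₀≤ nW<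
  in conclusion
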